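{- Let $q\ge 6$ be a prime power. Let $\bar{\mathcal C}$ be an $\mathbb F_q$-conic in an $\mathbb F_q$-subplane $\bar\pi$ of $\mathrm{PG}(2,q^3)$ that is tangent to $\ell_\infty$, and let $\bar T=\ell_\infty\cap\bar\pi$. In the exact-at-infinity Bruck-Bose representation in $\mathrm{PG}(6,q)$ we have the following. 1. If $\bar T\in\bar{\mathcal C}$, then $\bar{\mathcal C}^+\cap\ell_\infty=\{\bar T,\bar Q\}$ for some $\bar Q\ne\bar T$. The pointset of $[\mathcal C]$ consists of the spread plane $[T]$ and a 4-dimensional normal rational curve $\mathcal N_4$. Further, $\mathcal N_4^\star\cap\Sigma_\infty^\star$ consists of one real point (that is, a point over $\mathbb F_q$) of $[T]$, and the points $Q,Q^q,Q^{q^2}$. 2. Otherwise $\bar T\notin\bar{\mathcal C}$, and $\bar{\mathcal C}^+$ meets $\ell_\infty$ in two points $\bar P,\bar Q$, possibly repeated, possibly in the quadratic extension. In this case $\mathcal V([\mathcal C])$ is a 6-dimensional normal rational curve $\mathcal N_6$ of $\mathrm{PG}(6,q)$. Further, $\mathcal N_6^\star$ meets $\Sigma_\infty^\star$ in six points $\{P,P^q,P^{q^2},Q,Q^q,Q^{q^2}\}$, where $P,Q\in g$, possibly repeated, or possibly in the extension $g^{\star\star}\setminus g$ (the intersection then being that of $\mathcal N_6^{\star\star}$ with $\Sigma_\infty^{\star\star}$), in which case $Q=P^{q^3}$.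
   Context: **$\mathbb F_q$-conics.** An $\mathbb F_q$-subplane of $\mathrm{PG}(2,q^3)$ is a subplane of order $q$; it is secant, tangent or exterior to a line if it meets it in $q+1$, $1$ or $0$ points. An $\mathbb F_q$-conic is a non-degenerate conic of an $\mathbb F_q$-subplane. For an $\mathbb F_q$-conic $\bar{\mathcal C}$, $\bar{\mathcal C}^{+}$ is the unique non-degenerate conic of $\mathrm{PG}(2,q^3)$ containing it, and $\bar{\mathcal C}^{++}$ the unique non-degenerate conic of $\mathrm{PG}(2,q^6)$ containing $\bar{\mathcal C}^+$ (if $\bar{\mathcal C}^+\cap\ell_\infty=\emptyset$, the points $\bar P,\bar Q$ are the intersections of $\bar{\mathcal C}^{++}$ with the extension of $\ell_\infty$ to $\mathrm{PG}(2,q^6)$). A line $\ell_\infty$ of $\mathrm{PG}(2,q^3)$ is fixed as line at infinity. **Normal rational curves.** An $r$-dimensional normal rational curve in $\mathrm{PG}(n,q)$ is a set of points lying in an $r$-space and projectively equivalent to $\{(1,\theta,\dots,\theta^r):\theta\in\mathbb F_q\}\cup\{(0,\dots,0,1)\}$; it extends naturally to a normal rational curve over extension fields. **Conjugacy.** For an $\mathbb F_q$-subplane $\bar\pi$, $\bar{\mathsf c}_\pi$ is the collineation $\bar X\mapsto B\bar X^q$ ($B\in\mathrm{GL}(3,q^3)$) of $\mathrm{PG}(2,q^3)$ that has order 3 and fixes $\bar\pi$ pointwise; the same formula defines it on $\mathrm{PG}(2,q^6)$, where it has order 6. **Bose representation.** Embed $\mathrm{PG}(8,q)\subset\mathrm{PG}(8,q^3)\subset\mathrm{PG}(8,q^6)$;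 $X^q$ is obtained by raising coordinates to the $q$-th power. For a subspace or variety $\mathcal K$ given over $\mathbb F_q$ (including normal rational curves), $\mathcal K^\star$ and $\mathcal K^{\star\star}$ denote its extensions to $\mathbb F_{q^3}$ and $\mathbb F_{q^6}$; for a subspace $\Sigma$ of $\mathrm{PG}(8,q^3)$, $\Sigma^{\star\star}$ is its extension to $\mathrm{PG}(8,q^6)$. Let $\Gamma$ be a plane of $\mathrm{PG}(8,q^3)$ disjoint from $\mathrm{PG}(8,q)$ such that $\Gamma,\Gamma^q,\Gamma^{q^2}$ span $\mathrm{PG}(8,q^3)$. The planes $[\![X]\!]=\langle X,X^q,X^{q^2}\rangle\cap\mathrm{PG}(8,q)$, $X\in\Gamma$, form a regular 2-spread of $\mathrm{PG}(8,q)$. Identify $\mathrm{PG}(2,q^3)$ with $\Gamma$ (and $\mathrm{PG}(2,q^6)$ with $\Gamma^{\star\star}$) by a linear isomorphism, $\bar X\leftrightarrow X$; dropping the bar denotes the corresponding object in $\Gamma$ or $\Gamma^{\star\star}$. **Scroll-planes.** For $X\in\Gamma^{\star\star}$, the $\pi$-scroll-plane is $(\!(X)\!)_\pi=\langle X,(X^{\mathsf c_\pi^5})^q,(X^{\mathsf c_\pi^4})^{q^2}\rangle$. **Exact-at-infinity Bruck-Bose representation.** Let $g\subset\Gamma$ be the line corresponding to $\ell_\infty$, $\Sigma_\infty=\langle g,g^q,g^{q^2}\rangle\cap\mathrm{PG}(8,q)$ (a 5-space), and $\Sigma_{6,q}\cong\mathrm{PG}(6,q)$ a 6-space of $\mathrm{PG}(8,q)$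 containing $\Sigma_\infty$ as its hyperplane at infinity. The planes $[\![X]\!]$, $X\in g$, form a regular 2-spread $\mathcal S$ of $\Sigma_\infty$, with transversal lines $g,g^q,g^{q^2}$; its elements are the spread planes. For a point $\bar X$ let $[X]=[\![X]\!]\cap\Sigma_{6,q}$: a point of $\Sigma_{6,q}\setminus\Sigma_\infty$ if $\bar X\notin\ell_\infty$, the spread plane $[\![X]\!]$ if $\bar X\in\ell_\infty$. $[\mathcal C]$ is the set of points lying in the $[X]$, $\bar X\in\bar{\mathcal C}$. **Varieties.** It is known that the pointset of $\{[\![X]\!]:X\in\mathcal C\}$ is an intersection $\mathcal V([\![\mathcal C]\!])$ of nine quadrics of $\mathrm{PG}(8,q)$, that $\mathcal V([\![\mathcal C]\!])^\star$ is the set of points on the planes $(\!(X)\!)_\pi$, $X\in\mathcal C^+$, and $\mathcal V([\![\mathcal C]\!])^{\star\star}$ is the set of points on the planes $(\!(X)\!)_\pi$, $X\in\mathcal C^{++}$. Put $\mathcal V([\mathcal C])=\mathcal V([\![\mathcal C]\!])\cap\Sigma_{6,q}$ (its pointset is $[\mathcal C]$). -}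

module Defs where

open import Algebra.Apartness.Bundles using (HeytingField; HeytingCommutativeRing)
open import Algebra.Bundles using (CommutativeRing)
import Algebra.Properties.Semiring.Exp as Exp
import Algebra.Properties.Semiring.Sum as Sum
open import Data.Fin.Base using (Fin; zero; suc; toℕ)
open import Data.Nat.Base as ℕ using (ℕ)
open import Data.Nat.GeneralisedArithmetic using (iterate)
open import Data.Nat.Primality using (Prime)
open import Data.Product.Base using (Σ; ∃; ∃₂; ∃-syntax; _×_; _,_)
open import Data.Vec.Functional using (Vector; []; _∷_; _++_; foldr)
import Data.Vec.Functional.Relation.Binary.Equality.Setoid as VecEq
open import Function.Base using (_∘_)
open import Function.Bundles using (Inverse; _⇔_)
open import Level using (Level; _⊔_) renaming (suc to lsuc)
open import Relation.Binary.PropositionalEquality as ≡ using (_≡_; _≢_)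
open import Relation.Nullary.Negation using (¬_)
open import Relation.Unary using (Pred)

IsPrimePower : ℕ → Set
IsPrimePower q = ∃₂ λ p n → Prime p × q ≡ p ℕ.^ ℕ.suc n

record FiniteField c ℓ₁ ℓ₂ (n : ℕ) : Set (lsuc (c ⊔ ℓ₁ ⊔ ℓ₂)) where
  field
    heytingField : HeytingField c ℓ₁ ℓ₂

  commutativeRing : CommutativeRing c ℓ₁
  commutativeRing =
    HeytingCommutativeRing.commutativeRing (HeytingField.heytingCommutativeRing heytingField)

  field
    enumeration : Inverse (CommutativeRing.setoid commutativeRing) (≡.setoid (Fin n))

-- K is the field of order q⁶.  All the geometry is done with homogeneous
-- coordinates in K; the subfield of order q ^ k, for k ∈ {1, 3, 6}, is the
-- set of roots of x ^ (q ^ k) = x, and "level k" below refers to it.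

module Geometry {c ℓ₁ ℓ₂} (q : ℕ) (K : FiniteField c ℓ₁ ℓ₂ (q ℕ.^ 6)) where

  open CommutativeRing (FiniteField.commutativeRing K) public
    using (Carrier; _≈_; _+_; _*_; _-_; 0#; 1#; semiring; setoid)
  open Exp semiring public using (_^_)
  open Sum semiring public using (sum)
  open VecEq setoid public using (_≋_)

  private
    variable
      p p₁ p₂ : Level
      m n : ℕ

  V : ℕ → Set c
  V n = Vector Carrier n

  𝟎 : V n
  𝟎 _ = 0#

  _⊕_ : V n → V n → V n
  (v ⊕ w) i = v i + w i

  InGF : ℕ → Carrier → Set ℓ₁
  InGF k x = x ^ (q ℕ.^ k) ≈ x

  Over : ℕ → V n → Set ℓ₁
  Over k v = ∀ i → InGF k (v i)

  -- v is a coordinate vector, at level k, of a point of PG(n - 1, q ^ k).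
  Point : ℕ → V n → Set ℓ₁
  Point k v = Over k v × ¬ v ≋ 𝟎

  infix 4 _∼_ _∈⟨_⟩

  _∼_ : V n → V n → Set (c ⊔ ℓ₁)
  v ∼ w = ∃[ a ] ¬ a ≈ 0# × v ≋ (λ i → a * w i)

  infixr 8 _·_

  -- A matrix is the family of its columns.
  _·_ : Vector (V n) m → V m → V n
  (M · x) i = sum (λ j → x j * M j i)

  dot : V n → V n → Carrier
  dot h x = sum (λ i → h i * x i)

  Independent : Vector (V n) m → Set (c ⊔ ℓ₁)
  Independent vs = ∀ x → vs · x ≋ 𝟎 → x ≋ 𝟎

  -- Subspaces are spans with coefficients in K.  If the vs and v are over a
  -- subfield, then v lies in the span over that subfield as soon as it lies
  -- in the span over K; so the points of ⟨ vs ⟩ satisfying Point k are the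
  -- points over level k of the (extended) subspace.
  _∈⟨_⟩ : V n → Vector (V n) m → Set (c ⊔ ℓ₁)
  v ∈⟨ vs ⟩ = ∃[ x ] v ≋ vs · x

  GL : ℕ → (n : ℕ) → Vector (V n) n → Set (c ⊔ ℓ₁)
  GL k n M = (∀ j → Over k (M j)) ×
    Σ (Vector (V n) n) λ N → (∀ j → Over k (N j)) ×
      (∀ x → M · N · x ≋ x) × (∀ x → N · M · x ≋ x)

  -- X ↦ X^(q^j)
  frob : ℕ → V n → V n
  frob j v i = v i ^ (q ℕ.^ j)

  conjugates : V n → Vector (V n) 3
  conjugates X = X ∷ frob 1 X ∷ frob 2 X ∷ []

  -- A d-dimensional subspace of PG(n, q ^ k).
  record Flat (k n d : ℕ) : Set (c ⊔ ℓ₁) where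
    field
      basis       : Vector (V (ℕ.suc n)) (ℕ.suc d)
      over        : ∀ i → Over k (basis i)
      independent : Independent basis

  HasSize : ℕ → Pred (V n) p → Set (c ⊔ ℓ₁ ⊔ p)
  HasSize {n} N S = Σ (Vector (V n) N) λ pts →
    (∀ i → S (pts i)) × (∀ i j → pts i ∼ pts j → i ≡ j) × (∀ X → S X → ∃[ i ] X ∼ pts i)

  -- A subplane of order q of PG(2, q³).  Its lines are the joins of two of
  -- its points.
  record IsSubplane (π : Pred (V 3) p) : Set (c ⊔ ℓ₁ ⊔ p) where
    field
      points     : ∀ {X} → π X → Point 3 X
      respects   : ∀ {X Y} → π X → Point 3 Y → Y ∼ X → π Y
      meet       : ∀ {X Y Z W} → π X → π Y → π Z → π W → ¬ X ∼ Y → ¬ Z ∼ W →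
                   ∃[ P ] π P × P ∈⟨ X ∷ Y ∷ [] ⟩ × P ∈⟨ Z ∷ W ∷ [] ⟩
      quadrangle : Σ (Vector (V 3) 4) λ f → (∀ i → π (f i)) ×
                   (∀ i j k → i ≢ j → j ≢ k → i ≢ k → Independent (f i ∷ f j ∷ f k ∷ []))
      order      : ∀ {X Y} → π X → π Y → ¬ X ∼ Y →
                   HasSize (ℕ.suc q) (λ Z → π Z × Z ∈⟨ X ∷ Y ∷ [] ⟩)

  -- The quadratic form Σ aᵢⱼ xᵢ xⱼ; the matrix need not be symmetric, so that
  -- every form is covered in characteristic 2 as well.
  quad : Vector (V n) n → V n → Carrier
  quad a x = sum (λ i → sum (λ j → a i j * (x i * x j)))

  -- Non-degenerate: no point of the plane is singular, i.e. no change of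
  -- coordinates rewrites the form in fewer than three variables.
  record Conic (k : ℕ) : Set (c ⊔ ℓ₁) where
    field
      form          : Vector (V 3) 3
      over          : ∀ i → Over k (form i)
      nondegenerate : ∀ v → Point k v → ¬ (∀ x → Over k x → quad form (x ⊕ v) ≈ quad form x)

  infix 4 _∈ᶜ_

  _∈ᶜ_ : ∀ {k} → V 3 → Conic k → Set ℓ₁
  X ∈ᶜ 𝒞 = quad (Conic.form 𝒞) X ≈ 0#

  -- C is a non-degenerate conic of the subplane π: the matrix A supplies
  -- homogeneous coordinates in the field of order q for π, in which C has a
  -- non-degenerate quadratic equation over that field.
  IsConicOf : Pred (V 3) p₁ → Pred (V 3) p₂ → Set (c ⊔ ℓ₁ ⊔ p₁ ⊔ p₂)
  IsConicOf π C = Σ (Vector (V 3) 3) λ A → GL 3 3 A × Σ (Conic 1) λ 𝒞 →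
    (∀ X → π X ⇔ (Point 3 X × ∃[ x ] Point 1 x × X ∼ A · x)) ×
    (∀ X → C X ⇔ (Point 3 X × ∃[ x ] Point 1 x × x ∈ᶜ 𝒞 × X ∼ A · x))

  -- The map X ↦ B X^q
  semilinear : Vector (V 3) 3 → V 3 → V 3
  semilinear B X = B · frob 1 X

  record IsConjugacy (π : Pred (V 3) p) (B : Vector (V 3) 3) : Set (c ⊔ ℓ₁ ⊔ p) where
    field
      invertible : GL 3 3 B
      fixes      : ∀ X → π X → semilinear B X ∼ X
      cubed      : ∀ X → Point 3 X → iterate (semilinear B) X 3 ∼ X
      not-one    : ¬ (∀ X → Point 3 X → semilinear B X ∼ X)
      not-two    : ¬ (∀ X → Point 3 X → iterate (semilinear B) X 2 ∼ X)

  -- The plane Γ of PG(8, q³); its basis also fixes the linear isomorphism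
  -- X ↦ Γ · X from PG(2, q³) (and PG(2, q⁶)) onto it.
  record BosePlane : Set (c ⊔ ℓ₁) where
    field
      Γ-flat : Flat 3 8 2

    Γ : Vector (V 9) 3
    Γ = Flat.basis Γ-flat

    field
      disjoint : ∀ y → Point 1 y → ¬ y ∈⟨ Γ ⟩
      spanning : ∀ y → y ∈⟨ Γ ++ (frob 1 ∘ Γ) ++ (frob 2 ∘ Γ) ⟩

    φ : V 3 → V 9
    φ X = Γ · X

    ⟦_⟧ : V 3 → Pred (V 9) (c ⊔ ℓ₁)
    ⟦ X ⟧ y = Point 1 y × y ∈⟨ conjugates (φ X) ⟩

    scrollPlane : Vector (V 3) 3 → V 3 → Vector (V 9) 3
    scrollPlane B X =
      φ X ∷ frob 1 (φ (iterate (semilinear B) X 5)) ∷ frob 2 (φ (iterate (semilinear B) X 4)) ∷ []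

  module _ (ℬ : BosePlane) where

    open BosePlane ℬ

    -- Six vectors spanning ⟨ g, g^q, g^(q²) ⟩, for the line g of Γ
    -- corresponding to ℓ∞.  The points of level 1, 3, 6 in their span form
    -- Σ∞ and its extensions.
    atInfinity : Flat 3 2 1 → Vector (V 9) 6
    atInfinity ℓ∞ = g ++ (frob 1 ∘ g) ++ (frob 2 ∘ g)
      where
      g : Vector (V 9) 2
      g = φ ∘ Flat.basis ℓ∞

    ⟦_⟧ₛ : Pred (V 3) p → Pred (V 9) (c ⊔ ℓ₁ ⊔ p)
    ⟦ C ⟧ₛ y = ∃[ X ] C X × ⟦ X ⟧ y

    -- Nine quadrics of PG(8, q) whose intersection is the set of points on the
    -- planes ⟦ X ⟧, X ∈ C, and whose extensions meet in the scroll-planes of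
    -- C⁺ and C⁺⁺.
    record BoseVariety (C : Pred (V 3) p) (C⁺ : Conic 3) (C⁺⁺ : Conic 6)
                       (B : Vector (V 3) 3) : Set (c ⊔ ℓ₁ ⊔ p) where
      field
        forms : Fin 9 → Vector (V 9) 9
        over  : ∀ r i → Over 1 (forms r i)

      𝒱 : Pred (V 9) ℓ₁
      𝒱 y = ∀ r → quad (forms r) y ≈ 0#

      field
        points   : ∀ y → Point 1 y → 𝒱 y ⇔ ⟦ C ⟧ₛ y
        points⋆  : ∀ y → Point 3 y →
                   𝒱 y ⇔ (∃[ X ] Point 3 X × X ∈ᶜ C⁺ × y ∈⟨ scrollPlane B X ⟩)
        points⋆⋆ : ∀ y → Point 6 y →
                   𝒱 y ⇔ (∃[ X ] Point 6 X × X ∈ᶜ C⁺⁺ × y ∈⟨ scrollPlane B X ⟩)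

    record IsBruckBose (ℓ∞ : Flat 3 2 1) (Σ₆ : Flat 1 8 6) : Set (c ⊔ ℓ₁) where
      field
        contains : ∀ y → Point 1 y → y ∈⟨ atInfinity ℓ∞ ⟩ → y ∈⟨ Flat.basis Σ₆ ⟩

    module _ (Σ₆ : Flat 1 8 6) where

      [_] : V 3 → Pred (V 9) (c ⊔ ℓ₁)
      [ X ] y = ⟦ X ⟧ y × y ∈⟨ Flat.basis Σ₆ ⟩

      [_]ₛ : Pred (V 3) p → Pred (V 9) (c ⊔ ℓ₁ ⊔ p)
      [ C ]ₛ y = ∃[ X ] C X × [ X ] y

  -- (s, t) ↦ (s^r, s^(r-1) t, …, t^r): the point (1, θ, …, θ^r) at (1, θ) and
  -- (0, …, 0, 1) at (0, 1).
  veronese : (r : ℕ) → V 2 → V (ℕ.suc r)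
  veronese r u i = u zero ^ (r ℕ.∸ toℕ i) * u (suc zero) ^ toℕ i

  -- An r-dimensional normal rational curve of PG(8, q) in the subspace Σ₆.
  record NRC (r : ℕ) (Σ₆ : Flat 1 8 6) : Set (c ⊔ ℓ₁) where
    field
      ambient : Flat 1 8 r
      inside  : ∀ i → Flat.basis ambient i ∈⟨ Flat.basis Σ₆ ⟩

    param : V 2 → V 9
    param u = Flat.basis ambient · veronese r u

    -- The points of the curve (k = 1) and of its extensions (k = 3, 6).
    curve : ℕ → Pred (V 9) (c ⊔ ℓ₁)
    curve k y = Point k y × ∃[ u ] Point k u × y ∼ param u

  -- The hyperplane of Σ₆ spanned by H cuts the curve exactly in the r points
  -- pts, counted with multiplicity: the equation h of the hyperplane pulls
  -- back to a binary form of degree r which is the product of the linear forms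
  -- vanishing at the parameters of the pts.  For r < q⁶, equality of values on
  -- K × K is equality of binary forms of degree r.
  CutsWithMultiplicity : ∀ {r Σ₆} → NRC r Σ₆ → Vector (V 9) m → Vector (V 9) r → Set (c ⊔ ℓ₁)
  CutsWithMultiplicity {r = r} {Σ₆ = Σ₆} 𝒩 H pts =
    Σ (V 9) λ h → Σ (Vector (V 2) r) λ u →
      (∀ y → y ∈⟨ Flat.basis Σ₆ ⟩ → y ∈⟨ H ⟩ ⇔ dot h y ≈ 0#) ×
      (∀ i → Point 6 (u i) × pts i ∼ NRC.param 𝒩 (u i)) ×
      (∀ w → dot h (NRC.param 𝒩 w) ≈
             foldr _*_ 1# (λ i → u i zero * w (suc zero) - u i (suc zero) * w zero))

-- Φ X Y Z = φ X + φ₁ Y + φ₂ Z identifies PG(8, q⁶) with triples of vectors of the plane Γ and its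
-- conjugates, and Σ₆ is the set of triples at which a linear form ℓ vanishing on ℓ∞ and its
-- conjugates ℓ′, ℓ″ take equal values on X, Y, Z.  The conic C is γ = D · (s², s t, t²), ℓ pulls back
-- along γ to a binary quadratic form h over the field of order q³, and the points of [C] off infinity
-- are Φ (h′ h″ γ) (h h″ γ′) (h h′ γ″), a curve of degree 6.  It is a normal rational curve because
-- h, h′, h″ are pairwise coprime: π meets ℓ∞ in T only, so ℓ and its conjugates have no other common
-- zero in the coordinates of π.  It meets infinity where h h′ h″ = 0, that is at P, Q and their
-- conjugates.  If T lies on C, then the linear factor of h at T is rational and divides h, h′ and h″;
-- the other factor takes the place of h and the degree drops to 4.

module Submission where

open import Algebra.Apartness.Bundles using (HeytingField)
open import Algebra.Bundles using (CommutativeRing; AbelianGroup)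
open import Algebra.Bundles.Raw using (RawRing)
import Algebra.Construct.DirectProduct
import Algebra.Properties.AbelianGroup
import Algebra.Properties.CommutativeMonoid.Sum
import Algebra.Properties.CommutativeSemiring.Binomial
import Algebra.Properties.CommutativeSemiring.Exp
import Algebra.Properties.Ring
import Algebra.Properties.Semiring.Exp
import Algebra.Properties.Semiring.Mult
import Algebra.Properties.Semiring.Mult.TCOptimised
import Algebra.Properties.Semiring.Sum
import Algebra.Solver.Ring
open import Algebra.Solver.Ring.AlmostCommutativeRing using (fromCommutativeRing; _-Raw-AlmostCommutative⟶_; Induced-equivalence)
open import Data.Empty using (⊥-elim; ⊥)
open import Data.Fin.Base as Fin using (Fin; zero; suc; toℕ; inject₁; fromℕ; punchIn; _↑ˡ_; _↑ʳ_; splitAt; funToFin; finToFun; punchOut)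
open import Data.Fin.Patterns using (0F; 1F; 2F; 3F; 4F; 5F; 6F)
open import Data.Fin.Permutation using (Permutation; permutation; _⟨$⟩ʳ_)
import Data.Fin.Properties as Fin
open import Data.Integer.Base as ℤ using (ℤ; +_; -[1+_])
import Data.Integer.Properties as ℤ
open import Data.Maybe.Base using (just; nothing)
open import Data.Nat.Base as ℕ using (ℕ; zero; suc; _!; _≤_) renaming (_^_ to _^ℕ_)
open import Data.Nat.Combinatorics using (nCk≡n!/k![n-k]!; k![n∸k]!∣n!; nCn≡1) renaming (_C_ to _choose_)
open import Data.Nat.DivMod using (m/n*n≡m)
open import Data.Nat.Divisibility using (_∣_; _∤_; divides; ∣⇒≤; ∣1⇒≡1; m∣m*n; ∣-refl)
open import Data.Nat.GeneralisedArithmetic using (iterate)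
open import Data.Nat.Primality using (Prime; euclidsLemma; prime⇒nonZero; ¬prime[1])
import Data.Nat.Properties as ℕ
import Data.Nat.Solver
open import Data.Nat.Tactic.RingSolver using (solve-∀)
open import Data.Product.Base using (Σ; ∃-syntax; _×_; _,_; proj₁; proj₂)
open import Data.Sum.Base using (_⊎_; inj₁; inj₂; [_,_]′)
open import Data.Vec.Base using (Vec) renaming ([] to []ᵛ; _∷_ to _∷ᵛ_)
open import Data.Vec.Functional using (Vector; replicate; removeAt; []; _∷_; _++_; take; drop; foldr)
open import Data.Vec.Functional.Properties using (lookup-++ˡ; lookup-++ʳ)
open import Defs
open import Function.Base using (_∘_; _$_; id)
open import Function.Bundles using (Inverse; _⇔_; mk⇔; Equivalence)
open import Level using (Level; _⊔_; Setω)
open import Relation.Binary.Definitions using (WeaklyDecidable; Decidable)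
open import Relation.Binary.PropositionalEquality as ≡ using (_≡_; _≢_)
import Relation.Binary.Reasoning.Setoid
open import Relation.Nullary.Decidable using (yes; no; Dec; map′; ¬?; _×-dec_)
open import Relation.Nullary.Negation using (¬_; contradiction)
open import Relation.Unary using (Pred)

-- Only one abstract field K of order q⁶ is given, so what is usually quoted from field theory has
-- to be counted out: facts about subfields, norms and roots of quadratics come from bounding roots
-- of monic polynomials, and facts about dimension come from the number of vectors. Characteristic 2
-- is included, so forms are handled through their polarisation, never by completing squares.
--
-- The parametrisation γ rests on C having a rational point. It also gives the equations of C⁺ and
-- C⁺⁺: pulled back along γ they are quartics vanishing on GF(q), and q is large enough to make them
-- zero up to a multiple of y² - x z.
--
-- Coprimality is used in transposed form: no nonzero coefficient sequence is annihilated by both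
-- forms. This is exactly what the independence of the 7 (or 5) coefficient vectors of the curve
-- requires, and a nonzero resultant yields it by elimination.
--
-- Over q³ and q⁶ the variety consists of scroll-planes. In the frame D the conjugacy is the
-- coordinatewise Frobenius, so the powers 5 and 4 combine with q and q² to the identity on
-- coordinates, and the same planes appear at all three levels.

-- Ring solver with integer coefficients, and ring laws with plain types

module RingSolver {c ℓ : Level} (R : CommutativeRing c ℓ) where

  open CommutativeRing R hiding (zero)
  open Algebra.Properties.Ring ring using (-‿distribˡ-*; -‿distribʳ-*; -‿involutive; -0#≈0#)
  open Algebra.Properties.AbelianGroup +-abelianGroup using (⁻¹-∙-comm)
  open Algebra.Properties.Semiring.Mult semiring using (×-homo-+; ×1-homo-*) renaming (_×_ to _ℕ×_)
  open Algebra.Properties.Semiring.Mult.TCOptimised semiring using (×ᵤ≈×) renaming (_×_ to _×′_)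
  open Relation.Binary.Reasoning.Setoid setoid

  private
    -- The homomorphism laws are proved for this version, whose successor clause reduces uniformly,
    -- and are then transferred along `unopt`.
    ⟦_⟧ᵤ : ℤ → Carrier
    ⟦ + n ⟧ᵤ      = n ℕ× 1#
    ⟦ -[1+ n ] ⟧ᵤ = - (suc n ℕ× 1#)

    cancel : ∀ x y z → (x + y) - (x + z) ≈ y - z
    cancel x y z = begin
      (x + y) + - (x + z)     ≈⟨ +-congˡ (⁻¹-∙-comm x z) ⟨
      (x + y) + (- x + - z)   ≈⟨ +-congʳ (+-comm x y) ⟩
      (y + x) + (- x + - z)   ≈⟨ +-assoc y x _ ⟩
      y + (x + (- x + - z))   ≈⟨ +-congˡ (+-assoc x (- x) (- z)) ⟨
      y + ((x + - x) + - z)   ≈⟨ +-congˡ (+-congʳ (-‿inverseʳ x)) ⟩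
      y + (0# + - z)          ≈⟨ +-congˡ (+-identityˡ _) ⟩
      y - z                   ∎

    ⊖-homo : ∀ m n → ⟦ m ℤ.⊖ n ⟧ᵤ ≈ m ℕ× 1# - n ℕ× 1#
    ⊖-homo m       zero    = trans (sym (+-identityʳ _)) (+-congˡ (sym -0#≈0#))
    ⊖-homo zero    (suc n) = sym (+-identityˡ _)
    ⊖-homo (suc m) (suc n) = begin
      ⟦ suc m ℤ.⊖ suc n ⟧ᵤ          ≡⟨ ≡.cong ⟦_⟧ᵤ (ℤ.[1+m]⊖[1+n]≡m⊖n m n) ⟩
      ⟦ m ℤ.⊖ n ⟧ᵤ                  ≈⟨ ⊖-homo m n ⟩
      m ℕ× 1# - n ℕ× 1#               ≈⟨ cancel 1# _ _ ⟨
      suc m ℕ× 1# - suc n ℕ× 1#       ∎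

    +-homoᵤ : ∀ i j → ⟦ i ℤ.+ j ⟧ᵤ ≈ ⟦ i ⟧ᵤ + ⟦ j ⟧ᵤ
    +-homoᵤ (+ m)    (+ n)    = ×-homo-+ 1# m n
    +-homoᵤ (+ m)    -[1+ n ] = ⊖-homo m (suc n)
    +-homoᵤ -[1+ m ] (+ n)    = trans (⊖-homo n (suc m)) (+-comm _ _)
    +-homoᵤ -[1+ m ] -[1+ n ] = begin
      - (suc (suc (m ℕ.+ n)) ℕ× 1#)       ≡⟨ ≡.cong (λ k → - (suc k ℕ× 1#)) (ℕ.+-suc m n) ⟨
      - ((suc m ℕ.+ suc n) ℕ× 1#)         ≈⟨ -‿cong (×-homo-+ 1# (suc m) (suc n)) ⟩
      - (suc m ℕ× 1# + suc n ℕ× 1#)        ≈⟨ ⁻¹-∙-comm _ _ ⟨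
      - (suc m ℕ× 1#) + - (suc n ℕ× 1#)    ∎

    -‿homoᵤ : ∀ i → ⟦ ℤ.- i ⟧ᵤ ≈ - ⟦ i ⟧ᵤ
    -‿homoᵤ (+ zero)  = sym -0#≈0#
    -‿homoᵤ (+ suc n) = refl
    -‿homoᵤ -[1+ n ]  = sym (-‿involutive _)

    *-homo⁺ : ∀ m j → ⟦ + m ℤ.* j ⟧ᵤ ≈ m ℕ× 1# * ⟦ j ⟧ᵤ
    *-homo⁺ m (+ n) = trans (reflexive (≡.cong ⟦_⟧ᵤ (≡.sym (ℤ.pos-* m n)))) (×1-homo-* m n)
    *-homo⁺ m -[1+ n ] = begin
      ⟦ + m ℤ.* -[1+ n ] ⟧ᵤ          ≡⟨ ≡.cong ⟦_⟧ᵤ (ℤ.neg-distribʳ-* (+ m) (+ suc n)) ⟨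
      ⟦ ℤ.- (+ m ℤ.* + suc n) ⟧ᵤ     ≈⟨ -‿homoᵤ (+ m ℤ.* + suc n) ⟩
      - ⟦ + m ℤ.* + suc n ⟧ᵤ         ≈⟨ -‿cong (*-homo⁺ m (+ suc n)) ⟩
      - (m ℕ× 1# * suc n ℕ× 1#)        ≈⟨ -‿distribʳ-* _ _ ⟩
      m ℕ× 1# * - (suc n ℕ× 1#)        ∎

    *-homoᵤ : ∀ i j → ⟦ i ℤ.* j ⟧ᵤ ≈ ⟦ i ⟧ᵤ * ⟦ j ⟧ᵤ
    *-homoᵤ (+ m)    j = *-homo⁺ m j
    *-homoᵤ -[1+ m ] j = begin
      ⟦ -[1+ m ] ℤ.* j ⟧ᵤ            ≡⟨ ≡.cong ⟦_⟧ᵤ (ℤ.neg-distribˡ-* (+ suc m) j) ⟨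
      ⟦ ℤ.- (+ suc m ℤ.* j) ⟧ᵤ       ≈⟨ -‿homoᵤ (+ suc m ℤ.* j) ⟩
      - ⟦ + suc m ℤ.* j ⟧ᵤ           ≈⟨ -‿cong (*-homo⁺ (suc m) j) ⟩
      - (suc m ℕ× 1# * ⟦ j ⟧ᵤ)        ≈⟨ -‿distribˡ-* _ _ ⟩
      - (suc m ℕ× 1#) * ⟦ j ⟧ᵤ        ∎

    -- Agrees with ⟦_⟧ᵤ, but sends 1 to 1# and not to 1# + 0#.
    ⟦_⟧ : ℤ → Carrier
    ⟦ + n ⟧      = n ×′ 1#
    ⟦ -[1+ n ] ⟧ = - (suc n ×′ 1#)

    unopt : ∀ i → ⟦ i ⟧ ≈ ⟦ i ⟧ᵤ
    unopt (+ n)    = sym (×ᵤ≈× n 1#)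
    unopt -[1+ n ] = -‿cong (sym (×ᵤ≈× (suc n) 1#))

    ℤ-rawRing : RawRing _ _
    ℤ-rawRing = record
      { Carrier = ℤ ; _≈_ = _≡_ ; _+_ = ℤ._+_ ; _*_ = ℤ._*_ ; -_ = ℤ.-_ ; 0# = ℤ.0ℤ ; 1# = ℤ.1ℤ }

    morphism : ℤ-rawRing -Raw-AlmostCommutative⟶ fromCommutativeRing R
    morphism = record
      { ⟦_⟧    = ⟦_⟧
      ; +-homo = λ i j → trans (unopt (i ℤ.+ j)) (trans (+-homoᵤ i j) (+-cong (sym (unopt i)) (sym (unopt j))))
      ; *-homo = λ i j → trans (unopt (i ℤ.* j)) (trans (*-homoᵤ i j) (*-cong (sym (unopt i)) (sym (unopt j))))
      ; -‿homo = λ i → trans (unopt (ℤ.- i)) (trans (-‿homoᵤ i) (-‿cong (sym (unopt i))))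
      ; 0-homo = refl
      ; 1-homo = refl
      }

    _≟_ : WeaklyDecidable (Induced-equivalence morphism)
    i ≟ j with i ℤ.≟ j
    ... | yes i≡j = just (reflexive (≡.cong ⟦_⟧ i≡j))
    ... | no  _   = nothing

  open Algebra.Solver.Ring ℤ-rawRing (fromCommutativeRing R) morphism _≟_ public
    using (Polynomial; solve; con; _:+_; _:*_; _:-_; :-_; _:^_; _:=_)

  :0 : ∀ {n} → Polynomial n
  :0 = con (+ 0)

  :1 : ∀ {n} → Polynomial n
  :1 = con (+ 1)

  :2 : ∀ {n} → Polynomial n
  :2 = con (+ 2)

-- Restated with plain types: elaborated against the types inherited through the tower of
-- algebraic records, every term would carry that tower along.
module RingLaws {c ℓ : Level} (R : CommutativeRing c ℓ) where

  private
    module R = CommutativeRing R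
  open R using (Carrier; _≈_; _+_; _*_; -_; _-_; 0#; 1#)
  private
    module Exp = Algebra.Properties.Semiring.Exp R.semiring
    module Sum = Algebra.Properties.Semiring.Sum R.semiring
    module Group = Algebra.Properties.Ring R.ring
    module CExp = Algebra.Properties.CommutativeSemiring.Exp R.commutativeSemiring
    variable
      x y z w : Carrier
      m n : ℕ
  open Exp using (_^_)
  open Sum using (sum)

  refl : x ≈ x
  refl = R.refl

  sym : x ≈ y → y ≈ x
  sym = R.sym

  trans : x ≈ y → y ≈ z → x ≈ z
  trans = R.trans

  reflexive : x ≡ y → x ≈ y
  reflexive = R.reflexive

  +-cong : x ≈ y → z ≈ w → x + z ≈ y + w
  +-cong = R.+-cong

  +-congˡ : y ≈ z → x + y ≈ x + z
  +-congˡ = R.+-congˡ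

  +-congʳ : y ≈ z → y + x ≈ z + x
  +-congʳ = R.+-congʳ

  *-cong : x ≈ y → z ≈ w → x * z ≈ y * w
  *-cong = R.*-cong

  *-congˡ : y ≈ z → x * y ≈ x * z
  *-congˡ = R.*-congˡ

  *-congʳ : y ≈ z → y * x ≈ z * x
  *-congʳ = R.*-congʳ

  -‿cong : x ≈ y → - x ≈ - y
  -‿cong = R.-‿cong

  +-comm : ∀ x y → x + y ≈ y + x
  +-comm = R.+-comm

  +-assoc : ∀ x y z → x + y + z ≈ x + (y + z)
  +-assoc = R.+-assoc

  *-comm : ∀ x y → x * y ≈ y * x
  *-comm = R.*-comm

  *-assoc : ∀ x y z → x * y * z ≈ x * (y * z)
  *-assoc = R.*-assoc

  +-identityˡ : ∀ x → 0# + x ≈ x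
  +-identityˡ = R.+-identityˡ

  +-identityʳ : ∀ x → x + 0# ≈ x
  +-identityʳ = R.+-identityʳ

  *-identityˡ : ∀ x → 1# * x ≈ x
  *-identityˡ = R.*-identityˡ

  *-identityʳ : ∀ x → x * 1# ≈ x
  *-identityʳ = R.*-identityʳ

  zeroˡ : ∀ x → 0# * x ≈ 0#
  zeroˡ = R.zeroˡ

  zeroʳ : ∀ x → x * 0# ≈ 0#
  zeroʳ = R.zeroʳ

  -‿inverseˡ : ∀ x → - x + x ≈ 0#
  -‿inverseˡ = R.-‿inverseˡ

  -‿inverseʳ : ∀ x → x - x ≈ 0#
  -‿inverseʳ = R.-‿inverseʳ

  distribˡ : ∀ x y z → x * (y + z) ≈ x * y + x * z
  distribˡ = R.distribˡ

  distribʳ : ∀ x y z → (y + z) * x ≈ y * x + z * x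
  distribʳ = R.distribʳ

  x≈y⇒x∙y⁻¹≈ε : x ≈ y → x - y ≈ 0#
  x≈y⇒x∙y⁻¹≈ε = Group.x≈y⇒x∙y⁻¹≈ε

  x∙y⁻¹≈ε⇒x≈y : ∀ x y → x - y ≈ 0# → x ≈ y
  x∙y⁻¹≈ε⇒x≈y = Group.x∙y⁻¹≈ε⇒x≈y

  ^-congˡ : ∀ n → x ≈ y → x ^ n ≈ y ^ n
  ^-congˡ n = Exp.^-congˡ n

  ^-congʳ : ∀ x → m ≡ n → x ^ m ≈ x ^ n
  ^-congʳ x = Exp.^-congʳ x

  ^-homo-* : ∀ x m n → x ^ (m ℕ.+ n) ≈ x ^ m * x ^ n
  ^-homo-* = Exp.^-homo-*

  ^-assocʳ : ∀ x m n → (x ^ m) ^ n ≈ x ^ (m ℕ.* n)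
  ^-assocʳ = Exp.^-assocʳ

  ^-distrib-* : ∀ x y n → (x * y) ^ n ≈ x ^ n * y ^ n
  ^-distrib-* = CExp.^-distrib-*

  sum-cong-≋ : {f g : Vector Carrier n} → (∀ i → f i ≈ g i) → sum f ≈ sum g
  sum-cong-≋ = Sum.sum-cong-≋

  sum-replicate-zero : ∀ n → sum {n} (λ _ → 0#) ≈ 0#
  sum-replicate-zero = Sum.sum-replicate-zero

  ∑-distrib-+ : ∀ (f g : Vector Carrier n) → sum (λ i → f i + g i) ≈ sum f + sum g
  ∑-distrib-+ = Sum.∑-distrib-+

  ∑-comm : ∀ (f : Fin m → Fin n → Carrier) → sum (λ i → sum (f i)) ≈ sum (λ j → sum (λ i → f i j))
  ∑-comm = Sum.∑-comm

  *-distribˡ-sum : ∀ x (f : Vector Carrier n) → x * sum f ≈ sum (λ i → x * f i)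
  *-distribˡ-sum = Sum.*-distribˡ-sum

  *-distribʳ-sum : ∀ x (f : Vector Carrier n) → sum f * x ≈ sum (λ i → f i * x)
  *-distribʳ-sum = Sum.*-distribʳ-sum

  infix  1 begin_
  infixr 2 step-≈ step-≈˘ step-≡
  infix  3 _∎

  begin_ : x ≈ y → x ≈ y
  begin x≈y = x≈y

  step-≈ : ∀ x → y ≈ z → x ≈ y → x ≈ z
  step-≈ _ y≈z x≈y = trans x≈y y≈z

  step-≈˘ : ∀ x → y ≈ z → y ≈ x → x ≈ z
  step-≈˘ _ y≈z y≈x = trans (sym y≈x) y≈z

  step-≡ : ∀ x → y ≈ z → x ≡ y → x ≈ z
  step-≡ _ y≈z ≡.refl = y≈z

  _∎ : ∀ x → x ≈ x
  _ ∎ = refl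

  syntax step-≈  x y≈z x≈y = x ≈⟨ x≈y ⟩ y≈z
  syntax step-≈˘ x y≈z y≈x = x ≈⟨ y≈x ⟨ y≈z
  syntax step-≡  x y≈z x≡y = x ≡⟨ x≡y ⟩ y≈z

-- Binomial coefficients of a prime, and additivity of the Frobenius map

prime∤! : ∀ {p} → Prime p → ∀ n → n ℕ.< p → p ∤ n !
prime∤! pr zero    _   p∣1 = ¬prime[1] (≡.subst Prime (∣1⇒≡1 p∣1) pr)
prime∤! pr (suc n) n<p p∣n! with euclidsLemma (suc n) (n !) pr p∣n!
... | inj₁ p∣n = ℕ.<⇒≱ n<p (∣⇒≤ p∣n)
... | inj₂ p∣r = prime∤! pr n (ℕ.<-trans (ℕ.n<1+n n) n<p) p∣r

-- The prime divides p! = C(p, k) · k! · (p - k)! but neither factorial, since all their factors are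
-- below p.
prime∣C : ∀ {p k} → Prime p → 0 ℕ.< k → k ℕ.< p → p ∣ p choose k
prime∣C {p} {k} pr 0<k k<p
  with euclidsLemma (p choose k) (k ! ℕ.* (p ℕ.∸ k) !) pr p∣C*k![p-k]!
  where
  instance
    _ = k ℕ.!* (p ℕ.∸ k) !≢0
    _ = prime⇒nonZero pr
  n∣n! : ∀ n → .{{ℕ.NonZero n}} → n ∣ n !
  n∣n! (suc n) = m∣m*n (n !)
  p∣C*k![p-k]! : p ∣ (p choose k) ℕ.* (k ! ℕ.* (p ℕ.∸ k) !)
  p∣C*k![p-k]! = ≡.subst (p ∣_)
    (≡.sym (≡.trans (≡.cong (ℕ._* (k ! ℕ.* (p ℕ.∸ k) !)) (nCk≡n!/k![n-k]! (ℕ.<⇒≤ k<p))) (m/n*n≡m (k![n∸k]!∣n! (ℕ.<⇒≤ k<p)))))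
    (n∣n! p)
... | inj₁ p∣C = p∣C
... | inj₂ p∣d with euclidsLemma (k !) ((p ℕ.∸ k) !) pr p∣d
...   | inj₁ p∣k!     = contradiction p∣k! (prime∤! pr k k<p)
...   | inj₂ p∣[p-k]! = contradiction p∣[p-k]! (prime∤! pr (p ℕ.∸ k) (ℕ.∸-monoʳ-< 0<k (ℕ.<⇒≤ k<p)))

module Frobenius {c ℓ : Level} (R : CommutativeRing c ℓ) where

  open CommutativeRing R hiding (zero)
  open Algebra.Properties.CommutativeSemiring.Binomial commutativeSemiring using (theorem; binomialTerm)
  open Algebra.Properties.CommutativeSemiring.Exp commutativeSemiring using (^-distrib-*)
  open Algebra.Properties.Semiring.Exp semiring
  open Algebra.Properties.Semiring.Mult semiring using (×-congʳ; ×-assoc-*; ×1-homo-*) renaming (_×_ to _ℕ×_)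
  open Algebra.Properties.Semiring.Sum semiring
  open Relation.Binary.Reasoning.Setoid setoid

  module _ {p : ℕ} (pr : Prime p) (p×1≈0 : p ℕ× 1# ≈ 0#) where

    ×-char : ∀ {m} → p ∣ m → ∀ x → m ℕ× x ≈ 0#
    ×-char (divides k ≡.refl) x = begin
      (k ℕ.* p) ℕ× x              ≈⟨ ×-congʳ (k ℕ.* p) (*-identityˡ x) ⟨
      (k ℕ.* p) ℕ× (1# * x)       ≈⟨ ×-assoc-* (k ℕ.* p) 1# x ⟨
      (k ℕ.* p) ℕ× 1# * x         ≈⟨ *-congʳ (×1-homo-* k p) ⟩
      (k ℕ× 1# * p ℕ× 1#) * x      ≈⟨ *-congʳ (*-congˡ p×1≈0) ⟩
      (k ℕ× 1# * 0#) * x          ≈⟨ *-congʳ (zeroʳ _) ⟩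
      0# * x                     ≈⟨ zeroˡ x ⟩
      0#                         ∎

    private
      -- Stated for a variable `m`, which can be matched as a successor, so that the two end terms
      -- split off the binomial sum; `kill` removes every term in between, whose coefficient the
      -- prime divides.
      expand : ∀ {m} → Prime m → (∀ {k} → 0 ℕ.< k → k ℕ.< m → m ∣ m choose k) → (∀ {k} → m ∣ k → ∀ x → k ℕ× x ≈ 0#) →
               ∀ x y → (x + y) ^ m ≈ x ^ m + y ^ m
      expand {zero}  pr0 _ _ = contradiction (prime⇒nonZero pr0) λ ()
      expand {suc m} _ m∣C kill x y = begin
        (x + y) ^ suc m                                       ≈⟨ theorem (suc m) x y ⟩
        t zero + sum (t ∘ suc)                                ≈⟨ +-congˡ (sum-init-last (t ∘ suc)) ⟩
        t zero + (sum (t ∘ suc ∘ inject₁) + t (suc (fromℕ m)))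
          ≈⟨ +-cong first (+-cong (trans (sum-cong-≋ middle) (sum-replicate-zero m)) lst) ⟩
        y ^ suc m + (0# + x ^ suc m)                          ≈⟨ +-congˡ (+-identityˡ _) ⟩
        y ^ suc m + x ^ suc m                                 ≈⟨ +-comm _ _ ⟩
        x ^ suc m + y ^ suc m                                 ∎
        where
        t = binomialTerm x y (suc m)
        first : t zero ≈ y ^ suc m
        first = trans (+-identityʳ _) (*-identityˡ _)
        middle : ∀ i → t (suc (inject₁ i)) ≈ 0#
        middle i = kill (m∣C (ℕ.s≤s ℕ.z≤n)
          (ℕ.s≤s (≡.subst (ℕ._< m) (≡.sym (Fin.toℕ-inject₁ i)) (Fin.toℕ<n i)))) _
        lst : t (suc (fromℕ m)) ≈ x ^ suc m
        lst rewrite Fin.toℕ-fromℕ m | nCn≡1 (suc m) | ℕ.n∸n≡0 m =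
          trans (+-identityʳ _) (*-identityʳ _)

    ^p-+ : ∀ x y → (x + y) ^ p ≈ x ^ p + y ^ p
    ^p-+ = expand pr (prime∣C pr) ×-char

    ^p^k-+ : ∀ k x y → (x + y) ^ (p ℕ.^ k) ≈ x ^ (p ℕ.^ k) + y ^ (p ℕ.^ k)
    ^p^k-+ zero    x y = trans (*-identityʳ _) (sym (+-cong (*-identityʳ x) (*-identityʳ y)))
    ^p^k-+ (suc k) x y = begin
      (x + y) ^ (p ℕ.* p ℕ.^ k)                              ≈⟨ ^-assocʳ (x + y) p (p ℕ.^ k) ⟨
      ((x + y) ^ p) ^ (p ℕ.^ k)                              ≈⟨ ^-congˡ (p ℕ.^ k) (^p-+ x y) ⟩
      (x ^ p + y ^ p) ^ (p ℕ.^ k)                            ≈⟨ ^p^k-+ k (x ^ p) (y ^ p) ⟩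
      (x ^ p) ^ (p ℕ.^ k) + (y ^ p) ^ (p ℕ.^ k)              ≈⟨ +-cong (^-assocʳ x p _) (^-assocʳ y p _) ⟩
      x ^ (p ℕ.* p ℕ.^ k) + y ^ (p ℕ.* p ℕ.^ k)              ∎

-- Monic polynomials and the number of their roots

module MonicPolynomials {c ℓ : Level} (R : CommutativeRing c ℓ) where

  open CommutativeRing R hiding (zero)
  open RingSolver R
  open Algebra.Properties.Ring ring using (x≈y⇒x∙y⁻¹≈ε; x∙y⁻¹≈ε⇒x≈y)
  open Algebra.Properties.Semiring.Exp semiring using (_^_; ^-homo-*)
  open Relation.Binary.Reasoning.Setoid setoid

  -- c₀ ∷ᵛ … ∷ᵛ c_{d-1} ∷ᵛ []ᵛ stands for x^d + c_{d-1} x^{d-1} + … + c₀.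
  eval : ∀ {d} → Vec Carrier d → Carrier → Carrier
  eval []ᵛ       x = 1#
  eval (c ∷ᵛ cs) x = c + x * eval cs x

  -- Synthetic division by x - a: as in Horner's scheme, the coefficients are the values at `a` of
  -- the successive tails of the polynomial.
  quotient : ∀ {d} → Carrier → Vec Carrier (suc d) → Vec Carrier d
  quotient a (c ∷ᵛ []ᵛ)        = []ᵛ
  quotient a (c ∷ᵛ cs@(_ ∷ᵛ _)) = eval cs a ∷ᵛ quotient a cs

  factor : ∀ {d} (f : Vec Carrier (suc d)) a x → eval f x - eval f a ≈ (x - a) * eval (quotient a f) x
  factor (c ∷ᵛ []ᵛ) a x = solve 3 (λ c a x → (c :+ x :* :1) :- (c :+ a :* :1) := (x :- a) :* :1) refl c a x
  factor (c ∷ᵛ cs@(_ ∷ᵛ _)) a x = begin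
    (c + x * eval cs x) - (c + a * eval cs a)
      ≈⟨ solve 5 (λ c x a u v → (c :+ x :* u) :- (c :+ a :* v) := (x :- a) :* v :+ x :* (u :- v)) refl c x a (eval cs x) (eval cs a) ⟩
    (x - a) * eval cs a + x * (eval cs x - eval cs a)
      ≈⟨ +-congˡ (*-congˡ (factor cs a x)) ⟩
    (x - a) * eval cs a + x * ((x - a) * eval (quotient a cs) x)
      ≈⟨ solve 4 (λ x a v w → (x :- a) :* v :+ x :* ((x :- a) :* w) := (x :- a) :* (v :+ x :* w)) refl x a (eval cs a) (eval (quotient a cs) x) ⟩
    (x - a) * (eval cs a + x * eval (quotient a cs) x) ∎

  module _ (noZeroDivisors : ∀ {x y} → x * y ≈ 0# → x ≈ 0# ⊎ y ≈ 0#) (1≉0 : ¬ 1# ≈ 0#) where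

    -- Dividing by x - `e zero` keeps all other roots, because they differ from `e zero` and there
    -- are no zero divisors; the degree drops by one each time.
    roots≤degree : ∀ {d N} (f : Vec Carrier d) (e : Fin N → Carrier) → (∀ {i j} → e i ≈ e j → i ≡ j) →
                   (∀ i → eval f (e i) ≈ 0#) → N ℕ.≤ d
    roots≤degree {N = zero}  f  e inj root = ℕ.z≤n
    roots≤degree {N = suc N} []ᵛ e inj root = ⊥-elim (1≉0 (root zero))
    roots≤degree {N = suc N} f@(_ ∷ᵛ _) e inj root =
      ℕ.s≤s (roots≤degree (quotient (e zero) f) (e ∘ suc) (Fin.suc-injective ∘ inj) root′)
      where
      root′ : ∀ i → eval (quotient (e zero) f) (e (suc i)) ≈ 0#
      root′ i with noZeroDivisors (trans (sym (factor f (e zero) (e (suc i))))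
                     (x≈y⇒x∙y⁻¹≈ε (trans (root (suc i)) (sym (root zero)))))
      ... | inj₁ e≈e = contradiction (inj (x∙y⁻¹≈ε⇒x≈y _ _ e≈e)) λ ()
      ... | inj₂ eq  = eq

  shift : ∀ {d} r → Vec Carrier d → Vec Carrier (r ℕ.+ d)
  shift zero    f = f
  shift (suc r) f = 0# ∷ᵛ shift r f

  eval-shift : ∀ {d} r (f : Vec Carrier d) x → eval (shift r f) x ≈ x ^ r * eval f x
  eval-shift zero    f x = sym (*-identityˡ _)
  eval-shift (suc r) f x = begin
    0# + x * eval (shift r f) x   ≈⟨ +-identityˡ _ ⟩
    x * eval (shift r f) x        ≈⟨ *-congˡ (eval-shift r f x) ⟩
    x * (x ^ r * eval f x)        ≈⟨ *-assoc x _ _ ⟨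
    x ^ suc r * eval f x          ∎

  -- f(x) ↦ f(x^(r+1))
  inflate : ∀ {d} r → Vec Carrier d → Vec Carrier (d ℕ.* suc r)
  inflate r []ᵛ       = []ᵛ
  inflate r (c ∷ᵛ cs) = c ∷ᵛ shift r (inflate r cs)

  eval-inflate : ∀ {d} r (f : Vec Carrier d) x → eval (inflate r f) x ≈ eval f (x ^ suc r)
  eval-inflate r []ᵛ       x = refl
  eval-inflate r (c ∷ᵛ cs) x = +-congˡ (begin
    x * eval (shift r (inflate r cs)) x      ≈⟨ *-congˡ (eval-shift r (inflate r cs) x) ⟩
    x * (x ^ r * eval (inflate r cs) x)      ≈⟨ *-assoc x _ _ ⟨
    x ^ suc r * eval (inflate r cs) x        ≈⟨ *-congˡ (eval-inflate r cs x) ⟩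
    x ^ suc r * eval cs (x ^ suc r)          ∎)

-- Finite fields: inverses, and the equation xⁿ = x

module FiniteFieldProperties {c ℓ₁ ℓ₂ : Level} {n : ℕ} (K : FiniteField c ℓ₁ ℓ₂ n) where

  open CommutativeRing (FiniteField.commutativeRing K) hiding (zero)
  private module H = HeytingField (FiniteField.heytingField K)
  open RingSolver (FiniteField.commutativeRing K)
  open Algebra.Properties.Ring ring using (x≈y⇒x∙y⁻¹≈ε; x∙y⁻¹≈ε⇒x≈y; +-cancelˡ)
  open Algebra.Properties.Semiring.Exp semiring using (_^_; ^-congˡ)
  open Algebra.Properties.Semiring.Mult semiring using () renaming (_×_ to _ℕ×_)
  open Algebra.Properties.Semiring.Sum semiring using (sum; sum-permute; ∑-distrib-+; sum-replicate; sum-cong-≋)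
  open Relation.Binary.Reasoning.Setoid setoid
  private module Π = Algebra.Properties.CommutativeMonoid.Sum *-commutativeMonoid

  index : Carrier → Fin n
  index = Inverse.to (FiniteField.enumeration K)

  element : Fin n → Carrier
  element = Inverse.from (FiniteField.enumeration K)

  index-cong : ∀ {x y} → x ≈ y → index x ≡ index y
  index-cong = Inverse.to-cong (FiniteField.enumeration K)

  element-index : ∀ x → element (index x) ≈ x
  element-index x = Inverse.inverseʳ (FiniteField.enumeration K) ≡.refl

  index-element : ∀ i → index (element i) ≡ i
  index-element i = Inverse.inverseˡ (FiniteField.enumeration K) refl

  index-injective : ∀ {x y} → index x ≡ index y → x ≈ y
  index-injective {x} {y} eq = trans (sym (element-index x)) (trans (reflexive (≡.cong element eq)) (element-index y))

  element-injective : ∀ {i j} → element i ≈ element j → i ≡ j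
  element-injective {i} {j} eq = ≡.trans (≡.sym (index-element i)) (≡.trans (index-cong eq) (index-element j))

  infix 4 _≈?_
  _≈?_ : Decidable _≈_
  x ≈? y = map′ index-injective index-cong (index x Fin.≟ index y)

  -- A Heyting field inverts only elements apart from 0. The finite search bridges the gap: if it
  -- fails, x cannot be apart from 0, and tightness gives x ≈ 0.
  inverse : ∀ x → ¬ x ≈ 0# → ∃[ y ] x * y ≈ 1#
  inverse x x≉0 with Fin.any? (λ i → x * element i ≈? 1#)
  ... | yes (i , eq) = element i , eq
  ... | no ¬inv = contradiction (proj₁ (H.tight x 0#) ¬apart) x≉0
    where
    ¬apart : ¬ x H.# 0#
    ¬apart x#0 with H.#⇒invertible x#0
    ... | y , _ , [x-0]y≈1 = ¬inv (index y , (begin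
      x * element (index y)    ≈⟨ *-congˡ (element-index y) ⟩
      x * y                    ≈⟨ solve 2 (λ x y → x :* y := (x :- :0) :* y) refl x y ⟩
      (x - 0#) * y             ≈⟨ [x-0]y≈1 ⟩
      1#                       ∎))

  -- Zero is sent to zero.
  infix 9 _⁻¹
  _⁻¹ : Carrier → Carrier
  x ⁻¹ with x ≈? 0#
  ... | yes _  = 0#
  ... | no x≉0 = proj₁ (inverse x x≉0)

  *-inverseʳ : ∀ {x} → ¬ x ≈ 0# → x * x ⁻¹ ≈ 1#
  *-inverseʳ {x} x≉0 with x ≈? 0#
  ... | yes x≈0 = contradiction x≈0 x≉0
  ... | no x≉0′ = proj₂ (inverse x x≉0′)

  *-cancelˡ : ∀ {x y z} → ¬ x ≈ 0# → x * y ≈ x * z → y ≈ z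
  *-cancelˡ {x} {y} {z} x≉0 eq = begin
    y                  ≈⟨ *-identityˡ y ⟨
    1# * y             ≈⟨ *-congʳ (*-inverseʳ x≉0) ⟨
    x * x ⁻¹ * y       ≈⟨ solve 3 (λ x i y → x :* i :* y := i :* (x :* y)) refl x (x ⁻¹) y ⟩
    x ⁻¹ * (x * y)     ≈⟨ *-congˡ eq ⟩
    x ⁻¹ * (x * z)     ≈⟨ solve 3 (λ x i y → x :* i :* y := i :* (x :* y)) refl x (x ⁻¹) z ⟨
    x * x ⁻¹ * z       ≈⟨ *-congʳ (*-inverseʳ x≉0) ⟩
    1# * z             ≈⟨ *-identityˡ z ⟩
    z                  ∎

  noZeroDivisors : ∀ {x y} → x * y ≈ 0# → x ≈ 0# ⊎ y ≈ 0#
  noZeroDivisors {x} {y} xy≈0 with x ≈? 0#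
  ... | yes x≈0 = inj₁ x≈0
  ... | no x≉0  = inj₂ (*-cancelˡ x≉0 (trans xy≈0 (sym (zeroʳ x))))

  *-nonzero : ∀ {x y} → ¬ x ≈ 0# → ¬ y ≈ 0# → ¬ x * y ≈ 0#
  *-nonzero x≉0 y≉0 xy≈0 = [ x≉0 , y≉0 ]′ (noZeroDivisors xy≈0)

  *-nonzeroʳ : ∀ {x y} → ¬ x * y ≈ 0# → ¬ y ≈ 0#
  *-nonzeroʳ xy≉0 y≈0 = xy≉0 (trans (*-congˡ y≈0) (zeroʳ _))

  private
    translate : ∀ f g → (∀ x y → x ≈ y → f x ≈ f y) → (∀ x y → x ≈ y → g x ≈ g y) →
                (∀ x → f (g x) ≈ x) → (∀ x → g (f x) ≈ x) → Permutation n n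
    translate f g f-cong g-cong f∘g g∘f = permutation (index ∘ f ∘ element) (index ∘ g ∘ element)
      (inv f g f-cong f∘g) (inv g f g-cong g∘f)
      where
      inv : ∀ f g → (∀ x y → x ≈ y → f x ≈ f y) → (∀ x → f (g x) ≈ x) →
            ∀ i → index (f (element (index (g (element i))))) ≡ i
      inv f g f-cong f∘g i =
        ≡.trans (index-cong (trans (f-cong _ _ (element-index _)) (f∘g (element i)))) (index-element i)

  -- Σ x = Σ (x + 1) = Σ x + n · 1
  n×1≈0 : n ℕ× 1# ≈ 0#
  n×1≈0 = +-cancelˡ (sum element) _ _ (begin
    sum element + n ℕ× 1#                          ≈⟨ +-congˡ (sum-replicate n) ⟨
    sum element + sum (replicate n 1#)             ≈⟨ ∑-distrib-+ element (replicate n 1#) ⟨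
    sum (λ i → element i + 1#)                     ≈⟨ sum-cong-≋ (λ i → element-index (element i + 1#)) ⟨
    sum (λ i → element (π ⟨$⟩ʳ i))                 ≈⟨ sum-permute element π ⟨
    sum element                                    ≈⟨ +-identityʳ _ ⟨
    sum element + 0#                               ∎)
    where
    π : Permutation n n
    π = translate (_+ 1#) (_- 1#) (λ _ _ → +-congʳ) (λ _ _ → +-congʳ)
          (solve 1 (λ x → x :- :1 :+ :1 := x) refl) (solve 1 (λ x → x :+ :1 :- :1 := x) refl)

  private
    -- Isolates the one index at which two families differ; it is applied at the index of 0, where
    -- `unit` holds a placeholder.
    product-differing : ∀ {m} (f g : Fin m → Carrier) i a → f i ≈ a * g i → (∀ j → j ≢ i → f j ≈ g j) →
                        Π.sum f ≈ a * Π.sum g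
    product-differing {suc m} f g i a fi≈ fj≈ = begin
      Π.sum f                             ≈⟨ Π.sum-remove {i = i} f ⟩
      f i * Π.sum (removeAt f i)          ≈⟨ *-cong fi≈ (Π.sum-cong-≋ (λ j → fj≈ (punchIn i j) (Fin.punchInᵢ≢i i j))) ⟩
      a * g i * Π.sum (removeAt g i)      ≈⟨ *-assoc a _ _ ⟩
      a * (g i * Π.sum (removeAt g i))    ≈⟨ *-congˡ (Π.sum-remove {i = i} g) ⟨
      a * Π.sum g                         ∎

  module _ (1≉0 : ¬ 1# ≈ 0#) where

    private
      -- Zero is replaced by 1, so that a product over all indices is the product of the nonzero
      -- elements and can be cancelled.
      unit : Fin n → Carrier
      unit i with element i ≈? 0#
      ... | yes _ = 1#
      ... | no _  = element i

      unit≉0 : ∀ i → ¬ unit i ≈ 0#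
      unit≉0 i with element i ≈? 0#
      ... | yes _  = 1≉0
      ... | no x≉0 = x≉0

      unit-zero : ∀ {i} → element i ≈ 0# → unit i ≈ 1#
      unit-zero {i} eq with element i ≈? 0#
      ... | yes _  = refl
      ... | no x≉0 = contradiction eq x≉0

      unit-nonzero : ∀ {i} → ¬ element i ≈ 0# → unit i ≈ element i
      unit-nonzero {i} neq with element i ≈? 0#
      ... | yes eq = contradiction eq neq
      ... | no _   = refl

      product≉0 : ∀ {m} (f : Fin m → Carrier) → (∀ i → ¬ f i ≈ 0#) → ¬ Π.sum f ≈ 0#
      product≉0 {zero}  f f≉0 = 1≉0
      product≉0 {suc m} f f≉0 = *-nonzero (f≉0 zero) (product≉0 (f ∘ suc) (f≉0 ∘ suc))

    -- Multiplication by a permutes the nonzero elements, whose product therefore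
    -- absorbs a^(n-1); the index of 0 contributes one further factor a.
    x^n≈x : ∀ x → x ^ n ≈ x
    x^n≈x a with a ≈? 0#
    -- `index 0#` inhabits `Fin n`, so the exponent n is positive.
    ... | yes a≈0 = trans (^-congˡ n a≈0) (trans (0^ n (index 0#)) (sym a≈0))
      where
      0^ : ∀ m → Fin m → 0# ^ m ≈ 0#
      0^ (suc m) _ = zeroˡ _
    ... | no a≉0 = *-cancelˡ (product≉0 unit unit≉0) (begin
      Π.sum unit * a ^ n                          ≈⟨ *-comm _ _ ⟩
      a ^ n * Π.sum unit                          ≈⟨ *-congʳ (Π.sum-replicate n) ⟨
      Π.sum (replicate n a) * Π.sum unit          ≈⟨ Π.∑-distrib-+ (replicate n a) unit ⟨
      Π.sum (λ i → a * unit i)                    ≈⟨ product-differing _ (λ i → unit (π ⟨$⟩ʳ i)) (index 0#) a at-zero elsewhere ⟩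
      a * Π.sum (λ i → unit (π ⟨$⟩ʳ i))           ≈⟨ *-congˡ (Π.sum-permute unit π) ⟨
      a * Π.sum unit                              ≈⟨ *-comm _ _ ⟩
      Π.sum unit * a                              ∎)
      where
      a[a⁻¹x] : ∀ x → a * (a ⁻¹ * x) ≈ x
      a[a⁻¹x] x = trans (sym (*-assoc a _ x)) (trans (*-congʳ (*-inverseʳ a≉0)) (*-identityˡ x))
      a⁻¹[ax] : ∀ x → a ⁻¹ * (a * x) ≈ x
      a⁻¹[ax] x = trans (sym (*-assoc _ a x)) (trans (*-congʳ (trans (*-comm _ a) (*-inverseʳ a≉0))) (*-identityˡ x))
      π : Permutation n n
      π = translate (a *_) (a ⁻¹ *_) (λ _ _ → *-congˡ) (λ _ _ → *-congˡ) a[a⁻¹x] a⁻¹[ax]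
      image : ∀ i → element (π ⟨$⟩ʳ i) ≈ a * element i
      image i = element-index _
      at-zero : a * unit (index 0#) ≈ a * unit (π ⟨$⟩ʳ index 0#)
      at-zero = *-congˡ (trans (unit-zero (element-index 0#))
        (sym (unit-zero (trans (image _) (trans (*-congˡ (element-index 0#)) (zeroʳ a))))))
      elsewhere : ∀ i → i ≢ index 0# → a * unit i ≈ unit (π ⟨$⟩ʳ i)
      elsewhere i i≢0 = trans (*-congˡ (unit-nonzero x≉0)) (trans (sym (image i))
        (sym (unit-nonzero (*-nonzero a≉0 x≉0 ∘ trans (sym (image i))))))
        where
        x≉0 : ¬ element i ≈ 0#
        x≉0 eq = i≢0 (≡.trans (≡.sym (index-element i)) (index-cong eq))

  -- With 1 = 0 all elements coincide, and the enumeration would inject `Fin n` into a one-element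
  -- type.
  1≉0-if : 1 ℕ.< n → ¬ 1# ≈ 0#
  1≉0-if 1<n 1≈0 = ℕ.<⇒≱ 1<n (Fin.injective⇒≤ {f = λ (_ : Fin n) → zero {0}} λ {i} {j} _ →
    element-injective (trans (all-zero (element i)) (sym (all-zero (element j)))))
    where
    all-zero : ∀ x → x ≈ 0#
    all-zero x = trans (sym (*-identityˡ x)) (trans (*-congʳ 1≈0) (zeroˡ x))

-- Roots of quadratics, by counting in a quadratic extension

-- K[ω] with ω² = τ ω − ν; the pair (u , v) stands for u + v ω.
module QuadraticExtension {c ℓ : Level} (K : CommutativeRing c ℓ) (τ ν : CommutativeRing.Carrier K) where

  open CommutativeRing K hiding (zero)
  open RingSolver K
  open Algebra.Construct.DirectProduct using (abelianGroup)

  private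
    pairs : AbelianGroup c ℓ
    pairs = abelianGroup +-abelianGroup +-abelianGroup

  extension : CommutativeRing c ℓ
  extension = record
    { Carrier = AbelianGroup.Carrier pairs
    ; _≈_ = AbelianGroup._≈_ pairs
    ; _+_ = AbelianGroup._∙_ pairs
    ; _*_ = λ (a , b) (c , d) → a * c - ν * (b * d) , a * d + b * c + τ * (b * d)
    ; -_ = AbelianGroup._⁻¹ pairs
    ; 0# = 0# , 0#
    ; 1# = 1# , 0#
    ; isCommutativeRing = record
      { isRing = record
        { +-isAbelianGroup = AbelianGroup.isAbelianGroup pairs
        ; *-cong = λ (p , q) (r , s) →
            +-cong (*-cong p r) (-‿cong (*-congˡ (*-cong q s))) ,
            +-cong (+-cong (*-cong p s) (*-cong q r)) (*-congˡ (*-cong q s))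
        ; *-assoc = λ (a , b) (c , d) (e , f) →
            solve 8 (λ a b c d e f τ ν →
              (a :* c :- ν :* (b :* d)) :* e :- ν :* ((a :* d :+ b :* c :+ τ :* (b :* d)) :* f) :=
              a :* (c :* e :- ν :* (d :* f)) :- ν :* (b :* (c :* f :+ d :* e :+ τ :* (d :* f)))) refl a b c d e f τ ν ,
            solve 8 (λ a b c d e f τ ν →
              (a :* c :- ν :* (b :* d)) :* f :+ (a :* d :+ b :* c :+ τ :* (b :* d)) :* e
                :+ τ :* ((a :* d :+ b :* c :+ τ :* (b :* d)) :* f) :=
              a :* (c :* f :+ d :* e :+ τ :* (d :* f)) :+ b :* (c :* e :- ν :* (d :* f))
                :+ τ :* (b :* (c :* f :+ d :* e :+ τ :* (d :* f)))) refl a b c d e f τ ν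
        ; *-identity =
            (λ (a , b) → solve 3 (λ a b ν → :1 :* a :- ν :* (:0 :* b) := a) refl a b ν ,
                         solve 3 (λ a b τ → :1 :* b :+ :0 :* a :+ τ :* (:0 :* b) := b) refl a b τ) ,
            (λ (a , b) → solve 3 (λ a b ν → a :* :1 :- ν :* (b :* :0) := a) refl a b ν ,
                         solve 3 (λ a b τ → a :* :0 :+ b :* :1 :+ τ :* (b :* :0) := b) refl a b τ)
        ; distrib =
            (λ (a , b) (c , d) (e , f) →
              solve 7 (λ a b c d e f ν → a :* (c :+ e) :- ν :* (b :* (d :+ f)) :=
                (a :* c :- ν :* (b :* d)) :+ (a :* e :- ν :* (b :* f))) refl a b c d e f ν ,
              solve 7 (λ a b c d e f τ → a :* (d :+ f) :+ b :* (c :+ e) :+ τ :* (b :* (d :+ f)) :=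
                (a :* d :+ b :* c :+ τ :* (b :* d)) :+ (a :* f :+ b :* e :+ τ :* (b :* f))) refl a b c d e f τ) ,
            (λ (a , b) (c , d) (e , f) →
              solve 7 (λ a b c d e f ν → (c :+ e) :* a :- ν :* ((d :+ f) :* b) :=
                (c :* a :- ν :* (d :* b)) :+ (e :* a :- ν :* (f :* b))) refl a b c d e f ν ,
              solve 7 (λ a b c d e f τ → (c :+ e) :* b :+ (d :+ f) :* a :+ τ :* ((d :+ f) :* b) :=
                (c :* b :+ d :* a :+ τ :* (d :* b)) :+ (e :* b :+ f :* a :+ τ :* (f :* b))) refl a b c d e f τ)
        }
      ; *-comm = λ (a , b) (c , d) →
          solve 5 (λ a b c d ν → a :* c :- ν :* (b :* d) := c :* a :- ν :* (d :* b)) refl a b c d ν ,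
          solve 5 (λ a b c d τ → a :* d :+ b :* c :+ τ :* (b :* d) := c :* b :+ d :* a :+ τ :* (d :* b)) refl a b c d τ
      }
    }

module Domains {c ℓ : Level} (E : CommutativeRing c ℓ) where

  open CommutativeRing E hiding (zero)
  open RingSolver E
  open Algebra.Properties.Ring ring using (x≈y⇒x∙y⁻¹≈ε; x∙y⁻¹≈ε⇒x≈y; +-cancelʳ)
  open Algebra.Properties.Semiring.Exp semiring
  open Algebra.Properties.CommutativeSemiring.Exp commutativeSemiring using (^-distrib-*)
  open Algebra.Properties.Semiring.Mult semiring using () renaming (_×_ to _ℕ×_)
  open Relation.Binary.Reasoning.Setoid setoid

  module _ (noZeroDivisors : ∀ {x y} → x * y ≈ 0# → x ≈ 0# ⊎ y ≈ 0#) where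

    module _ {p : ℕ} (pr : Prime p) (p×1≈0 : p ℕ× 1# ≈ 0#) (k : ℕ) where

      private
        F : Carrier → Carrier
        F x = x ^ (p ℕ.^ k)

        F-+ : ∀ x y → F (x + y) ≈ F x + F y
        F-+ = Frobenius.^p^k-+ E pr p×1≈0 k

      -- The Frobenius map permutes the roots of the quadratic, so its square fixes them.
      frobenius²-root : ∀ {τ ν ω} → F τ ≈ τ → F ν ≈ ν → ω * ω + ν ≈ τ * ω → F (F ω) ≈ ω
      frobenius²-root {τ} {ν} {ω} Fτ Fν root = [ case₁ , case₂ ]′ (noZeroDivisors (begin
          (F ω - ω) * (F ω - (τ - ω))
            ≈⟨ solve 4 (λ y ω t n → (y :- ω) :* (y :- (t :- ω)) := (y :* y :+ n :- t :* y) :- (ω :* ω :+ n :- t :* ω)) refl (F ω) ω τ ν ⟩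
          (F ω * F ω + ν - τ * F ω) - (ω * ω + ν - τ * ω)
            ≈⟨ +-cong (x≈y⇒x∙y⁻¹≈ε Froot) (-‿cong (x≈y⇒x∙y⁻¹≈ε root)) ⟩
          0# - 0#     ≈⟨ -‿inverseʳ 0# ⟩
          0#          ∎))
        where
        Froot : F ω * F ω + ν ≈ τ * F ω
        Froot = begin
          F ω * F ω + ν       ≈⟨ +-cong (^-distrib-* ω ω (p ℕ.^ k)) Fν ⟨
          F (ω * ω) + F ν     ≈⟨ F-+ (ω * ω) ν ⟨
          F (ω * ω + ν)       ≈⟨ ^-congˡ (p ℕ.^ k) root ⟩
          F (τ * ω)           ≈⟨ ^-distrib-* τ ω (p ℕ.^ k) ⟩
          F τ * F ω           ≈⟨ *-congʳ Fτ ⟩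
          τ * F ω             ∎
        case₁ : F ω - ω ≈ 0# → F (F ω) ≈ ω
        case₁ eq = trans (^-congˡ (p ℕ.^ k) Fω≈ω) Fω≈ω
          where Fω≈ω = x∙y⁻¹≈ε⇒x≈y _ _ eq
        case₂ : F ω - (τ - ω) ≈ 0# → F (F ω) ≈ ω
        case₂ eq = +-cancelʳ (F ω) _ _ (begin
          F (F ω) + F ω     ≈⟨ F-+ (F ω) ω ⟨
          F (F ω + ω)       ≈⟨ ^-congˡ (p ℕ.^ k) (trans (+-congʳ Fω≈τ-ω) (solve 2 (λ t ω → t :- ω :+ ω := t) refl τ ω)) ⟩
          F τ               ≈⟨ Fτ ⟩
          τ                 ≈⟨ solve 2 (λ t ω → ω :+ (t :- ω) := t) refl τ ω ⟨
          ω + (τ - ω)       ≈⟨ +-congˡ Fω≈τ-ω ⟨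
          ω + F ω           ∎)
          where Fω≈τ-ω = x∙y⁻¹≈ε⇒x≈y _ _ eq

    fixed-points≤ : ¬ 1# ≈ 0# → ∀ {N n} → 1 ℕ.< n → (e : Fin N → Carrier) → (∀ {i j} → e i ≈ e j → i ≡ j) →
                    (∀ i → e i ^ n ≈ e i) → N ℕ.≤ n
    fixed-points≤ 1≉0 {n = suc zero} (ℕ.s≤s ())
    fixed-points≤ 1≉0 {N} {suc (suc m)} _ e inj fixed =
      ≡.subst (λ k → N ℕ.≤ suc (suc k)) (ℕ.+-identityʳ m) (roots≤degree noZeroDivisors 1≉0 f e inj root)
      where
      open MonicPolynomials E
      f : Vec Carrier (suc (suc (m ℕ.+ 0)))
      -- This is x^(m+2) - x: the leading coefficient is implicit in the encoding, and `shift`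
      -- inserts the zeros below it.
      f = 0# ∷ᵛ - 1# ∷ᵛ shift m []ᵛ
      root : ∀ i → eval f (e i) ≈ 0#
      root i = begin
        0# + x * (- 1# + x * eval (shift m []ᵛ) x)
          ≈⟨ +-congˡ (*-congˡ (+-congˡ (*-congˡ (eval-shift m []ᵛ x)))) ⟩
        0# + x * (- 1# + x * (x ^ m * 1#))
          ≈⟨ solve 2 (λ x y → :0 :+ x :* (:- :1 :+ x :* (y :* :1)) := x :* (x :* y) :- x) refl x (x ^ m) ⟩
        x ^ suc (suc m) - x      ≈⟨ x≈y⇒x∙y⁻¹≈ε (fixed i) ⟩
        0#                       ∎
        where x = e i

module QuadraticRoots {c ℓ₁ ℓ₂ : Level} {n : ℕ} (K : FiniteField c ℓ₁ ℓ₂ n) (1<n : 1 ℕ.< n)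
                      {p : ℕ} (pr : Prime p) where

  open CommutativeRing (FiniteField.commutativeRing K) hiding (zero)
  open FiniteFieldProperties K
  open RingSolver (FiniteField.commutativeRing K)
  open Algebra.Properties.Semiring.Exp semiring using (_^_; ^-congˡ)
  open Algebra.Properties.Semiring.Mult semiring using (×-congʳ; ×-congˡ; ×1-homo-*) renaming (_×_ to _ℕ×_)
  open Relation.Binary.Reasoning.Setoid setoid

  -- From `n×1≈0`: with n a power of p, the element n × 1 is a power of p × 1, and there are no zero
  -- divisors.
  characteristic : ∀ m → n ≡ p ℕ.^ m → p ℕ× 1# ≈ 0#
  characteristic m n≡p^m = go m (trans (×-congˡ {1#} (≡.sym n≡p^m)) n×1≈0)
    where
    go : ∀ m → (p ℕ.^ m) ℕ× 1# ≈ 0# → p ℕ× 1# ≈ 0#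
    go zero    eq = contradiction (trans (sym (+-identityʳ 1#)) eq) (1≉0-if 1<n)
    go (suc m) eq = [ (λ z → z) , go m ]′ (noZeroDivisors (trans (sym (×1-homo-* p (p ℕ.^ m))) eq))

  module _ (k : ℕ) (n≡Q² : n ≡ p ℕ.^ k ℕ.* p ℕ.^ k) (τ ν : Carrier) where

    private
      Q = p ℕ.^ k
      E = QuadraticExtension.extension (FiniteField.commutativeRing K) τ ν
      module E = CommutativeRing E
      open Algebra.Properties.Semiring.Exp E.semiring renaming (_^_ to _^ᴱ_; ^-assocʳ to ^ᴱ-assocʳ) using ()
      open Algebra.Properties.Semiring.Mult E.semiring using () renaming (_×_ to _ℕ×ᴱ_)

      ι : Carrier → E.Carrier
      ι a = a , 0#

      ω : E.Carrier
      ω = 0# , 1#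

      ι-^ : ∀ a m → ι a ^ᴱ m E.≈ ι (a ^ m)
      ι-^ a zero    = E.refl
      ι-^ a (suc m) = E.trans (E.*-congˡ {x = ι a} (ι-^ a m)) (ι-* (a ^ m))
        where
        ι-* : ∀ b → ι a E.* ι b E.≈ ι (a * b)
        ι-* b = solve 3 (λ a b ν → a :* b :- ν :* (:0 :* :0) := a :* b) refl a b ν ,
                solve 3 (λ a b τ → a :* :0 :+ :0 :* b :+ τ :* (:0 :* :0) := :0) refl a b τ

      ω²+ν≈τω : ω E.* ω E.+ ι ν E.≈ ι τ E.* ω
      ω²+ν≈τω = solve 2 (λ τ ν → :0 :* :0 :- ν :* (:1 :* :1) :+ ν := τ :* :0 :- ν :* (:0 :* :1)) refl τ ν ,
                solve 1 (λ τ → :0 :* :1 :+ :1 :* :0 :+ τ :* (:1 :* :1) :+ :0 := τ :* :1 :+ :0 :* :0 :+ τ :* (:0 :* :1)) refl τ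

      ×-componentwise : ∀ m a b → m ℕ×ᴱ (a , b) E.≈ (m ℕ× a , m ℕ× b)
      ×-componentwise zero    a b = E.refl
      ×-componentwise (suc m) a b = E.+-congˡ {x = a , b} (×-componentwise m a b)

      module Irreducible (noRoot : ∀ θ → ¬ θ * θ - τ * θ + ν ≈ 0#) where

        -- The norm of a + b ω, where ω has trace τ and norm ν. If it vanished with b nonzero, -a /
        -- b would be a root of the quadratic.
        norm : Carrier → Carrier → Carrier
        norm a b = a * a + τ * (a * b) + ν * (b * b)

        norm≈0⇒≈0 : ∀ a b → norm a b ≈ 0# → (a , b) E.≈ E.0#
        norm≈0⇒≈0 a b N≈0 with b ≈? 0#
        ... | no b≉0 = contradiction (begin
            - (a * i) * - (a * i) - τ * - (a * i) + ν
              ≈⟨ solve 4 (λ a i τ ν → :- (a :* i) :* :- (a :* i) :- τ :* :- (a :* i) :+ ν :=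
                   a :* a :* (i :* i) :+ τ :* a :* i :* :1 :+ ν :* (:1 :* :1)) refl a i τ ν ⟩
            a * a * (i * i) + τ * a * i * 1# + ν * (1# * 1#)
              ≈⟨ +-cong (+-congˡ (*-congˡ b*i≈1)) (*-congˡ (*-cong b*i≈1 b*i≈1)) ⟨
            a * a * (i * i) + τ * a * i * (b * i) + ν * (b * i * (b * i))
              ≈⟨ solve 5 (λ a b i τ ν → a :* a :* (i :* i) :+ τ :* a :* i :* (b :* i) :+ ν :* (b :* i :* (b :* i)) :=
                   (a :* a :+ τ :* (a :* b) :+ ν :* (b :* b)) :* (i :* i)) refl a b i τ ν ⟩
            norm a b * (i * i)  ≈⟨ *-congʳ N≈0 ⟩
            0# * (i * i)        ≈⟨ zeroˡ _ ⟩
            0#                  ∎) (noRoot (- (a * i)))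
          where
          i = b ⁻¹
          b*i≈1 = *-inverseʳ b≉0
        ... | yes b≈0 = [ (λ z → z) , (λ z → z) ]′ (noZeroDivisors (begin
            a * a                    ≈⟨ solve 3 (λ a τ ν → a :* a := a :* a :+ τ :* (a :* :0) :+ ν :* (:0 :* :0)) refl a τ ν ⟩
            norm a 0#                ≈⟨ +-cong (+-congˡ (*-congˡ (*-congˡ b≈0))) (*-congˡ (*-cong b≈0 b≈0)) ⟨
            norm a b                 ≈⟨ N≈0 ⟩
            0#                       ∎)) , b≈0

        -- Multiplying x y = 0 by the conjugate (a + τ b) - b ω of x turns it into norm(x) · y = 0,
        -- which is read off componentwise in K.
        noZeroDivisorsᴱ : ∀ {x y} → x E.* y E.≈ E.0# → x E.≈ E.0# ⊎ y E.≈ E.0#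
        noZeroDivisorsᴱ {a , b} {c , d} (eq₁ , eq₂) with norm a b ≈? 0#
        ... | yes N≈0 = inj₁ (norm≈0⇒≈0 a b N≈0)
        ... | no  N≉0 = inj₂ (*-cancelˡ N≉0 (begin
            norm a b * c
              ≈⟨ solve 6 (λ a b c d τ ν → (a :* a :+ τ :* (a :* b) :+ ν :* (b :* b)) :* c :=
                   (a :+ τ :* b) :* (a :* c :- ν :* (b :* d)) :+ ν :* b :* (a :* d :+ b :* c :+ τ :* (b :* d))) refl a b c d τ ν ⟩
            (a + τ * b) * (a * c - ν * (b * d)) + ν * b * (a * d + b * c + τ * (b * d))
              ≈⟨ +-cong (*-congˡ eq₁) (*-congˡ eq₂) ⟩
            (a + τ * b) * 0# + ν * b * 0#
              ≈⟨ solve 3 (λ x y z → x :* :0 :+ y :* :0 := z :* :0) refl (a + τ * b) (ν * b) (norm a b) ⟩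
            norm a b * 0#       ∎) , *-cancelˡ N≉0 (begin
            norm a b * d
              ≈⟨ solve 6 (λ a b c d τ ν → (a :* a :+ τ :* (a :* b) :+ ν :* (b :* b)) :* d :=
                   a :* (a :* d :+ b :* c :+ τ :* (b :* d)) :- b :* (a :* c :- ν :* (b :* d))) refl a b c d τ ν ⟩
            a * (a * d + b * c + τ * (b * d)) - b * (a * c - ν * (b * d))
              ≈⟨ +-cong (*-congˡ eq₂) (-‿cong (*-congˡ eq₁)) ⟩
            a * 0# - b * 0#
              ≈⟨ solve 3 (λ x y z → x :* :0 :- y :* :0 := z :* :0) refl a b (norm a b) ⟩
            norm a b * 0#       ∎))

        module _ (p×1≈0 : p ℕ× 1# ≈ 0#) (τ^Q≈τ : τ ^ Q ≈ τ) (ν^Q≈ν : ν ^ Q ≈ ν) where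

          p×ᴱ1≈0 : p ℕ×ᴱ E.1# E.≈ E.0#
          p×ᴱ1≈0 = E.trans (×-componentwise p 1# 0#)
            (p×1≈0 , Frobenius.×-char (FiniteField.commutativeRing K) pr p×1≈0 ∣-refl 0#)

          Fι : ∀ a → a ^ Q ≈ a → ι a ^ᴱ Q E.≈ ι a
          Fι a eq = E.trans (ι-^ a Q) (eq , refl)

          fixed : Fin (suc n) → E.Carrier
          fixed zero    = ω
          fixed (suc i) = ι (element i)

          fixed-injective : ∀ {i j} → fixed i E.≈ fixed j → i ≡ j
          fixed-injective {zero}  {zero}  _        = ≡.refl
          fixed-injective {zero}  {suc j} (_ , eq) = contradiction eq (1≉0-if 1<n)
          fixed-injective {suc i} {zero}  (_ , eq) = contradiction (sym eq) (1≉0-if 1<n)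
          fixed-injective {suc i} {suc j} (eq , _) = ≡.cong suc (element-injective eq)

          -- On K this is `x^n≈x`; for ω it holds because n = Q², so that the n-th power is the
          -- Q-Frobenius applied twice.
          fixed^n : ∀ i → fixed i ^ᴱ n E.≈ fixed i
          fixed^n (suc i) = E.trans (ι-^ _ n) (x^n≈x (1≉0-if 1<n) _ , refl)
          fixed^n zero    = E.trans (E.reflexive (≡.cong (ω ^ᴱ_) n≡Q²)) (E.trans (E.sym (^ᴱ-assocʳ ω Q Q))
            (Domains.frobenius²-root E noZeroDivisorsᴱ pr p×ᴱ1≈0 k (Fι τ τ^Q≈τ) (Fι ν ν^Q≈ν) ω²+ν≈τω))

          absurd : suc n ℕ.≤ n
          absurd = Domains.fixed-points≤ E noZeroDivisorsᴱ (λ (eq , _) → 1≉0-if 1<n eq) 1<n fixed fixed-injective fixed^n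

    -- Were the quadratic irreducible, the field K[ω] would contain n + 1 roots of
    -- xⁿ − x: the elements of K, and ω itself.
    quadratic-root : p ℕ× 1# ≈ 0# → τ ^ Q ≈ τ → ν ^ Q ≈ ν → ∃[ θ ] θ * θ - τ * θ + ν ≈ 0#
    quadratic-root p×1≈0 τ^Q≈τ ν^Q≈ν with Fin.any? (λ i → let θ = element i in θ * θ - τ * θ + ν ≈? 0#)
    ... | yes (i , root) = element i , root
    ... | no  noRoot = contradiction (Irreducible.absurd noRoot′ p×1≈0 τ^Q≈τ ν^Q≈ν) ℕ.1+n≰n
      where
      noRoot′ : ∀ θ → ¬ θ * θ - τ * θ + ν ≈ 0#
      noRoot′ θ root = noRoot (index θ , trans (+-congʳ (+-cong (*-cong eq eq) (-‿cong (*-congˡ eq)))) root)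
        where eq = element-index θ

-- Pigeonhole, exponents of norms, and index arithmetic

injective⇒surjective : ∀ {m} (f : Fin m → Fin m) → (∀ {i j} → f i ≡ f j → i ≡ j) → ∀ y → ∃[ x ] f x ≡ y
injective⇒surjective {suc m} f inj y with Fin.any? (λ x → f x Fin.≟ y)
... | yes found = found
-- A missed value could be punched out of the codomain, leaving an injection into a smaller finite
-- set.
... | no  none  = contradiction (Fin.injective⇒≤ f′-injective) ℕ.1+n≰n
  where
  missed : ∀ x → y ≢ f x
  missed x eq = none (x , ≡.sym eq)
  f′-injective : ∀ {x x′} → punchOut (missed x) ≡ punchOut (missed x′) → x ≡ x′
  f′-injective {x} {x′} eq = inj (Fin.punchOut-injective (missed x) (missed x′) eq)

module NormExponents where

  open Data.Nat.Solver.+-*-Solver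

  -- For the norm exponent N = 1 + q + ... + q⁵: q N = (N - 1) + q⁶. As x^(q⁶) = x, raising x^N to
  -- the power q gives x^N back.
  norm₁*q : ∀ q → suc (q ℕ.+ (q ℕ.^ 2 ℕ.+ (q ℕ.^ 3 ℕ.+ (q ℕ.^ 4 ℕ.+ q ℕ.^ 5)))) ℕ.* q ℕ.^ 1 ≡
            (q ℕ.+ (q ℕ.^ 2 ℕ.+ (q ℕ.^ 3 ℕ.+ (q ℕ.^ 4 ℕ.+ q ℕ.^ 5)))) ℕ.+ q ℕ.^ 6
  norm₁*q = solve 1 (λ q → let n = q :+ (q :^ 2 :+ (q :^ 3 :+ (q :^ 4 :+ q :^ 5))) in
    (con 1 :+ n) :* q :^ 1 := n :+ q :^ 6) ≡.refl

  -- The identity (q - 1) N = q⁶ - 1 with q = r + 1; it bounds the degree of a polynomial composed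
  -- with the norm to GF(q).
  pred*norm₁ : ∀ r → suc (r ℕ.* suc (suc r ℕ.+ (suc r ℕ.^ 2 ℕ.+ (suc r ℕ.^ 3 ℕ.+ (suc r ℕ.^ 4 ℕ.+ suc r ℕ.^ 5))))) ≡ suc r ℕ.^ 6
  pred*norm₁ = solve 1 (λ r → let s = con 1 :+ r in
    con 1 :+ r :* (con 1 :+ (s :+ (s :^ 2 :+ (s :^ 3 :+ (s :^ 4 :+ s :^ 5))))) := s :^ 6) ≡.refl

  -- With q = r + 2, the long summand is q⁶ - q⁴ - q - 1 expanded in r, where all coefficients are
  -- nonnegative; this certifies q (1 + q³) < q⁶.
  degree-bound : ∀ r → suc (suc (suc (r ℕ.+ 0)) ℕ.* suc (suc (suc r) ℕ.^ 3)) ℕ.+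
    (45 ℕ.+ r ℕ.* (159 ℕ.+ r ℕ.* (216 ℕ.+ r ℕ.* (152 ℕ.+ r ℕ.* (59 ℕ.+ r ℕ.* (12 ℕ.+ r)))))) ≡ suc (suc r) ℕ.^ 6
  degree-bound = solve 1 (λ r → let s = con 2 :+ r in
    con 1 :+ (con 2 :+ (r :+ con 0)) :* (con 1 :+ s :^ 3) :+
    (con 45 :+ r :* (con 159 :+ r :* (con 216 :+ r :* (con 152 :+ r :* (con 59 :+ r :* (con 12 :+ r)))))) := s :^ 6) ≡.refl

  -- The factorisation q⁶ - 1 = (q - 1)(1 + q² + q⁴) · (q + 1) with q = m + 2, its first two factors
  -- multiplied out as a successor.
  factorisation : ∀ m → let r = suc (suc m) ; Y = r ℕ.* r ℕ.+ r ℕ.^ 4 in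
    suc ((suc (Y ℕ.+ m ℕ.* suc Y)) ℕ.* suc r) ≡ r ℕ.^ 6
  factorisation = solve 1 (λ m → let r = con 2 :+ m ; Y = r :* r :+ r :^ 4 in
    con 1 :+ (con 1 :+ (Y :+ m :* (con 1 :+ Y))) :* (con 1 :+ r) := r :^ 6) ≡.refl

-- The index j + i. A form of degree e has e + 1 coefficients and takes sequences of length e + n to
-- sequences of length n, which dictates the types.
shift-index : ∀ {e n} → Fin (suc e) → Fin n → Fin (e ℕ.+ n)
shift-index {zero}  zero    i = i
shift-index {suc e} zero    i = inject₁ (shift-index {e} zero i)
shift-index {suc e} (suc j) i = suc (shift-index j i)

toℕ-shift-index : ∀ {e n} (j : Fin (suc e)) (i : Fin n) → toℕ (shift-index j i) ≡ toℕ j ℕ.+ toℕ i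
toℕ-shift-index {zero}  zero    i = ≡.refl
toℕ-shift-index {suc e} zero    i = ≡.trans (Fin.toℕ-inject₁ (shift-index {e} zero i)) (toℕ-shift-index {e} zero i)
toℕ-shift-index {suc e} (suc j) i = ≡.cong suc (toℕ-shift-index j i)

shift-index-comm : ∀ {e n} (j l : Fin (suc e)) (i : Fin n) → shift-index j (shift-index l i) ≡ shift-index l (shift-index j i)
shift-index-comm j l i = Fin.toℕ-injective (begin
  toℕ (shift-index j (shift-index l i))     ≡⟨ toℕ-shift-index j _ ⟩
  toℕ j ℕ.+ toℕ (shift-index l i)           ≡⟨ ≡.cong (toℕ j ℕ.+_) (toℕ-shift-index l i) ⟩
  toℕ j ℕ.+ (toℕ l ℕ.+ toℕ i)               ≡⟨ ℕ.+-assoc (toℕ j) (toℕ l) (toℕ i) ⟨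
  toℕ j ℕ.+ toℕ l ℕ.+ toℕ i                 ≡⟨ ≡.cong (ℕ._+ toℕ i) (ℕ.+-comm (toℕ j) (toℕ l)) ⟩
  toℕ l ℕ.+ toℕ j ℕ.+ toℕ i                 ≡⟨ ℕ.+-assoc (toℕ l) (toℕ j) (toℕ i) ⟩
  toℕ l ℕ.+ (toℕ j ℕ.+ toℕ i)               ≡⟨ ≡.cong (toℕ l ℕ.+_) (toℕ-shift-index j i) ⟨
  toℕ l ℕ.+ toℕ (shift-index j i)           ≡⟨ toℕ-shift-index l _ ⟨
  toℕ (shift-index l (shift-index j i))     ∎)
  where open ≡.≡-Reasoning

-- The field of order q⁶: powers of Frobenius, vectors and matrices

-- Bundled, so that every lemma below has one parameter instead of seven.
record Ground : Setω where
  constructor ground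
  field
    {c ℓ₁ ℓ₂} : Level
    q          : ℕ
    primePower : IsPrimePower q
    6≤q        : 6 ℕ.≤ q
    K          : FiniteField c ℓ₁ ℓ₂ (q ℕ.^ 6)

module Development (𝒢 : Ground) where

  open Ground 𝒢 public

  open Geometry q K public
  open CommutativeRing (FiniteField.commutativeRing K) public using (-_; ring)
  open FiniteFieldProperties K public
  open RingLaws (FiniteField.commutativeRing K) public
  open RingSolver (FiniteField.commutativeRing K) public
  open Algebra.Properties.Semiring.Mult semiring using () renaming (_×_ to _ℕ×_)

  private
    variable
      m n : ℕ

  1<q^6 : 1 ℕ.< q ℕ.^ 6
  1<q^6 = ℕ.≤-trans {j = 2 ℕ.^ 6} (ℕ.s≤s (ℕ.s≤s ℕ.z≤n)) (ℕ.^-monoˡ-≤ 6 (ℕ.≤-trans (ℕ.s≤s (ℕ.s≤s ℕ.z≤n)) 6≤q))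

  1≉0 : ¬ 1# ≈ 0#
  1≉0 = 1≉0-if 1<q^6

  char : ℕ
  char = proj₁ primePower

  exponent : ℕ
  exponent = suc (proj₁ (proj₂ primePower))

  char-prime : Prime char
  char-prime = proj₁ (proj₂ (proj₂ primePower))

  q^j≡ : ∀ j → q ℕ.^ j ≡ char ℕ.^ (exponent ℕ.* j)
  q^j≡ j = ≡.trans (≡.cong (ℕ._^ j) (proj₂ (proj₂ (proj₂ primePower)))) (ℕ.^-*-assoc char exponent j)

  char×1≈0 : char ℕ× 1# ≈ 0#
  char×1≈0 = QuadraticRoots.characteristic K 1<q^6 char-prime (exponent ℕ.* 6) (q^j≡ 6)

  σ : ℕ → Carrier → Carrier
  σ j x = x ^ (q ℕ.^ j)

  σ-cong : ∀ j {x y} → x ≈ y → σ j x ≈ σ j y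
  σ-cong j = ^-congˡ (q ℕ.^ j)

  σ-+ : ∀ j x y → σ j (x + y) ≈ σ j x + σ j y
  σ-+ j x y rewrite q^j≡ j = Frobenius.^p^k-+ (FiniteField.commutativeRing K) char-prime char×1≈0 (exponent ℕ.* j) x y

  σ-* : ∀ j x y → σ j (x * y) ≈ σ j x * σ j y
  σ-* j x y = ^-distrib-* x y (q ℕ.^ j)

  σ-1 : ∀ j → σ j 1# ≈ 1#
  σ-1 j = go (q ℕ.^ j)
    where
    go : ∀ m → 1# ^ m ≈ 1#
    go zero    = refl
    go (suc m) = trans (*-identityˡ _) (go m)

  σ-0 : ∀ j → σ j 0# ≈ 0#
  σ-0 j = +-cancelˡ′ (trans (sym (σ-+ j 0# 0#)) (trans (σ-cong j (+-identityˡ 0#)) (sym (+-identityʳ _))))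
    where
    +-cancelˡ′ : ∀ {x y z} → x + y ≈ x + z → y ≈ z
    +-cancelˡ′ = Algebra.Properties.Ring.+-cancelˡ ring _ _ _

  σ-neg : ∀ j x → σ j (- x) ≈ - σ j x
  σ-neg j x = x∙y⁻¹≈ε⇒x≈y _ _ (begin
    σ j (- x) - - σ j x        ≈⟨ solve 2 (λ a b → a :- :- b := a :+ b) refl _ _ ⟩
    σ j (- x) + σ j x          ≈⟨ σ-+ j (- x) x ⟨
    σ j (- x + x)              ≈⟨ σ-cong j (-‿inverseˡ x) ⟩
    σ j 0#                     ≈⟨ σ-0 j ⟩
    0#                         ∎)

  σ-minus : ∀ j x y → σ j (x - y) ≈ σ j x - σ j y
  σ-minus j x y = trans (σ-+ j x (- y)) (+-congˡ (σ-neg j y))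

  σ-∘ : ∀ i j x → σ i (σ j x) ≈ σ (j ℕ.+ i) x
  σ-∘ i j x = trans (^-assocʳ x (q ℕ.^ j) (q ℕ.^ i)) (^-congʳ x (≡.sym (ℕ.^-distribˡ-+-* q j i)))

  σ-6 : ∀ x → σ 6 x ≈ x
  σ-6 = x^n≈x 1≉0

  -- `σ (6 ∸ j)` undoes `σ j`, because `σ 6` is the identity of K.
  σ-injective : ∀ j {x y} → j ℕ.≤ 6 → σ j x ≈ σ j y → x ≈ y
  σ-injective j {x} {y} j≤6 eq = trans (sym (σ-6 x)) (trans (lift x) (trans (σ-cong (6 ℕ.∸ j) eq) (trans (sym (lift y)) (σ-6 y))))
    where
    lift : ∀ x → σ 6 x ≈ σ (6 ℕ.∸ j) (σ j x)
    lift x = trans (^-congʳ x (≡.cong (q ℕ.^_) (≡.sym (ℕ.m+[n∸m]≡n j≤6)))) (sym (σ-∘ (6 ℕ.∸ j) j x))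

  σ-sum : ∀ j (f : V n) → σ j (sum f) ≈ sum (σ j ∘ f)
  σ-sum {zero}  j f = σ-0 j
  σ-sum {suc n} j f = trans (σ-+ j _ _) (+-congˡ (σ-sum j (f ∘ suc)))

  σ-≉0 : ∀ j {x} → ¬ x ≈ 0# → ¬ σ j x ≈ 0#
  σ-≉0 j x≉0 = go (q ℕ.^ j)
    where
    go : ∀ m → ¬ _ ^ m ≈ 0#
    go zero    = 1≉0
    go (suc m) = *-nonzero x≉0 (go m)

  InGF-+ : ∀ j {x y} → InGF j x → InGF j y → InGF j (x + y)
  InGF-+ j p q = trans (σ-+ j _ _) (+-cong p q)

  InGF-* : ∀ j {x y} → InGF j x → InGF j y → InGF j (x * y)
  InGF-* j p q = trans (σ-* j _ _) (*-cong p q)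

  InGF-neg : ∀ j {x} → InGF j x → InGF j (- x)
  InGF-neg j p = trans (σ-neg j _) (-‿cong p)

  InGF-minus : ∀ j {x y} → InGF j x → InGF j y → InGF j (x - y)
  InGF-minus j p q = InGF-+ j p (InGF-neg j q)

  InGF-cong : ∀ j {x y} → x ≈ y → InGF j x → InGF j y
  InGF-cong j x≈y p = trans (σ-cong j (sym x≈y)) (trans p x≈y)

  InGF-⁻¹ : ∀ j {x} → InGF j x → InGF j (x ⁻¹)
  InGF-⁻¹ j {x} p with x ≈? 0#
  ... | yes _  = σ-0 j
  ... | no x≉0 = *-cancelˡ x≉0 (begin
    x * σ j y             ≈⟨ *-congʳ p ⟨
    σ j x * σ j y         ≈⟨ σ-* j x y ⟨
    σ j (x * y)           ≈⟨ σ-cong j (proj₂ (inverse x x≉0)) ⟩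
    σ j 1#                ≈⟨ σ-1 j ⟩
    1#                    ≈⟨ proj₂ (inverse x x≉0) ⟨
    x * y                 ∎)
    where y = proj₁ (inverse x x≉0)

  InGF-sum : ∀ j (f : V n) → (∀ i → InGF j (f i)) → InGF j (sum f)
  InGF-sum j f p = trans (σ-sum j f) (sum-cong-≋ p)

  InGF-1⇒ : ∀ j {x} → InGF 1 x → InGF j x
  InGF-1⇒ zero    p = *-identityʳ _
  InGF-1⇒ (suc j) {x} p = begin
    σ (suc j) x       ≈⟨ σ-∘ j 1 x ⟨
    σ j (σ 1 x)       ≈⟨ σ-cong j p ⟩
    σ j x             ≈⟨ InGF-1⇒ j p ⟩
    x                 ∎

  infixr 8 _⊛_
  _⊛_ : Carrier → V n → V n
  (a ⊛ v) i = a * v i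

  ≋-refl : {v : V n} → v ≋ v
  ≋-refl i = refl

  ≋-sym : {v w : V n} → v ≋ w → w ≋ v
  ≋-sym p i = sym (p i)

  ≋-trans : {u v w : V n} → u ≋ v → v ≋ w → u ≋ w
  ≋-trans p q i = trans (p i) (q i)

  ⊕-cong : {u v u′ v′ : V n} → u ≋ u′ → v ≋ v′ → u ⊕ v ≋ u′ ⊕ v′
  ⊕-cong p q i = +-cong (p i) (q i)

  ⊛-cong : ∀ {a b} {v w : V n} → a ≈ b → v ≋ w → a ⊛ v ≋ b ⊛ w
  ⊛-cong p q i = *-cong p (q i)

  ·-cong : {M N : Vector (V n) m} {x y : V m} → (∀ j → M j ≋ N j) → x ≋ y → M · x ≋ N · y
  ·-cong M≋N x≋y i = sum-cong-≋ (λ j → *-cong (x≋y j) (M≋N j i))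

  ·-congˡ : (M : Vector (V n) m) {x y : V m} → x ≋ y → M · x ≋ M · y
  ·-congˡ M x≋y i = sum-cong-≋ (λ j → *-congʳ (x≋y j))

  ·-congʳ : {M N : Vector (V n) m} (x : V m) → (∀ j → M j ≋ N j) → M · x ≋ N · x
  ·-congʳ x M≋N i = sum-cong-≋ (λ j → *-congˡ (M≋N j i))

  ·-⊕ : (M : Vector (V n) m) (x y : V m) → M · (x ⊕ y) ≋ (M · x) ⊕ (M · y)
  ·-⊕ M x y i = trans (sum-cong-≋ (λ j → distribʳ (M j i) (x j) (y j))) (∑-distrib-+ (λ j → x j * M j i) (λ j → y j * M j i))

  ·-⊛ : ∀ (M : Vector (V n) m) a (x : V m) → M · (a ⊛ x) ≋ a ⊛ (M · x)
  ·-⊛ M a x i = trans (sum-cong-≋ (λ j → *-assoc a (x j) (M j i))) (sym (*-distribˡ-sum a (λ j → x j * M j i)))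

  ·-𝟎 : (M : Vector (V n) m) → M · 𝟎 ≋ 𝟎
  ·-𝟎 {m = m} M i = trans (sum-cong-≋ (λ j → zeroˡ (M j i))) (sum-replicate-zero m)

  ·-∘ : ∀ {k} (M : Vector (V n) m) (N : Vector (V m) k) (x : V k) → (λ j → M · N j) · x ≋ M · (N · x)
  ·-∘ M N x i = begin
    sum (λ j → x j * sum (λ l → N j l * M l i))    ≈⟨ sum-cong-≋ (λ j → *-distribˡ-sum (x j) (λ l → N j l * M l i)) ⟩
    sum (λ j → sum (λ l → x j * (N j l * M l i)))  ≈⟨ ∑-comm (λ j l → x j * (N j l * M l i)) ⟩
    sum (λ l → sum (λ j → x j * (N j l * M l i)))
      ≈⟨ sum-cong-≋ (λ l → trans (sum-cong-≋ (λ j → sym (*-assoc (x j) (N j l) (M l i)))) (sym (*-distribʳ-sum (M l i) (λ j → x j * N j l)))) ⟩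
    sum (λ l → sum (λ j → x j * N j l) * M l i)    ∎

  ·-scaled : (a : V m) (M : Vector (V n) m) (x : V m) → (λ j → a j ⊛ M j) · x ≋ M · (λ j → a j * x j)
  ·-scaled a M x i = sum-cong-≋ (λ j → solve 3 (λ x a b → x :* (a :* b) := a :* x :* b) refl (x j) (a j) (M j i))

  unit : Fin n → V n
  unit zero    zero    = 1#
  unit zero    (suc _) = 0#
  unit (suc i) zero    = 0#
  unit (suc i) (suc j) = unit i j

  unit-sym : (i j : Fin n) → unit i j ≈ unit j i
  unit-sym zero    zero    = refl
  unit-sym zero    (suc j) = refl
  unit-sym (suc i) zero    = refl
  unit-sym (suc i) (suc j) = unit-sym i j

  sum-unit : (i : Fin n) (f : V n) → sum (λ j → unit i j * f j) ≈ f i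
  sum-unit {suc n} zero f = begin
    1# * f zero + sum (λ j → 0# * f (suc j))    ≈⟨ +-cong (*-identityˡ _) (sum-cong-≋ (λ j → zeroˡ (f (suc j)))) ⟩
    f zero + sum (replicate n 0#)               ≈⟨ +-congˡ (sum-replicate-zero n) ⟩
    f zero + 0#                                 ≈⟨ +-identityʳ _ ⟩
    f zero                                      ∎
  sum-unit (suc i) f = trans (+-cong (zeroˡ _) (sum-unit i (f ∘ suc))) (+-identityˡ _)

  ·-unit : (M : Vector (V n) m) (j : Fin m) → M · unit j ≋ M j
  ·-unit M j i = sum-unit j (λ l → M l i)

  unit-· : (x : V n) → unit · x ≋ x
  unit-· x i = trans (sum-cong-≋ (λ j → trans (*-comm (x j) _) (*-congʳ (unit-sym j i)))) (sum-unit i x)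

  unit-over : ∀ k (i : Fin n) → Over k (unit i)
  unit-over k zero    zero    = σ-1 k
  unit-over k zero    (suc j) = σ-0 k
  unit-over k (suc i) zero    = σ-0 k
  unit-over k (suc i) (suc j) = unit-over k i j

  sum-++ : ∀ m {n} (f : V (m ℕ.+ n)) → sum f ≈ sum (f ∘ (_↑ˡ n)) + sum (f ∘ (m ↑ʳ_))
  sum-++ zero    f = sym (+-identityˡ _)
  sum-++ (suc m) f = trans (+-congˡ (sum-++ m (f ∘ suc))) (sym (+-assoc _ _ _))

  ·-++ : ∀ {k} (M : Vector (V k) m) (N : Vector (V k) n) (x : V m) (y : V n) → (M ++ N) · (x ++ y) ≋ (M · x) ⊕ (N · y)
  ·-++ {m = m} M N x y i = trans (sum-++ m _) (+-cong
    (sum-cong-≋ (λ j → reflexive (≡.cong₂ _*_ (lookup-++ˡ x y j) (≡.cong (_$ i) (lookup-++ˡ M N j)))))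
    (sum-cong-≋ (λ j → reflexive (≡.cong₂ _*_ (lookup-++ʳ x y j) (≡.cong (_$ i) (lookup-++ʳ M N j))))))

  take-drop : ∀ m {n} (x : V (m ℕ.+ n)) → x ≋ take m x ++ drop m x
  take-drop m x i with splitAt m i in eq
  ... | inj₁ j = reflexive (≡.cong x (≡.sym (Fin.splitAt⁻¹-↑ˡ eq)))
  ... | inj₂ j = reflexive (≡.cong x (≡.sym (Fin.splitAt⁻¹-↑ʳ eq)))

  ++-cong : {x x′ : V m} {y y′ : V n} → x ≋ x′ → y ≋ y′ → x ++ y ≋ x′ ++ y′
  ++-cong {m = m} p q i with splitAt m i
  ... | inj₁ j = p j
  ... | inj₂ j = q j

  ++-≋𝟎 : (x : V m) (y : V n) → x ++ y ≋ 𝟎 → x ≋ 𝟎 × y ≋ 𝟎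
  ++-≋𝟎 x y eq = (λ i → trans (reflexive (≡.sym (lookup-++ˡ x y i))) (eq _)) , (λ i → trans (reflexive (≡.sym (lookup-++ʳ x y i))) (eq _))

  -- A linear map given by a formula is recovered from its values on the unit vectors; this is how
  -- the curve gets its basis.
  linear-matrix : ∀ {m n} (f : V m → V n) → (∀ {x y} → x ≋ y → f x ≋ f y) → (∀ x y → f (x ⊕ y) ≋ f x ⊕ f y) →
                  (∀ a x → f (a ⊛ x) ≋ a ⊛ f x) → ∀ x → (f ∘ unit) · x ≋ f x
  linear-matrix {m} f f-cong f-⊕ f-⊛ x i = trans (sum-cong-≋ (λ j → sym (f-⊛ (x j) (unit j) i))) (trans (sym (f-sum m (λ j → x j ⊛ unit j) i)) (f-cong (unit-· x) i))
    where
    Σᵥ : ∀ {l} k → Vector (V l) k → V l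
    Σᵥ k v i = sum (λ j → v j i)
    f-𝟎 : f 𝟎 ≋ 𝟎
    f-𝟎 = ≋-trans (f-cong (λ _ → sym (zeroˡ 0#))) (≋-trans (f-⊛ 0# 𝟎) (λ _ → zeroˡ _))
    f-sum : ∀ k (v : Vector (V m) k) → f (Σᵥ k v) ≋ Σᵥ k (f ∘ v)
    f-sum zero    v = f-𝟎
    f-sum (suc k) v = ≋-trans (f-⊕ (v zero) (Σᵥ k (v ∘ suc))) (⊕-cong ≋-refl (f-sum k (v ∘ suc)))

  -- Linear algebra by counting vectors

  module LinearAlgebra where

    private
      encode : V m → Fin ((q ℕ.^ 6) ℕ.^ m)
      encode v = funToFin (index ∘ v)

      decode : Fin ((q ℕ.^ 6) ℕ.^ m) → V m
      decode k i = element (finToFun k i)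

      decode-encode : (v : V m) → decode (encode v) ≋ v
      decode-encode v i = trans (reflexive (≡.cong element (Fin.finToFun-funToFin (index ∘ v) i))) (element-index (v i))

      encode-injective : {v w : V m} → encode v ≡ encode w → v ≋ w
      encode-injective {v = v} {w} eq i = trans (sym (decode-encode v i))
        (trans (reflexive (≡.cong (λ k → decode k i) eq)) (decode-encode w i))

      funToFin-cong : ∀ {m n} {f g : Fin m → Fin n} → (∀ i → f i ≡ g i) → funToFin f ≡ funToFin g
      funToFin-cong {zero}  eq = ≡.refl
      funToFin-cong {suc m} eq = ≡.cong₂ Fin.combine (eq zero) (funToFin-cong (eq ∘ suc))

      decode-injective : {k l : Fin ((q ℕ.^ 6) ℕ.^ m)} → decode {m} k ≋ decode l → k ≡ l
      decode-injective {m} {k} {l} eq = ≡.trans (≡.sym (Fin.funToFin-finToFin {m} k))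
        (≡.trans (funToFin-cong (λ i → element-injective (eq i))) (Fin.funToFin-finToFin {m} l))

    -- Cardinalities replace elimination: `V m` has (q⁶)^m elements, so it embeds in `V n` only if m
    -- ≤ n.
    injective⇒≤ : (f : V m → V n) → (∀ {x y} → f x ≋ f y → x ≋ y) → m ℕ.≤ n
    injective⇒≤ {m} {n} f inj with m ℕ.≤? n
    ... | yes m≤n = m≤n
    ... | no  m≰n = contradiction
      (Fin.injective⇒≤ {f = encode ∘ f ∘ decode} (decode-injective ∘ inj ∘ encode-injective))
      (ℕ.<⇒≱ (ℕ.^-monoʳ-< (q ℕ.^ 6) 1<q^6 (ℕ.≰⇒> m≰n)))

    injective⇒surjectiveᵛ : (f : V m → V m) → (∀ {x y} → f x ≋ f y → x ≋ y) → ∀ y → ∃[ x ] f x ≋ y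
    injective⇒surjectiveᵛ f inj y =
      let k , eq = injective⇒surjective (encode ∘ f ∘ decode) (decode-injective ∘ inj ∘ encode-injective) (encode y) in
      decode k , encode-injective eq

    -- There are finitely many coefficient vectors to try.
    _∈⟨_⟩? : (v : V n) (M : Vector (V n) m) → Dec (v ∈⟨ M ⟩)
    v ∈⟨ M ⟩? = map′ (λ (k , eq) → decode k , eq)
      (λ (x , eq) → encode x , λ i → trans (eq i) (sum-cong-≋ (λ j → *-congʳ (sym (decode-encode x j)))))
      (Fin.any? (λ k → Fin.all? (λ i → v i ≈? (M · decode k) i)))

    -ᵛ_ : V n → V n
    (-ᵛ v) = (- 1#) ⊛ v

    independent⇒injective : {M : Vector (V n) m} → Independent M → ∀ {x y} → M · x ≋ M · y → x ≋ y
    independent⇒injective {M = M} ind {x} {y} eq i = x∙y⁻¹≈ε⇒x≈y _ _ (begin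
      x i - y i              ≈⟨ solve 2 (λ a b → a :- b := a :+ :- :1 :* b) refl (x i) (y i) ⟩
      x i + (- 1#) * y i     ≈⟨ ind (x ⊕ (-ᵛ y)) Mz≋0 i ⟩
      0#                     ∎)
      where
      Mz≋0 : M · (x ⊕ (-ᵛ y)) ≋ 𝟎
      Mz≋0 i = begin
        (M · (x ⊕ (-ᵛ y))) i               ≈⟨ ·-⊕ M x (-ᵛ y) i ⟩
        (M · x) i + (M · (-ᵛ y)) i         ≈⟨ +-cong (eq i) (·-⊛ M (- 1#) y i) ⟩
        (M · y) i + - 1# * (M · y) i       ≈⟨ solve 1 (λ a → a :+ :- :1 :* a := :0) refl _ ⟩
        0#                                 ∎

    coefficients : ∀ {k} {vs : Vector (V n) m} {ws : Vector (V n) k} → (∀ j → vs j ∈⟨ ws ⟩) → Vector (V k) m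
    coefficients vs∈ j = proj₁ (vs∈ j)

    ·-coefficients : ∀ {k} {vs : Vector (V n) m} {ws : Vector (V n) k} (vs∈ : ∀ j → vs j ∈⟨ ws ⟩) →
                     ∀ x → vs · x ≋ ws · (coefficients {ws = ws} vs∈ · x)
    ·-coefficients {ws = ws} vs∈ x = ≋-trans (·-congʳ x (λ j → proj₂ (vs∈ j))) (·-∘ ws (coefficients {ws = ws} vs∈) x)

    coefficients-injective : ∀ {k} {vs : Vector (V n) m} {ws : Vector (V n) k} (vs∈ : ∀ j → vs j ∈⟨ ws ⟩) → Independent vs →
                             ∀ {x y} → coefficients {ws = ws} vs∈ · x ≋ coefficients {ws = ws} vs∈ · y → x ≋ y
    coefficients-injective {ws = ws} vs∈ ind eq = independent⇒injective ind
      (≋-trans (·-coefficients {ws = ws} vs∈ _) (≋-trans (·-congˡ ws eq) (≋-sym (·-coefficients {ws = ws} vs∈ _))))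

    independent⇒≤ : ∀ {k} {vs : Vector (V n) m} {ws : Vector (V n) k} → Independent vs → (∀ j → vs j ∈⟨ ws ⟩) → m ℕ.≤ k
    independent⇒≤ {ws = ws} ind vs∈ = injective⇒≤ (coefficients {ws = ws} vs∈ ·_) (coefficients-injective {ws = ws} vs∈ ind)

    -- Writing the `vs` in terms of equally many `ws` gives an injective coefficient map of `V m` to
    -- itself, which is therefore surjective.
    independent⇒spanning : {vs ws : Vector (V n) m} → Independent vs → (∀ j → vs j ∈⟨ ws ⟩) → ∀ {y} → y ∈⟨ ws ⟩ → y ∈⟨ vs ⟩
    independent⇒spanning {ws = ws} ind vs∈ (z , y≋wsz)
      = let x , cx≋z = injective⇒surjectiveᵛ (coefficients {ws = ws} vs∈ ·_) (coefficients-injective {ws = ws} vs∈ ind) z in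
        x , ≋-trans y≋wsz (≋-trans (·-congˡ ws (≋-sym cx≋z)) (≋-sym (·-coefficients {ws = ws} vs∈ x)))

    spanning⇒independent : {vs ws : Vector (V n) m} → Independent vs → (∀ j → vs j ∈⟨ ws ⟩) → Independent ws
    spanning⇒independent {ws = ws} ind vs∈ z wsz≋0
      = let x , cx≋z = injective⇒surjectiveᵛ (coefficients {ws = ws} vs∈ ·_) (coefficients-injective {ws = ws} vs∈ ind) z in
        ≋-trans (≋-sym cx≋z) (≋-trans (·-congˡ _ (x≋0 x cx≋z)) (·-𝟎 (coefficients {ws = ws} vs∈)))
      where
      x≋0 : ∀ x → coefficients {ws = ws} vs∈ · x ≋ z → x ≋ 𝟎
      x≋0 x cx≋z = ind x (≋-trans (·-coefficients {ws = ws} vs∈ x) (≋-trans (·-congˡ ws cx≋z) wsz≋0))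

    unit-independent : Independent (unit {n})
    unit-independent x eq = ≋-trans (≋-sym (unit-· x)) eq

    independent⇒basis : {M : Vector (V n) n} → Independent M → ∀ y → y ∈⟨ M ⟩
    independent⇒basis {M = M} ind y = independent⇒spanning ind (λ j → M j , ≋-sym (unit-· (M j))) (y , ≋-sym (unit-· y))

    spanning⇒basis : {M : Vector (V n) n} → (∀ y → y ∈⟨ M ⟩) → Independent M
    spanning⇒basis span = spanning⇒independent unit-independent (λ j → span (unit j))

    inverse-matrix : (M : Vector (V n) n) → Independent M →
                     Σ (Vector (V n) n) λ N → (∀ x → M · (N · x) ≋ x) × (∀ x → N · (M · x) ≋ x)
    inverse-matrix M ind = N , MN≋ , λ x → independent⇒injective ind (MN≋ (M · x))
      where
      N = coefficients {ws = M} (λ i → independent⇒basis {M = M} ind (unit i))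
      MN≋ : ∀ x → M · (N · x) ≋ x
      MN≋ x = ≋-trans (≋-sym (·-coefficients {ws = M} (λ i → independent⇒basis {M = M} ind (unit i)) x)) (unit-· x)

    ∈⟨⟩-trans : ∀ {k} {vs : Vector (V n) m} {ws : Vector (V n) k} → (∀ j → vs j ∈⟨ ws ⟩) → ∀ {y} → y ∈⟨ vs ⟩ → y ∈⟨ ws ⟩
    ∈⟨⟩-trans {ws = ws} vs∈ (x , eq) = coefficients {ws = ws} vs∈ · x , ≋-trans eq (·-coefficients {ws = ws} vs∈ x)

    ∈⟨⟩-resp : {M : Vector (V n) m} {x y : V n} → x ≋ y → x ∈⟨ M ⟩ → y ∈⟨ M ⟩
    ∈⟨⟩-resp x≋y (a , eq) = a , ≋-trans (≋-sym x≋y) eq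

    ∈⟨⟩-⊕ : {M : Vector (V n) m} {x y : V n} → x ∈⟨ M ⟩ → y ∈⟨ M ⟩ → x ⊕ y ∈⟨ M ⟩
    ∈⟨⟩-⊕ {M = M} (a , p) (b , q) = a ⊕ b , ≋-trans (⊕-cong p q) (≋-sym (·-⊕ M a b))

    ∈⟨⟩-⊛ : {M : Vector (V n) m} {x : V n} → ∀ a → x ∈⟨ M ⟩ → a ⊛ x ∈⟨ M ⟩
    ∈⟨⟩-⊛ {M = M} a (b , p) = a ⊛ b , ≋-trans (⊛-cong refl p) (≋-sym (·-⊛ M a b))

    ∈⟨⟩-𝟎 : {M : Vector (V n) m} → 𝟎 ∈⟨ M ⟩
    ∈⟨⟩-𝟎 {M = M} = 𝟎 , ≋-sym (·-𝟎 M)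

    ∈⟨⟩-basis : (M : Vector (V n) m) (j : Fin m) → M j ∈⟨ M ⟩
    ∈⟨⟩-basis M j = unit j , ≋-sym (·-unit M j)

    nonzero-coordinate : {v : V n} → ¬ v ≋ 𝟎 → ∃[ i ] ¬ v i ≈ 0#
    nonzero-coordinate {v = v} v≉0 with Fin.any? (λ i → ¬? (v i ≈? 0#))
    ... | yes found = found
    ... | no  none  = contradiction all-zero v≉0
      where
      all-zero : v ≋ 𝟎
      all-zero i with v i ≈? 0#
      ... | yes eq = eq
      ... | no neq = contradiction (i , neq) none

    ≋𝟎? : (v : V n) → Dec (v ≋ 𝟎)
    ≋𝟎? v = Fin.all? (λ i → v i ≈? 0#)

    independent-nonzero : {M : Vector (V n) m} → Independent M → ∀ {x} → ¬ x ≋ 𝟎 → ¬ M · x ≋ 𝟎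
    independent-nonzero ind x≉0 eq = x≉0 (ind _ eq)

    ∼-refl : {v : V n} → v ∼ v
    ∼-refl = 1# , 1≉0 , λ i → sym (*-identityˡ _)

    ≋⇒∼ : {v w : V n} → v ≋ w → v ∼ w
    ≋⇒∼ eq = 1# , 1≉0 , λ i → trans (eq i) (sym (*-identityˡ _))

    ⁻¹-nonzero : ∀ {a} → ¬ a ≈ 0# → ¬ a ⁻¹ ≈ 0#
    ⁻¹-nonzero a≉0 = *-nonzeroʳ (λ eq → 1≉0 (trans (sym (*-inverseʳ a≉0)) eq))

    ∼-sym : {v w : V n} → v ∼ w → w ∼ v
    ∼-sym {v = v} {w} (a , a≉0 , eq) = a ⁻¹ , ⁻¹-nonzero a≉0 , λ i → begin
      w i                  ≈⟨ *-identityˡ (w i) ⟨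
      1# * w i             ≈⟨ *-congʳ (*-inverseʳ a≉0) ⟨
      a * a ⁻¹ * w i       ≈⟨ solve 3 (λ a i w → a :* i :* w := i :* (a :* w)) refl a (a ⁻¹) (w i) ⟩
      a ⁻¹ * (a * w i)     ≈⟨ *-congˡ (eq i) ⟨
      a ⁻¹ * v i           ∎

    ∼-trans : {u v w : V n} → u ∼ v → v ∼ w → u ∼ w
    ∼-trans (a , a≉0 , p) (b , b≉0 , q) = a * b , *-nonzero a≉0 b≉0 ,
      λ i → trans (p i) (trans (*-congˡ (q i)) (sym (*-assoc a b _)))

    ·-∼ : (M : Vector (V n) m) {x y : V m} → x ∼ y → M · x ∼ M · y
    ·-∼ M {x} {y} (a , a≉0 , eq) = a , a≉0 , ≋-trans (·-congˡ M eq) (·-⊛ M a y)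

    ∈⟨⟩-∼ : {M : Vector (V n) m} {x y : V n} → x ∼ y → y ∈⟨ M ⟩ → x ∈⟨ M ⟩
    ∈⟨⟩-∼ (a , _ , eq) y∈ = ∈⟨⟩-resp (≋-sym eq) (∈⟨⟩-⊛ a y∈)

    independent-∼ : {M : Vector (V n) m} → Independent M → ∀ {x y} → M · x ∼ M · y → x ∼ y
    independent-∼ {M = M} ind {x} {y} (a , a≉0 , eq) =
      a , a≉0 , independent⇒injective ind (≋-trans eq (≋-sym (·-⊛ M a y)))

    frob-cong : ∀ j {v w : V n} → v ≋ w → frob j v ≋ frob j w
    frob-cong j eq i = σ-cong j (eq i)

    frob-· : ∀ j (M : Vector (V n) m) x → frob j (M · x) ≋ (frob j ∘ M) · frob j x
    frob-· j M x i = trans (σ-sum j (λ l → x l * M l i)) (sum-cong-≋ (λ l → σ-* j (x l) (M l i)))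

    frob-∘ : ∀ i j (v : V n) → frob i (frob j v) ≋ frob (j ℕ.+ i) v
    frob-∘ i j v l = σ-∘ i j (v l)

    frob-6 : (v : V n) → frob 6 v ≋ v
    frob-6 v i = σ-6 (v i)

    frob-⊛ : ∀ j a (v : V n) → frob j (a ⊛ v) ≋ σ j a ⊛ frob j v
    frob-⊛ j a v i = σ-* j a (v i)

    frob-𝟎 : ∀ j → frob j (𝟎 {n}) ≋ 𝟎
    frob-𝟎 j i = σ-0 j

    frob-injective : ∀ j {v w : V n} → j ℕ.≤ 6 → frob j v ≋ frob j w → v ≋ w
    frob-injective j j≤6 eq i = σ-injective j j≤6 (eq i)

    frob-nonzero : ∀ j {v : V n} → ¬ v ≋ 𝟎 → ¬ frob j v ≋ 𝟎
    frob-nonzero j v≉0 eq with nonzero-coordinate v≉0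
    ... | i , vi≉0 = σ-≉0 j vi≉0 (eq i)

    frob-∼ : ∀ j {v w : V n} → v ∼ w → frob j v ∼ frob j w
    frob-∼ j {w = w} (a , a≉0 , eq) = σ j a , σ-≉0 j a≉0 , ≋-trans (frob-cong j eq) (frob-⊛ j a w)

    -- The inverse power of Frobenius carries a relation among the conjugate vectors back to one
    -- among the original vectors.
    frob-independent : ∀ j {M : Vector (V n) m} → j ℕ.≤ 6 → Independent M → Independent (frob j ∘ M)
    frob-independent j {M} j≤6 ind x eq = ≋-trans (≋-sym (x≋ x)) (≋-trans (frob-cong j (ind x′ Mx′≋0)) (frob-𝟎 j))
      where
      x′ = frob (6 ℕ.∸ j) x
      x≋ : ∀ {n} (x : V n) → frob j (frob (6 ℕ.∸ j) x) ≋ x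
      x≋ x = ≋-trans (frob-∘ j (6 ℕ.∸ j) x) (λ i → trans (^-congʳ (x i) (≡.cong (q ℕ.^_) (ℕ.m∸n+n≡m j≤6))) (σ-6 (x i)))
      Mx′≋0 : M · x′ ≋ 𝟎
      Mx′≋0 = frob-injective j j≤6 (≋-trans (frob-· j M x′) (≋-trans (·-congˡ (frob j ∘ M) (x≋ x)) (≋-trans eq (≋-sym (frob-𝟎 j)))))

    over-· : ∀ k {M : Vector (V n) m} → (∀ j → Over k (M j)) → ∀ {x} → Over k x → Over k (M · x)
    over-· k {M} M-over {x} x-over i = InGF-sum k (λ j → x j * M j i) (λ j → InGF-* k (x-over j) (M-over j i))

    -- Galois descent: Frobenius fixes both M and M · x, so x and its conjugate have the same image
    -- under M and agree by independence.
    over-coordinates : ∀ k {M : Vector (V n) m} → Independent M → (∀ j → Over k (M j)) → ∀ {x} → Over k (M · x) → Over k x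
    over-coordinates k {M} ind M-over {x} Mx-over = independent⇒injective ind
      (≋-trans (≋-sym (≋-trans (frob-· k M x) (·-congʳ (frob k x) M-over))) Mx-over)

    over-1⇒ : ∀ k {v : V n} → Over 1 v → Over k v
    over-1⇒ k p i = InGF-1⇒ k (p i)

    over-6 : (v : V n) → Over 6 v
    over-6 v i = σ-6 (v i)

    dot-cong : {h k x y : V n} → h ≋ k → x ≋ y → dot h x ≈ dot k y
    dot-cong p q = sum-cong-≋ (λ i → *-cong (p i) (q i))

    dot-⊕ : (h x y : V n) → dot h (x ⊕ y) ≈ dot h x + dot h y
    dot-⊕ h x y = trans (sum-cong-≋ (λ i → distribˡ (h i) (x i) (y i))) (∑-distrib-+ (λ i → h i * x i) (λ i → h i * y i))

    dot-⊛ : ∀ (h : V n) a x → dot h (a ⊛ x) ≈ a * dot h x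
    dot-⊛ h a x = trans (sum-cong-≋ (λ i → solve 3 (λ h a x → h :* (a :* x) := a :* (h :* x)) refl (h i) a (x i)))
      (sym (*-distribˡ-sum a (λ i → h i * x i)))

    dot-𝟎 : (h : V n) → dot h 𝟎 ≈ 0#
    dot-𝟎 {n} h = trans (sum-cong-≋ (λ i → zeroʳ (h i))) (sum-replicate-zero n)

    dot-· : (h : V n) (M : Vector (V n) m) (x : V m) → dot h (M · x) ≈ dot (λ j → dot h (M j)) x
    dot-· h M x = begin
      sum (λ i → h i * sum (λ j → x j * M j i))      ≈⟨ sum-cong-≋ (λ i → *-distribˡ-sum (h i) (λ j → x j * M j i)) ⟩
      sum (λ i → sum (λ j → h i * (x j * M j i)))    ≈⟨ ∑-comm (λ i j → h i * (x j * M j i)) ⟩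
      sum (λ j → sum (λ i → h i * (x j * M j i)))
        ≈⟨ sum-cong-≋ (λ j → trans (sum-cong-≋ (λ i → solve 3 (λ h x m → h :* (x :* m) := h :* m :* x) refl (h i) (x j) (M j i)))
             (sym (*-distribʳ-sum (x j) (λ i → h i * M j i)))) ⟩
      sum (λ j → sum (λ i → h i * M j i) * x j)      ∎

    frob-dot : ∀ j (h x : V n) → σ j (dot h x) ≈ dot (frob j h) (frob j x)
    frob-dot j h x = trans (σ-sum j (λ i → h i * x i)) (sum-cong-≋ (λ i → σ-* j (h i) (x i)))

    dot-∈⟨⟩ : (h : V n) {M : Vector (V n) m} → (∀ j → dot h (M j) ≈ 0#) → ∀ {y} → y ∈⟨ M ⟩ → dot h y ≈ 0#
    dot-∈⟨⟩ {m = m} h {M} p (x , eq) = begin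
      dot h _                            ≈⟨ dot-cong {h = h} ≋-refl eq ⟩
      dot h (M · x)                      ≈⟨ dot-· h M x ⟩
      dot (λ j → dot h (M j)) x          ≈⟨ sum-cong-≋ (λ j → trans (*-congʳ (p j)) (zeroˡ (x j))) ⟩
      sum {m} (λ _ → 0#)                 ≈⟨ sum-replicate-zero m ⟩
      0#                                 ∎

  open LinearAlgebra

  -- Subfields: polynomials vanishing on them, elements outside GF(q), norms

  module Subfields where

    open NormExponents
    open MonicPolynomials (FiniteField.commutativeRing K)

    private
      variable
        d : ℕ

      q′ : ℕ
      q′ = ℕ.pred q

      q≡ : q ≡ suc q′
      q≡ = ≡.sym (ℕ.suc-pred q {{ℕ.>-nonZero (ℕ.≤-trans (ℕ.s≤s ℕ.z≤n) 6≤q)}})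

      q″ : ℕ
      q″ = q ℕ.∸ 2

      q≡2+ : q ≡ suc (suc q″)
      q≡2+ = ≡.sym (ℕ.m+[n∸m]≡n (ℕ.≤-trans (ℕ.s≤s (ℕ.s≤s ℕ.z≤n)) 6≤q))

    InGF? : ∀ j x → Dec (InGF j x)
    InGF? j x = x ^ (q ℕ.^ j) ≈? x

    eval-cong : (f : Vec Carrier d) → ∀ {x y} → x ≈ y → eval f x ≈ eval f y
    eval-cong []ᵛ       x≈y = refl
    eval-cong (c ∷ᵛ cs) x≈y = +-congˡ (*-cong x≈y (eval-cong cs x≈y))

    not-all-roots : (f : Vec Carrier d) → d ℕ.< q ℕ.^ 6 → ¬ (∀ x → eval f x ≈ 0#)
    not-all-roots f d< root = ℕ.<⇒≱ d< (roots≤degree noZeroDivisors 1≉0 f element element-injective (λ i → root (element i)))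

    -- x ↦ x^(r+1) is the norm to the subfield.
    not-all-roots-in : ∀ j r → (∀ x → InGF j (x ^ suc r)) → (f : Vec Carrier d) → d ℕ.* suc r ℕ.< q ℕ.^ 6 →
                       ¬ (∀ x → InGF j x → eval f x ≈ 0#)
    not-all-roots-in j r norm f d< root = not-all-roots (inflate r f) d<
      (λ x → trans (eval-inflate r f x) (root (x ^ suc r) (norm x)))

    evalᵛ : V d → Carrier → Carrier
    evalᵛ {zero}  f x = 0#
    evalᵛ {suc d} f x = f zero + x * evalᵛ (f ∘ suc) x

    -- Brings a coefficient list of unknown degree into the monic encoding, for which roots can be
    -- counted.
    leading-coefficient : (f : V d) → f ≋ 𝟎 ⊎
      (∃[ e ] e ℕ.< d × Σ Carrier λ a → ¬ a ≈ 0# × Σ (Vec Carrier e) λ g → ∀ x → evalᵛ f x ≈ a * eval g x)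
    leading-coefficient {zero}  f = inj₁ (λ ())
    leading-coefficient {suc d} f with leading-coefficient (f ∘ suc)
    ... | inj₂ (e , e<d , a , a≉0 , g , eq) = inj₂ (suc e , ℕ.s≤s e<d , a , a≉0 , a ⁻¹ * f zero ∷ᵛ g , λ x → begin
      f zero + x * evalᵛ (f ∘ suc) x               ≈⟨ +-cong (sym (*-identityˡ _)) (*-congˡ (eq x)) ⟩
      1# * f zero + x * (a * eval g x)             ≈⟨ +-congʳ (*-congʳ (*-inverseʳ a≉0)) ⟨
      a * a ⁻¹ * f zero + x * (a * eval g x)       ≈⟨ solve 5 (λ a b c x y → a :* b :* c :+ x :* (a :* y) := a :* (b :* c :+ x :* y)) refl a (a ⁻¹) (f zero) x (eval g x) ⟩
      a * (a ⁻¹ * f zero + x * eval g x)           ∎)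
    ... | inj₁ tail≋0 with f zero ≈? 0#
    ...   | yes f0≈0 = inj₁ λ { zero → f0≈0 ; (suc i) → tail≋0 i }
    ...   | no  f0≉0 = inj₂ (0 , ℕ.s≤s ℕ.z≤n , f zero , f0≉0 , []ᵛ , λ x →
            trans (+-congˡ (trans (*-congˡ (evalᵛ-𝟎 (f ∘ suc) x tail≋0)) (zeroʳ x))) (trans (+-identityʳ _) (sym (*-identityʳ _))))
      where
      evalᵛ-𝟎 : ∀ {d} (f : V d) x → f ≋ 𝟎 → evalᵛ f x ≈ 0#
      evalᵛ-𝟎 {zero}  f x eq = refl
      evalᵛ-𝟎 {suc d} f x eq = trans (+-cong (eq zero) (trans (*-congˡ (evalᵛ-𝟎 (f ∘ suc) x (eq ∘ suc))) (zeroʳ x))) (+-identityʳ 0#)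

    private
      norm₁ : ℕ
      norm₁ = q ℕ.+ (q ℕ.^ 2 ℕ.+ (q ℕ.^ 3 ℕ.+ (q ℕ.^ 4 ℕ.+ q ℕ.^ 5)))

      norm₁-InGF : ∀ x → InGF 1 (x ^ suc norm₁)
      norm₁-InGF x = begin
        σ 1 (x ^ suc norm₁)                ≈⟨ ^-assocʳ x (suc norm₁) (q ℕ.^ 1) ⟩
        x ^ (suc norm₁ ℕ.* q ℕ.^ 1)        ≡⟨ ≡.cong (x ^_) (norm₁*q q) ⟩
        x ^ (norm₁ ℕ.+ q ℕ.^ 6)            ≈⟨ ^-homo-* x norm₁ (q ℕ.^ 6) ⟩
        x ^ norm₁ * x ^ (q ℕ.^ 6)          ≈⟨ *-congˡ (σ-6 x) ⟩
        x ^ norm₁ * x                      ≈⟨ *-comm _ x ⟩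
        x ^ suc norm₁                      ∎

      pred[q]*norm₁ : q′ ℕ.* suc norm₁ ℕ.< q ℕ.^ 6
      pred[q]*norm₁ = ℕ.≤-reflexive (≡.subst
        (λ q → suc (q′ ℕ.* suc (q ℕ.+ (q ℕ.^ 2 ℕ.+ (q ℕ.^ 3 ℕ.+ (q ℕ.^ 4 ℕ.+ q ℕ.^ 5))))) ≡ q ℕ.^ 6) (≡.sym q≡) (pred*norm₁ q′))

    -- No enumeration of GF(q) is available. Instead the polynomial is composed with the norm x^(1 +
    -- q + ... + q⁵), whose values lie in GF(q); the composite vanishes on all of K, yet its degree
    -- is at most (q - 1)(1 + q + ... + q⁵) < q⁶.
    vanishing-on-GFq : (f : V d) → d ℕ.≤ q → (∀ x → InGF 1 x → evalᵛ f x ≈ 0#) → f ≋ 𝟎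
    vanishing-on-GFq f d≤q vanish with leading-coefficient f
    ... | inj₁ f≋0 = f≋0
    ... | inj₂ (e , e<d , a , a≉0 , g , eq) = contradiction
      (λ x x∈ → [ (λ a≈0 → contradiction a≈0 a≉0) , id ]′ (noZeroDivisors (trans (sym (eq x)) (vanish x x∈))))
      (not-all-roots-in 1 norm₁ norm₁-InGF g (ℕ.≤-<-trans (ℕ.*-monoˡ-≤ (suc norm₁) e≤q′) pred[q]*norm₁))
      where
      e≤q′ : e ℕ.≤ q′
      e≤q′ = ℕ.≤-pred (≡.subst (suc e ℕ.≤_) q≡ (ℕ.≤-trans e<d d≤q))

    -- Otherwise X^q − X would vanish on the field of order q³.
    primitive-element : ∃[ α ] InGF 3 α × ¬ InGF 1 α
    primitive-element with Fin.any? (λ i → InGF? 3 (element i) ×-dec ¬? (InGF? 1 (element i)))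
    ... | yes (i , found) = element i , found
    ... | no  none = contradiction root (not-all-roots-in 3 (q ℕ.^ 3) norm f degree)
      where
      -- This is X^q - X; composed with the norm x^(1+q³) to GF(q³) it has degree q (1 + q³), which
      -- is below q⁶.
      f : Vec Carrier (suc (suc (q″ ℕ.+ 0)))
      f = 0# ∷ᵛ - 1# ∷ᵛ shift q″ []ᵛ
      degree : suc (suc (q″ ℕ.+ 0)) ℕ.* suc (q ℕ.^ 3) ℕ.< q ℕ.^ 6
      degree = ≡.subst (λ r → suc (suc (q″ ℕ.+ 0)) ℕ.* suc (r ℕ.^ 3) ℕ.< r ℕ.^ 6) (≡.sym q≡2+) (ℕ.m+n≤o⇒m≤o _ (ℕ.≤-reflexive (degree-bound q″)))
      norm : ∀ x → InGF 3 (x ^ suc (q ℕ.^ 3))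
      norm x = begin
        σ 3 (x * σ 3 x)       ≈⟨ σ-* 3 x (σ 3 x) ⟩
        σ 3 x * σ 3 (σ 3 x)   ≈⟨ *-congˡ (σ-∘ 3 3 x) ⟩
        σ 3 x * σ 6 x         ≈⟨ *-congˡ (σ-6 x) ⟩
        σ 3 x * x             ≈⟨ *-comm _ x ⟩
        x * σ 3 x             ∎
      root : ∀ x → InGF 3 x → eval f x ≈ 0#
      root x x∈ with InGF? 1 x
      ... | no x∉ = contradiction (index x , InGF-cong 3 (sym (element-index x)) x∈ , x∉ ∘ InGF-cong 1 (element-index x)) none
      ... | yes x^q≈x = begin
        0# + x * (- 1# + x * eval (shift q″ []ᵛ) x)   ≈⟨ +-congˡ (*-congˡ (+-congˡ (*-congˡ (eval-shift q″ []ᵛ x)))) ⟩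
        0# + x * (- 1# + x * (x ^ q″ * 1#))
          ≈⟨ solve 2 (λ x y → :0 :+ x :* (:- :1 :+ x :* (y :* :1)) := x :* (x :* y) :- x) refl x (x ^ q″) ⟩
        x ^ suc (suc q″) - x     ≡⟨ ≡.sym (≡.cong (λ r → x ^ r - x) (≡.trans (ℕ.*-identityʳ q) q≡2+)) ⟩
        σ 1 x - x                ≈⟨ x≈y⇒x∙y⁻¹≈ε x^q≈x ⟩
        0#                       ∎

    quadratic-root : ∀ τ ν → InGF 3 τ → InGF 3 ν → ∃[ θ ] θ * θ - τ * θ + ν ≈ 0#
    quadratic-root τ ν τ∈ ν∈ = QuadraticRoots.quadratic-root K 1<q^6 char-prime (exponent ℕ.* 3) q^6≡ τ ν char×1≈0
      (≡.subst (λ r → τ ^ r ≈ τ) (q^j≡ 3) τ∈) (≡.subst (λ r → ν ^ r ≈ ν) (q^j≡ 3) ν∈)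
      where
      q^6≡ : q ℕ.^ 6 ≡ char ℕ.^ (exponent ℕ.* 3) ℕ.* char ℕ.^ (exponent ℕ.* 3)
      q^6≡ = ≡.trans (ℕ.^-distribˡ-+-* q 3 3) (≡.cong₂ ℕ._*_ (q^j≡ 3) (q^j≡ 3))

    x^r≈1 : ∀ {x} r → ¬ x ≈ 0# → x ^ suc r ≈ x → x ^ r ≈ 1#
    x^r≈1 r x≉0 eq = *-cancelˡ x≉0 (trans eq (sym (*-identityʳ _)))

    1^ : ∀ m → 1# ^ m ≈ 1#
    1^ zero    = refl
    1^ (suc m) = trans (*-identityˡ _) (1^ m)

    -- q⁶ − 1 = (q + 1) M with M a multiple of q − 1, so X^(q+1) − a divides X^(q⁶−1) − 1;
    -- the cofactor is the quotient of Y^M − a^M by Y − a at Y = X^(q+1).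
    norm-surjective : ∀ a → InGF 1 a → ¬ a ≈ 0# → ∃[ z ] z ^ suc q ≈ a
    norm-surjective a a∈ a≉0 with Fin.any? (λ i → element i ^ suc q ≈? a)
    ... | yes (i , eq) = element i , eq
    -- The extra factor X contributed by `0# ∷ᵛ` takes care of the element 0, at which X^(q⁶-1) - 1
    -- does not vanish.
    ... | no  none = contradiction root (not-all-roots (0# ∷ᵛ inflate q f) degree)
      where
      -- Chosen so that 1 + `M′` = (q - 1)(1 + q² + q⁴); the factor q - 1 makes the corresponding
      -- power of `a` equal to 1.
      Y = q ℕ.* q ℕ.+ q ℕ.^ 4
      M′ = Y ℕ.+ q″ ℕ.* suc Y
      suc[M′]≡ : suc M′ ≡ q′ ℕ.* suc Y
      suc[M′]≡ = ≡.cong (ℕ._* suc Y) (≡.sym (≡.cong ℕ.pred q≡2+))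
      q^6≡ : suc (suc M′ ℕ.* suc q) ≡ q ℕ.^ 6
      q^6≡ = ≡.subst (λ r → suc ((suc ((r ℕ.* r ℕ.+ r ℕ.^ 4) ℕ.+ q″ ℕ.* suc (r ℕ.* r ℕ.+ r ℕ.^ 4))) ℕ.* suc r) ≡ r ℕ.^ 6) (≡.sym q≡2+) (factorisation q″)
      f : Vec Carrier (M′ ℕ.+ 0)
      f = quotient a (shift (suc M′) []ᵛ)
      degree : suc ((M′ ℕ.+ 0) ℕ.* suc q) ℕ.< q ℕ.^ 6
      degree rewrite ℕ.+-identityʳ M′ = ≡.subst (suc (M′ ℕ.* suc q) ℕ.<_) q^6≡ (ℕ.s≤s (ℕ.s≤s (ℕ.m≤n+m _ q)))
      power : ∀ x → eval (shift (suc M′) []ᵛ) x ≈ x ^ suc M′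
      power x = trans (eval-shift (suc M′) []ᵛ x) (*-identityʳ _)
      a^M≈1 : a ^ suc M′ ≈ 1#
      a^M≈1 = begin
        a ^ suc M′                ≡⟨ ≡.cong (a ^_) suc[M′]≡ ⟩
        a ^ (q′ ℕ.* suc Y)        ≈⟨ ^-assocʳ a q′ (suc Y) ⟨
        (a ^ q′) ^ suc Y          ≈⟨ ^-congˡ (suc Y) (x^r≈1 q′ a≉0 (≡.subst (λ r → a ^ r ≈ a) (≡.trans (ℕ.*-identityʳ q) q≡) a∈)) ⟩
        1# ^ suc Y                ≈⟨ 1^ (suc Y) ⟩
        1#                        ∎
      root : ∀ x → eval (0# ∷ᵛ inflate q f) x ≈ 0#
      root x with x ≈? 0#
      ... | yes x≈0 = trans (+-identityˡ _) (trans (*-congʳ x≈0) (zeroˡ _))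
      ... | no  x≉0 = trans (+-identityˡ _) (trans (*-congˡ (trans (eval-inflate q f x) f[y]≈0)) (zeroʳ x))
        where
        y = x ^ suc q
        y^M≈1 : y ^ suc M′ ≈ 1#
        y^M≈1 = trans (^-assocʳ x (suc q) (suc M′)) (trans (^-congʳ x (ℕ.*-comm (suc q) (suc M′)))
          (x^r≈1 (suc M′ ℕ.* suc q) x≉0 (trans (^-congʳ x q^6≡) (σ-6 x))))
        y≉a : ¬ y - a ≈ 0#
        y≉a eq = none (index x , trans (^-congˡ (suc q) (element-index x)) (x∙y⁻¹≈ε⇒x≈y _ _ eq))
        f[y]≈0 : eval f y ≈ 0#
        f[y]≈0 = [ (λ eq → contradiction eq y≉a) , id ]′ (noZeroDivisors (trans (sym (factor (shift (suc M′) []ᵛ) a y))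
          (x≈y⇒x∙y⁻¹≈ε (trans (power y) (trans y^M≈1 (sym (trans (power a) a^M≈1)))))))

  open Subfields

  -- Cross products, quadratic forms and their polarisation

  module Conics where

    cross : V 3 → V 3 → V 3
    cross p r = p (suc zero) * r (suc (suc zero)) - p (suc (suc zero)) * r (suc zero)
              ∷ p (suc (suc zero)) * r zero - p zero * r (suc (suc zero))
              ∷ p zero * r (suc zero) - p (suc zero) * r zero ∷ []

    dot-crossˡ : ∀ p r → dot p (cross p r) ≈ 0#
    dot-crossˡ p r = solve 6 (λ a b c x y z → a :* (b :* z :- c :* y) :+ (b :* (c :* x :- a :* z) :+ (c :* (a :* y :- b :* x) :+ :0)) := :0)
      refl (p 0F) (p 1F) (p 2F) (r 0F) (r 1F) (r 2F)

    dot-crossʳ : ∀ p r → dot r (cross p r) ≈ 0#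
    dot-crossʳ p r = solve 6 (λ a b c x y z → x :* (b :* z :- c :* y) :+ (y :* (c :* x :- a :* z) :+ (z :* (a :* y :- b :* x) :+ :0)) := :0)
      refl (p 0F) (p 1F) (p 2F) (r 0F) (r 1F) (r 2F)

    binet-cauchy : ∀ p r v w → dot (cross p r) (cross v w) ≈ dot p v * dot r w - dot p w * dot r v
    binet-cauchy p r v w = solve 12 (λ p0 p1 p2 r0 r1 r2 v0 v1 v2 w0 w1 w2 →
        (p1 :* r2 :- p2 :* r1) :* (v1 :* w2 :- v2 :* w1) :+ ((p2 :* r0 :- p0 :* r2) :* (v2 :* w0 :- v0 :* w2)
          :+ ((p0 :* r1 :- p1 :* r0) :* (v0 :* w1 :- v1 :* w0) :+ :0)) :=
        (p0 :* v0 :+ (p1 :* v1 :+ (p2 :* v2 :+ :0))) :* (r0 :* w0 :+ (r1 :* w1 :+ (r2 :* w2 :+ :0)))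
          :- (p0 :* w0 :+ (p1 :* w1 :+ (p2 :* w2 :+ :0))) :* (r0 :* v0 :+ (r1 :* v1 :+ (r2 :* v2 :+ :0))))
      refl (p 0F) (p 1F) (p 2F) (r 0F) (r 1F) (r 2F) (v 0F) (v 1F) (v 2F) (w 0F) (w 1F) (w 2F)

    over-cross : ∀ k {p r} → Over k p → Over k r → Over k (cross p r)
    over-cross k p∈ r∈ zero             = InGF-minus k (InGF-* k (p∈ 1F) (r∈ 2F)) (InGF-* k (p∈ 2F) (r∈ 1F))
    over-cross k p∈ r∈ (suc zero)       = InGF-minus k (InGF-* k (p∈ 2F) (r∈ 0F)) (InGF-* k (p∈ 0F) (r∈ 2F))
    over-cross k p∈ r∈ (suc (suc zero)) = InGF-minus k (InGF-* k (p∈ 0F) (r∈ 1F)) (InGF-* k (p∈ 1F) (r∈ 0F))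

    bilinear : Vector (V n) n → V n → V n → Carrier
    bilinear a x y = sum (λ i → sum (λ j → a i j * (x i * y j)))

    -- `covector a x` represents the linear form y ↦ `polar a x y`. The two halves are kept apart
    -- because the matrix of a form is not assumed symmetric.
    leftCovector rightCovector covector : Vector (V n) n → V n → V n
    leftCovector  a x j = sum (λ i → a i j * x i)
    rightCovector a x i = sum (λ j → a i j * x j)
    covector a x = leftCovector a x ⊕ rightCovector a x

    polar : Vector (V n) n → V n → V n → Carrier
    polar a x y = bilinear a x y + bilinear a y x

    private
      bilinear-left : ∀ (a : Vector (V n) n) x y → bilinear a x y ≈ dot (leftCovector a x) y
      bilinear-left a x y = trans (∑-comm (λ i j → a i j * (x i * y j))) (sum-cong-≋ (λ j → trans
        (sum-cong-≋ (λ i → sym (*-assoc (a i j) (x i) (y j)))) (sym (*-distribʳ-sum (y j) (λ i → a i j * x i)))))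

      bilinear-right : ∀ (a : Vector (V n) n) x y → bilinear a y x ≈ dot (rightCovector a x) y
      bilinear-right a x y = sum-cong-≋ (λ i → trans
        (sum-cong-≋ (λ j → solve 3 (λ a y x → a :* (y :* x) := a :* x :* y) refl (a i j) (y i) (x j))) (sym (*-distribʳ-sum (y i) (λ j → a i j * x j))))

    polar-covector : ∀ (a : Vector (V n) n) x y → polar a x y ≈ dot (covector a x) y
    polar-covector a x y = sym (trans (sum-cong-≋ (λ i → distribʳ (y i) (leftCovector a x i) (rightCovector a x i)))
      (trans (∑-distrib-+ (λ i → leftCovector a x i * y i) (λ i → rightCovector a x i * y i))
      (sym (+-cong (bilinear-left a x y) (bilinear-right a x y)))))

    polar-sym : ∀ (a : Vector (V n) n) x y → polar a x y ≈ polar a y x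
    polar-sym a x y = +-comm _ _

    polar-⊕ : ∀ (a : Vector (V n) n) x y z → polar a x (y ⊕ z) ≈ polar a x y + polar a x z
    polar-⊕ a x y z = trans (polar-covector a x (y ⊕ z)) (trans (dot-⊕ (covector a x) y z)
      (sym (+-cong (polar-covector a x y) (polar-covector a x z))))

    polar-⊛ : ∀ (a : Vector (V n) n) x b y → polar a x (b ⊛ y) ≈ b * polar a x y
    polar-⊛ a x b y = trans (polar-covector a x (b ⊛ y)) (trans (dot-⊛ (covector a x) b y) (*-congˡ (sym (polar-covector a x y))))

    polar-cong : ∀ (a : Vector (V n) n) x {y z} → y ≋ z → polar a x y ≈ polar a x z
    polar-cong a x y≋z = trans (polar-covector a x _) (trans (dot-cong {h = covector a x} ≋-refl y≋z) (sym (polar-covector a x _)))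

    quad-cong : ∀ (a : Vector (V n) n) {x y} → x ≋ y → quad a x ≈ quad a y
    quad-cong a x≋y = sum-cong-≋ (λ i → sum-cong-≋ (λ j → *-congˡ (*-cong (x≋y i) (x≋y j))))

    quad-⊛ : ∀ (a : Vector (V n) n) b x → quad a (b ⊛ x) ≈ b * b * quad a x
    quad-⊛ a b x = trans (sum-cong-≋ (λ i → trans
        (sum-cong-≋ (λ j → solve 4 (λ a b x y → a :* (b :* x :* (b :* y)) := b :* b :* (a :* (x :* y))) refl (a i j) b (x i) (x j)))
        (sym (*-distribˡ-sum (b * b) (λ j → a i j * (x i * x j))))))
      (sym (*-distribˡ-sum (b * b) (λ i → sum (λ j → a i j * (x i * x j)))))

    quad-⊕ : ∀ (a : Vector (V n) n) x y → quad a (x ⊕ y) ≈ quad a x + quad a y + polar a x y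
    quad-⊕ {n} a x y = begin
      bilinear a (x ⊕ y) (x ⊕ y)
        ≈⟨ sum-cong-≋ (λ i → sum-cong-≋ (λ j → solve 5 (λ a x y x′ y′ → a :* ((x :+ y) :* (x′ :+ y′)) :=
             (a :* (x :* x′) :+ a :* (y :* y′)) :+ (a :* (x :* y′) :+ a :* (y :* x′))) refl (a i j) (x i) (y i) (x j) (y j))) ⟩
      sum (λ i → sum (λ j → (t x x i j + t y y i j) + (t x y i j + t y x i j)))
        ≈⟨ split (λ i j → t x x i j + t y y i j) (λ i j → t x y i j + t y x i j) ⟩
      sum (λ i → sum (λ j → t x x i j + t y y i j)) + sum (λ i → sum (λ j → t x y i j + t y x i j))
        ≈⟨ +-cong (split (t x x) (t y y)) (split (t x y) (t y x)) ⟩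
      quad a x + quad a y + polar a x y ∎
      where
      t : V n → V n → Fin n → Fin n → Carrier
      t x y i j = a i j * (x i * y j)
      split : ∀ (f g : Fin n → Fin n → Carrier) → sum (λ i → sum (λ j → f i j + g i j)) ≈ sum (λ i → sum (f i)) + sum (λ i → sum (g i))
      split f g = trans (sum-cong-≋ (λ i → ∑-distrib-+ (f i) (g i))) (∑-distrib-+ (λ i → sum (f i)) (λ i → sum (g i)))

    over-covector : ∀ k {a : Vector (V n) n} {x} → (∀ i → Over k (a i)) → Over k x → Over k (covector a x)
    over-covector k {a} {x} a∈ x∈ i = InGF-+ k (InGF-sum k (λ j → a j i * x j) (λ j → InGF-* k (a∈ j i) (x∈ j)))
      (InGF-sum k (λ j → a i j * x j) (λ j → InGF-* k (a∈ i j) (x∈ j)))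

    over-quad : ∀ k {a : Vector (V n) n} {x} → (∀ i → Over k (a i)) → Over k x → InGF k (quad a x)
    over-quad k {a} {x} a∈ x∈ = InGF-sum k (λ i → sum (λ j → a i j * (x i * x j))) (λ i →
      InGF-sum k (λ j → a i j * (x i * x j)) (λ j → InGF-* k (a∈ i j) (InGF-* k (x∈ i) (x∈ j))))

    over-polar : ∀ k {a : Vector (V n) n} {x y} → (∀ i → Over k (a i)) → Over k x → Over k y → InGF k (polar a x y)
    over-polar k {a} {x} {y} a∈ x∈ y∈ = InGF-cong k (sym (polar-covector a x y))
      (InGF-sum k (λ i → covector a x i * y i) (λ i → InGF-* k (over-covector k a∈ x∈ i) (y∈ i)))

    over-⊕ : ∀ k {x y : V n} → Over k x → Over k y → Over k (x ⊕ y)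
    over-⊕ k x∈ y∈ i = InGF-+ k (x∈ i) (y∈ i)

    over-⊛ : ∀ k {b} {x : V n} → InGF k b → Over k x → Over k (b ⊛ x)
    over-⊛ k b∈ x∈ i = InGF-* k b∈ (x∈ i)

    quad-combination : ∀ (a : Vector (V n) n) (M : Vector (V n) 3) x → quad a (M · x) ≈
      x 0F * x 0F * quad a (M 0F) + (x 1F * x 1F * quad a (M 1F) + x 2F * x 2F * quad a (M 2F) + x 1F * x 2F * polar a (M 1F) (M 2F))
        + (x 0F * x 1F * polar a (M 0F) (M 1F) + x 0F * x 2F * polar a (M 0F) (M 2F))
    quad-combination a M x = begin
      quad a (M · x)           ≈⟨ quad-cong a (λ i → +-congˡ (+-congˡ (+-identityʳ _))) ⟩
      quad a (X ⊕ (Y ⊕ Z))     ≈⟨ quad-⊕ a X (Y ⊕ Z) ⟩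
      quad a X + quad a (Y ⊕ Z) + polar a X (Y ⊕ Z)
        ≈⟨ +-cong (+-cong (quad-⊛ a (x 0F) (M 0F)) (trans (quad-⊕ a Y Z)
             (+-cong (+-cong (quad-⊛ a (x 1F) (M 1F)) (quad-⊛ a (x 2F) (M 2F))) (polar-⊛₂ (x 1F) (x 2F) (M 1F) (M 2F)))))
             (trans (polar-⊕ a X Y Z) (+-cong (polar-⊛₂ (x 0F) (x 1F) (M 0F) (M 1F)) (polar-⊛₂ (x 0F) (x 2F) (M 0F) (M 2F)))) ⟩
      _ ∎
      where
      X = x 0F ⊛ M 0F
      Y = x 1F ⊛ M 1F
      Z = x 2F ⊛ M 2F
      polar-⊛₂ : ∀ b c v w → polar a (b ⊛ v) (c ⊛ w) ≈ b * c * polar a v w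
      polar-⊛₂ b c v w = begin
        polar a (b ⊛ v) (c ⊛ w)    ≈⟨ polar-⊛ a (b ⊛ v) c w ⟩
        c * polar a (b ⊛ v) w      ≈⟨ *-congˡ (polar-sym a (b ⊛ v) w) ⟩
        c * polar a w (b ⊛ v)      ≈⟨ *-congˡ (polar-⊛ a w b v) ⟩
        c * (b * polar a w v)      ≈⟨ *-congˡ (*-congˡ (polar-sym a w v)) ⟩
        c * (b * polar a v w)      ≈⟨ solve 3 (λ b c p → c :* (b :* p) := b :* c :* p) refl b c _ ⟩
        b * c * polar a v w        ∎

  open Conics

  -- Isotropic vectors of ternary forms over GF(q)

  module IsotropicVectors where

    root-of : ∀ {A B C} → ¬ A ≈ 0# → InGF 3 A → InGF 3 B → InGF 3 C → ∃[ θ ] A * (θ * θ) + B * θ + C ≈ 0#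
    root-of {A} {B} {C} A≉0 A∈ B∈ C∈ = scale (quadratic-root (- (A ⁻¹ * B)) (A ⁻¹ * C) (InGF-neg 3 (InGF-* 3 A⁻¹∈ B∈)) (InGF-* 3 A⁻¹∈ C∈))
      where
      A⁻¹∈ = InGF-⁻¹ 3 A∈
      scale : ∃[ θ ] θ * θ - - (A ⁻¹ * B) * θ + A ⁻¹ * C ≈ 0# → ∃[ θ ] A * (θ * θ) + B * θ + C ≈ 0#
      scale (θ , root) = θ , (begin
        A * (θ * θ) + B * θ + C
          ≈⟨ solve 4 (λ A B C θ → A :* (θ :* θ) :+ B :* θ :+ C := A :* (θ :* θ) :+ :1 :* B :* θ :+ :1 :* C) refl A B C θ ⟩
        A * (θ * θ) + 1# * B * θ + 1# * C
          ≈⟨ +-cong (+-congˡ (*-congʳ (*-congʳ (*-inverseʳ A≉0)))) (*-congʳ (*-inverseʳ A≉0)) ⟨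
        A * (θ * θ) + A * A ⁻¹ * B * θ + A * A ⁻¹ * C
          ≈⟨ solve 5 (λ A I B C θ → A :* (θ :* θ) :+ A :* I :* B :* θ :+ A :* I :* C := A :* (θ :* θ :- :- (I :* B) :* θ :+ I :* C)) refl A (A ⁻¹) B C θ ⟩
        A * (θ * θ - - (A ⁻¹ * B) * θ + A ⁻¹ * C)     ≈⟨ *-congˡ root ⟩
        A * 0#                                        ≈⟨ zeroʳ A ⟩
        0#                                            ∎)

    module _ {k A B C θ} (A≉0 : ¬ A ≈ 0#) (A∈ : InGF k A) (B∈ : InGF k B) (C∈ : InGF k C)
             (root : A * (θ * θ) + B * θ + C ≈ 0#) (θ∉ : ¬ InGF k θ) where

      private
        θ̄ = σ k θ

      conjugate-root : A * (θ̄ * θ̄) + B * θ̄ + C ≈ 0#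
      conjugate-root = begin
        A * (θ̄ * θ̄) + B * θ̄ + C                   ≈⟨ +-cong (+-cong (*-cong A∈ (σ-* k θ θ)) (*-congʳ B∈)) C∈ ⟨
        σ k A * σ k (θ * θ) + σ k B * θ̄ + σ k C   ≈⟨ +-congʳ (+-cong (σ-* k A _) (σ-* k B θ)) ⟨
        σ k (A * (θ * θ)) + σ k (B * θ) + σ k C    ≈⟨ +-congʳ (σ-+ k _ _) ⟨
        σ k (A * (θ * θ) + B * θ) + σ k C          ≈⟨ σ-+ k _ C ⟨
        σ k (A * (θ * θ) + B * θ + C)              ≈⟨ σ-cong k root ⟩
        σ k 0#                                     ≈⟨ σ-0 k ⟩
        0#                                         ∎

      -- Subtracting the equations of θ and of its conjugate leaves a multiple of θ - θ̄, which is
      -- nonzero as θ is outside the subfield.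
      sum-of-roots : B ≈ - (A * (θ + θ̄))
      sum-of-roots = x∙y⁻¹≈ε⇒x≈y _ _ (begin
        B - - (A * (θ + θ̄))    ≈⟨ solve 4 (λ A B θ η → B :- :- (A :* (θ :+ η)) := A :* (θ :+ η) :+ B) refl A B θ θ̄ ⟩
        A * (θ + θ̄) + B        ≈⟨ [ (λ eq → contradiction (sym (x∙y⁻¹≈ε⇒x≈y _ _ eq)) θ∉) , id ]′ (noZeroDivisors product) ⟩
        0#                     ∎)
        where
        product : (θ - θ̄) * (A * (θ + θ̄) + B) ≈ 0#
        product = begin
          (θ - θ̄) * (A * (θ + θ̄) + B)
            ≈⟨ solve 5 (λ A B C θ η → (θ :- η) :* (A :* (θ :+ η) :+ B) := (A :* (θ :* θ) :+ B :* θ :+ C) :- (A :* (η :* η) :+ B :* η :+ C)) refl A B C θ θ̄ ⟩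
          (A * (θ * θ) + B * θ + C) - (A * (θ̄ * θ̄) + B * θ̄ + C)   ≈⟨ +-cong root (-‿cong conjugate-root) ⟩
          0# - 0#     ≈⟨ -‿inverseʳ 0# ⟩
          0#          ∎

      product-of-roots : C ≈ A * (θ * θ̄)
      product-of-roots = x∙y⁻¹≈ε⇒x≈y _ _ (begin
        C - A * (θ * θ̄)
          ≈⟨ solve 4 (λ A C θ η → C :- A :* (θ :* η) := A :* (θ :* θ) :+ :- (A :* (θ :+ η)) :* θ :+ C) refl A C θ θ̄ ⟩
        A * (θ * θ) + - (A * (θ + θ̄)) * θ + C   ≈⟨ +-congʳ (+-congˡ (*-congʳ sum-of-roots)) ⟨
        A * (θ * θ) + B * θ + C                 ≈⟨ root ⟩
        0#                                      ∎)

    -- Both elements change sign under `σ k`, so their quotient is fixed.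
    InGF-ratio : ∀ {k x y} → ¬ x ≈ 0# → σ k x ≈ - x → σ k y ≈ - y → InGF k (y * x ⁻¹)
    InGF-ratio {k} {x} {y} x≉0 σx σy = *-cancelˡ x≉0 (begin
      x * σ k (y * x ⁻¹)                 ≈⟨ solve 2 (λ x z → x :* z := :- (:- x :* z)) refl x _ ⟩
      - (- x * σ k (y * x ⁻¹))           ≈⟨ -‿cong (*-congʳ σx) ⟨
      - (σ k x * σ k (y * x ⁻¹))         ≈⟨ -‿cong (σ-* k x _) ⟨
      - σ k (x * (y * x ⁻¹))             ≈⟨ -‿cong (σ-cong k cancel) ⟩
      - σ k y                            ≈⟨ -‿cong σy ⟩
      - - y                              ≈⟨ solve 1 (λ y → :- :- y := y) refl y ⟩
      y                                  ≈⟨ cancel ⟨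
      x * (y * x ⁻¹)                     ∎)
      where
      cancel : x * (y * x ⁻¹) ≈ y
      cancel = begin
        x * (y * x ⁻¹)    ≈⟨ solve 3 (λ x y i → x :* (y :* i) := x :* i :* y) refl x y (x ⁻¹) ⟩
        x * x ⁻¹ * y      ≈⟨ *-congʳ (*-inverseʳ x≉0) ⟩
        1# * y            ≈⟨ *-identityˡ y ⟩
        y                 ∎

    -- On the line ⟨e₀, e₁⟩ an anisotropic form is A times the norm of s − θ t; as the norm
    -- is surjective it also takes the value − quad a w for a w orthogonal to that line.
    module Anisotropic (a : Vector (V 3) 3) (a∈ : ∀ i → Over 1 (a i)) where

      private
        e₀ e₁ p r w : V 3
        e₀ = unit 0F
        e₁ = unit 1F
        p = covector a e₀
        r = covector a e₁
        w = cross p r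
        A = quad a e₀
        B = polar a e₀ e₁
        C = quad a e₁
        E = quad a w

        A∈ : InGF 1 A
        A∈ = over-quad 1 a∈ (unit-over 1 0F)
        B∈ : InGF 1 B
        B∈ = over-polar 1 a∈ (unit-over 1 0F) (unit-over 1 1F)
        C∈ : InGF 1 C
        C∈ = over-quad 1 a∈ (unit-over 1 1F)

        w-over : Over 1 w
        w-over = over-cross 1 {p} {r} (over-covector 1 {a} a∈ (unit-over 1 0F)) (over-covector 1 {a} a∈ (unit-over 1 1F))

        coordinate : ∀ x j → covector a x j ≈ polar a x (unit j)
        coordinate x j = trans (sym (sum-unit j (covector a x))) (trans (sum-cong-≋ (λ i → *-comm (unit j i) (covector a x i)))
          (sym (polar-covector a x (unit j))))

        combination : ∀ s t → quad a ((e₀ ∷ e₁ ∷ w ∷ []) · (s ∷ t ∷ 1# ∷ [])) ≈ A * (s * s) + B * (s * t) + C * (t * t) + E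
        combination s t = begin
          quad a ((e₀ ∷ e₁ ∷ w ∷ []) · (s ∷ t ∷ 1# ∷ []))   ≈⟨ quad-combination a (e₀ ∷ e₁ ∷ w ∷ []) (s ∷ t ∷ 1# ∷ []) ⟩
          s * s * A + (t * t * C + 1# * 1# * E + t * 1# * polar a e₁ w) + (s * t * B + s * 1# * polar a e₀ w)
            ≈⟨ +-cong (+-congˡ (+-congˡ (*-congˡ (trans (polar-covector a e₁ w) (dot-crossʳ p r)))))
                 (+-congˡ (*-congˡ (trans (polar-covector a e₀ w) (dot-crossˡ p r)))) ⟩
          s * s * A + (t * t * C + 1# * 1# * E + t * 1# * 0#) + (s * t * B + s * 1# * 0#)
            ≈⟨ solve 6 (λ A B C E s t → s :* s :* A :+ (t :* t :* C :+ :1 :* :1 :* E :+ t :* :1 :* :0) :+ (s :* t :* B :+ s :* :1 :* :0) :=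
                 A :* (s :* s) :+ B :* (s :* t) :+ C :* (t :* t) :+ E) refl A B C E s t ⟩
          A * (s * s) + B * (s * t) + C * (t * t) + E   ∎

        Isotropic : Set (c ⊔ ℓ₁)
        Isotropic = ∃[ v ] Point 1 v × quad a v ≈ 0#

        module _ {θ} (A≉0 : ¬ A ≈ 0#) (root : A * (θ * θ) + B * θ + C ≈ 0#) (θ∉ : ¬ InGF 1 θ) where

          θ̄ δ : Carrier
          θ̄ = σ 1 θ
          δ = θ - θ̄

          B≈ : B ≈ - (A * (θ + θ̄))
          B≈ = sum-of-roots {1} {A} {B} {C} {θ} A≉0 A∈ B∈ C∈ root θ∉
          C≈ : C ≈ A * (θ * θ̄)
          C≈ = product-of-roots {1} {A} {B} {C} {θ} A≉0 A∈ B∈ C∈ root θ∉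

          δ≉0 : ¬ δ ≈ 0#
          δ≉0 eq = θ∉ (sym (x∙y⁻¹≈ε⇒x≈y _ _ eq))

          -- This coordinate is 4 A C - B² = -A² (θ - θ̄)². Since e₀ and e₁ have last coordinate 0,
          -- it also guarantees that the isotropic vector built from `w` is nonzero.
          w₂≉0 : ¬ w 2F ≈ 0#
          w₂≉0 eq = *-nonzero (*-nonzero A≉0 δ≉0) (*-nonzero A≉0 δ≉0) (begin
            A * δ * (A * δ)
              ≈⟨ solve 3 (λ A θ η → A :* (θ :- η) :* (A :* (θ :- η)) :=
                   :- ((A :+ A) :* (A :* (θ :* η) :+ A :* (θ :* η)) :- (:- (A :* (θ :+ η))) :* (:- (A :* (θ :+ η))))) refl A θ θ̄ ⟩
            - ((A + A) * (A * (θ * θ̄) + A * (θ * θ̄)) - - (A * (θ + θ̄)) * - (A * (θ + θ̄)))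
              ≈⟨ -‿cong (+-cong (*-congˡ (+-cong C≈ C≈)) (-‿cong (*-cong B≈ B≈))) ⟨
            - ((A + A) * (C + C) - B * B)
              ≈⟨ -‿cong (+-cong (*-cong (coordinate e₀ 0F) (coordinate e₁ 1F)) (-‿cong (*-cong (coordinate e₀ 1F) (trans (coordinate e₁ 0F) (polar-sym a e₁ e₀))))) ⟨
            - (w 2F)    ≈⟨ -‿cong eq ⟩
            - 0#        ≈⟨ solve 0 (:- :0 := :0) refl ⟩
            0#          ∎)

          -- The sum θ + θ̄ = -B / A is rational, so it equals its conjugate.
          θ̄̄≈θ : σ 1 θ̄ ≈ θ
          θ̄̄≈θ = x∙y⁻¹≈ε⇒x≈y _ _ ([ (λ eq → contradiction eq A≉0) , id ]′ (noZeroDivisors (begin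
            A * (σ 1 θ̄ - θ)
              ≈⟨ solve 4 (λ A θ η κ → A :* (κ :- θ) := :- (A :* (θ :+ η)) :- :- (A :* (η :+ κ))) refl A θ θ̄ (σ 1 θ̄) ⟩
            - (A * (θ + θ̄)) - - (A * (θ̄ + σ 1 θ̄))
              ≈⟨ +-cong (sym B≈) (-‿cong (-‿cong (sym (trans (σ-* 1 A _) (*-cong A∈ (σ-+ 1 θ θ̄)))))) ⟩
            B - - σ 1 (A * (θ + θ̄))    ≈⟨ +-congˡ (-‿cong (trans (sym (σ-neg 1 _)) (trans (σ-cong 1 (sym B≈)) B∈))) ⟩
            B - B                      ≈⟨ -‿inverseʳ B ⟩
            0#                         ∎)))

          σδ : σ 1 δ ≈ - δ
          σδ = trans (σ-minus 1 θ θ̄) (trans (+-congˡ (-‿cong θ̄̄≈θ)) (solve 2 (λ a b → a :- b := :- (b :- a)) refl θ̄ θ))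

          nonisotropic-case : ¬ E ≈ 0# → Isotropic
          nonisotropic-case E≉0 = v , (v-over , λ v≋0 → w₂≉0 (trans (sym v₂) (v≋0 2F))) , (begin
              quad a v                                        ≈⟨ combination s t ⟩
              A * (s * s) + B * (s * t) + C * (t * t) + E     ≈⟨ +-congʳ (+-cong (+-congˡ (*-congʳ B≈)) (*-congʳ C≈)) ⟩
              A * (s * s) + - (A * (θ + θ̄)) * (s * t) + A * (θ * θ̄) * (t * t) + E
                ≈⟨ solve 6 (λ A E s t θ η → A :* (s :* s) :+ :- (A :* (θ :+ η)) :* (s :* t) :+ A :* (θ :* η) :* (t :* t) :+ E :=
                     A :* ((s :- θ :* t) :* (s :- η :* t)) :+ E) refl A E s t θ θ̄ ⟩
              A * ((s - θ * t) * (s - θ̄ * t)) + E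
                ≈⟨ +-congʳ (*-congˡ (*-cong (solve 3 (λ z θ t → z :+ θ :* t :- θ :* t := z) refl z θ t) s-θ̄t)) ⟩
              A * (z * z̄) + E                                 ≈⟨ +-congʳ (*-congˡ zz̄) ⟩
              A * (- (A ⁻¹ * E)) + E
                ≈⟨ solve 3 (λ A I E → A :* (:- (I :* E)) :+ E := (:1 :- A :* I) :* E) refl A (A ⁻¹) E ⟩
              (1# - A * A ⁻¹) * E                             ≈⟨ *-congʳ (+-congˡ (-‿cong (*-inverseʳ A≉0))) ⟩
              (1# - 1#) * E                                   ≈⟨ solve 1 (λ E → (:1 :- :1) :* E := :0) refl E ⟩
              0#                                              ∎)
            where
            d = - (A ⁻¹ * E)
            E∈ : InGF 1 E
            E∈ = over-quad 1 a∈ w-over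
            d∈ : InGF 1 d
            d∈ = InGF-neg 1 (InGF-* 1 (InGF-⁻¹ 1 A∈) E∈)
            d≉0 : ¬ d ≈ 0#
            d≉0 eq = *-nonzero (⁻¹-nonzero A≉0) E≉0 (trans (solve 1 (λ x → x := :- :- x) refl _) (trans (-‿cong eq) (solve 0 (:- :0 := :0) refl)))
            norm-preimage = norm-surjective d d∈ d≉0
            z = proj₁ norm-preimage
            z̄ = σ 1 z
            zz̄ : z * z̄ ≈ d
            zz̄ = trans (*-congˡ (^-congʳ z (ℕ.*-identityʳ q))) (proj₂ norm-preimage)
            z̄≉0 : ¬ z̄ ≈ 0#
            z̄≉0 = *-nonzeroʳ (d≉0 ∘ trans (sym zz̄))
            -- The norm lemma gives `z` only in K; since z z̄ is rational it equals its conjugate z̄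
            -- z̄̄, which forces z̄̄ = z.
            z̄̄≈z : σ 1 z̄ ≈ z
            z̄̄≈z = *-cancelˡ z̄≉0 (trans (trans (sym (σ-* 1 z z̄)) (trans (σ-cong 1 zz̄) (trans d∈ (sym zz̄)))) (*-comm z z̄))
            -- Solves s - θ t = z and s - θ̄ t = z̄; the solution is rational because Frobenius
            -- exchanges the two equations.
            t = (z̄ - z) * δ ⁻¹
            s = z + θ * t
            δt : δ * t ≈ z̄ - z
            δt = trans (solve 3 (λ d y i → d :* (y :* i) := d :* i :* y) refl δ (z̄ - z) (δ ⁻¹)) (trans (*-congʳ (*-inverseʳ δ≉0)) (*-identityˡ _))
            s-θ̄t : s - θ̄ * t ≈ z̄
            s-θ̄t = trans (solve 4 (λ z θ η t → z :+ θ :* t :- η :* t := z :+ (θ :- η) :* t) refl z θ θ̄ t)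
              (trans (+-congˡ δt) (solve 2 (λ z y → z :+ (y :- z) := y) refl z z̄))
            t∈ : InGF 1 t
            t∈ = InGF-ratio {1} {δ} {z̄ - z} δ≉0 σδ (trans (σ-minus 1 z̄ z) (trans (+-congʳ z̄̄≈z) (solve 2 (λ a b → a :- b := :- (b :- a)) refl z z̄)))
            s∈ : InGF 1 s
            s∈ = begin
              σ 1 (z + θ * t)      ≈⟨ σ-+ 1 z _ ⟩
              z̄ + σ 1 (θ * t)      ≈⟨ +-congˡ (trans (σ-* 1 θ t) (*-congˡ t∈)) ⟩
              z̄ + θ̄ * t            ≈⟨ +-congʳ s-θ̄t ⟨
              s - θ̄ * t + θ̄ * t    ≈⟨ solve 2 (λ s x → s :- x :+ x := s) refl s (θ̄ * t) ⟩
              s                    ∎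
            v : V 3
            v = (e₀ ∷ e₁ ∷ w ∷ []) · (s ∷ t ∷ 1# ∷ [])
            v-over : Over 1 v
            v-over = over-· 1 {M = e₀ ∷ e₁ ∷ w ∷ []} (λ { 0F → unit-over 1 0F ; 1F → unit-over 1 1F ; 2F → w-over }) {s ∷ t ∷ 1# ∷ []} (λ { 0F → s∈ ; 1F → t∈ ; 2F → σ-1 1 })
            v₂ : v 2F ≈ w 2F
            v₂ = solve 3 (λ s t w → s :* :0 :+ (t :* :0 :+ (:1 :* w :+ :0)) := w) refl s t (w 2F)

          irrational-case : Isotropic
          irrational-case = by (E ≈? 0#)
            where
            by : Dec (E ≈ 0#) → Isotropic
            by (yes E≈0) = w , (w-over , λ w≋0 → w₂≉0 (w≋0 2F)) , E≈0
            by (no E≉0)  = nonisotropic-case E≉0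

        rational-case : ∀ {θ} → A * (θ * θ) + B * θ + C ≈ 0# → InGF 1 θ → Isotropic
        rational-case {θ} root θ∈ = (θ ⊛ e₀) ⊕ e₁ , (over-⊕ 1 (over-⊛ 1 θ∈ (unit-over 1 0F)) (unit-over 1 1F) ,
          λ eq → 1≉0 (trans (solve 1 (λ θ → :1 := θ :* :0 :+ :1) refl θ) (eq 1F))) , (begin
            quad a ((θ ⊛ e₀) ⊕ e₁)               ≈⟨ quad-⊕ a (θ ⊛ e₀) e₁ ⟩
            quad a (θ ⊛ e₀) + C + polar a (θ ⊛ e₀) e₁
              ≈⟨ +-cong (+-congʳ (quad-⊛ a θ e₀)) (trans (polar-sym a (θ ⊛ e₀) e₁) (trans (polar-⊛ a e₁ θ e₀) (*-congˡ (polar-sym a e₁ e₀)))) ⟩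
            θ * θ * A + C + θ * B              ≈⟨ solve 4 (λ A B C θ → θ :* θ :* A :+ C :+ θ :* B := A :* (θ :* θ) :+ B :* θ :+ C) refl A B C θ ⟩
            A * (θ * θ) + B * θ + C            ≈⟨ root ⟩
            0#                                 ∎)

      isotropic : Isotropic
      isotropic = by (A ≈? 0#)
        where
        by-root : ¬ A ≈ 0# → (∃[ θ ] A * (θ * θ) + B * θ + C ≈ 0#) → Isotropic
        by-root A≉0 (θ , root) = go (InGF? 1 θ)
          where
          go : Dec (InGF 1 θ) → Isotropic
          go (yes θ∈) = rational-case root θ∈
          go (no θ∉)  = irrational-case A≉0 root θ∉
        by : Dec (A ≈ 0#) → Isotropic
        by (yes A≈0) = e₀ , (unit-over 1 0F , λ eq → 1≉0 (eq 0F)) , A≈0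
        by (no A≉0)  = by-root A≉0 (root-of A≉0 (InGF-1⇒ 3 A∈) (InGF-1⇒ 3 B∈) (InGF-1⇒ 3 C∈))

  open IsotropicVectors

  -- The canonical form y² - x z of a conic

  module ConicCoordinates where

    -- The form takes the shape a (y² − x z) in the basis v₀, u, w, where v₀ and a
    -- multiple of w form a hyperbolic pair and u spans its orthogonal complement.
    module _ (𝒞 : Conic 1) where

      private
        a : Vector (V 3) 3
        a = Conic.form 𝒞
        a∈ = Conic.over 𝒞

        module _ (v₀ : V 3) (v₀∈ : Point 1 v₀) (qv₀ : quad a v₀ ≈ 0#) where

          -- Otherwise v₀ is an isotropic vector in the radical of the polar form, that is, a
          -- singular point of the conic.
          covector≉0 : ¬ covector a v₀ ≋ 𝟎
          covector≉0 eq = Conic.nondegenerate 𝒞 v₀ v₀∈ (λ x _ → begin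
            quad a (x ⊕ v₀)                           ≈⟨ quad-⊕ a x v₀ ⟩
            quad a x + quad a v₀ + polar a x v₀       ≈⟨ +-cong (+-congˡ qv₀) (trans (polar-sym a x v₀) (trans (polar-covector a v₀ x) (dot-cong eq (≋-refl {v = x})))) ⟩
            quad a x + 0# + dot 𝟎 x                   ≈⟨ +-cong (+-identityʳ _) (sum-cong-≋ (λ i → zeroˡ (x i))) ⟩
            quad a x + sum {3} (λ _ → 0#)             ≈⟨ trans (+-congˡ (sum-replicate-zero 3)) (+-identityʳ _) ⟩
            quad a x                                  ∎)

          j : Fin 3
          j = proj₁ (nonzero-coordinate covector≉0)

          β Ew : Carrier
          β = covector a v₀ j
          Ew = quad a (unit j)

          β≉0 : ¬ β ≈ 0#
          β≉0 = proj₂ (nonzero-coordinate covector≉0)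

          polar-v₀-unit : polar a v₀ (unit j) ≈ β
          polar-v₀-unit = trans (polar-covector a v₀ (unit j)) (trans (sum-cong-≋ (λ i → *-comm (covector a v₀ i) (unit j i))) (sum-unit j (covector a v₀)))

          polar-v₀-v₀ : polar a v₀ v₀ ≈ 0#
          polar-v₀-v₀ = trans (+-cong qv₀ qv₀) (+-identityʳ 0#)

          -- The solution of `Ew` + κ β = 0, which makes `w` isotropic.
          κ : Carrier
          κ = - (Ew * β ⁻¹)

          w : V 3
          w = unit j ⊕ (κ ⊛ v₀)

          polar-v₀-w : polar a v₀ w ≈ β
          polar-v₀-w = trans (polar-⊕ a v₀ (unit j) (κ ⊛ v₀)) (trans (+-cong polar-v₀-unit
            (trans (polar-⊛ a v₀ κ v₀) (trans (*-congˡ polar-v₀-v₀) (zeroʳ κ)))) (+-identityʳ β))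

          qw : quad a w ≈ 0#
          qw = begin
            quad a (unit j ⊕ (κ ⊛ v₀))                                  ≈⟨ quad-⊕ a (unit j) (κ ⊛ v₀) ⟩
            Ew + quad a (κ ⊛ v₀) + polar a (unit j) (κ ⊛ v₀)
              ≈⟨ +-cong (+-congˡ (trans (quad-⊛ a κ v₀) (*-congˡ qv₀))) (trans (polar-⊛ a (unit j) κ v₀) (*-congˡ (trans (polar-sym a (unit j) v₀) polar-v₀-unit))) ⟩
            Ew + κ * κ * 0# + - (Ew * β ⁻¹) * β
              ≈⟨ solve 4 (λ E k i b → E :+ k :* k :* :0 :+ :- (E :* i) :* b := E :* (:1 :- b :* i)) refl Ew κ (β ⁻¹) β ⟩
            Ew * (1# - β * β ⁻¹)                                        ≈⟨ *-congˡ (+-congˡ (-‿cong (*-inverseʳ β≉0))) ⟩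
            Ew * (1# - 1#)                                              ≈⟨ solve 1 (λ E → E :* (:1 :- :1) := :0) refl Ew ⟩
            0#                                                          ∎

          polar-w-w : polar a w w ≈ 0#
          polar-w-w = trans (+-cong qw qw) (+-identityʳ 0#)

          u : V 3
          u = cross (covector a v₀) (covector a w)

          polar-v₀-u : polar a v₀ u ≈ 0#
          polar-v₀-u = trans (polar-covector a v₀ u) (dot-crossˡ (covector a v₀) (covector a w))

          polar-w-u : polar a w u ≈ 0#
          polar-w-u = trans (polar-covector a w u) (dot-crossʳ (covector a v₀) (covector a w))

          -- By the Binet-Cauchy identity the product of `u` with v₀ × w is the Gram determinant of
          -- v₀ and w, which is -β².
          u≉0 : ¬ u ≋ 𝟎
          u≉0 eq = *-nonzero β≉0 β≉0 (begin
            β * β                                                       ≈⟨ solve 1 (λ b → b :* b := :- (:0 :* :0 :- b :* b)) refl β ⟩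
            - (0# * 0# - β * β)
              ≈⟨ -‿cong (+-cong (*-cong (as-dot v₀ v₀ polar-v₀-v₀) (as-dot w w polar-w-w))
                   (-‿cong (*-cong (as-dot v₀ w polar-v₀-w) (as-dot w v₀ (trans (polar-sym a w v₀) polar-v₀-w))))) ⟨
            - (dot P v₀ * dot R w - dot P w * dot R v₀)                 ≈⟨ -‿cong (binet-cauchy P R v₀ w) ⟨
            - dot u (cross v₀ w)                                        ≈⟨ -‿cong (dot-cong eq (≋-refl {v = cross v₀ w})) ⟩
            - dot 𝟎 (cross v₀ w)                                        ≈⟨ -‿cong (trans (sum-cong-≋ (λ i → zeroˡ (cross v₀ w i))) (sum-replicate-zero 3)) ⟩
            - 0#                                                        ≈⟨ solve 0 (:- :0 := :0) refl ⟩
            0#                                                          ∎)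
            where
            P = covector a v₀
            R = covector a w
            as-dot : ∀ x y {b} → polar a x y ≈ b → dot (covector a x) y ≈ b
            as-dot x y eq = trans (sym (polar-covector a x y)) eq

          w∈ : Over 1 w
          w∈ = over-⊕ 1 (unit-over 1 j) (over-⊛ 1 κ∈ (proj₁ v₀∈))
            where
            κ∈ : InGF 1 κ
            κ∈ = InGF-neg 1 (InGF-* 1 (over-quad 1 {a} a∈ (unit-over 1 j)) (InGF-⁻¹ 1 (over-covector 1 {a} a∈ (proj₁ v₀∈) j)))

          u∈ : Over 1 u
          u∈ = over-cross 1 {covector a v₀} {covector a w} (over-covector 1 {a} a∈ (proj₁ v₀∈)) (over-covector 1 {a} a∈ w∈)

          basis : Vector (V 3) 3
          basis = v₀ ∷ u ∷ w ∷ []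

          -- Pairing with v₀ and with w isolates x₂ and x₀. Pairing with u would not isolate x₁ in
          -- characteristic 2, where `polar a u u` is 0; a nonzero coordinate of u is used instead.
          basis-independent : Independent basis
          basis-independent x eq = λ { 0F → x₀≈0 ; 1F → x₁≈0 ; 2F → x₂≈0 }
            where
            pair : ∀ y → polar a y (basis · x) ≈ x 0F * polar a y v₀ + (x 1F * polar a y u + x 2F * polar a y w)
            pair y = trans (polar-cong a y {basis · x} {(x 0F ⊛ v₀) ⊕ ((x 1F ⊛ u) ⊕ (x 2F ⊛ w))} (λ i → +-congˡ (+-congˡ (+-identityʳ _))))
              (trans (polar-⊕ a y (x 0F ⊛ v₀) ((x 1F ⊛ u) ⊕ (x 2F ⊛ w)))
              (+-cong (polar-⊛ a y (x 0F) v₀) (trans (polar-⊕ a y (x 1F ⊛ u) (x 2F ⊛ w)) (+-cong (polar-⊛ a y (x 1F) u) (polar-⊛ a y (x 2F) w)))))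
            vanish : ∀ y → polar a y (basis · x) ≈ 0#
            vanish y = trans (polar-cong a y eq) (trans (polar-covector a y 𝟎) (dot-𝟎 (covector a y)))
            x₂≈0 : x 2F ≈ 0#
            x₂≈0 = [ id , (λ eq → contradiction eq β≉0) ]′ (noZeroDivisors (begin
              x 2F * β      ≈⟨ solve 4 (λ x y z b → z :* b := x :* :0 :+ (y :* :0 :+ z :* b)) refl (x 0F) (x 1F) (x 2F) β ⟩
              x 0F * 0# + (x 1F * 0# + x 2F * β)   ≈⟨ +-cong (*-congˡ polar-v₀-v₀) (+-cong (*-congˡ polar-v₀-u) (*-congˡ polar-v₀-w)) ⟨
              x 0F * polar a v₀ v₀ + (x 1F * polar a v₀ u + x 2F * polar a v₀ w)   ≈⟨ pair v₀ ⟨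
              polar a v₀ (basis · x)  ≈⟨ vanish v₀ ⟩
              0#  ∎))
            x₀≈0 : x 0F ≈ 0#
            x₀≈0 = [ id , (λ eq → contradiction eq β≉0) ]′ (noZeroDivisors (begin
              x 0F * β      ≈⟨ solve 4 (λ x y z b → x :* b := x :* b :+ (y :* :0 :+ z :* :0)) refl (x 0F) (x 1F) (x 2F) β ⟩
              x 0F * β + (x 1F * 0# + x 2F * 0#)
                ≈⟨ +-cong (*-congˡ (trans (polar-sym a w v₀) polar-v₀-w)) (+-cong (*-congˡ polar-w-u) (*-congˡ polar-w-w)) ⟨
              x 0F * polar a w v₀ + (x 1F * polar a w u + x 2F * polar a w w)   ≈⟨ pair w ⟨
              polar a w (basis · x)  ≈⟨ vanish w ⟩
              0#  ∎))
            i = proj₁ (nonzero-coordinate u≉0)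
            x₁≈0 : x 1F ≈ 0#
            x₁≈0 = [ id , (λ eq → contradiction eq (proj₂ (nonzero-coordinate u≉0))) ]′ (noZeroDivisors (begin
              x 1F * u i     ≈⟨ solve 3 (λ v y w → y := :0 :* v :+ (y :+ (:0 :* w :+ :0))) refl (v₀ i) (x 1F * u i) (w i) ⟩
              0# * v₀ i + (x 1F * u i + (0# * w i + 0#))  ≈⟨ +-cong (*-congʳ x₀≈0) (+-congˡ (+-congʳ (*-congʳ x₂≈0))) ⟨
              (basis · x) i  ≈⟨ eq i ⟩
              0#             ∎))

          -- If the form vanished at u, then u would be orthogonal to the whole basis, itself
          -- included, and hence singular.
          qu≉0 : ¬ quad a u ≈ 0#
          qu≉0 eq = Conic.nondegenerate 𝒞 u (u∈ , u≉0) (λ x _ → begin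
            quad a (x ⊕ u)                        ≈⟨ quad-⊕ a x u ⟩
            quad a x + quad a u + polar a x u     ≈⟨ +-cong (+-congˡ eq) (trans (polar-sym a x u) (trans (polar-covector a u x)
                                                       (dot-∈⟨⟩ (covector a u) {basis} orthogonal (independent⇒basis {M = basis} basis-independent x)))) ⟩
            quad a x + 0# + 0#                    ≈⟨ trans (+-identityʳ _) (+-identityʳ _) ⟩
            quad a x                              ∎)
            where
            orthogonal : ∀ i → dot (covector a u) (basis i) ≈ 0#
            orthogonal 0F = trans (sym (polar-covector a u v₀)) (trans (polar-sym a u v₀) polar-v₀-u)
            orthogonal 1F = trans (sym (polar-covector a u u)) (trans (+-cong eq eq) (+-identityʳ 0#))
            orthogonal 2F = trans (sym (polar-covector a u w)) (trans (polar-sym a u w) polar-w-u)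

          -- Multiplying w by it turns the coefficient β of x z into -`quad a u`, the negative of
          -- the coefficient of y².
          scaling : Carrier
          scaling = - (quad a u * β ⁻¹)

          scaling≉0 : ¬ scaling ≈ 0#
          scaling≉0 eq = *-nonzero qu≉0 (⁻¹-nonzero β≉0) (trans (solve 1 (λ x → x := :- :- x) refl _) (trans (-‿cong eq) (solve 0 (:- :0 := :0) refl)))

          scaled : V 3 → V 3
          scaled z = z 0F ∷ z 1F ∷ z 2F * scaling ∷ []

          quad-basis : ∀ z → quad a (basis · scaled z) ≈ quad a u * (z 1F * z 1F - z 0F * z 2F)
          quad-basis z = begin
            quad a (basis · scaled z)    ≈⟨ quad-combination a basis (scaled z) ⟩
            z 0F * z 0F * quad a v₀ + (z 1F * z 1F * quad a u + z₂ * z₂ * quad a w + z 1F * z₂ * polar a u w)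
              + (z 0F * z 1F * polar a v₀ u + z 0F * z₂ * polar a v₀ w)
              ≈⟨ +-cong (+-cong (*-congˡ qv₀) (+-cong (+-congˡ (*-congˡ qw)) (*-congˡ (trans (polar-sym a u w) polar-w-u))))
                   (+-cong (*-congˡ polar-v₀-u) (*-congˡ polar-v₀-w)) ⟩
            z 0F * z 0F * 0# + (z 1F * z 1F * quad a u + z₂ * z₂ * 0# + z 1F * z₂ * 0#) + (z 0F * z 1F * 0# + z 0F * z₂ * β)
              ≈⟨ solve 6 (λ x y z Q i b → let w = z :* :- (Q :* i) in
                   x :* x :* :0 :+ (y :* y :* Q :+ w :* w :* :0 :+ y :* w :* :0) :+ (x :* y :* :0 :+ x :* w :* b) :=
                   Q :* (y :* y :- x :* z :* (b :* i))) refl (z 0F) (z 1F) (z 2F) (quad a u) (β ⁻¹) β ⟩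
            quad a u * (z 1F * z 1F - z 0F * z 2F * (β * β ⁻¹))
              ≈⟨ *-congˡ (+-congˡ (-‿cong (trans (*-congˡ (*-inverseʳ β≉0)) (*-identityʳ _)))) ⟩
            quad a u * (z 1F * z 1F - z 0F * z 2F)   ∎
            where z₂ = z 2F * scaling

          frame : Vector (V 3) 3
          frame = v₀ ∷ u ∷ scaling ⊛ w ∷ []

          frame-· : ∀ z → frame · z ≋ basis · scaled z
          frame-· z i = +-congˡ (+-congˡ (+-congʳ (sym (*-assoc (z 2F) scaling (w i)))))

          canonical-form : Σ (Vector (V 3) 3) λ M → (∀ j → Over 1 (M j)) × Independent M ×
            Σ Carrier λ b → ¬ b ≈ 0# × (∀ z → quad a (M · z) ≈ b * (z 1F * z 1F - z 0F * z 2F))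
          canonical-form = frame , frame-over , frame-independent , quad a u , qu≉0 ,
            λ z → trans (quad-cong a (frame-· z)) (quad-basis z)
            where
            frame-over : ∀ j → Over 1 (frame j)
            frame-over 0F = proj₁ v₀∈
            frame-over 1F = u∈
            frame-over 2F = over-⊛ 1 (InGF-neg 1 (InGF-* 1 (over-quad 1 {a} a∈ u∈) (InGF-⁻¹ 1 (over-covector 1 {a} a∈ (proj₁ v₀∈) j)))) w∈
            frame-independent : Independent frame
            frame-independent z eq = λ { 0F → s≋0 0F ; 1F → s≋0 1F ; 2F → [ id , (λ eq → contradiction eq scaling≉0) ]′ (noZeroDivisors (s≋0 2F)) }
              where
              s≋0 : scaled z ≋ 𝟎
              s≋0 = basis-independent (scaled z) (≋-trans (≋-sym (frame-· z)) eq)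

      conic-canonical-form : Σ (Vector (V 3) 3) λ M → (∀ j → Over 1 (M j)) × Independent M ×
        Σ Carrier λ b → ¬ b ≈ 0# × (∀ z → quad a (M · z) ≈ b * (z 1F * z 1F - z 0F * z 2F))
      conic-canonical-form = canonical-form (proj₁ point) (proj₁ (proj₂ point)) (proj₂ (proj₂ point))
        where
        point : ∃[ v ] Point 1 v × quad a v ≈ 0#
        point = Anisotropic.isotropic a a∈

  open ConicCoordinates

  -- Parametrisation of the conic, and the equations of its extensions

  module ConicParametrisation where

    private
      variable
        p₁ p₂ : Level

    veronese-conic : ∀ u → veronese 2 u 1F * veronese 2 u 1F ≈ veronese 2 u 0F * veronese 2 u 2F
    veronese-conic u = solve 2 (λ s t → (s :^ 1 :* t :^ 1) :* (s :^ 1 :* t :^ 1) := (s :^ 2 :* t :^ 0) :* (s :^ 0 :* t :^ 2)) refl (u 0F) (u 1F)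

    x*x≈0⇒x≈0 : ∀ {x} → x * x ≈ 0# → x ≈ 0#
    x*x≈0⇒x≈0 eq = [ id , id ]′ (noZeroDivisors eq)

    veronese-nonzero : ∀ {u} → ¬ u ≋ 𝟎 → ¬ veronese 2 u ≋ 𝟎
    veronese-nonzero {u} u≉0 eq = u≉0 λ
      { 0F → x*x≈0⇒x≈0 (trans (solve 2 (λ s t → s :* s := s :^ 2 :* t :^ 0) refl (u 0F) (u 1F)) (eq 0F))
      ; 1F → x*x≈0⇒x≈0 (trans (solve 2 (λ s t → t :* t := s :^ 0 :* t :^ 2) refl (u 0F) (u 1F)) (eq 2F)) }

    ^-InGF : ∀ k {x} r → InGF k x → InGF k (x ^ r)
    ^-InGF k zero    x∈ = σ-1 k
    ^-InGF k (suc r) x∈ = InGF-* k x∈ (^-InGF k r x∈)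

    over-veronese : ∀ k r {u} → Over k u → Over k (veronese r u)
    over-veronese k r u∈ i = InGF-* k (^-InGF k (r ℕ.∸ toℕ i) (u∈ 0F)) (^-InGF k (toℕ i) (u∈ 1F))

    σ-^ : ∀ k x r → σ k (x ^ r) ≈ σ k x ^ r
    σ-^ k x zero    = σ-1 k
    σ-^ k x (suc r) = trans (σ-* k x (x ^ r)) (*-congˡ (σ-^ k x r))

    frob-veronese : ∀ k r u → frob k (veronese r u) ≋ veronese r (frob k u)
    frob-veronese k r u i = trans (σ-* k _ _) (*-cong (σ-^ k (u 0F) (r ℕ.∸ toℕ i)) (σ-^ k (u 1F) (toℕ i)))

    veronese-cong : ∀ r {u v} → u ≋ v → veronese r u ≋ veronese r v
    veronese-cong r u≋v i = *-cong (^-congˡ (r ℕ.∸ toℕ i) (u≋v 0F)) (^-congˡ (toℕ i) (u≋v 1F))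

    veronese-⊛ : ∀ r a u → veronese r (a ⊛ u) ≋ (a ^ r) ⊛ veronese r u
    veronese-⊛ r a u i = begin
      (a * u 0F) ^ (r ℕ.∸ k) * (a * u 1F) ^ k               ≈⟨ *-cong (^-distrib-* a (u 0F) (r ℕ.∸ k)) (^-distrib-* a (u 1F) k) ⟩
      a ^ (r ℕ.∸ k) * u 0F ^ (r ℕ.∸ k) * (a ^ k * u 1F ^ k)
        ≈⟨ solve 4 (λ a x b y → a :* x :* (b :* y) := a :* b :* (x :* y)) refl (a ^ (r ℕ.∸ k)) (u 0F ^ (r ℕ.∸ k)) (a ^ k) (u 1F ^ k) ⟩
      a ^ (r ℕ.∸ k) * a ^ k * veronese r u i
        ≈⟨ *-congʳ (trans (sym (^-homo-* a (r ℕ.∸ k) k)) (^-congʳ a (ℕ.m∸n+n≡m (ℕ.≤-pred (Fin.toℕ<n i))))) ⟩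
      a ^ r * veronese r u i                                ∎
      where k = toℕ i

    veronese-∼ : ∀ r {u v} → u ∼ v → veronese r u ∼ veronese r v
    veronese-∼ r {u} {v} (a , a≉0 , eq) = a ^ r , ^-nonzero r , ≋-trans (veronese-cong r eq) (veronese-⊛ r a v)
      where
      ^-nonzero : ∀ r → ¬ a ^ r ≈ 0#
      ^-nonzero zero    = 1≉0
      ^-nonzero (suc r) = *-nonzero a≉0 (^-nonzero r)

    ⁻¹-cancel : ∀ {x y} → ¬ x ≈ 0# → x ⁻¹ * (x * y) ≈ y
    ⁻¹-cancel {x} {y} x≉0 = begin
      x ⁻¹ * (x * y)    ≈⟨ solve 3 (λ x i y → i :* (x :* y) := x :* i :* y) refl x (x ⁻¹) y ⟩
      x * x ⁻¹ * y      ≈⟨ *-congʳ (*-inverseʳ x≉0) ⟩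
      1# * y            ≈⟨ *-identityˡ y ⟩
      y                 ∎

    -- Off z₀ = 0 the parameter is (z₀ : z₁), and the Veronese map returns z times z₀. With z₀ = 0
    -- the equation leaves only the point (0 : 0 : 1).
    veronese-surjective : ∀ k {z} → Point k z → z 1F * z 1F ≈ z 0F * z 2F → ∃[ u ] Point k u × z ∼ veronese 2 u
    veronese-surjective k {z} (z∈ , z≉0) conic = by (z 0F ≈? 0#)
      where
      by : Dec (z 0F ≈ 0#) → ∃[ u ] Point k u × z ∼ veronese 2 u
      by (no z₀≉0) = u , ((λ { 0F → z∈ 0F ; 1F → z∈ 1F }) , λ eq → z₀≉0 (eq 0F)) , ∼-sym (z 0F , z₀≉0 , λ
        { 0F → solve 2 (λ x y → x :^ 2 :* y :^ 0 := x :* x) refl (z 0F) (z 1F)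
        ; 1F → solve 2 (λ x y → x :^ 1 :* y :^ 1 := x :* y) refl (z 0F) (z 1F)
        ; 2F → trans (solve 2 (λ x y → x :^ 0 :* y :^ 2 := y :* y) refl (z 0F) (z 1F)) conic })
        where
        u : V 2
        u = z 0F ∷ z 1F ∷ []
      by (yes z₀≈0) = u , ((λ { 0F → σ-0 k ; 1F → z∈ 2F }) , λ eq → z₂≉0 (eq 1F)) , ∼-sym (z 2F , z₂≉0 , λ
        { 0F → trans (solve 1 (λ z → :0 :^ 2 :* z :^ 0 := z :* :0) refl (z 2F)) (*-congˡ (sym z₀≈0))
        ; 1F → trans (solve 1 (λ z → :0 :^ 1 :* z :^ 1 := z :* :0) refl (z 2F)) (*-congˡ (sym z₁≈0))
        ; 2F → solve 1 (λ z → :0 :^ 0 :* z :^ 2 := z :* z) refl (z 2F) })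
        where
        u : V 2
        u = 0# ∷ z 2F ∷ []
        z₁≈0 : z 1F ≈ 0#
        z₁≈0 = x*x≈0⇒x≈0 (trans conic (trans (*-congʳ z₀≈0) (zeroˡ _)))
        z₂≉0 : ¬ z 2F ≈ 0#
        z₂≉0 z₂≈0 = z≉0 λ { 0F → z₀≈0 ; 1F → z₁≈0 ; 2F → z₂≈0 }

    veronese-injective : ∀ {u v} → veronese 2 u ∼ veronese 2 v → ¬ v ≋ 𝟎 → ¬ u ≋ 𝟎 → u ∼ v
    veronese-injective {u} {v} (a , a≉0 , eq) v≉0 u≉0 = by (v 0F ≈? 0#)
      where
      e₀ : u 0F * u 0F ≈ a * (v 0F * v 0F)
      e₀ = trans (solve 2 (λ s t → s :* s := s :^ 2 :* t :^ 0) refl (u 0F) (u 1F)) (trans (eq 0F)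
        (*-congˡ (solve 2 (λ s t → s :^ 2 :* t :^ 0 := s :* s) refl (v 0F) (v 1F))))
      e₁ : u 0F * u 1F ≈ a * (v 0F * v 1F)
      e₁ = trans (solve 2 (λ s t → s :* t := s :^ 1 :* t :^ 1) refl (u 0F) (u 1F)) (trans (eq 1F)
        (*-congˡ (solve 2 (λ s t → s :^ 1 :* t :^ 1 := s :* t) refl (v 0F) (v 1F))))
      by : Dec (v 0F ≈ 0#) → u ∼ v
      by (no v₀≉0) = u 0F * v 0F ⁻¹ , *-nonzero u₀≉0 (⁻¹-nonzero v₀≉0) , λ
        { 0F → sym (trans (solve 3 (λ x i y → x :* i :* y := x :* (y :* i)) refl (u 0F) (v 0F ⁻¹) (v 0F))
                 (trans (*-congˡ (*-inverseʳ v₀≉0)) (*-identityʳ _)))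
        ; 1F → *-cancelˡ u₀≉0 (begin
            u 0F * u 1F                       ≈⟨ e₁ ⟩
            a * (v 0F * v 1F)                 ≈⟨ *-congˡ (*-congʳ (trans (sym (*-identityʳ _)) (*-congˡ (sym (*-inverseʳ v₀≉0))))) ⟩
            a * (v 0F * (v 0F * v 0F ⁻¹) * v 1F)
              ≈⟨ solve 4 (λ a x i y → a :* (x :* (x :* i) :* y) := a :* (x :* x) :* (i :* y)) refl a (v 0F) (v 0F ⁻¹) (v 1F) ⟩
            a * (v 0F * v 0F) * (v 0F ⁻¹ * v 1F)   ≈⟨ *-congʳ e₀ ⟨
            u 0F * u 0F * (v 0F ⁻¹ * v 1F)    ≈⟨ solve 3 (λ x i y → x :* x :* (i :* y) := x :* (x :* i :* y)) refl (u 0F) (v 0F ⁻¹) (v 1F) ⟩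
            u 0F * (u 0F * v 0F ⁻¹ * v 1F)    ∎) }
        where
        u₀≉0 : ¬ u 0F ≈ 0#
        u₀≉0 u₀≈0 = *-nonzero a≉0 (*-nonzero v₀≉0 v₀≉0) (trans (sym e₀) (trans (*-congʳ u₀≈0) (zeroˡ _)))
      by (yes v₀≈0) = u 1F * v 1F ⁻¹ , *-nonzero u₁≉0 (⁻¹-nonzero v₁≉0) , λ
        { 0F → trans u₀≈0 (sym (trans (*-congˡ v₀≈0) (zeroʳ _)))
        ; 1F → sym (trans (solve 3 (λ x i y → x :* i :* y := x :* (y :* i)) refl (u 1F) (v 1F ⁻¹) (v 1F))
                 (trans (*-congˡ (*-inverseʳ v₁≉0)) (*-identityʳ _))) }
        where
        u₀≈0 : u 0F ≈ 0#
        u₀≈0 = x*x≈0⇒x≈0 (trans e₀ (trans (*-congˡ (trans (*-congʳ v₀≈0) (zeroˡ _))) (zeroʳ a)))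
        v₁≉0 : ¬ v 1F ≈ 0#
        v₁≉0 v₁≈0 = v≉0 λ { 0F → v₀≈0 ; 1F → v₁≈0 }
        u₁≉0 : ¬ u 1F ≈ 0#
        u₁≉0 u₁≈0 = u≉0 λ { 0F → u₀≈0 ; 1F → u₁≈0 }

    point-resp-over : ∀ k {v w : V n} → v ≋ w → Over k v → Over k w
    point-resp-over k v≋w v∈ i = InGF-cong k (v≋w i) (v∈ i)

    -- `D` is a frame of the subplane adapted to the conic: in its coordinates over GF(q) the
    -- equation is y² = x z.
    record Parametrised {p₁ p₂ : Level} (π : Pred (V 3) p₁) (C : Pred (V 3) p₂) : Set (c ⊔ ℓ₁ ⊔ p₁ ⊔ p₂) where
      field
        D             : Vector (V 3) 3
        D-over        : ∀ j → Over 3 (D j)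
        D-independent : Independent D
        plane         : ∀ X → π X ⇔ (Point 3 X × ∃[ t ] Point 1 t × X ∼ D · t)
        conic         : ∀ X → C X ⇔ (Point 3 X × ∃[ u ] Point 1 u × X ∼ D · veronese 2 u)

      γ : V 2 → V 3
      γ u = D · veronese 2 u

    module _ {π : Pred (V 3) p₁} {C : Pred (V 3) p₂} (A : Vector (V 3) 3) (A∈ : ∀ j → Over 3 (A j)) (A-ind : Independent A) (𝒞 : Conic 1)
             (π⇔ : ∀ X → π X ⇔ (Point 3 X × ∃[ x ] Point 1 x × X ∼ A · x))
             (C⇔ : ∀ X → C X ⇔ (Point 3 X × ∃[ x ] Point 1 x × x ∈ᶜ 𝒞 × X ∼ A · x))
             (M : Vector (V 3) 3) (M-over : ∀ j → Over 1 (M j)) (M-ind : Independent M)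
             (b : Carrier) (b≉0 : ¬ b ≈ 0#)
             (M-quad : ∀ z → quad (Conic.form 𝒞) (M · z) ≈ b * (z 1F * z 1F - z 0F * z 2F)) where

      private
        D : Vector (V 3) 3
        D j = A · M j

        preimage : ∀ {x} → Point 1 x → ∃[ t ] Point 1 t × x ≋ M · t
        preimage {x} (x∈ , x≉0) = go (independent⇒basis {M = M} M-ind x)
          where
          go : x ∈⟨ M ⟩ → ∃[ t ] Point 1 t × x ≋ M · t
          go (t , x≋Mt) = t , (over-coordinates 1 {M} M-ind M-over (point-resp-over 1 x≋Mt x∈) ,
             λ t≋0 → x≉0 (≋-trans x≋Mt (≋-trans (·-congˡ M t≋0) (·-𝟎 M)))) , x≋Mt

        on-conic : ∀ t {x} → x ≋ M · t → x ∈ᶜ 𝒞 → t 1F * t 1F ≈ t 0F * t 2F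
        on-conic t x≋Mt on = x∙y⁻¹≈ε⇒x≈y _ _ ([ (λ eq → contradiction eq b≉0) , id ]′ (noZeroDivisors
          (trans (sym (M-quad t)) (trans (quad-cong (Conic.form 𝒞) (≋-sym x≋Mt)) on))))

        to-frame : ∀ {X x t} → X ∼ A · x → x ≋ M · t → X ∼ D · t
        to-frame {t = t} X∼ x≋Mt = ∼-trans X∼ (≋⇒∼ (≋-trans (·-congˡ A x≋Mt) (≋-sym (·-∘ A M t))))

        from-frame : ∀ {X} t → X ∼ D · t → X ∼ A · (M · t)
        from-frame t X∼ = ∼-trans X∼ (≋⇒∼ (·-∘ A M t))

        M-point : ∀ {t} → Point 1 t → Point 1 (M · t)
        M-point {t} (t∈ , t≉0) = over-· 1 {M} M-over t∈ , independent-nonzero {M = M} M-ind {t} t≉0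

        plane-to : ∀ X → Point 3 X × ∃[ x ] Point 1 x × X ∼ A · x → Point 3 X × ∃[ t ] Point 1 t × X ∼ D · t
        plane-to X (X∈ , x , x∈ , X∼) = go (preimage x∈)
          where
          go : ∃[ t ] Point 1 t × x ≋ M · t → Point 3 X × ∃[ t ] Point 1 t × X ∼ D · t
          go (t , t∈ , x≋Mt) = X∈ , t , t∈ , to-frame {X} {x} {t} X∼ x≋Mt

        plane-from : ∀ X → Point 3 X × ∃[ t ] Point 1 t × X ∼ D · t → Point 3 X × ∃[ x ] Point 1 x × X ∼ A · x
        plane-from X (X∈ , t , t∈ , X∼) = X∈ , M · t , M-point t∈ , from-frame {X} t X∼

        conic-to : ∀ X → Point 3 X × ∃[ x ] Point 1 x × x ∈ᶜ 𝒞 × X ∼ A · x → Point 3 X × ∃[ u ] Point 1 u × X ∼ D · veronese 2 u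
        conic-to X (X∈ , x , x∈ , on , X∼) = go (preimage x∈)
          where
          go : ∃[ t ] Point 1 t × x ≋ M · t → Point 3 X × ∃[ u ] Point 1 u × X ∼ D · veronese 2 u
          go (t , t∈ , x≋Mt) = go′ (veronese-surjective 1 t∈ (on-conic t x≋Mt on))
            where
            go′ : ∃[ u ] Point 1 u × t ∼ veronese 2 u → Point 3 X × ∃[ u ] Point 1 u × X ∼ D · veronese 2 u
            go′ (u , u∈ , t∼) = X∈ , u , u∈ , ∼-trans (to-frame {X} {x} {t} X∼ x≋Mt) (·-∼ D t∼)

        conic-from : ∀ X → Point 3 X × ∃[ u ] Point 1 u × X ∼ D · veronese 2 u → Point 3 X × ∃[ x ] Point 1 x × x ∈ᶜ 𝒞 × X ∼ A · x
        conic-from X (X∈ , u , (u∈ , u≉0) , X∼) = X∈ , M · veronese 2 u ,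
          M-point (over-veronese 1 2 u∈ , veronese-nonzero u≉0) ,
          trans (M-quad (veronese 2 u)) (trans (*-congˡ (x≈y⇒x∙y⁻¹≈ε (veronese-conic u))) (zeroʳ b)) ,
          from-frame {X} (veronese 2 u) X∼

      change-frame : Parametrised π C
      change-frame = record
        { D = D
        ; D-over = λ j → over-· 3 {M = A} A∈ (over-1⇒ 3 (M-over j))
        ; D-independent = λ x eq → M-ind x (A-ind (M · x) (≋-trans (≋-sym (·-∘ A M x)) eq))
        ; plane = λ X → mk⇔ (plane-to X ∘ Equivalence.to (π⇔ X)) (Equivalence.from (π⇔ X) ∘ plane-from X)
        ; conic = λ X → mk⇔ (conic-to X ∘ Equivalence.to (C⇔ X)) (Equivalence.from (C⇔ X) ∘ conic-from X)
        }

    parametrise : {π : Pred (V 3) p₁} {C : Pred (V 3) p₂} → IsConicOf π C → Parametrised π C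
    parametrise {π = π} {C = C} (A , (A∈ , N , _ , _ , NA≋) , 𝒞 , π⇔ , C⇔) = go (conic-canonical-form 𝒞)
      where
      go : (Σ (Vector (V 3) 3) λ M → (∀ j → Over 1 (M j)) × Independent M ×
            Σ Carrier λ b → ¬ b ≈ 0# × (∀ z → quad (Conic.form 𝒞) (M · z) ≈ b * (z 1F * z 1F - z 0F * z 2F))) → Parametrised π C
      go (M , M-over , M-ind , b , b≉0 , M-quad) = change-frame A A∈
        (λ x eq → ≋-trans (≋-sym (NA≋ x)) (≋-trans (·-congˡ N eq) (·-𝟎 N))) 𝒞 π⇔ C⇔ M M-over M-ind b b≉0 M-quad

    -- Pulled back along D and the Veronese map the form is a binary quartic, and GF(q) has too
    -- many elements for it to vanish there.
    extension-equation : ∀ {k} (D : Vector (V 3) 3) → Independent D → (𝒞⁺ : Conic k) →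
      (∀ u → Point 1 u → D · veronese 2 u ∈ᶜ 𝒞⁺) →
      Σ Carrier λ b → ¬ b ≈ 0# × (∀ z → quad (Conic.form 𝒞⁺) (D · z) ≈ b * (z 1F * z 1F - z 0F * z 2F))
    extension-equation {k} D D-ind 𝒞⁺ on = G₁₁ , G₁₁≉0 , pulled-back
      where
      a = Conic.form 𝒞⁺
      G₀₀ = quad a (D 0F)
      G₁₁ = quad a (D 1F)
      G₂₂ = quad a (D 2F)
      G₀₁ = polar a (D 0F) (D 1F)
      G₀₂ = polar a (D 0F) (D 2F)
      G₁₂ = polar a (D 1F) (D 2F)
      quartic : V 5
      -- The form at (s², s, 1), by increasing powers of s. The coefficients of y² and x z both fall
      -- on s², which is why a multiple of y² - x z survives.
      quartic = G₂₂ ∷ G₁₂ ∷ G₁₁ + G₀₂ ∷ G₀₁ ∷ G₀₀ ∷ []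
      quartic≋0 : quartic ≋ 𝟎
      quartic≋0 = vanishing-on-GFq quartic (ℕ.≤-trans (ℕ.n≤1+n 5) 6≤q) (λ s s∈ → begin
        evalᵛ quartic s
          ≈⟨ solve 7 (λ A B C P Q R s → C :+ s :* (R :+ s :* ((B :+ Q) :+ s :* (P :+ s :* (A :+ s :* :0)))) :=
               (let x = s :^ 2 :* :1 :^ 0 ; y = s :^ 1 :* :1 :^ 1 ; z = s :^ 0 :* :1 :^ 2 in
               x :* x :* A :+ (y :* y :* B :+ z :* z :* C :+ y :* z :* R) :+ (x :* y :* P :+ x :* z :* Q))) refl G₀₀ G₁₁ G₂₂ G₀₁ G₀₂ G₁₂ s ⟩
        _   ≈⟨ quad-combination a D (veronese 2 (s ∷ 1# ∷ [])) ⟨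
        quad a (D · veronese 2 (s ∷ 1# ∷ []))   ≈⟨ on (s ∷ 1# ∷ []) ((λ { 0F → s∈ ; 1F → σ-1 1 }) , λ eq → 1≉0 (eq 1F)) ⟩
        0#                                      ∎)
      G₀₂≈ : G₀₂ ≈ - G₁₁
      G₀₂≈ = x∙y⁻¹≈ε⇒x≈y _ _ (trans (solve 2 (λ x y → y :- :- x := x :+ y) refl G₁₁ G₀₂) (quartic≋0 2F))
      pulled-back : ∀ z → quad a (D · z) ≈ G₁₁ * (z 1F * z 1F - z 0F * z 2F)
      pulled-back z = begin
        quad a (D · z)   ≈⟨ quad-combination a D z ⟩
        z 0F * z 0F * G₀₀ + (z 1F * z 1F * G₁₁ + z 2F * z 2F * G₂₂ + z 1F * z 2F * G₁₂) + (z 0F * z 1F * G₀₁ + z 0F * z 2F * G₀₂)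
          ≈⟨ +-cong (+-cong (*-congˡ (quartic≋0 (suc (suc (suc (suc zero)))))) (+-cong (+-congˡ (*-congˡ (quartic≋0 0F))) (*-congˡ (quartic≋0 1F))))
               (+-cong (*-congˡ (quartic≋0 (suc (suc (suc zero))))) (*-congˡ G₀₂≈)) ⟩
        z 0F * z 0F * 0# + (z 1F * z 1F * G₁₁ + z 2F * z 2F * 0# + z 1F * z 2F * 0#) + (z 0F * z 1F * 0# + z 0F * z 2F * - G₁₁)
          ≈⟨ solve 4 (λ x y z G → x :* x :* :0 :+ (y :* y :* G :+ z :* z :* :0 :+ y :* z :* :0) :+ (x :* y :* :0 :+ x :* z :* :- G) :=
               G :* (y :* y :- x :* z)) refl (z 0F) (z 1F) (z 2F) G₁₁ ⟩
        G₁₁ * (z 1F * z 1F - z 0F * z 2F)   ∎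
      G₁₁≉0 : ¬ G₁₁ ≈ 0#
      -- Otherwise the form vanishes on the whole plane and every point is singular.
      G₁₁≉0 eq = Conic.nondegenerate 𝒞⁺ (unit 0F) (unit-over k 0F , λ e → 1≉0 (e 0F)) (λ x _ → trans (zero-form (x ⊕ unit 0F)) (sym (zero-form x)))
        where
        zero-form : ∀ x → quad a x ≈ 0#
        zero-form x = let z , x≋Dz = independent⇒basis {M = D} D-ind x in
          trans (quad-cong a x≋Dz) (trans (pulled-back z) (trans (*-congʳ eq) (zeroˡ _)))

  open ConicParametrisation

  -- Coordinates on PG(8, q⁶) from Γ and its conjugates

  module BoseRepresentation where

    ++-all : ∀ {a p} {A : Set a} (P : A → Set p) (u : Vector A m) (v : Vector A n) →
             (∀ i → P (u i)) → (∀ j → P (v j)) → ∀ k → P ((u ++ v) k)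
    ++-all {m = m} P u v Pu Pv k with splitAt m k
    ... | inj₁ i = Pu i
    ... | inj₂ j = Pv j

    module Coordinates (ℬ : BosePlane) where

      open BosePlane ℬ public

      φ₁ φ₂ : V 3 → V 9
      φ₁ Y = (frob 1 ∘ Γ) · Y
      φ₂ Z = (frob 2 ∘ Γ) · Z

      Φ : V 3 → V 3 → V 3 → V 9
      Φ X Y Z = φ X ⊕ (φ₁ Y ⊕ φ₂ Z)

      Γ₃ : Vector (V 9) 9
      Γ₃ = Γ ++ (frob 1 ∘ Γ) ++ (frob 2 ∘ Γ)

      Γ₃-· : ∀ X Y Z → Γ₃ · (X ++ Y ++ Z) ≋ Φ X Y Z
      Γ₃-· X Y Z = ≋-trans (·-++ Γ ((frob 1 ∘ Γ) ++ (frob 2 ∘ Γ)) X (Y ++ Z)) (⊕-cong (≋-refl {v = φ X}) (·-++ (frob 1 ∘ Γ) (frob 2 ∘ Γ) Y Z))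

      Γ₃-independent : Independent Γ₃
      Γ₃-independent = spanning⇒basis {M = Γ₃} spanning

      Φ-surjective : ∀ y → Σ (V 3) λ X → Σ (V 3) λ Y → Σ (V 3) λ Z → y ≋ Φ X Y Z
      Φ-surjective y = go (spanning y)
        where
        go : y ∈⟨ Γ₃ ⟩ → Σ (V 3) λ X → Σ (V 3) λ Y → Σ (V 3) λ Z → y ≋ Φ X Y Z
        go (x , eq) = X , Y , Z , ≋-trans eq (≋-trans (·-congˡ Γ₃ (≋-trans (take-drop 3 x) (++-cong (≋-refl {v = X}) (take-drop 3 (drop 3 x))))) (Γ₃-· X Y Z))
          where
          X Y Z : V 3
          X = take 3 x
          Y = take 3 (drop 3 x)
          Z = drop 3 (drop 3 x)

      Φ-⊕ : ∀ X Y Z X′ Y′ Z′ → Φ (X ⊕ X′) (Y ⊕ Y′) (Z ⊕ Z′) ≋ Φ X Y Z ⊕ Φ X′ Y′ Z′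
      Φ-⊕ X Y Z X′ Y′ Z′ i = trans (+-cong (·-⊕ Γ X X′ i) (+-cong (·-⊕ (frob 1 ∘ Γ) Y Y′ i) (·-⊕ (frob 2 ∘ Γ) Z Z′ i)))
        (solve 6 (λ a a′ b b′ c c′ → (a :+ a′) :+ ((b :+ b′) :+ (c :+ c′)) := (a :+ (b :+ c)) :+ (a′ :+ (b′ :+ c′))) refl _ _ _ _ _ _)

      Φ-⊛ : ∀ a X Y Z → Φ (a ⊛ X) (a ⊛ Y) (a ⊛ Z) ≋ a ⊛ Φ X Y Z
      Φ-⊛ a X Y Z i = trans (+-cong (·-⊛ Γ a X i) (+-cong (·-⊛ (frob 1 ∘ Γ) a Y i) (·-⊛ (frob 2 ∘ Γ) a Z i)))
        (solve 4 (λ a x y z → a :* x :+ (a :* y :+ a :* z) := a :* (x :+ (y :+ z))) refl a _ _ _)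

      Φ-cong : ∀ {X Y Z X′ Y′ Z′} → X ≋ X′ → Y ≋ Y′ → Z ≋ Z′ → Φ X Y Z ≋ Φ X′ Y′ Z′
      Φ-cong p r s = ⊕-cong (·-congˡ Γ p) (⊕-cong (·-congˡ (frob 1 ∘ Γ) r) (·-congˡ (frob 2 ∘ Γ) s))

      Φ-injective : ∀ {X Y Z X′ Y′ Z′} → Φ X Y Z ≋ Φ X′ Y′ Z′ → X ≋ X′ × Y ≋ Y′ × Z ≋ Z′
      Φ-injective {X} {Y} {Z} {X′} {Y′} {Z′} eq = by-≋ X X′ first , by-≋ Y Y′ second , by-≋ Z Z′ third
        where
        _⊖_ : V n → V n → V n
        v ⊖ w = v ⊕ (-ᵛ w)
        by-≋ : ∀ (v w : V n) → (v ⊖ w) ≋ 𝟎 → v ≋ w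
        by-≋ v w p i = x∙y⁻¹≈ε⇒x≈y _ _ (trans (solve 2 (λ a b → a :- b := a :+ :- :1 :* b) refl (v i) (w i)) (p i))
        Φ≋0 : Φ (X ⊖ X′) (Y ⊖ Y′) (Z ⊖ Z′) ≋ 𝟎
        Φ≋0 i = begin
          Φ (X ⊖ X′) (Y ⊖ Y′) (Z ⊖ Z′) i                          ≈⟨ Φ-⊕ X Y Z (-ᵛ X′) (-ᵛ Y′) (-ᵛ Z′) i ⟩
          Φ X Y Z i + Φ (-ᵛ X′) (-ᵛ Y′) (-ᵛ Z′) i                 ≈⟨ +-cong (eq i) (Φ-⊛ (- 1#) X′ Y′ Z′ i) ⟩
          Φ X′ Y′ Z′ i + - 1# * Φ X′ Y′ Z′ i                      ≈⟨ solve 1 (λ a → a :+ :- :1 :* a := :0) refl _ ⟩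
          0#                                                      ∎
        all = Γ₃-independent ((X ⊖ X′) ++ (Y ⊖ Y′) ++ (Z ⊖ Z′)) (≋-trans (Γ₃-· (X ⊖ X′) (Y ⊖ Y′) (Z ⊖ Z′)) Φ≋0)
        first : (X ⊖ X′) ≋ 𝟎
        first = proj₁ (++-≋𝟎 (X ⊖ X′) ((Y ⊖ Y′) ++ (Z ⊖ Z′)) all)
        rest = proj₂ (++-≋𝟎 (X ⊖ X′) ((Y ⊖ Y′) ++ (Z ⊖ Z′)) all)
        second : (Y ⊖ Y′) ≋ 𝟎
        second = proj₁ (++-≋𝟎 (Y ⊖ Y′) (Z ⊖ Z′) rest)
        third : (Z ⊖ Z′) ≋ 𝟎
        third = proj₂ (++-≋𝟎 (Y ⊖ Y′) (Z ⊖ Z′) rest)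

      Φ-𝟎 : Φ 𝟎 𝟎 𝟎 ≋ 𝟎
      Φ-𝟎 i = trans (+-cong (·-𝟎 Γ i) (trans (+-cong (·-𝟎 (frob 1 ∘ Γ) i) (·-𝟎 (frob 2 ∘ Γ) i)) (+-identityʳ 0#))) (+-identityʳ 0#)

      frob1-φ : ∀ X → frob 1 (φ X) ≋ φ₁ (frob 1 X)
      frob1-φ X = frob-· 1 Γ X

      frob1-φ₁ : ∀ Y → frob 1 (φ₁ Y) ≋ φ₂ (frob 1 Y)
      frob1-φ₁ Y = ≋-trans (frob-· 1 (frob 1 ∘ Γ) Y) (·-congʳ (frob 1 Y) (λ j → frob-∘ 1 1 (Γ j)))

      frob1-φ₂ : ∀ Z → frob 1 (φ₂ Z) ≋ φ (frob 1 Z)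
      frob1-φ₂ Z = ≋-trans (frob-· 1 (frob 2 ∘ Γ) Z) (·-congʳ (frob 1 Z) (λ j → ≋-trans (frob-∘ 1 2 (Γ j)) (Flat.over Γ-flat j)))

      frob2-φ : ∀ X → frob 2 (φ X) ≋ φ₂ (frob 2 X)
      frob2-φ X = frob-· 2 Γ X

      frob3-φ : ∀ X → frob 3 (φ X) ≋ φ (frob 3 X)
      frob3-φ X = ≋-trans (frob-· 3 Γ X) (·-congʳ (frob 3 X) (Flat.over Γ-flat))

      -- Frobenius permutes Γ and its conjugates cyclically, the third step closing up because the
      -- basis of Γ is over GF(q³); so the three blocks rotate.
      frob-Φ : ∀ X Y Z → frob 1 (Φ X Y Z) ≋ Φ (frob 1 Z) (frob 1 X) (frob 1 Y)
      frob-Φ X Y Z i = begin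
        frob 1 (Φ X Y Z) i     ≈⟨ trans (σ-+ 1 (φ X i) _) (+-congˡ (σ-+ 1 (φ₁ Y i) (φ₂ Z i))) ⟩
        frob 1 (φ X) i + (frob 1 (φ₁ Y) i + frob 1 (φ₂ Z) i)   ≈⟨ +-cong (frob1-φ X i) (+-cong (frob1-φ₁ Y i) (frob1-φ₂ Z i)) ⟩
        φ₁ (frob 1 X) i + (φ₂ (frob 1 Y) i + φ (frob 1 Z) i)
          ≈⟨ solve 3 (λ a b c → a :+ (b :+ c) := c :+ (a :+ b)) refl (φ₁ (frob 1 X) i) (φ₂ (frob 1 Y) i) (φ (frob 1 Z) i) ⟩
        Φ (frob 1 Z) (frob 1 X) (frob 1 Y) i                   ∎

      trace : V 3 → V 9
      trace X = Φ X (frob 1 X) (frob 2 X)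

      trace-over : ∀ {X} → Over 3 X → Over 1 (trace X)
      trace-over {X} X∈ = ≋-trans (frob-Φ X (frob 1 X) (frob 2 X))
        (Φ-cong (≋-trans (frob-∘ 1 2 X) X∈) (≋-refl {v = frob 1 X}) (frob-∘ 1 1 X))

      -- A vector fixed by the rotation of the blocks is determined by the first one: points over
      -- GF(q) are traces of vectors over GF(q³).
      over⇒trace : ∀ {X Y Z} → Over 1 (Φ X Y Z) → Over 3 X × Y ≋ frob 1 X × Z ≋ frob 2 X
      over⇒trace {X} {Y} {Z} y∈ = ≋-trans (≋-sym (frob-∘ 1 2 X)) (≋-trans (frob-cong 1 (≋-sym Z≋)) X≋) , Y≋ , Z≋
        where
        eqs = Φ-injective (≋-trans (≋-sym (frob-Φ X Y Z)) y∈)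
        X≋ : frob 1 Z ≋ X
        X≋ = proj₁ eqs
        Y≋ : Y ≋ frob 1 X
        Y≋ = ≋-sym (proj₁ (proj₂ eqs))
        Z≋ : Z ≋ frob 2 X
        Z≋ = ≋-trans (≋-sym (proj₂ (proj₂ eqs))) (≋-trans (frob-cong 1 Y≋) (frob-∘ 1 1 X))

      trace-⊛ : ∀ a X i → trace (a ⊛ X) i ≈ a * φ X i + (σ 1 a * φ₁ (frob 1 X) i + σ 2 a * φ₂ (frob 2 X) i)
      trace-⊛ a X i = +-cong (·-⊛ Γ a X i) (+-cong (trans (·-congˡ (frob 1 ∘ Γ) (frob-⊛ 1 a X) i) (·-⊛ (frob 1 ∘ Γ) (σ 1 a) (frob 1 X) i))
        (trans (·-congˡ (frob 2 ∘ Γ) (frob-⊛ 2 a X) i) (·-⊛ (frob 2 ∘ Γ) (σ 2 a) (frob 2 X) i)))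

      module AtInfinity (ℓ∞ : Flat 3 2 1) where

        L : Vector (V 3) 2
        L = Flat.basis ℓ∞

        Σ∞ : Vector (V 9) 6
        Σ∞ = atInfinity ℬ ℓ∞

        private
          g : Vector (V 9) 2
          g = φ ∘ L

          frob-g : ∀ k (x : V 2) → (frob k ∘ g) · x ≋ (frob k ∘ Γ) · ((frob k ∘ L) · x)
          frob-g k x = ≋-trans (·-congʳ x (λ j → frob-· k Γ (L j))) (·-∘ (frob k ∘ Γ) (frob k ∘ L) x)

        Σ∞-· : ∀ x y z → Σ∞ · (x ++ y ++ z) ≋ Φ (L · x) ((frob 1 ∘ L) · y) ((frob 2 ∘ L) · z)
        Σ∞-· x y z = ≋-trans (·-++ g ((frob 1 ∘ g) ++ (frob 2 ∘ g)) x (y ++ z))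
          (⊕-cong (·-∘ Γ L x) (≋-trans (·-++ (frob 1 ∘ g) (frob 2 ∘ g) y z) (⊕-cong (frob-g 1 y) (frob-g 2 z))))

        ∈Σ∞ : ∀ {X Y Z} → X ∈⟨ L ⟩ → Y ∈⟨ frob 1 ∘ L ⟩ → Z ∈⟨ frob 2 ∘ L ⟩ → Φ X Y Z ∈⟨ Σ∞ ⟩
        ∈Σ∞ (x , p) (y , r) (z , s) = x ++ y ++ z , ≋-trans (Φ-cong p r s) (≋-sym (Σ∞-· x y z))

        Σ∞-split : (w : V 6) → Σ∞ · w ≋ Φ (L · take 2 w) ((frob 1 ∘ L) · take 2 (drop 2 w)) ((frob 2 ∘ L) · drop 2 (drop 2 w))
        Σ∞-split w = ≋-trans (·-congˡ Σ∞ (≋-trans (take-drop 2 w) (++-cong (≋-refl {v = take 2 w}) (take-drop 2 (drop 2 w)))))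
          (Σ∞-· (take 2 w) (take 2 (drop 2 w)) (drop 2 (drop 2 w)))

        Σ∞∋ : ∀ {X Y Z} → Φ X Y Z ∈⟨ Σ∞ ⟩ → X ∈⟨ L ⟩ × Y ∈⟨ frob 1 ∘ L ⟩ × Z ∈⟨ frob 2 ∘ L ⟩
        Σ∞∋ {X} {Y} {Z} (w , eq) = (take 2 w , proj₁ eqs) , (take 2 (drop 2 w) , proj₁ (proj₂ eqs)) , (drop 2 (drop 2 w) , proj₂ (proj₂ eqs))
          where eqs = Φ-injective (≋-trans eq (Σ∞-split w))

        frob-∈⟨L⟩ : ∀ k {X} → X ∈⟨ L ⟩ → frob k X ∈⟨ frob k ∘ L ⟩
        frob-∈⟨L⟩ k (x , eq) = frob k x , ≋-trans (frob-cong k eq) (frob-· k L x)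

        trace∈Σ∞ : ∀ {X} → X ∈⟨ L ⟩ → trace X ∈⟨ Σ∞ ⟩
        trace∈Σ∞ X∈ = ∈Σ∞ X∈ (frob-∈⟨L⟩ 1 X∈) (frob-∈⟨L⟩ 2 X∈)

  open BoseRepresentation

  -- The 6-space as a section by conjugate linear forms

  module BruckBose where

    record Configuration : Set (c ⊔ ℓ₁) where
      field
        ℬ         : BosePlane
        ℓ∞        : Flat 3 2 1
        Σ₆        : Flat 1 8 6
        bruckBose : IsBruckBose ℬ ℓ∞ Σ₆

    module Section (𝒞 : Configuration) where

      open Configuration 𝒞
      open Coordinates ℬ
      open AtInfinity ℓ∞

      S : Vector (V 9) 7
      S = Flat.basis Σ₆

      frob-∈⟨S⟩ : ∀ {y} → y ∈⟨ S ⟩ → frob 1 y ∈⟨ S ⟩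
      frob-∈⟨S⟩ (x , eq) = frob 1 x , ≋-trans (frob-cong 1 eq) (≋-trans (frob-· 1 S x) (·-congʳ (frob 1 x) (Flat.over Σ₆)))

      trace∈S : ∀ {X} → Over 3 X → X ∈⟨ L ⟩ → trace X ∈⟨ S ⟩
      trace∈S {X} X∈ X∈L = by (≋𝟎? (trace X))
        where
        by : Dec (trace X ≋ 𝟎) → trace X ∈⟨ S ⟩
        by (yes eq) = ∈⟨⟩-resp {M = S} (≋-sym eq) (∈⟨⟩-𝟎 {M = S})
        by (no neq) = IsBruckBose.contains bruckBose (trace X) (trace-over X∈ , neq) (trace∈Σ∞ X∈L)

      -- For α of degree 3 over GF(q), the point X is a combination of the traces of
      -- X, α X and α² X, by inversion of a Vandermonde matrix.
      module _ (α : Carrier) (α∈ : InGF 3 α) (α∉ : ¬ InGF 1 α) where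

        private
          β δ : Carrier
          β = σ 1 α
          δ = σ 2 α

          α-β≉0 : ¬ α - β ≈ 0#
          α-β≉0 eq = α∉ (sym (x∙y⁻¹≈ε⇒x≈y _ _ eq))

          α-δ≉0 : ¬ α - δ ≈ 0#
          α-δ≉0 eq = α∉ (trans (σ-cong 1 (x∙y⁻¹≈ε⇒x≈y _ _ eq)) (trans (σ-∘ 1 2 α) α∈))

          κ : Carrier
          κ = (α - β) * (α - δ)

          -- The coefficients are those of (x - β)(x - δ), which vanishes at the conjugates of α and
          -- has the value κ at α.
          combination : ∀ X → (trace (α ⊛ (α ⊛ X)) ⊕ ((- (β + δ)) ⊛ trace (α ⊛ X))) ⊕ ((β * δ) ⊛ trace X) ≋ κ ⊛ φ X
          combination X i = begin
            trace (α ⊛ (α ⊛ X)) i + - (β + δ) * trace (α ⊛ X) i + β * δ * trace X i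
              ≈⟨ +-congʳ (+-cong squares (*-congˡ (trace-⊛ α X i))) ⟩
            (α * (α * a) + (β * (β * b) + δ * (δ * d))) + - (β + δ) * (α * a + (β * b + δ * d)) + β * δ * (a + (b + d))
              ≈⟨ solve 6 (λ α β δ a b d → (α :* (α :* a) :+ (β :* (β :* b) :+ δ :* (δ :* d))) :+ :- (β :+ δ) :* (α :* a :+ (β :* b :+ δ :* d))
                   :+ β :* δ :* (a :+ (b :+ d)) := (α :- β) :* (α :- δ) :* a) refl α β δ a b d ⟩
            κ * a   ∎
            where
            a = φ X i
            b = φ₁ (frob 1 X) i
            d = φ₂ (frob 2 X) i
            squares : trace (α ⊛ (α ⊛ X)) i ≈ α * (α * a) + (β * (β * b) + δ * (δ * d))
            squares = trans (trace-⊛ α (α ⊛ X) i) (+-cong (*-congˡ (·-⊛ Γ α X i))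
              (+-cong (*-congˡ (trans (·-congˡ (frob 1 ∘ Γ) (frob-⊛ 1 α X) i) (·-⊛ (frob 1 ∘ Γ) β (frob 1 X) i)))
                      (*-congˡ (trans (·-congˡ (frob 2 ∘ Γ) (frob-⊛ 2 α X) i) (·-⊛ (frob 2 ∘ Γ) δ (frob 2 X) i)))))

        φ∈S : ∀ {X} → Over 3 X → X ∈⟨ L ⟩ → φ X ∈⟨ S ⟩
        φ∈S {X} X∈ X∈L = ∈⟨⟩-resp {M = S} (λ i → ⁻¹-cancel (*-nonzero α-β≉0 α-δ≉0)) (∈⟨⟩-⊛ {M = S} (κ ⁻¹) (∈⟨⟩-resp {M = S} (combination X)
          (∈⟨⟩-⊕ {M = S} (∈⟨⟩-⊕ {M = S} (trace∈S (over-⊛ 3 α∈ (over-⊛ 3 α∈ X∈)) (∈⟨⟩-⊛ {M = L} α (∈⟨⟩-⊛ {M = L} α X∈L)))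
            (∈⟨⟩-⊛ {M = S} (- (β + δ)) (trace∈S (over-⊛ 3 α∈ X∈) (∈⟨⟩-⊛ {M = L} α X∈L))))
            (∈⟨⟩-⊛ {M = S} (β * δ) (trace∈S X∈ X∈L)))))

      -- `contains` speaks of points over GF(q) only. The vectors spanning g are reached through
      -- traces, and their conjugates follow because S has a basis over GF(q).
      Σ∞⊆S : ∀ j → Σ∞ j ∈⟨ S ⟩
      Σ∞⊆S = ++-all (_∈⟨ S ⟩) (φ ∘ L) ((frob 1 ∘ φ ∘ L) ++ (frob 2 ∘ φ ∘ L)) first
        (++-all (_∈⟨ S ⟩) (frob 1 ∘ φ ∘ L) (frob 2 ∘ φ ∘ L) (frob-∈⟨S⟩ ∘ first)
          (λ i → ∈⟨⟩-resp {M = S} (frob-∘ 1 1 (φ (L i))) (frob-∈⟨S⟩ (frob-∈⟨S⟩ (first i)))))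
        where
        first : ∀ i → φ (L i) ∈⟨ S ⟩
        first i = φ∈S (proj₁ primitive-element) (proj₁ (proj₂ primitive-element)) (proj₂ (proj₂ primitive-element))
          (Flat.over ℓ∞ i) (∈⟨⟩-basis L i)

      record SectionForm : Set (c ⊔ ℓ₁) where
        field
          form     : V 3
          over     : Over 3 form
          nonzero  : ¬ form ≋ 𝟎
          line     : ∀ X → X ∈⟨ L ⟩ ⇔ dot form X ≈ 0#
          infinity : ∀ X Y Z → Φ X Y Z ∈⟨ Σ∞ ⟩ ⇔ (dot form X ≈ 0# × dot (frob 1 form) Y ≈ 0# × dot (frob 2 form) Z ≈ 0#)
          affine   : ∀ X Y Z → Φ X Y Z ∈⟨ S ⟩ ⇔ (dot form X ≈ dot (frob 1 form) Y × dot (frob 1 form) Y ≈ dot (frob 2 form) Z)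

      -- A basis of Σ₆ not lying in Σ∞ has a member trace E; then Σ₆ is the set of Φ X Y Z on
      -- which the coordinate with respect to E, and its conjugates, agree.
      module _ (E : V 3) (E∈ : Over 3 E) (E∉ : ¬ E ∈⟨ L ⟩) (traceE∈S : trace E ∈⟨ S ⟩) where

        private
          M : Vector (V 3) 3
          M = E ∷ L

          M-independent : Independent M
          M-independent x eq = λ { 0F → x₀≈0 ; (suc i) → Flat.independent ℓ∞ (x ∘ suc) Lx≋0 i }
            where
            x₀≈0 : x 0F ≈ 0#
            x₀≈0 = by (x 0F ≈? 0#)
              where
              by : Dec (x 0F ≈ 0#) → x 0F ≈ 0#
              by (yes p) = p
              by (no p)  = contradiction (∈⟨⟩-resp {M = L} (λ i → trans (*-congˡ (isolate i)) (⁻¹-cancel p))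
                (∈⟨⟩-⊛ {M = L} (x 0F ⁻¹) (∈⟨⟩-⊛ {M = L} (- 1#) (x ∘ suc , ≋-refl {v = L · (x ∘ suc)})))) E∉
                where
                isolate : ∀ i → - 1# * (L · (x ∘ suc)) i ≈ x 0F * E i
                isolate i = sym (x∙y⁻¹≈ε⇒x≈y _ _ (trans (solve 2 (λ a b → a :- :- :1 :* b := a :+ b) refl _ _) (eq i)))
            Lx≋0 : L · (x ∘ suc) ≋ 𝟎
            Lx≋0 i = trans (sym (+-identityˡ _)) (trans (+-congʳ (sym (trans (*-congʳ x₀≈0) (zeroˡ (E i))))) (eq i))

          dual = inverse-matrix M M-independent

        module _ (N : Vector (V 3) 3) (MN : ∀ x → M · (N · x) ≋ x) (NM : ∀ x → N · (M · x) ≋ x) where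

          private
            -- The member dual to E of the basis `E ∷ L`: its value at X is the coordinate of X
            -- along E.
            ℓ : V 3
            ℓ i = N i 0F

            ℓ-· : ∀ X → dot ℓ X ≈ (N · X) 0F
            ℓ-· X = sum-cong-≋ (λ i → *-comm (N i 0F) (X i))

            ℓ-M : ∀ x → dot ℓ (M · x) ≈ x 0F
            ℓ-M x = trans (ℓ-· (M · x)) (NM x 0F)

            ℓ-L : ∀ {X} → X ∈⟨ L ⟩ → dot ℓ X ≈ 0#
            ℓ-L (x , eq) = trans (dot-cong {h = ℓ} ≋-refl (λ i → trans (eq i) (trans (sym (+-identityˡ _)) (+-congʳ (sym (zeroˡ (E i))))))) (ℓ-M (0# ∷ x))

            L-ℓ : ∀ {X} → dot ℓ X ≈ 0# → X ∈⟨ L ⟩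
            L-ℓ {X} eq = (N · X) ∘ suc , λ i → trans (sym (MN X i)) (trans (+-congʳ (trans (*-congʳ (trans (sym (ℓ-· X)) eq)) (zeroˡ (E i)))) (+-identityˡ _))

            ℓ-E : dot ℓ E ≈ 1#
            ℓ-E = trans (dot-cong {h = ℓ} ≋-refl (≋-sym (·-unit M 0F))) (ℓ-M (unit 0F))

            ℓ∈ : Over 3 ℓ
            ℓ∈ i = over-coordinates 3 {M} M-independent (λ { 0F → E∈ ; (suc j) → Flat.over ℓ∞ j }) {N i}
              (point-resp-over 3 (≋-trans (≋-sym (MN (unit i))) (·-congˡ M (·-unit N i))) (unit-over 3 i)) 0F

            -- Frobenius is invertible on K, so every vector is a conjugate of another, and the
            -- facts about ℓ carry over to the conjugate line.
            module Conjugate (k : ℕ) (k≤6 : k ℕ.≤ 6) where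

              ℓₖ : V 3
              ℓₖ = frob k ℓ

              back : ∀ {n} (Y : V n) → frob k (frob (6 ℕ.∸ k) Y) ≋ Y
              back Y = ≋-trans (frob-∘ k (6 ℕ.∸ k) Y) (λ i → trans (^-congʳ (Y i) (≡.cong (q ℕ.^_) (ℕ.m∸n+n≡m k≤6))) (σ-6 (Y i)))

              to : ∀ {Y} → Y ∈⟨ frob k ∘ L ⟩ → dot ℓₖ Y ≈ 0#
              to {Y} (y , eq) = begin
                dot ℓₖ Y                        ≈⟨ dot-cong {h = ℓₖ} ≋-refl (≋-sym Y≋) ⟩
                dot ℓₖ (frob k (L · y′))        ≈⟨ frob-dot k ℓ (L · y′) ⟨
                σ k (dot ℓ (L · y′))            ≈⟨ σ-cong k (ℓ-L (y′ , ≋-refl {v = L · y′})) ⟩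
                σ k 0#                          ≈⟨ σ-0 k ⟩
                0#                              ∎
                where
                y′ = frob (6 ℕ.∸ k) y
                Y≋ : frob k (L · y′) ≋ Y
                Y≋ = ≋-trans (frob-· k L y′) (≋-trans (·-congˡ (frob k ∘ L) (back y)) (≋-sym eq))

              from : ∀ {Y} → dot ℓₖ Y ≈ 0# → Y ∈⟨ frob k ∘ L ⟩
              from {Y} eq = ∈⟨⟩-resp {M = frob k ∘ L} (back Y) (frob-∈⟨L⟩ k (L-ℓ (σ-injective k k≤6 (begin
                σ k (dot ℓ Y′)              ≈⟨ frob-dot k ℓ Y′ ⟩
                dot ℓₖ (frob k Y′)          ≈⟨ dot-cong {h = ℓₖ} ≋-refl (back Y) ⟩
                dot ℓₖ Y                    ≈⟨ eq ⟩
                0#                          ≈⟨ σ-0 k ⟨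
                σ k 0#                      ∎))))
                where Y′ = frob (6 ℕ.∸ k) Y

              unit-value : dot ℓₖ (frob k E) ≈ 1#
              unit-value = trans (sym (frob-dot k ℓ E)) (trans (σ-cong k ℓ-E) (σ-1 k))

            module C₁ = Conjugate 1 (ℕ.s≤s ℕ.z≤n)
            module C₂ = Conjugate 2 (ℕ.s≤s (ℕ.s≤s ℕ.z≤n))

            value : ∀ {k : V 3} {X Y : V 3} d → dot k X ≈ 0# → dot k Y ≈ 1# → dot k (X ⊕ (d ⊛ Y)) ≈ d
            value {k} {X} {Y} d p r = trans (dot-⊕ k X (d ⊛ Y)) (trans (+-cong p (trans (dot-⊛ k d Y) (*-congˡ r))) (trans (+-identityˡ _) (*-identityʳ d)))

            subtract : ∀ {k : V 3} {X Y : V 3} d → dot k X ≈ d → dot k Y ≈ 1# → dot k (X ⊕ ((- d) ⊛ Y)) ≈ 0#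
            subtract {k} {X} {Y} d p r = trans (dot-⊕ k X ((- d) ⊛ Y)) (trans (+-cong p (trans (dot-⊛ k (- d) Y) (trans (*-congˡ r) (*-identityʳ _)))) (-‿inverseʳ d))

            W : Vector (V 9) 7
            W = trace E ∷ Σ∞

            W-split : ∀ w → W · w ≋ Φ ((L · take 2 (w ∘ suc)) ⊕ (w 0F ⊛ E)) (((frob 1 ∘ L) · take 2 (drop 2 (w ∘ suc))) ⊕ (w 0F ⊛ frob 1 E))
                                      (((frob 2 ∘ L) · drop 2 (drop 2 (w ∘ suc))) ⊕ (w 0F ⊛ frob 2 E))
            W-split w i = trans (+-comm _ _) (trans (+-cong (Σ∞-split (w ∘ suc) i) (sym (Φ-⊛ (w 0F) E (frob 1 E) (frob 2 E) i)))
              (sym (Φ-⊕ (L · take 2 (w ∘ suc)) ((frob 1 ∘ L) · take 2 (drop 2 (w ∘ suc))) ((frob 2 ∘ L) · drop 2 (drop 2 (w ∘ suc))) (w 0F ⊛ E) (w 0F ⊛ frob 1 E) (w 0F ⊛ frob 2 E) i)))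

            values : ∀ {X Y Z} w → Φ X Y Z ≋ W · w → dot ℓ X ≈ w 0F × dot C₁.ℓₖ Y ≈ w 0F × dot C₂.ℓₖ Z ≈ w 0F
            values {X} {Y} {Z} w eq = go (Φ-injective (≋-trans eq (W-split w)))
              where
              X′ Y′ Z′ : V 3
              X′ = L · take 2 (w ∘ suc)
              Y′ = (frob 1 ∘ L) · take 2 (drop 2 (w ∘ suc))
              Z′ = (frob 2 ∘ L) · drop 2 (drop 2 (w ∘ suc))
              go : X ≋ X′ ⊕ (w 0F ⊛ E) × Y ≋ Y′ ⊕ (w 0F ⊛ frob 1 E) × Z ≋ Z′ ⊕ (w 0F ⊛ frob 2 E) →
                   dot ℓ X ≈ w 0F × dot C₁.ℓₖ Y ≈ w 0F × dot C₂.ℓₖ Z ≈ w 0F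
              go (p , r , s) =
                trans (dot-cong {h = ℓ} ≋-refl p) (value {ℓ} {X′} {E} (w 0F) (ℓ-L {X′} (take 2 (w ∘ suc) , ≋-refl {v = X′})) ℓ-E) ,
                trans (dot-cong {h = C₁.ℓₖ} ≋-refl r) (value {C₁.ℓₖ} {Y′} {frob 1 E} (w 0F) (C₁.to {Y′} (take 2 (drop 2 (w ∘ suc)) , ≋-refl {v = Y′})) C₁.unit-value) ,
                trans (dot-cong {h = C₂.ℓₖ} ≋-refl s) (value {C₂.ℓₖ} {Z′} {frob 2 E} (w 0F) (C₂.to {Z′} (drop 2 (drop 2 (w ∘ suc)) , ≋-refl {v = Z′})) C₂.unit-value)

            Σ∞-independent : Independent Σ∞
            Σ∞-independent w eq = ≋-trans (take-drop 2 w) (≋-trans (++-cong (Flat.independent ℓ∞ (take 2 w) (proj₁ eqs)) (≋-trans (take-drop 2 (drop 2 w))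
                (++-cong (frob-independent 1 {L} (ℕ.s≤s ℕ.z≤n) (Flat.independent ℓ∞) (take 2 (drop 2 w)) (proj₁ (proj₂ eqs)))
                         (frob-independent 2 {L} (ℕ.s≤s (ℕ.s≤s ℕ.z≤n)) (Flat.independent ℓ∞) (drop 2 (drop 2 w)) (proj₂ (proj₂ eqs))))))
                (≋-sym (≋-trans (take-drop 2 (𝟎 {6})) (++-cong (≋-refl {v = 𝟎 {2}}) (take-drop 2 (𝟎 {4}))))))
              where eqs = Φ-injective (≋-trans (≋-sym (Σ∞-split w)) (≋-trans eq (≋-sym Φ-𝟎)))

            W-independent : Independent W
            W-independent w eq = λ { 0F → w₀≈0 ; (suc i) → Σ∞-independent (w ∘ suc) rest i }
              where
              w₀≈0 : w 0F ≈ 0#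
              w₀≈0 = trans (sym (proj₁ (values {𝟎} {𝟎} {𝟎} w (≋-trans Φ-𝟎 (≋-sym eq))))) (dot-𝟎 ℓ)
              rest : Σ∞ · (w ∘ suc) ≋ 𝟎
              rest i = trans (sym (+-identityˡ _)) (trans (+-congʳ (sym (trans (*-congʳ w₀≈0) (zeroˡ (trace E i))))) (eq i))

            -- `W` consists of seven independent vectors in the span of the seven vectors of S, so
            -- the spans agree.
            S⊆W : ∀ {y} → y ∈⟨ S ⟩ → y ∈⟨ W ⟩
            S⊆W = independent⇒spanning {vs = W} {ws = S} W-independent (λ { 0F → traceE∈S ; (suc j) → Σ∞⊆S j })

            -- Subtracting the common value times `trace E` leaves a vector on which all three forms
            -- vanish, hence one in the span of Σ∞.
            from-values : ∀ X Y Z → dot ℓ X ≈ dot C₁.ℓₖ Y → dot C₁.ℓₖ Y ≈ dot C₂.ℓₖ Z → Φ X Y Z ∈⟨ S ⟩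
            from-values X Y Z p r = ∈⟨⟩-resp {M = S} recombine (∈⟨⟩-⊕ {M = S} {Φ X′ Y′ Z′} {d ⊛ trace E} (∈⟨⟩-trans {vs = Σ∞} {ws = S} Σ∞⊆S
                (∈Σ∞ {X′} {Y′} {Z′} (L-ℓ {X′} (subtract {ℓ} {X} {E} d refl ℓ-E)) (C₁.from {Y′} (subtract {C₁.ℓₖ} {Y} {frob 1 E} d (sym p) C₁.unit-value))
                  (C₂.from {Z′} (subtract {C₂.ℓₖ} {Z} {frob 2 E} d (sym (trans p r)) C₂.unit-value)))) (∈⟨⟩-⊛ {M = S} d traceE∈S))
              where
              d = dot ℓ X
              X′ Y′ Z′ : V 3
              X′ = X ⊕ ((- d) ⊛ E)
              Y′ = Y ⊕ ((- d) ⊛ frob 1 E)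
              Z′ = Z ⊕ ((- d) ⊛ frob 2 E)
              recombine : Φ X′ Y′ Z′ ⊕ (d ⊛ trace E) ≋ Φ X Y Z
              recombine i = trans (+-congʳ (trans (Φ-⊕ X Y Z ((- d) ⊛ E) ((- d) ⊛ frob 1 E) ((- d) ⊛ frob 2 E) i) (+-congˡ (Φ-⊛ (- d) E (frob 1 E) (frob 2 E) i))))
                (solve 3 (λ y d t → y :+ :- d :* t :+ d :* t := y) refl (Φ X Y Z i) d (trace E i))

          section-form-with : SectionForm
          section-form-with = record
            { form     = ℓ
            ; over     = ℓ∈
            ; nonzero  = λ eq → 1≉0 (trans (sym ℓ-E) (trans (sum-cong-≋ (λ i → trans (*-congʳ (eq i)) (zeroˡ (E i)))) (sum-replicate-zero 3)))
            ; line     = λ X → mk⇔ (ℓ-L {X}) (L-ℓ {X})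
            ; infinity = λ X Y Z → mk⇔
                (λ y∈ → ℓ-L {X} (proj₁ (Σ∞∋ {X} {Y} {Z} y∈)) , C₁.to {Y} (proj₁ (proj₂ (Σ∞∋ {X} {Y} {Z} y∈))) ,
                        C₂.to {Z} (proj₂ (proj₂ (Σ∞∋ {X} {Y} {Z} y∈))))
                (λ (p , r , s) → ∈Σ∞ {X} {Y} {Z} (L-ℓ {X} p) (C₁.from {Y} r) (C₂.from {Z} s))
            ; affine   = λ X Y Z → mk⇔ (to X Y Z) (λ (p , r) → from-values X Y Z p r)
            }
            where
            to : ∀ X Y Z → Φ X Y Z ∈⟨ S ⟩ → dot ℓ X ≈ dot C₁.ℓₖ Y × dot C₁.ℓₖ Y ≈ dot C₂.ℓₖ Z
            to X Y Z y∈ = go (S⊆W y∈)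
              where
              go : Φ X Y Z ∈⟨ W ⟩ → dot ℓ X ≈ dot C₁.ℓₖ Y × dot C₁.ℓₖ Y ≈ dot C₂.ℓₖ Z
              go (w , eq) = go′ (values {X} {Y} {Z} w eq)
                where
                go′ : dot ℓ X ≈ w 0F × dot C₁.ℓₖ Y ≈ w 0F × dot C₂.ℓₖ Z ≈ w 0F → dot ℓ X ≈ dot C₁.ℓₖ Y × dot C₁.ℓₖ Y ≈ dot C₂.ℓₖ Z
                go′ (p , r , s) = trans p (sym r) , trans r (sym s)

        section-form-from : SectionForm
        section-form-from = section-form-with (proj₁ dual) (proj₁ (proj₂ dual)) (proj₂ (proj₂ dual))

      section-form : SectionForm
      section-form = by (Fin.any? (λ i → ¬? (S i ∈⟨ Σ∞ ⟩?)))
        where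
        by : Dec (∃[ i ] ¬ S i ∈⟨ Σ∞ ⟩) → SectionForm
        -- Seven independent vectors do not fit into the span of six.
        by (no none) = contradiction (independent⇒≤ {vs = S} {ws = Σ∞} (Flat.independent Σ₆) S⊆Σ∞) (ℕ.1+n≰n {6})
          where
          S⊆Σ∞ : ∀ i → S i ∈⟨ Σ∞ ⟩
          S⊆Σ∞ i = dec (S i ∈⟨ Σ∞ ⟩?)
            where
            dec : Dec (S i ∈⟨ Σ∞ ⟩) → S i ∈⟨ Σ∞ ⟩
            dec (yes p) = p
            dec (no p)  = contradiction (i , p) none
        by (yes (i , Si∉)) = go (Φ-surjective (S i))
          where
          go : (Σ (V 3) λ X → Σ (V 3) λ Y → Σ (V 3) λ Z → S i ≋ Φ X Y Z) → SectionForm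
          go (E , Y , Z , Si≋) = go′ (over⇒trace (point-resp-over 1 Si≋ (Flat.over Σ₆ i)))
            where
            go′ : Over 3 E × Y ≋ frob 1 E × Z ≋ frob 2 E → SectionForm
            go′ (E∈ , Y≋ , Z≋) = section-form-from E E∈ (λ E∈L → Si∉ (∈⟨⟩-resp {M = Σ∞} (≋-sym Si≋trace) (trace∈Σ∞ E∈L)))
              (∈⟨⟩-resp {M = S} Si≋trace (∈⟨⟩-basis S i))
              where
              Si≋trace : S i ≋ trace E
              Si≋trace = ≋-trans Si≋ (Φ-cong (≋-refl {v = E}) Y≋ Z≋)

  open BruckBose

  -- Binary forms acting on coefficient sequences

  module Apolarity where

    private
      variable
        e : ℕ

    -- The transpose of multiplication by the binary form f = Σ fⱼ s^(e−j) t^j: a sequence x of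
    -- length e + n is a functional on forms of degree e + n − 1, and f ⋆ x is the functional
    -- h ↦ x (f h).
    infixr 8 _⋆_
    _⋆_ : V (suc e) → V (e ℕ.+ n) → V n
    (f ⋆ x) i = sum (λ j → f j * x (shift-index j i))

    ⋆-cong : ∀ (f : V (suc e)) {x y : V (e ℕ.+ n)} → x ≋ y → f ⋆ x ≋ f ⋆ y
    ⋆-cong f eq i = sum-cong-≋ (λ j → *-congˡ {x = f j} (eq (shift-index j i)))

    ⋆-congʳ : ∀ {f g : V (suc e)} (x : V (e ℕ.+ n)) → f ≋ g → f ⋆ x ≋ g ⋆ x
    ⋆-congʳ x eq i = sum-cong-≋ (λ j → *-congʳ {x = x (shift-index j i)} (eq j))

    ⋆-⊕ : ∀ (f : V (suc e)) (x y : V (e ℕ.+ n)) → f ⋆ (x ⊕ y) ≋ (f ⋆ x) ⊕ (f ⋆ y)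
    ⋆-⊕ f x y i = dot-⊕ f (λ j → x (shift-index j i)) (λ j → y (shift-index j i))

    ⋆-⊛ : ∀ (f : V (suc e)) a (x : V (e ℕ.+ n)) → f ⋆ (a ⊛ x) ≋ a ⊛ (f ⋆ x)
    ⋆-⊛ f a x i = dot-⊛ f a (λ j → x (shift-index j i))

    -- The transpose of the commutativity of multiplication of forms.
    ⋆-comm : ∀ (f g : V (suc e)) (x : V (e ℕ.+ (e ℕ.+ n))) → f ⋆ g ⋆ x ≋ g ⋆ f ⋆ x
    ⋆-comm f g x i = begin
      sum (λ j → f j * sum (λ l → g l * x (shift-index l (shift-index j i))))
        ≈⟨ sum-cong-≋ (λ j → *-distribˡ-sum (f j) (λ l → g l * x (shift-index l (shift-index j i)))) ⟩
      sum (λ j → sum (λ l → f j * (g l * x (shift-index l (shift-index j i)))))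
        ≈⟨ ∑-comm (λ j l → f j * (g l * x (shift-index l (shift-index j i)))) ⟩
      sum (λ l → sum (λ j → f j * (g l * x (shift-index l (shift-index j i)))))
        ≈⟨ sum-cong-≋ (λ l → trans (sum-cong-≋ (λ j → trans
             (*-congˡ (*-congˡ (reflexive (≡.cong x (shift-index-comm l j i)))))
             (solve 3 (λ a b z → a :* (b :* z) := b :* (a :* z)) refl (f j) (g l) _)))
             (sym (*-distribˡ-sum (g l) (λ j → f j * x (shift-index j (shift-index l i)))))) ⟩
      sum (λ l → g l * sum (λ j → f j * x (shift-index j (shift-index l i))))   ∎

    frob-⋆ : ∀ k (f : V (suc e)) (x : V (e ℕ.+ n)) → frob k (f ⋆ x) ≋ frob k f ⋆ frob k x
    frob-⋆ k f x i = frob-dot k f (λ j → x (shift-index j i))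

    -- `monomials (suc r)` is `veronese r` by definition; indexing by the length rather than the
    -- degree fits the lengths e + n in `⋆`.
    monomials : ∀ n → V 2 → V n
    monomials n u i = u 0F ^ (n ℕ.∸ suc (toℕ i)) * u 1F ^ toℕ i

    value : V (suc e) → V 2 → Carrier
    value {e} f u = dot f (monomials (suc e) u)

    -- The sequence of monomials is the functional of evaluation at u, and evaluation is
    -- multiplicative.
    ⋆-monomials : ∀ (f : V (suc e)) u → f ⋆ monomials (e ℕ.+ n) u ≋ value f u ⊛ monomials n u
    ⋆-monomials {e} {n} f u i = trans (sum-cong-≋ term) (sym (*-distribʳ-sum (monomials n u i) (λ j → f j * monomials (suc e) u j)))
      where
      s = u 0F
      t = u 1F
      ∸-split : ∀ a b j k → (j ℕ.+ a) ℕ.+ (suc k ℕ.+ b) ℕ.∸ suc (j ℕ.+ k) ≡ a ℕ.+ b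
      ∸-split a b j k = ≡.trans (≡.cong (ℕ._∸ suc (j ℕ.+ k)) (lemma a b j k)) (ℕ.m+n∸m≡n (suc (j ℕ.+ k)) (a ℕ.+ b))
        where
        lemma : ∀ a b j k → (j ℕ.+ a) ℕ.+ (suc k ℕ.+ b) ≡ suc (j ℕ.+ k) ℕ.+ (a ℕ.+ b)
        lemma = solve-∀
      exponent-split : ∀ j → (e ℕ.+ n) ℕ.∸ suc (toℕ (shift-index j i)) ≡ (suc e ℕ.∸ suc (toℕ j)) ℕ.+ (n ℕ.∸ suc (toℕ i))
      exponent-split j = ≡.trans
        (≡.cong₂ (λ a b → a ℕ.∸ suc b) (≡.cong₂ ℕ._+_ (≡.sym (ℕ.m+[n∸m]≡n (ℕ.≤-pred (Fin.toℕ<n j)))) (≡.sym (ℕ.m+[n∸m]≡n (Fin.toℕ<n i)))) (toℕ-shift-index j i))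
        (∸-split (e ℕ.∸ toℕ j) (n ℕ.∸ suc (toℕ i)) (toℕ j) (toℕ i))
      term : ∀ j → f j * monomials (e ℕ.+ n) u (shift-index j i) ≈ f j * monomials (suc e) u j * monomials n u i
      term j = begin
        f j * (s ^ ((e ℕ.+ n) ℕ.∸ suc (toℕ (shift-index j i))) * t ^ toℕ (shift-index j i))
          ≡⟨ ≡.cong₂ (λ a b → f j * (s ^ a * t ^ b)) (exponent-split j) (toℕ-shift-index j i) ⟩
        f j * (s ^ ((suc e ℕ.∸ suc (toℕ j)) ℕ.+ (n ℕ.∸ suc (toℕ i))) * t ^ (toℕ j ℕ.+ toℕ i))
          ≈⟨ *-congˡ (*-cong (^-homo-* s (suc e ℕ.∸ suc (toℕ j)) (n ℕ.∸ suc (toℕ i))) (^-homo-* t (toℕ j) (toℕ i))) ⟩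
        f j * (s ^ (suc e ℕ.∸ suc (toℕ j)) * s ^ (n ℕ.∸ suc (toℕ i)) * (t ^ toℕ j * t ^ toℕ i))
          ≈⟨ solve 5 (λ f a b c d → f :* (a :* b :* (c :* d)) := f :* (a :* c) :* (b :* d)) refl (f j) _ _ _ _ ⟩
        f j * monomials (suc e) u j * monomials n u i   ∎

    ^≈0⇒≈0 : ∀ n {x} → x ^ n ≈ 0# → x ≈ 0#
    ^≈0⇒≈0 zero    eq = contradiction eq 1≉0
    ^≈0⇒≈0 (suc n) eq = [ id , ^≈0⇒≈0 n ]′ (noZeroDivisors eq)

    monomials-nonzero : ∀ n {u} → ¬ u ≋ 𝟎 → ¬ monomials (suc n) u ≋ 𝟎
    monomials-nonzero n {u} u≉0 eq = u≉0 λ { 0F → first n eq ; 1F → last n eq }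
      where
      first : ∀ n → monomials (suc n) u ≋ 𝟎 → u 0F ≈ 0#
      first n eq = ^≈0⇒≈0 n (trans (sym (*-identityʳ _)) (eq 0F))
      last : ∀ n → monomials (suc n) u ≋ 𝟎 → u 1F ≈ 0#
      last n eq = ^≈0⇒≈0 (toℕ (fromℕ n)) (trans (sym (*-identityˡ _)) (trans (*-congʳ (reflexive (≡.cong (u 0F ^_) (≡.sym (≡.trans (≡.cong (n ℕ.∸_) (Fin.toℕ-fromℕ n)) (ℕ.n∸n≡0 n)))))) (eq (fromℕ n))))

    frob-value : ∀ k (f : V (suc e)) u → σ k (value f u) ≈ value (frob k f) (frob k u)
    frob-value {e} k f u = trans (frob-dot k f (monomials (suc e) u)) (dot-cong {h = frob k f} ≋-refl (frob-veronese k e u))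

    -- Dual to the statement that the multiples of f and g together span the forms of degree e + n -
    -- 1: a functional killing both families is zero.
    Coprime : ∀ n → V (suc e) → V (suc e) → Set (c ⊔ ℓ₁)
    Coprime {e} n f g = (z : V (e ℕ.+ n)) → f ⋆ z ≋ 𝟎 → g ⋆ z ≋ 𝟎 → z ≋ 𝟎

    -- Evaluation at a common zero would be a nonzero functional annihilated by both forms.
    coprime-values : ∀ {n} {f g : V (suc (suc e))} → Coprime n f g → ∀ {u} → ¬ u ≋ 𝟎 → value f u ≈ 0# → ¬ value g u ≈ 0#
    coprime-values {e} {n} {f} {g} coprime {u} u≉0 f≈0 g≈0 = monomials-nonzero (e ℕ.+ n) u≉0
      (coprime (monomials (suc e ℕ.+ n) u) (vanish f f≈0) (vanish g g≈0))
      where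
      vanish : ∀ (f : V (suc (suc e))) → value f u ≈ 0# → f ⋆ monomials (suc e ℕ.+ n) u ≋ 𝟎 {n}
      vanish f eq i = trans (⋆-monomials f u i) (trans (*-congʳ eq) (zeroˡ _))

  open Apolarity

  -- The rational curve attached to a binary form and its conjugates

  module Curves where

    -- If no two of l, l′, l″ vanish, the equations a l = b l′ = d l″ determine
    -- (a : b : d) = (l′ l″ : l l″ : l l′).
    proportional : ∀ {l l′ l″ a b d} → ¬ (l ≈ 0# × l′ ≈ 0#) → ¬ (l ≈ 0# × l″ ≈ 0#) → ¬ (l′ ≈ 0# × l″ ≈ 0#) →
                   a * l ≈ b * l′ → b * l′ ≈ d * l″ →
                   ∃[ κ ] a ≈ κ * (l′ * l″) × b ≈ κ * (l * l″) × d ≈ κ * (l * l′)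
    proportional {l} {l′} {l″} {a} {b} {d} ¬01 ¬02 ¬12 p r = by (l′ ≈? 0#) (l″ ≈? 0#)
      where
      zero-factor : ∀ {x y} → ¬ y ≈ 0# → x * y ≈ 0# → x ≈ 0#
      zero-factor y≉0 eq = [ id , (λ y≈0 → contradiction y≈0 y≉0) ]′ (noZeroDivisors eq)
      full : ∀ {u v} → ¬ v ≈ 0# → u * v ⁻¹ * v ≈ u
      full {u} {v} v≉0 = trans (solve 3 (λ u i v → u :* i :* v := u :* (v :* i)) refl u (v ⁻¹) v) (trans (*-congˡ (*-inverseʳ v≉0)) (*-identityʳ u))
      by : Dec (l′ ≈ 0#) → Dec (l″ ≈ 0#) → ∃[ κ ] a ≈ κ * (l′ * l″) × b ≈ κ * (l * l″) × d ≈ κ * (l * l′)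
      by (yes l′≈0) _ = b * (l * l″) ⁻¹ ,
          trans a≈0 (sym (trans (*-congˡ (trans (*-congʳ l′≈0) (zeroˡ l″))) (zeroʳ _))) ,
          sym (full (*-nonzero l≉0 l″≉0)) ,
          trans d≈0 (sym (trans (*-congˡ (trans (*-congˡ l′≈0) (zeroʳ l))) (zeroʳ _)))
        where
        l≉0 : ¬ l ≈ 0#
        l≉0 l≈0 = ¬01 (l≈0 , l′≈0)
        l″≉0 : ¬ l″ ≈ 0#
        l″≉0 l″≈0 = ¬12 (l′≈0 , l″≈0)
        a≈0 : a ≈ 0#
        a≈0 = zero-factor l≉0 (trans p (trans (*-congˡ l′≈0) (zeroʳ b)))
        d≈0 : d ≈ 0#
        d≈0 = zero-factor l″≉0 (trans (sym r) (trans (*-congˡ l′≈0) (zeroʳ b)))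
      by (no l′≉0) (yes l″≈0) = d * (l * l′) ⁻¹ ,
          trans a≈0 (sym (trans (*-congˡ (trans (*-congˡ l″≈0) (zeroʳ l′))) (zeroʳ _))) ,
          trans b≈0 (sym (trans (*-congˡ (trans (*-congˡ l″≈0) (zeroʳ l))) (zeroʳ _))) ,
          sym (full (*-nonzero l≉0 l′≉0))
        where
        l≉0 : ¬ l ≈ 0#
        l≉0 l≈0 = ¬02 (l≈0 , l″≈0)
        bl′≈0 : b * l′ ≈ 0#
        bl′≈0 = trans r (trans (*-congˡ l″≈0) (zeroʳ d))
        a≈0 : a ≈ 0#
        a≈0 = zero-factor l≉0 (trans p bl′≈0)
        b≈0 : b ≈ 0#
        b≈0 = zero-factor l′≉0 bl′≈0
      by (no l′≉0) (no l″≉0) = κ , sym κl′l″ , *-cancelˡ l′≉0 (begin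
          l′ * b               ≈⟨ trans (*-comm l′ b) (trans (sym p) (*-congʳ (sym κl′l″))) ⟩
          κ * (l′ * l″) * l    ≈⟨ solve 4 (λ κ l l′ l″ → κ :* (l′ :* l″) :* l := l′ :* (κ :* (l :* l″))) refl κ l l′ l″ ⟩
          l′ * (κ * (l * l″))  ∎) , *-cancelˡ l″≉0 (begin
          l″ * d               ≈⟨ trans (*-comm l″ d) (trans (sym (trans p r)) (*-congʳ (sym κl′l″))) ⟩
          κ * (l′ * l″) * l    ≈⟨ solve 4 (λ κ l l′ l″ → κ :* (l′ :* l″) :* l := l″ :* (κ :* (l :* l′))) refl κ l l′ l″ ⟩
          l″ * (κ * (l * l′))  ∎)
        where
        κ = a * (l′ * l″) ⁻¹
        κl′l″ : κ * (l′ * l″) ≈ a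
        κl′l″ = full (*-nonzero l′≉0 l″≉0)

    module Functional (ℬ : BosePlane) where

      open Coordinates ℬ

      -- The inverse of Γ₃ turns a form on the first block into a single covector on PG(8, q⁶), the
      -- shape in which `CutsWithMultiplicity` asks for a hyperplane.
      first-block : (ℓ : V 3) → ∃[ h ] (∀ X Y Z → dot h (Φ X Y Z) ≈ dot ℓ X)
      first-block ℓ = go (inverse-matrix Γ₃ Γ₃-independent)
        where
        go : (Σ (Vector (V 9) 9) λ N → (∀ x → Γ₃ · (N · x) ≋ x) × (∀ x → N · (Γ₃ · x) ≋ x)) → ∃[ h ] (∀ X Y Z → dot h (Φ X Y Z) ≈ dot ℓ X)
        go (N , _ , NΓ) = (λ i → dot ℓ (take 3 (N i))) , λ X Y Z → begin
          dot (λ i → dot ℓ (take 3 (N i))) (Φ X Y Z)    ≈⟨ dot-· ℓ (λ i → take 3 (N i)) (Φ X Y Z) ⟨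
          dot ℓ (take 3 (N · Φ X Y Z))                  ≈⟨ dot-cong {h = ℓ} ≋-refl (block X Y Z) ⟩
          dot ℓ X                                       ∎
          where
          block : ∀ X Y Z → take 3 (N · Φ X Y Z) ≋ X
          block X Y Z = ≋-trans (λ i → ·-congˡ N (≋-sym (Γ₃-· X Y Z)) (i Fin.↑ˡ 6)) (≋-trans (λ i → NΓ (X ++ Y ++ Z) (i Fin.↑ˡ 6))
            (λ { 0F → refl ; 1F → refl ; 2F → refl }))

    record Frame : Set (c ⊔ ℓ₁) where
      field
        𝒞             : Configuration
        sectionForm   : Section.SectionForm 𝒞
        D             : Vector (V 3) 3
        D-over        : ∀ j → Over 3 (D j)
        D-independent : Independent D

      open Configuration 𝒞 public

    -- `f` has degree e + 1. The lengths in the coprimality fields are those left when two such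
    -- forms are removed one after the other from a sequence of length 2 (e + 1) + 3.
    record Factor : Set (c ⊔ ℓ₁) where
      field
        e         : ℕ
        f         : V (suc (suc e))
        f-over    : Over 3 f
        coprime₀₁ : Coprime 3 f (frob 1 f)
        coprime₀₂ : Coprime 3 f (frob 2 f)
        coprime₁₂ : Coprime (suc e ℕ.+ 3) (frob 1 f) (frob 2 f)

    module Curve (𝒟 : Frame) (𝒻 : Factor) where

      open Frame 𝒟
      open Factor 𝒻
      open Coordinates ℬ
      open AtInfinity ℓ∞
      open Section 𝒞
      open SectionForm sectionForm renaming (form to ℓ; over to ℓ-over)

      private
        f₁ f₂ : V (suc (suc e))
        f₁ = frob 1 f
        f₂ = frob 2 f
        D₁ D₂ : Vector (V 3) 3
        D₁ = frob 1 ∘ D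
        D₂ = frob 2 ∘ D
        ℓ₁′ ℓ₂′ : V 3
        ℓ₁′ = frob 1 ℓ
        ℓ₂′ = frob 2 ℓ

      r : ℕ
      r = e ℕ.+ (suc e ℕ.+ 3)

      γ γ₁ γ₂ : V 2 → V 3
      γ u = D · veronese 2 u
      γ₁ u = D₁ · veronese 2 u
      γ₂ u = D₂ · veronese 2 u

      -- The coefficients of the parametrisation Φ (f₁ f₂ γ) (f f₂ γ₁) (f f₁ γ₂).
      lift : V (suc r) → V 9
      lift x = Φ (D · (f₁ ⋆ f₂ ⋆ x)) (D₁ · (f ⋆ f₂ ⋆ x)) (D₂ · (f ⋆ f₁ ⋆ x))

      private
        ⋆⋆-cong : ∀ (g h : V (suc (suc e))) (M : Vector (V 3) 3) {x y : V (suc r)} → x ≋ y → M · (g ⋆ h ⋆ x) ≋ M · (g ⋆ h ⋆ y)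
        ⋆⋆-cong g h M eq = ·-congˡ M (⋆-cong g (⋆-cong h eq))

        ⋆⋆-⊕ : ∀ (g h : V (suc (suc e))) (M : Vector (V 3) 3) (x y : V (suc r)) → M · (g ⋆ h ⋆ (x ⊕ y)) ≋ (M · (g ⋆ h ⋆ x)) ⊕ (M · (g ⋆ h ⋆ y))
        ⋆⋆-⊕ g h M x y = ≋-trans (·-congˡ M (≋-trans (⋆-cong g (⋆-⊕ h x y)) (⋆-⊕ g (h ⋆ x) (h ⋆ y)))) (·-⊕ M (g ⋆ h ⋆ x) (g ⋆ h ⋆ y))

        ⋆⋆-⊛ : ∀ (g h : V (suc (suc e))) (M : Vector (V 3) 3) a (x : V (suc r)) → M · (g ⋆ h ⋆ (a ⊛ x)) ≋ a ⊛ (M · (g ⋆ h ⋆ x))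
        ⋆⋆-⊛ g h M a x = ≋-trans (·-congˡ M (≋-trans (⋆-cong g (⋆-⊛ h a x)) (⋆-⊛ g a (h ⋆ x)))) (·-⊛ M a (g ⋆ h ⋆ x))

        lift-cong : ∀ {x y} → x ≋ y → lift x ≋ lift y
        lift-cong eq = Φ-cong (⋆⋆-cong f₁ f₂ D eq) (⋆⋆-cong f f₂ D₁ eq) (⋆⋆-cong f f₁ D₂ eq)

        lift-⊕ : ∀ x y → lift (x ⊕ y) ≋ lift x ⊕ lift y
        lift-⊕ x y = ≋-trans (Φ-cong (⋆⋆-⊕ f₁ f₂ D x y) (⋆⋆-⊕ f f₂ D₁ x y) (⋆⋆-⊕ f f₁ D₂ x y))
          (Φ-⊕ (D · (f₁ ⋆ f₂ ⋆ x)) (D₁ · (f ⋆ f₂ ⋆ x)) (D₂ · (f ⋆ f₁ ⋆ x)) (D · (f₁ ⋆ f₂ ⋆ y)) (D₁ · (f ⋆ f₂ ⋆ y)) (D₂ · (f ⋆ f₁ ⋆ y)))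

        lift-⊛ : ∀ a x → lift (a ⊛ x) ≋ a ⊛ lift x
        lift-⊛ a x = ≋-trans (Φ-cong (⋆⋆-⊛ f₁ f₂ D a x) (⋆⋆-⊛ f f₂ D₁ a x) (⋆⋆-⊛ f f₁ D₂ a x))
          (Φ-⊛ a (D · (f₁ ⋆ f₂ ⋆ x)) (D₁ · (f ⋆ f₂ ⋆ x)) (D₂ · (f ⋆ f₁ ⋆ x)))

        frob-⋆⋆ : ∀ (g h : V (suc (suc e))) (M : Vector (V 3) 3) (x : V (suc r)) →
                  frob 1 (M · (g ⋆ h ⋆ x)) ≋ (frob 1 ∘ M) · (frob 1 g ⋆ frob 1 h ⋆ frob 1 x)
        frob-⋆⋆ g h M x = ≋-trans (frob-· 1 M (g ⋆ h ⋆ x)) (·-congˡ (frob 1 ∘ M)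
          (≋-trans (frob-⋆ 1 g (h ⋆ x)) (⋆-cong (frob 1 g) (frob-⋆ 1 h x))))

        frob-f₂ : frob 1 f₂ ≋ f
        frob-f₂ = ≋-trans (frob-∘ 1 2 f) f-over

        frob-f₁ : frob 1 f₁ ≋ f₂
        frob-f₁ = frob-∘ 1 1 f

        -- Frobenius rotates the blocks and the three conjugates of f alike; commutativity restores
        -- the order of the two factors. So the curve is defined over GF(q).
        frob-lift : ∀ x → frob 1 (lift x) ≋ lift (frob 1 x)
        frob-lift x = ≋-trans (frob-Φ (D · (f₁ ⋆ f₂ ⋆ x)) (D₁ · (f ⋆ f₂ ⋆ x)) (D₂ · (f ⋆ f₁ ⋆ x))) (Φ-cong
            (≋-trans (frob-⋆⋆ f f₁ D₂ x) (·-cong (λ j → ≋-trans (frob-∘ 1 2 (D j)) (D-over j)) (⋆-cong f₁ (⋆-congʳ y frob-f₁))))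
            (≋-trans (frob-⋆⋆ f₁ f₂ D x) (·-congˡ D₁ (≋-trans (⋆-congʳ (frob 1 f₂ ⋆ y) frob-f₁)
              (≋-trans (⋆-cong f₂ (⋆-congʳ y frob-f₂)) (⋆-comm f₂ f y)))))
            (≋-trans (frob-⋆⋆ f f₂ D₁ x) (·-cong (λ j → frob-∘ 1 1 (D j)) (≋-trans (⋆-cong f₁ (⋆-congʳ y frob-f₂)) (⋆-comm f₁ f y)))))
          where y = frob 1 x

      basis : Vector (V 9) (suc r)
      basis = lift ∘ unit

      basis-· : ∀ x → basis · x ≋ lift x
      basis-· = linear-matrix lift lift-cong lift-⊕ lift-⊛

      basis-over : ∀ i → Over 1 (basis i)
      basis-over i = ≋-trans (frob-lift (unit i)) (lift-cong (unit-over 1 i))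

      -- If all three blocks vanish, f and f₁ annihilate f₂ ⋆ x, and f and f₂ annihilate f₁ ⋆ x.
      -- Hence both of these are zero, and coprimality of f₁ and f₂ gives x = 0.
      basis-independent : Independent basis
      basis-independent x eq = coprime₁₂ x f₁⋆x≋0 f₂⋆x≋0
        where
        parts = Φ-injective (≋-trans (≋-sym (basis-· x)) (≋-trans eq (≋-sym Φ-𝟎)))
        p₀ : f₁ ⋆ f₂ ⋆ x ≋ 𝟎 {3}
        p₀ = D-independent (f₁ ⋆ f₂ ⋆ x) (proj₁ parts)
        p₁ : f ⋆ f₂ ⋆ x ≋ 𝟎 {3}
        p₁ = frob-independent 1 {D} (ℕ.s≤s ℕ.z≤n) D-independent (f ⋆ f₂ ⋆ x) (proj₁ (proj₂ parts))
        p₂ : f ⋆ f₁ ⋆ x ≋ 𝟎 {3}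
        p₂ = frob-independent 2 {D} (ℕ.s≤s (ℕ.s≤s ℕ.z≤n)) D-independent (f ⋆ f₁ ⋆ x) (proj₂ (proj₂ parts))
        f₂⋆x≋0 : f₂ ⋆ x ≋ 𝟎 {suc e ℕ.+ 3}
        f₂⋆x≋0 = coprime₀₁ (f₂ ⋆ x) p₁ p₀
        f₁⋆x≋0 : f₁ ⋆ x ≋ 𝟎 {suc e ℕ.+ 3}
        f₁⋆x≋0 = coprime₀₂ (f₁ ⋆ x) p₂ (≋-trans (⋆-comm f₂ f₁ x) p₀)

      module _ (compatible : ∀ x → dot ℓ (D · (f₁ ⋆ f₂ ⋆ x)) ≈ dot ℓ₁′ (D₁ · (f ⋆ f₂ ⋆ x)) ×
                                   dot ℓ₁′ (D₁ · (f ⋆ f₂ ⋆ x)) ≈ dot ℓ₂′ (D₂ · (f ⋆ f₁ ⋆ x))) where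

        curve : NRC r Σ₆
        curve = record
          { ambient = record { basis = basis ; over = basis-over ; independent = basis-independent }
          ; inside  = λ i → Equivalence.from (affine (D · (f₁ ⋆ f₂ ⋆ unit i)) (D₁ · (f ⋆ f₂ ⋆ unit i)) (D₂ · (f ⋆ f₁ ⋆ unit i))) (compatible (unit i))
          }

        param : V 2 → V 9
        param = NRC.param curve

        weights : V 2 → V 3
        weights u = value f₁ u * value f₂ u ∷ value f u * value f₂ u ∷ value f u * value f₁ u ∷ []

        param-Φ : ∀ u → param u ≋ Φ (weights u 0F ⊛ γ u) (weights u 1F ⊛ γ₁ u) (weights u 2F ⊛ γ₂ u)
        param-Φ u = ≋-trans (basis-· (veronese r u)) (Φ-cong (part f₁ f₂ D) (part f f₂ D₁) (part f f₁ D₂))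
          where
          part : ∀ g h (M : Vector (V 3) 3) → M · (g ⋆ h ⋆ veronese r u) ≋ (value g u * value h u) ⊛ (M · veronese 2 u)
          part g h M = ≋-trans (·-congˡ M (≋-trans (⋆-cong g (⋆-monomials h u)) (≋-trans (⋆-⊛ g (value h u) (monomials (suc e ℕ.+ 3) u))
            (λ i → trans (*-congˡ (⋆-monomials g u i)) (solve 3 (λ a b x → a :* (b :* x) := b :* a :* x) refl (value h u) (value g u) (monomials 3 u i))))))
            (·-⊛ M (value g u * value h u) (veronese 2 u))

        param∈S : ∀ u → param u ∈⟨ S ⟩
        param∈S u = ∈⟨⟩-trans {vs = basis} {ws = S} (NRC.inside curve) (veronese r u , ≋-refl {v = param u})

        param-nonzero : ∀ {u} → ¬ u ≋ 𝟎 → ¬ param u ≋ 𝟎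
        param-nonzero {u} u≉0 = independent-nonzero {M = basis} basis-independent {veronese r u} (monomials-nonzero r u≉0)

        param-over : ∀ k {u} → Over k u → Over k (param u)
        param-over k u∈ = over-· k {basis} (over-1⇒ k ∘ basis-over) (over-veronese k r u∈)

        param-∼ : ∀ {u v} → u ∼ v → param u ∼ param v
        param-∼ u∼v = ·-∼ basis (veronese-∼ r u∼v)

        -- At most one of the three conjugate values vanishes at u, so the equations of the 6-space
        -- fix the three weights up to a common scalar.
        on-curve : ∀ {u y a b d} → ¬ u ≋ 𝟎 → ¬ y ≋ 𝟎 → y ≋ Φ (a ⊛ γ u) (b ⊛ γ₁ u) (d ⊛ γ₂ u) →
                   a * value f u ≈ b * value f₁ u → b * value f₁ u ≈ d * value f₂ u → y ∼ param u
        on-curve {u} {y} {a} {b} {d} u≉0 y≉0 y≋ p s = go (proportional {value f u} {value f₁ u} {value f₂ u} {a} {b} {d}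
            (λ (x , y) → coprime-values {f = f} {g = f₁} coprime₀₁ u≉0 x y) (λ (x , y) → coprime-values {f = f} {g = f₂} coprime₀₂ u≉0 x y)
            (λ (x , y) → coprime-values {f = f₁} {g = f₂} coprime₁₂ u≉0 x y) p s)
          where
          go : (∃[ κ ] a ≈ κ * weights u 0F × b ≈ κ * weights u 1F × d ≈ κ * weights u 2F) → y ∼ param u
          go (κ , pa , pb , pd) = κ , κ≉0 , y≋κ
            where
            y≋κ : y ≋ κ ⊛ param u
            y≋κ = ≋-trans y≋ (≋-trans (Φ-cong (scale pa (γ u)) (scale pb (γ₁ u)) (scale pd (γ₂ u)))
              (≋-trans (Φ-⊛ κ (weights u 0F ⊛ γ u) (weights u 1F ⊛ γ₁ u) (weights u 2F ⊛ γ₂ u)) (⊛-cong refl (≋-sym (param-Φ u)))))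
              where
              scale : ∀ {a w} → a ≈ κ * w → ∀ (v : V 3) → a ⊛ v ≋ κ ⊛ (w ⊛ v)
              scale eq v i = trans (*-congʳ eq) (*-assoc κ _ (v i))
            κ≉0 : ¬ κ ≈ 0#
            κ≉0 κ≈0 = y≉0 (λ i → trans (y≋κ i) (trans (*-congʳ κ≈0) (zeroˡ _)))

        -- The three forms take equal values on Σ₆, so one block decides whether a point of the
        -- curve is at infinity.
        on-line : ∀ {Λ u} → dot ℓ (γ u) ≈ Λ → ∀ {y} → y ∼ param u → Λ * weights u 0F ≈ 0# → y ∈⟨ Σ∞ ⟩
        on-line {Λ} {u} γ≈Λ y∼ Λw≈0 = ∈⟨⟩-∼ {M = Σ∞} y∼ (∈⟨⟩-resp {M = Σ∞} (≋-sym (param-Φ u))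
          (Equivalence.from (infinity (weights u 0F ⊛ γ u) (weights u 1F ⊛ γ₁ u) (weights u 2F ⊛ γ₂ u)) (first , trans (sym (proj₁ relations)) first , trans (sym (trans (proj₁ relations) (proj₂ relations))) first)))
          where
          first : dot ℓ (weights u 0F ⊛ γ u) ≈ 0#
          first = trans (dot-⊛ ℓ (weights u 0F) (γ u)) (trans (*-congˡ γ≈Λ) (trans (*-comm _ _) Λw≈0))
          relations = Equivalence.to (affine (weights u 0F ⊛ γ u) (weights u 1F ⊛ γ₁ u) (weights u 2F ⊛ γ₂ u)) (∈⟨⟩-resp {M = S} (param-Φ u) (param∈S u))

        at-line : ∀ {Λ u} → dot ℓ (γ u) ≈ Λ → ∀ {y} → y ∼ param u → y ∈⟨ Σ∞ ⟩ → Λ * weights u 0F ≈ 0#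
        at-line {Λ} {u} γ≈Λ {y} y∼ y∈ = trans (*-comm Λ _) (trans (*-congˡ (sym γ≈Λ)) (trans (sym (dot-⊛ ℓ (weights u 0F) (γ u)))
          (proj₁ (Equivalence.to (infinity (weights u 0F ⊛ γ u) (weights u 1F ⊛ γ₁ u) (weights u 2F ⊛ γ₂ u)) (∈⟨⟩-resp {M = Σ∞} (param-Φ u) (∈⟨⟩-∼ {M = Σ∞} (∼-sym y∼) y∈))))))

  open Curves

  -- Resultants, factors of binary quadratics, and tangent lines

  module BinaryForms where

    cancel-zero : ∀ {x y} → ¬ x ≈ 0# → x * y ≈ 0# → y ≈ 0#
    cancel-zero x≉0 eq = [ (λ x≈0 → contradiction x≈0 x≉0) , id ]′ (noZeroDivisors eq)

    det : V 2 → V 2 → Carrier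
    det f g = f 0F * g 1F - f 1F * g 0F

    -- Cramer's rule for two consecutive entries; the coprimality proofs cover a sequence by such
    -- windows.
    linear-window : ∀ f g z₀ z₁ → ¬ det f g ≈ 0# → f 0F * z₀ + (f 1F * z₁ + 0#) ≈ 0# → g 0F * z₀ + (g 1F * z₁ + 0#) ≈ 0# →
                    z₀ ≈ 0# × z₁ ≈ 0#
    linear-window f g z₀ z₁ d≉0 p r = cancel-zero d≉0 (begin
        det f g * z₀
          ≈⟨ solve 6 (λ a b a′ b′ x y → (a :* b′ :- b :* a′) :* x := b′ :* (a :* x :+ (b :* y :+ :0)) :- b :* (a′ :* x :+ (b′ :* y :+ :0))) refl (f 0F) (f 1F) (g 0F) (g 1F) z₀ z₁ ⟩
        g 1F * (f 0F * z₀ + (f 1F * z₁ + 0#)) - f 1F * (g 0F * z₀ + (g 1F * z₁ + 0#))   ≈⟨ +-cong (*-congˡ p) (-‿cong (*-congˡ r)) ⟩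
        g 1F * 0# - f 1F * 0#     ≈⟨ solve 2 (λ a b → a :* :0 :- b :* :0 := :0) refl (g 1F) (f 1F) ⟩
        0#                        ∎) , cancel-zero d≉0 (begin
        det f g * z₁
          ≈⟨ solve 6 (λ a b a′ b′ x y → (a :* b′ :- b :* a′) :* y := a :* (a′ :* x :+ (b′ :* y :+ :0)) :- a′ :* (a :* x :+ (b :* y :+ :0))) refl (f 0F) (f 1F) (g 0F) (g 1F) z₀ z₁ ⟩
        f 0F * (g 0F * z₀ + (g 1F * z₁ + 0#)) - g 0F * (f 0F * z₀ + (f 1F * z₁ + 0#))   ≈⟨ +-cong (*-congˡ r) (-‿cong (*-congˡ p)) ⟩
        f 0F * 0# - g 0F * 0#     ≈⟨ solve 2 (λ a b → a :* :0 :- b :* :0 := :0) refl (f 0F) (g 0F) ⟩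
        0#                        ∎)

    linear-coprime₃ : ∀ {f g} → ¬ det f g ≈ 0# → Coprime 3 f g
    linear-coprime₃ {f} {g} d≉0 z p r = λ { 0F → proj₁ w₀ ; 1F → proj₂ w₀ ; 2F → proj₁ w₂ ; 3F → proj₂ w₂ }
      where
      w₀ = linear-window f g (z 0F) (z 1F) d≉0 (p 0F) (r 0F)
      w₂ = linear-window f g (z 2F) (z 3F) d≉0 (p 2F) (r 2F)

    linear-coprime₄ : ∀ {f g} → ¬ det f g ≈ 0# → Coprime 4 f g
    linear-coprime₄ {f} {g} d≉0 z p r = λ { 0F → proj₁ w₀ ; 1F → proj₂ w₀ ; 2F → proj₁ w₂ ; 3F → proj₁ w₃ ; 4F → proj₂ w₃ }
      where
      w₀ = linear-window f g (z 0F) (z 1F) d≉0 (p 0F) (r 0F)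
      w₂ = linear-window f g (z 2F) (z 3F) d≉0 (p 2F) (r 2F)
      w₃ = linear-window f g (z 3F) (z 4F) d≉0 (p 3F) (r 3F)

    det-frob : ∀ k f g → σ k (det f g) ≈ det (frob k f) (frob k g)
    det-frob k f g = trans (σ-minus k _ _) (+-cong (σ-* k (f 0F) (g 1F)) (-‿cong (σ-* k (f 1F) (g 0F))))

    det-cong : ∀ {f g f′ g′} → f ≋ f′ → g ≋ g′ → det f g ≈ det f′ g′
    det-cong p r = +-cong (*-cong (p 0F) (r 1F)) (-‿cong (*-cong (p 1F) (r 0F)))

    det-swap : ∀ f g → det f g ≈ - det g f
    det-swap f g = solve 4 (λ a b x y → a :* y :- b :* x := :- (x :* b :- y :* a)) refl (f 0F) (f 1F) (g 0F) (g 1F)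

    -- The resultant of two quadratic forms is y² − x z at the intersection point of the lines
    -- with the same coefficients.
    resultant : V 3 → V 3 → Carrier
    resultant f g = let p = cross f g in p 1F * p 1F - p 0F * p 2F

    resultant-frob : ∀ k f g → σ k (resultant f g) ≈ resultant (frob k f) (frob k g)
    resultant-frob k f g = trans (σ-minus k _ _) (+-cong (trans (σ-* k _ _) (*-cong (c₁ 1F) (c₁ 1F))) (-‿cong (trans (σ-* k _ _) (*-cong (c₁ 0F) (c₁ 2F)))))
      where
      minor : ∀ a b a′ b′ → σ k (a * b′ - b * a′) ≈ σ k a * σ k b′ - σ k b * σ k a′
      minor a b a′ b′ = trans (σ-minus k _ _) (+-cong (σ-* k a b′) (-‿cong (σ-* k b a′)))
      c₁ : frob k (cross f g) ≋ cross (frob k f) (frob k g)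
      c₁ 0F = minor (f 1F) (f 2F) (g 1F) (g 2F)
      c₁ 1F = minor (f 2F) (f 0F) (g 2F) (g 0F)
      c₁ 2F = minor (f 0F) (f 1F) (g 0F) (g 1F)

    resultant-cong : ∀ {f g f′ g′} → f ≋ f′ → g ≋ g′ → resultant f g ≈ resultant f′ g′
    resultant-cong {f} {g} {f′} {g′} p r = +-cong (*-cong (c₁ 1F) (c₁ 1F)) (-‿cong (*-cong (c₁ 0F) (c₁ 2F)))
      where
      c₁ : cross f g ≋ cross f′ g′
      c₁ 0F = +-cong (*-cong (p 1F) (r 2F)) (-‿cong (*-cong (p 2F) (r 1F)))
      c₁ 1F = +-cong (*-cong (p 2F) (r 0F)) (-‿cong (*-cong (p 0F) (r 2F)))
      c₁ 2F = +-cong (*-cong (p 0F) (r 1F)) (-‿cong (*-cong (p 1F) (r 0F)))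

    resultant-sym : ∀ f g → resultant f g ≈ resultant g f
    resultant-sym f g = solve 6 (λ a b c x y z →
        (c :* x :- a :* z) :* (c :* x :- a :* z) :- (b :* z :- c :* y) :* (a :* y :- b :* x) :=
        (z :* a :- x :* c) :* (z :* a :- x :* c) :- (y :* c :- z :* b) :* (x :* b :- y :* a)) refl (f 0F) (f 1F) (f 2F) (g 0F) (g 1F) (g 2F)

    reversed : V 3 → V 3
    reversed f = f 2F ∷ f 1F ∷ f 0F ∷ []

    resultant-reversed : ∀ f g → resultant f g ≈ resultant (reversed f) (reversed g)
    resultant-reversed f g = solve 6 (λ a b c x y z →
        (c :* x :- a :* z) :* (c :* x :- a :* z) :- (b :* z :- c :* y) :* (a :* y :- b :* x) :=
        (a :* z :- c :* x) :* (a :* z :- c :* x) :- (b :* x :- a :* y) :* (c :* y :- b :* z)) refl (f 0F) (f 1F) (f 2F) (g 0F) (g 1F) (g 2F)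

    private
      row : V 3 → Carrier → Carrier → Carrier → Carrier
      row f x y z = f 0F * x + (f 1F * y + (f 2F * z + 0#))

      -- Elimination in the Sylvester system.
      half-window : ∀ f g z₀ z₁ z₂ z₃ → ¬ resultant f g ≈ 0# → row f z₀ z₁ z₂ ≈ 0# → row g z₀ z₁ z₂ ≈ 0# →
                    row f z₁ z₂ z₃ ≈ 0# → row g z₁ z₂ z₃ ≈ 0# → z₀ ≈ 0# × z₁ ≈ 0#
      half-window f g z₀ z₁ z₂ z₃ R≉0 f0≈0 g0≈0 f1≈0 g1≈0 =
          cancel-zero R≉0 (trans id₀ (trans (+-cong (+-cong (vanish (f 2F) (g 2F) f0≈0 g0≈0 d₀₂) (vanish (g 1F) (f 1F) g0≈0 f0≈0 d₁₂)) (vanish (f 2F) (g 2F) f1≈0 g1≈0 (- d₁₂)))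
            (solve 0 (:0 :+ :0 :+ :0 := :0) refl))) ,
          cancel-zero R≉0 (trans id₁ (trans (+-cong (vanish (f 2F) (g 2F) f1≈0 g1≈0 d₀₂) (vanish (g 0F) (f 0F) g0≈0 f0≈0 (- d₁₂))) (+-identityʳ 0#)))
        where
        d₀₂ = f 0F * g 2F - f 2F * g 0F
        d₁₂ = f 1F * g 2F - f 2F * g 1F
        vanish : ∀ a b {x y} → x ≈ 0# → y ≈ 0# → ∀ d → d * (b * x - a * y) ≈ 0#
        vanish a b p r d = trans (*-congˡ (+-cong (*-congˡ p) (-‿cong (*-congˡ r)))) (solve 3 (λ a b d → d :* (b :* :0 :- a :* :0) := :0) refl a b d)
        id₀ : resultant f g * z₀ ≈ d₀₂ * (g 2F * row f z₀ z₁ z₂ - f 2F * row g z₀ z₁ z₂) +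
                                   d₁₂ * (f 1F * row g z₀ z₁ z₂ - g 1F * row f z₀ z₁ z₂) +
                                   - d₁₂ * (g 2F * row f z₁ z₂ z₃ - f 2F * row g z₁ z₂ z₃)
        id₀ = solve 10 (λ a b c x y z w0 w1 w2 w3 →
          let F0 = a :* w0 :+ (b :* w1 :+ (c :* w2 :+ :0)) ; G0 = x :* w0 :+ (y :* w1 :+ (z :* w2 :+ :0))
              F1 = a :* w1 :+ (b :* w2 :+ (c :* w3 :+ :0)) ; G1 = x :* w1 :+ (y :* w2 :+ (z :* w3 :+ :0))
              D02 = a :* z :- c :* x ; D12 = b :* z :- c :* y in
          ((c :* x :- a :* z) :* (c :* x :- a :* z) :- (b :* z :- c :* y) :* (a :* y :- b :* x)) :* w0 :=
          D02 :* (z :* F0 :- c :* G0) :+ D12 :* (b :* G0 :- y :* F0) :+ :- D12 :* (z :* F1 :- c :* G1))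
          refl (f 0F) (f 1F) (f 2F) (g 0F) (g 1F) (g 2F) z₀ z₁ z₂ z₃
        id₁ : resultant f g * z₁ ≈ d₀₂ * (g 2F * row f z₁ z₂ z₃ - f 2F * row g z₁ z₂ z₃) +
                                   - d₁₂ * (f 0F * row g z₀ z₁ z₂ - g 0F * row f z₀ z₁ z₂)
        id₁ = solve 10 (λ a b c x y z w0 w1 w2 w3 →
          let F0 = a :* w0 :+ (b :* w1 :+ (c :* w2 :+ :0)) ; G0 = x :* w0 :+ (y :* w1 :+ (z :* w2 :+ :0))
              F1 = a :* w1 :+ (b :* w2 :+ (c :* w3 :+ :0)) ; G1 = x :* w1 :+ (y :* w2 :+ (z :* w3 :+ :0))
              D02 = a :* z :- c :* x ; D12 = b :* z :- c :* y in
          ((c :* x :- a :* z) :* (c :* x :- a :* z) :- (b :* z :- c :* y) :* (a :* y :- b :* x)) :* w1 :=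
          D02 :* (z :* F1 :- c :* G1) :+ :- D12 :* (a :* G0 :- x :* F0))
          refl (f 0F) (f 1F) (f 2F) (g 0F) (g 1F) (g 2F) z₀ z₁ z₂ z₃

      -- The last two entries are the first two read backwards: reversing forms and sequence
      -- preserves the equations and the resultant.
      quadratic-window : ∀ f g z₀ z₁ z₂ z₃ → ¬ resultant f g ≈ 0# → row f z₀ z₁ z₂ ≈ 0# → row g z₀ z₁ z₂ ≈ 0# →
                         row f z₁ z₂ z₃ ≈ 0# → row g z₁ z₂ z₃ ≈ 0# → (z₀ ≈ 0# × z₁ ≈ 0#) × (z₃ ≈ 0# × z₂ ≈ 0#)
      quadratic-window f g z₀ z₁ z₂ z₃ R≉0 f0≈0 g0≈0 f1≈0 g1≈0 = half-window f g z₀ z₁ z₂ z₃ R≉0 f0≈0 g0≈0 f1≈0 g1≈0 ,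
        half-window (reversed f) (reversed g) z₃ z₂ z₁ z₀ (R≉0 ∘ trans (resultant-reversed f g))
          (trans (flip-row f z₁ z₂ z₃) f1≈0) (trans (flip-row g z₁ z₂ z₃) g1≈0) (trans (flip-row f z₀ z₁ z₂) f0≈0) (trans (flip-row g z₀ z₁ z₂) g0≈0)
        where
        flip-row : ∀ f x y z → row (reversed f) z y x ≈ row f x y z
        flip-row f x y z = solve 6 (λ a b c x y z → c :* z :+ (b :* y :+ (a :* x :+ :0)) := a :* x :+ (b :* y :+ (c :* z :+ :0))) refl (f 0F) (f 1F) (f 2F) x y z

    quadratic-coprime₃ : ∀ {f g} → ¬ resultant f g ≈ 0# → Coprime 3 f g
    quadratic-coprime₃ {f} {g} R≉0 z p r = λ
      { 0F → proj₁ (proj₁ w₀) ; 1F → proj₂ (proj₁ w₀) ; 2F → proj₂ (proj₂ w₀) ; 3F → proj₁ (proj₂ w₀) ; 4F → proj₁ (proj₂ w₁) }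
      where
      w₀ = quadratic-window f g (z 0F) (z 1F) (z 2F) (z 3F) R≉0 (p 0F) (r 0F) (p 1F) (r 1F)
      w₁ = quadratic-window f g (z 1F) (z 2F) (z 3F) (z 4F) R≉0 (p 1F) (r 1F) (p 2F) (r 2F)

    -- The windows of length four starting at 0 and at 3 overlap in one entry and cover all seven.
    quadratic-coprime₅ : ∀ {f g} → ¬ resultant f g ≈ 0# → Coprime 5 f g
    quadratic-coprime₅ {f} {g} R≉0 z p r = λ
      { 0F → proj₁ (proj₁ w₀) ; 1F → proj₂ (proj₁ w₀) ; 2F → proj₂ (proj₂ w₀) ; 3F → proj₁ (proj₂ w₀)
      ; 4F → proj₂ (proj₁ w₃) ; 5F → proj₂ (proj₂ w₃) ; 6F → proj₁ (proj₂ w₃) }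
      where
      w₀ = quadratic-window f g (z 0F) (z 1F) (z 2F) (z 3F) R≉0 (p 0F) (r 0F) (p 1F) (r 1F)
      w₃ = quadratic-window f g (z 3F) (z 4F) (z 5F) (z 6F) R≉0 (p 3F) (r 3F) (p 4F) (r 4F)

    linear : V 2 → V 2
    linear u = - u 1F ∷ u 0F ∷ []

    _⊠_ : V 2 → V 2 → V 3
    f ⊠ g = f 0F * g 0F ∷ f 0F * g 1F + f 1F * g 0F ∷ f 1F * g 1F ∷ []

    value-⊠ : ∀ f g w → dot (f ⊠ g) (veronese 2 w) ≈ value f w * value g w
    value-⊠ f g w = solve 6 (λ a b x y s t →
        a :* x :* (s :^ 2 :* t :^ 0) :+ ((a :* y :+ b :* x) :* (s :^ 1 :* t :^ 1) :+ (b :* y :* (s :^ 0 :* t :^ 2) :+ :0)) :=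
        (a :* (s :^ 1 :* t :^ 0) :+ (b :* (s :^ 0 :* t :^ 1) :+ :0)) :* (x :* (s :^ 1 :* t :^ 0) :+ (y :* (s :^ 0 :* t :^ 1) :+ :0)))
      refl (f 0F) (f 1F) (g 0F) (g 1F) (w 0F) (w 1F)

    value-linear : ∀ u w → value (linear u) w ≈ u 0F * w 1F - u 1F * w 0F
    value-linear u w = solve 4 (λ a b s t → :- b :* (s :^ 1 :* t :^ 0) :+ (a :* (s :^ 0 :* t :^ 1) :+ :0) := a :* t :- b :* s) refl (u 0F) (u 1F) (w 0F) (w 1F)

    root : V 2 → V 2
    root f = f 1F ∷ - f 0F ∷ []

    linear-root : ∀ f → linear (root f) ≋ f
    linear-root f 0F = solve 1 (λ x → :- :- x := x) refl (f 0F)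
    linear-root f 1F = refl

    parallel⇒∼ : ∀ {u w : V 2} → ¬ u ≋ 𝟎 → ¬ w ≋ 𝟎 → u 0F * w 1F - u 1F * w 0F ≈ 0# → w ∼ u
    parallel⇒∼ {u} {w} u≉0 w≉0 eq = by (u 0F ≈? 0#)
      where
      eq′ : u 0F * w 1F ≈ u 1F * w 0F
      eq′ = x∙y⁻¹≈ε⇒x≈y _ _ eq
      by : Dec (u 0F ≈ 0#) → w ∼ u
      by (no u₀≉0) = w 0F * u 0F ⁻¹ , *-nonzero w₀≉0 (⁻¹-nonzero u₀≉0) , λ
        { 0F → sym (ratio u₀≉0)
        ; 1F → *-cancelˡ u₀≉0 (trans eq′ (trans (*-congˡ (sym (ratio u₀≉0))) (solve 4 (λ u v w i → v :* (w :* i :* u) := u :* (w :* i :* v)) refl (u 0F) (u 1F) (w 0F) (u 0F ⁻¹)))) }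
        where
        ratio : ∀ {x y} → ¬ y ≈ 0# → x * y ⁻¹ * y ≈ x
        ratio {x} {y} y≉0 = trans (solve 3 (λ x i y → x :* i :* y := x :* (y :* i)) refl x (y ⁻¹) y) (trans (*-congˡ (*-inverseʳ y≉0)) (*-identityʳ x))
        w₀≉0 : ¬ w 0F ≈ 0#
        w₀≉0 w₀≈0 = w≉0 λ { 0F → w₀≈0 ; 1F → cancel-zero u₀≉0 (trans eq′ (trans (*-congˡ w₀≈0) (zeroʳ _))) }
      by (yes u₀≈0) = w 1F * u 1F ⁻¹ , *-nonzero w₁≉0 (⁻¹-nonzero u₁≉0) , λ
        { 0F → trans w₀≈0 (sym (trans (*-congˡ u₀≈0) (zeroʳ _)))
        ; 1F → sym (trans (solve 3 (λ x i y → x :* i :* y := x :* (y :* i)) refl (w 1F) (u 1F ⁻¹) (u 1F)) (trans (*-congˡ (*-inverseʳ u₁≉0)) (*-identityʳ _))) }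
        where
        u₁≉0 : ¬ u 1F ≈ 0#
        u₁≉0 u₁≈0 = u≉0 λ { 0F → u₀≈0 ; 1F → u₁≈0 }
        w₀≈0 : w 0F ≈ 0#
        w₀≈0 = cancel-zero u₁≉0 (trans (sym eq′) (trans (*-congʳ u₀≈0) (zeroˡ _)))
        w₁≉0 : ¬ w 1F ≈ 0#
        w₁≉0 w₁≈0 = w≉0 λ { 0F → w₀≈0 ; 1F → w₁≈0 }

    factor-at : ∀ k {h : V 3} {u : V 2} → Over k h → Over k u → ¬ u ≋ 𝟎 → dot h (veronese 2 u) ≈ 0# →
                ∃[ g ] Over k g × h ≋ linear u ⊠ g
    factor-at k {h} {u} h∈ u∈ u≉0 eq = by (u 0F ≈? 0#)
      where
      a = h 0F
      b = h 1F
      d = h 2F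
      s = u 0F
      t = u 1F
      eq′ : a * s * s + b * s * t + d * t * t ≈ 0#
      eq′ = trans (solve 5 (λ a b d s t → a :* s :* s :+ b :* s :* t :+ d :* t :* t :=
        a :* (s :^ 2 :* t :^ 0) :+ (b :* (s :^ 1 :* t :^ 1) :+ (d :* (s :^ 0 :* t :^ 2) :+ :0))) refl a b d s t) eq
      by : Dec (s ≈ 0#) → ∃[ g ] Over k g × h ≋ linear u ⊠ g
      by (no s≉0) = g₀ ∷ g₁ ∷ [] , (λ { 0F → g₀∈ ; 1F → g₁∈ }) , λ
        { 0F → *-cancelˡ (*-nonzero s≉0 s≉0) (begin
            s * s * a     ≈⟨ solve 5 (λ a b d s t → s :* s :* a := (a :* s :* s :+ b :* s :* t :+ d :* t :* t) :- (b :* s :+ t :* d) :* t) refl a b d s t ⟩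
            (a * s * s + b * s * t + d * t * t) - (b * s + t * d) * t
              ≈⟨ +-cong eq′ (-‿cong (*-congʳ (sym s²g₀))) ⟩
            0# - s * s * g₀ * t   ≈⟨ solve 3 (λ s t g → :0 :- s :* s :* g :* t := s :* s :* (:- t :* g)) refl s t g₀ ⟩
            s * s * (- t * g₀)    ∎)
        ; 1F → sym (trans (+-congˡ sg₀) (solve 3 (λ t b g → :- t :* g :+ (b :+ t :* g) := b) refl t b g₁))
        ; 2F → sym sg₁ }
        where
        -- The last and the middle coefficient determine the cofactor; the first one then agrees
        -- because `u` is a zero.
        g₁ = d * s ⁻¹
        g₀ = (b + t * g₁) * s ⁻¹
        g₁∈ : InGF k g₁
        g₁∈ = InGF-* k (h∈ 2F) (InGF-⁻¹ k (u∈ 0F))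
        g₀∈ : InGF k g₀
        g₀∈ = InGF-* k (InGF-+ k (h∈ 1F) (InGF-* k (u∈ 1F) g₁∈)) (InGF-⁻¹ k (u∈ 0F))
        times : ∀ x → s * (x * s ⁻¹) ≈ x
        times x = trans (solve 3 (λ s x i → s :* (x :* i) := x :* (s :* i)) refl s x (s ⁻¹)) (trans (*-congˡ (*-inverseʳ s≉0)) (*-identityʳ x))
        sg₁ : s * g₁ ≈ d
        sg₁ = times d
        sg₀ : s * g₀ ≈ b + t * g₁
        sg₀ = times (b + t * g₁)
        s²g₀ : s * s * g₀ ≈ b * s + t * d
        s²g₀ = begin
          s * s * g₀             ≈⟨ trans (*-assoc s s g₀) (*-congˡ sg₀) ⟩
          s * (b + t * g₁)       ≈⟨ solve 4 (λ s b t g → s :* (b :+ t :* g) := b :* s :+ t :* (s :* g)) refl s b t g₁ ⟩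
          b * s + t * (s * g₁)   ≈⟨ +-congˡ (*-congˡ sg₁) ⟩
          b * s + t * d          ∎
      by (yes s≈0) = g₀ ∷ g₁ ∷ [] , (λ { 0F → g₀∈ ; 1F → g₁∈ }) , λ
        { 0F → sym (trans (solve 2 (λ t g → :- t :* g := :- (t :* g)) refl t g₀) (trans (-‿cong tg₀) (solve 1 (λ a → :- :- a := a) refl a)))
        ; 1F → sym (begin
            - t * g₁ + s * g₀     ≈⟨ +-cong (solve 2 (λ t g → :- t :* g := :- (t :* g)) refl t g₁) (trans (*-congʳ s≈0) (zeroˡ g₀)) ⟩
            - (t * g₁) + 0#       ≈⟨ trans (+-identityʳ _) (-‿cong tg₁) ⟩
            - - b                 ≈⟨ solve 1 (λ a → :- :- a := a) refl b ⟩
            b                     ∎)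
        ; 2F → trans d≈0 (sym (trans (*-congʳ s≈0) (zeroˡ g₁))) }
        where
        t≉0 : ¬ t ≈ 0#
        t≉0 t≈0 = u≉0 λ { 0F → s≈0 ; 1F → t≈0 }
        times : ∀ x → t * (x * t ⁻¹) ≈ x
        times x = trans (solve 3 (λ s x i → s :* (x :* i) := x :* (s :* i)) refl t x (t ⁻¹)) (trans (*-congˡ (*-inverseʳ t≉0)) (*-identityʳ x))
        -- With s = 0 the first two coefficients determine the cofactor, and the zero at `u` makes
        -- the last one vanish.
        g₀ = - a * t ⁻¹
        g₁ = - b * t ⁻¹
        g₀∈ : InGF k g₀
        g₀∈ = InGF-* k (InGF-neg k (h∈ 0F)) (InGF-⁻¹ k (u∈ 1F))
        g₁∈ : InGF k g₁
        g₁∈ = InGF-* k (InGF-neg k (h∈ 1F)) (InGF-⁻¹ k (u∈ 1F))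
        tg₀ : t * g₀ ≈ - a
        tg₀ = times (- a)
        tg₁ : t * g₁ ≈ - b
        tg₁ = times (- b)
        d≈0 : d ≈ 0#
        d≈0 = cancel-zero (*-nonzero t≉0 t≉0) (begin
          t * t * d                                ≈⟨ solve 5 (λ a b d s t → t :* t :* d := a :* :0 :* :0 :+ b :* :0 :* t :+ d :* t :* t) refl a b d s t ⟩
          a * 0# * 0# + b * 0# * t + d * t * t     ≈⟨ +-congʳ (+-cong (*-cong (*-congˡ s≈0) s≈0) (*-congʳ (*-congˡ s≈0))) ⟨
          a * s * s + b * s * t + d * t * t        ≈⟨ eq′ ⟩
          0#                                       ∎)

    -- A line of PG(2, q³) with a single point t over GF(q) differs from its conjugate, and
    -- meets it in t.
    module Tangent (h : V 3) (h≉0 : ¬ h ≋ 𝟎) (t : V 3) (t∈ : Point 1 t) (ht≈0 : dot h t ≈ 0#)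
                   (only : ∀ v → Point 1 v → dot h v ≈ 0# → v ∼ t) where

      private
        h′ : V 3
        h′ = frob 1 h

        p : V 3
        p = cross h h′

        -- Both points would be proportional to t, although one has k-th coordinate zero and the
        -- other does not. `Fin 0` stands for the contradiction.
        two-points : ∀ v w (k : Fin 3) → Point 1 v → Point 1 w → dot h v ≈ 0# → dot h w ≈ 0# → v k ≈ 0# → ¬ w k ≈ 0# → Fin 0
        two-points v w k v∈ w∈ hv hw vk wk = go (only v v∈ hv) (only w w∈ hw)
          where
          go : v ∼ t → w ∼ t → Fin 0
          go (a , a≉0 , v≋) (b , _ , w≋) = contradiction (trans (w≋ k) (trans (*-congˡ (cancel-zero a≉0 (trans (sym (v≋ k)) vk))) (zeroʳ b))) wk

        ratio-InGF : ∀ {x y} → ¬ y ≈ 0# → x * σ 1 y ≈ y * σ 1 x → InGF 1 (x * y ⁻¹)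
        ratio-InGF {x} {y} y≉0 eq = *-cancelˡ (σ-≉0 1 y≉0) (begin
          σ 1 y * σ 1 (x * y ⁻¹)      ≈⟨ σ-* 1 y _ ⟨
          σ 1 (y * (x * y ⁻¹))        ≈⟨ σ-cong 1 (trans (solve 3 (λ y x i → y :* (x :* i) := x :* (y :* i)) refl y x (y ⁻¹)) (trans (*-congˡ (*-inverseʳ y≉0)) (*-identityʳ x))) ⟩
          σ 1 x                       ≈⟨ ⁻¹-cancel y≉0 ⟨
          y ⁻¹ * (y * σ 1 x)          ≈⟨ *-congˡ eq ⟨
          y ⁻¹ * (x * σ 1 y)          ≈⟨ solve 3 (λ i x s → i :* (x :* s) := s :* (x :* i)) refl (y ⁻¹) x (σ 1 y) ⟩
          σ 1 y * (x * y ⁻¹)          ∎)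

        solve-zero : ∀ {x y} → ¬ y ≈ 0# → y * - (x * y ⁻¹) + x ≈ 0#
        solve-zero {x} {y} y≉0 = trans (solve 3 (λ x y i → y :* :- (x :* i) :+ x := x :* (:1 :- y :* i)) refl x y (y ⁻¹))
          (trans (*-congˡ (trans (+-congˡ (-‿cong (*-inverseʳ y≉0))) (-‿inverseʳ 1#))) (zeroʳ x))

      -- If h were proportional to its conjugate, its coordinate ratios would lie in GF(q). The line
      -- would then contain two rational points, found by giving the remaining two coordinates the
      -- values 1, 0 and 0, 1.
      cross≉0 : ¬ p ≋ 𝟎
      cross≉0 p≋0 = by (nonzero-coordinate h≉0)
        where
        e₂ : h 0F * σ 1 (h 1F) ≈ h 1F * σ 1 (h 0F)
        e₂ = x∙y⁻¹≈ε⇒x≈y _ _ (p≋0 2F)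
        e₁ : h 2F * σ 1 (h 0F) ≈ h 0F * σ 1 (h 2F)
        e₁ = x∙y⁻¹≈ε⇒x≈y _ _ (p≋0 1F)
        e₀ : h 1F * σ 1 (h 2F) ≈ h 2F * σ 1 (h 1F)
        e₀ = x∙y⁻¹≈ε⇒x≈y _ _ (p≋0 0F)
        absurd : Fin 0 → ∀ {a} {A : Set a} → A
        absurd ()
        by : (∃[ i ] ¬ h i ≈ 0#) → _
        by (0F , nz) = absurd (two-points (- (h 1F * h 0F ⁻¹) ∷ 1# ∷ 0# ∷ []) (- (h 2F * h 0F ⁻¹) ∷ 0# ∷ 1# ∷ []) 2F
          ((λ { 0F → InGF-neg 1 (ratio-InGF nz (sym e₂)) ; 1F → σ-1 1 ; 2F → σ-0 1 }) , λ eq → 1≉0 (eq 1F))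
          ((λ { 0F → InGF-neg 1 (ratio-InGF nz e₁) ; 1F → σ-0 1 ; 2F → σ-1 1 }) , λ eq → 1≉0 (eq 2F))
          (trans (solve 4 (λ a b c x → a :* x :+ (b :* :1 :+ (c :* :0 :+ :0)) := a :* x :+ b) refl (h 0F) (h 1F) (h 2F) _) (solve-zero nz))
          (trans (solve 4 (λ a b c x → a :* x :+ (b :* :0 :+ (c :* :1 :+ :0)) := a :* x :+ c) refl (h 0F) (h 1F) (h 2F) _) (solve-zero nz))
          refl 1≉0)
        by (1F , nz) = absurd (two-points (1# ∷ - (h 0F * h 1F ⁻¹) ∷ 0# ∷ []) (0# ∷ - (h 2F * h 1F ⁻¹) ∷ 1# ∷ []) 2F
          ((λ { 0F → σ-1 1 ; 1F → InGF-neg 1 (ratio-InGF nz e₂) ; 2F → σ-0 1 }) , λ eq → 1≉0 (eq 0F))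
          ((λ { 0F → σ-0 1 ; 1F → InGF-neg 1 (ratio-InGF nz (sym e₀)) ; 2F → σ-1 1 }) , λ eq → 1≉0 (eq 2F))
          (trans (solve 4 (λ a b c x → a :* :1 :+ (b :* x :+ (c :* :0 :+ :0)) := b :* x :+ a) refl (h 0F) (h 1F) (h 2F) _) (solve-zero nz))
          (trans (solve 4 (λ a b c x → a :* :0 :+ (b :* x :+ (c :* :1 :+ :0)) := b :* x :+ c) refl (h 0F) (h 1F) (h 2F) _) (solve-zero nz))
          refl 1≉0)
        by (2F , nz) = absurd (two-points (1# ∷ 0# ∷ - (h 0F * h 2F ⁻¹) ∷ []) (0# ∷ 1# ∷ - (h 1F * h 2F ⁻¹) ∷ []) 1F
          ((λ { 0F → σ-1 1 ; 1F → σ-0 1 ; 2F → InGF-neg 1 (ratio-InGF nz (sym e₁)) }) , λ eq → 1≉0 (eq 0F))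
          ((λ { 0F → σ-0 1 ; 1F → σ-1 1 ; 2F → InGF-neg 1 (ratio-InGF nz e₀) }) , λ eq → 1≉0 (eq 1F))
          (trans (solve 4 (λ a b c x → a :* :1 :+ (b :* :0 :+ (c :* x :+ :0)) := c :* x :+ a) refl (h 0F) (h 1F) (h 2F) _) (solve-zero nz))
          (trans (solve 4 (λ a b c x → a :* :0 :+ (b :* :1 :+ (c :* x :+ :0)) := c :* x :+ b) refl (h 0F) (h 1F) (h 2F) _) (solve-zero nz))
          refl 1≉0)

      -- As t is rational, the conjugate of h vanishes at t as well, and p × t = h′ (h · t) - h (h′
      -- · t) is zero.
      cross∼t : p ∼ t
      cross∼t = p i * t i ⁻¹ , κ≉0 , p≋κt
        where
        i = proj₁ (nonzero-coordinate (proj₂ t∈))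
        ti≉0 = proj₂ (nonzero-coordinate (proj₂ t∈))
        h′t≈0 : dot h′ t ≈ 0#
        h′t≈0 = trans (dot-cong {h = h′} ≋-refl (≋-sym (proj₁ t∈))) (trans (sym (frob-dot 1 h t)) (trans (σ-cong 1 ht≈0) (σ-0 1)))
        double-cross : cross p t ≋ 𝟎
        double-cross = λ
          { 0F → trans (expand 0F) (vanish 0F) ; 1F → trans (expand 1F) (vanish 1F) ; 2F → trans (expand 2F) (vanish 2F) }
          where
          vanish : ∀ j → h′ j * dot h t - h j * dot h′ t ≈ 0#
          vanish j = trans (+-cong (*-congˡ ht≈0) (-‿cong (*-congˡ h′t≈0))) (solve 2 (λ a b → a :* :0 :- b :* :0 := :0) refl (h′ j) (h j))
          expand : ∀ j → cross p t j ≈ h′ j * dot h t - h j * dot h′ t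
          expand 0F = solve 9 (λ a b c x y z r s t → (c :* x :- a :* z) :* t :- (a :* y :- b :* x) :* s :=
            x :* (a :* r :+ (b :* s :+ (c :* t :+ :0))) :- a :* (x :* r :+ (y :* s :+ (z :* t :+ :0)))) refl (h 0F) (h 1F) (h 2F) (h′ 0F) (h′ 1F) (h′ 2F) (t 0F) (t 1F) (t 2F)
          expand 1F = solve 9 (λ a b c x y z r s t → (a :* y :- b :* x) :* r :- (b :* z :- c :* y) :* t :=
            y :* (a :* r :+ (b :* s :+ (c :* t :+ :0))) :- b :* (x :* r :+ (y :* s :+ (z :* t :+ :0)))) refl (h 0F) (h 1F) (h 2F) (h′ 0F) (h′ 1F) (h′ 2F) (t 0F) (t 1F) (t 2F)
          expand 2F = solve 9 (λ a b c x y z r s t → (b :* z :- c :* y) :* s :- (c :* x :- a :* z) :* r :=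
            z :* (a :* r :+ (b :* s :+ (c :* t :+ :0))) :- c :* (x :* r :+ (y :* s :+ (z :* t :+ :0)))) refl (h 0F) (h 1F) (h 2F) (h′ 0F) (h′ 1F) (h′ 2F) (t 0F) (t 1F) (t 2F)
        exchange : ∀ i j → p j * t i ≈ p i * t j
        exchange 0F 0F = refl
        exchange 1F 1F = refl
        exchange 2F 2F = refl
        exchange 0F 1F = sym (x∙y⁻¹≈ε⇒x≈y _ _ (double-cross 2F))
        exchange 1F 0F = x∙y⁻¹≈ε⇒x≈y _ _ (double-cross 2F)
        exchange 0F 2F = x∙y⁻¹≈ε⇒x≈y _ _ (double-cross 1F)
        exchange 2F 0F = sym (x∙y⁻¹≈ε⇒x≈y _ _ (double-cross 1F))
        exchange 1F 2F = sym (x∙y⁻¹≈ε⇒x≈y _ _ (double-cross 0F))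
        exchange 2F 1F = x∙y⁻¹≈ε⇒x≈y _ _ (double-cross 0F)
        p≋κt : p ≋ (p i * t i ⁻¹) ⊛ t
        p≋κt j = begin
          p j                      ≈⟨ trans (sym (*-identityʳ _)) (*-congˡ (sym (*-inverseʳ ti≉0))) ⟩
          p j * (t i * t i ⁻¹)     ≈⟨ *-assoc _ _ _ ⟨
          p j * t i * t i ⁻¹       ≈⟨ *-congʳ (exchange i j) ⟩
          p i * t j * t i ⁻¹       ≈⟨ solve 3 (λ a b c → a :* b :* c := a :* c :* b) refl (p i) (t j) (t i ⁻¹) ⟩
          p i * t i ⁻¹ * t j       ∎
        κ≉0 : ¬ p i * t i ⁻¹ ≈ 0#
        κ≉0 eq = cross≉0 (λ j → trans (p≋κt j) (trans (*-congʳ eq) (zeroˡ _)))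

      -- The resultant is the value of y² - x z at p, and p is a nonzero multiple of t.
      resultant≉0 : ¬ t 1F * t 1F ≈ t 0F * t 2F → ¬ resultant h h′ ≈ 0#
      resultant≉0 t∉ R≈0 = go cross∼t
        where
        go : p ∼ t → _
        go (κ , κ≉0 , p≋) = t∉ (x∙y⁻¹≈ε⇒x≈y _ _ (cancel-zero (*-nonzero κ≉0 κ≉0) (begin
          κ * κ * (t 1F * t 1F - t 0F * t 2F)
            ≈⟨ solve 4 (λ κ x y z → κ :* κ :* (y :* y :- x :* z) := κ :* y :* (κ :* y) :- κ :* x :* (κ :* z)) refl κ (t 0F) (t 1F) (t 2F) ⟩
          κ * t 1F * (κ * t 1F) - κ * t 0F * (κ * t 2F)    ≈⟨ +-cong (*-cong (p≋ 1F) (p≋ 1F)) (-‿cong (*-cong (p≋ 0F) (p≋ 2F))) ⟨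
          resultant h h′   ≈⟨ R≈0 ⟩
          0#               ∎)))

      -- With the rational factor at u = (s, t) in common, the cross product of h and its conjugate
      -- is the determinant times (s², s t, t²).
      det≉0 : ∀ {u g} → Over 1 u → h ≋ linear u ⊠ g → ¬ det g (frob 1 g) ≈ 0#
      det≉0 {u} {g} u∈ h≋ eq = cross≉0 (≋-trans (cross-cong h≋ h′≋) λ
          { 0F → minor-zero (solve 6 (λ s t a b x y → (:- t :* b :+ s :* a) :* (s :* y) :- s :* b :* (:- t :* y :+ s :* x) := s :* s :* (a :* y :- b :* x)) refl _ _ _ _ _ _)
          ; 1F → minor-zero (solve 6 (λ s t a b x y → s :* b :* (:- t :* x) :- :- t :* a :* (s :* y) := s :* t :* (a :* y :- b :* x)) refl _ _ _ _ _ _)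
          ; 2F → minor-zero (solve 6 (λ s t a b x y → :- t :* a :* (:- t :* y :+ s :* x) :- (:- t :* b :+ s :* a) :* (:- t :* x) := t :* t :* (a :* y :- b :* x)) refl _ _ _ _ _ _) })
        where
        g′ : V 2
        g′ = frob 1 g
        minor-zero : ∀ {x y} → x ≈ y * det g g′ → x ≈ 0#
        minor-zero e = trans e (trans (*-congˡ eq) (zeroʳ _))
        cross-cong : ∀ {f g f′ g′} → f ≋ f′ → g ≋ g′ → cross f g ≋ cross f′ g′
        cross-cong p r 0F = +-cong (*-cong (p 1F) (r 2F)) (-‿cong (*-cong (p 2F) (r 1F)))
        cross-cong p r 1F = +-cong (*-cong (p 2F) (r 0F)) (-‿cong (*-cong (p 0F) (r 2F)))
        cross-cong p r 2F = +-cong (*-cong (p 0F) (r 1F)) (-‿cong (*-cong (p 1F) (r 0F)))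
        h′≋ : h′ ≋ linear u ⊠ g′
        h′≋ 0F = trans (σ-cong 1 (h≋ 0F)) (trans (σ-* 1 _ _) (*-congʳ (InGF-neg 1 (u∈ 1F))))
        h′≋ 1F = trans (σ-cong 1 (h≋ 1F)) (trans (σ-+ 1 _ _) (+-cong (trans (σ-* 1 _ _) (*-congʳ (InGF-neg 1 (u∈ 1F)))) (trans (σ-* 1 _ _) (*-congʳ (u∈ 0F)))))
        h′≋ 2F = trans (σ-cong 1 (h≋ 2F)) (trans (σ-* 1 _ _) (*-congʳ (u∈ 0F)))

  open BinaryForms

  -- The conjugacy in a frame, spread planes and scroll-planes

  module TransversalPlanes where

    private
      variable
        p₁ p₂ : Level

    semilinear-∼ : ∀ B {X Y} → X ∼ Y → semilinear B X ∼ semilinear B Y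
    semilinear-∼ B X∼Y = ·-∼ B (frob-∼ 1 X∼Y)

    -- In the frame D of the subplane the conjugacy is X ↦ X^q, up to a scalar: it multiplies
    -- each Dᵢ by a scalar, and these agree because D₀ + D₁ + D₂ is fixed as well.
    module Conjugacy {π : Pred (V 3) p₁} (D : Vector (V 3) 3) (D-independent : Independent D)
                     (D∈ : ∀ t → Point 1 t → π (D · t)) (B : Vector (V 3) 3)
                     (fixes : ∀ X → π X → semilinear B X ∼ X) where

      private
        fixed : ∀ t → Point 1 t → semilinear B (D · t) ∼ D · t
        fixed t t∈ = fixes (D · t) (D∈ t t∈)

        one : V 3
        one _ = 1#

        one-point : Point 1 one
        one-point = (λ i → σ-1 1) , λ eq → 1≉0 (eq 0F)

        unit-point : ∀ i → Point 1 (unit {3} i)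
        unit-point i = unit-over 1 i , λ eq → 1≉0 (trans (sym (unit-diagonal i)) (eq i))
          where
          unit-diagonal : ∀ {n} (i : Fin n) → unit i i ≈ 1#
          unit-diagonal zero    = refl
          unit-diagonal (suc i) = unit-diagonal i

        μ : Carrier
        μ = proj₁ (fixed one one-point)

        μ≉0 : ¬ μ ≈ 0#
        μ≉0 = proj₁ (proj₂ (fixed one one-point))

        ν : V 3
        ν i = proj₁ (fixed (unit i) (unit-point i))

        image : V 3 → V 3
        image x = semilinear B (D · x)

        BD : Vector (V 3) 3
        BD j = B · frob 1 (D j)

        image-· : ∀ x → image x ≋ BD · frob 1 x
        image-· x = ≋-trans (·-congˡ B (frob-· 1 D x)) (≋-sym (·-∘ B (frob 1 ∘ D) (frob 1 x)))

        BD-ν : ∀ j → BD j ≋ ν j ⊛ D j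
        BD-ν j = ≋-trans (·-congˡ B (frob-cong 1 (≋-sym (·-unit D j)))) (≋-trans (proj₂ (proj₂ (fixed (unit j) (unit-point j)))) (⊛-cong refl (·-unit D j)))

        ν≈μ : ∀ j → ν j ≈ μ
        ν≈μ j = trans (trans (sym (*-identityʳ _)) (independent⇒injective {M = D} D-independent {λ j → ν j * 1#} {λ j → μ * 1#} (begin-≋) j)) (*-identityʳ μ)
          where
          begin-≋ : D · (λ j → ν j * 1#) ≋ D · (λ j → μ * 1#)
          begin-≋ = ≋-trans (≋-sym (·-scaled ν D one)) (≋-trans (·-congʳ one (λ j → ≋-sym (BD-ν j)))
            (≋-trans (·-congˡ BD (λ i → sym (σ-1 1))) (≋-trans (≋-sym (image-· one)) (≋-trans (proj₂ (proj₂ (fixed one one-point))) (≋-sym (·-⊛ D μ one))))))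

      step : ∀ x → semilinear B (D · x) ∼ D · frob 1 x
      step x = μ , μ≉0 , ≋-trans (image-· x) (≋-trans (·-congʳ (frob 1 x) (λ j → ≋-trans (BD-ν j) (⊛-cong (ν≈μ j) (≋-refl {v = D j}))))
        (≋-trans (·-scaled (λ _ → μ) D (frob 1 x)) (·-⊛ D μ (frob 1 x))))

      iterated : ∀ k {X} x → X ∼ D · x → iterate (semilinear B) X k ∼ D · frob k x
      iterated zero    {X} x X∼ = ∼-trans X∼ (≋⇒∼ (·-congˡ D (λ i → sym (*-identityʳ (x i)))))
      iterated (suc k) {X} x X∼ = ∼-trans (iterated k (frob 1 x) (∼-trans (semilinear-∼ B X∼) (step x))) (≋⇒∼ (·-congˡ D (frob-∘ k 1 x)))

    module Planes (ℬ : BosePlane) where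

      open Coordinates ℬ public

      -- The common shape of spread planes and scroll-planes: their spanning vectors differ from
      -- those of the three blocks only by scalars.
      Transversal : V 3 → V 3 → V 3 → V 9 → Set (c ⊔ ℓ₁)
      Transversal X Y Z y = ∃[ a ] ∃[ b ] ∃[ d ] y ≋ Φ (a ⊛ X) (b ⊛ Y) (d ⊛ Z)

      span⇔transversal : ∀ {X Y Z v₀ v₁ v₂} → v₀ ∼ φ X → v₁ ∼ φ₁ Y → v₂ ∼ φ₂ Z →
                         ∀ y → y ∈⟨ v₀ ∷ v₁ ∷ v₂ ∷ [] ⟩ ⇔ Transversal X Y Z y
      span⇔transversal {X} {Y} {Z} {v₀} {v₁} {v₂} (a₀ , a₀≉0 , p₀) (a₁ , a₁≉0 , p₁) (a₂ , a₂≉0 , p₂) y = mk⇔ to from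
        where
        Φ-scaled : ∀ a b d i → Φ (a ⊛ X) (b ⊛ Y) (d ⊛ Z) i ≈ a * φ X i + (b * φ₁ Y i + d * φ₂ Z i)
        Φ-scaled a b d i = +-cong (·-⊛ Γ a X i) (+-cong (·-⊛ (frob 1 ∘ Γ) b Y i) (·-⊛ (frob 2 ∘ Γ) d Z i))
        to : y ∈⟨ v₀ ∷ v₁ ∷ v₂ ∷ [] ⟩ → Transversal X Y Z y
        to (x , eq) = x 0F * a₀ , x 1F * a₁ , x 2F * a₂ , λ i → trans (eq i) (trans
          (+-cong (trans (*-congˡ (p₀ i)) (sym (*-assoc _ _ _))) (+-cong (trans (*-congˡ (p₁ i)) (sym (*-assoc _ _ _)))
            (trans (+-identityʳ _) (trans (*-congˡ (p₂ i)) (sym (*-assoc _ _ _))))))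
          (sym (Φ-scaled (x 0F * a₀) (x 1F * a₁) (x 2F * a₂) i)))
        from : Transversal X Y Z y → y ∈⟨ v₀ ∷ v₁ ∷ v₂ ∷ [] ⟩
        from (a , b , d , eq) = a * a₀ ⁻¹ ∷ b * a₁ ⁻¹ ∷ d * a₂ ⁻¹ ∷ [] , λ i → trans (eq i) (trans (Φ-scaled a b d i)
          (+-cong (undo a₀≉0 (p₀ i)) (+-cong (undo a₁≉0 (p₁ i)) (trans (undo a₂≉0 (p₂ i)) (sym (+-identityʳ _))))))
          where
          undo : ∀ {a a₀ v w} → ¬ a₀ ≈ 0# → v ≈ a₀ * w → a * w ≈ a * a₀ ⁻¹ * v
          undo {a} {a₀} {v} {w} a₀≉0 p = sym (begin
            a * a₀ ⁻¹ * v            ≈⟨ *-congˡ p ⟩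
            a * a₀ ⁻¹ * (a₀ * w)     ≈⟨ *-assoc a _ _ ⟩
            a * (a₀ ⁻¹ * (a₀ * w))   ≈⟨ *-congˡ (⁻¹-cancel a₀≉0) ⟩
            a * w                    ∎)

      φ-∼ : ∀ {X Y} → X ∼ Y → φ X ∼ φ Y
      φ-∼ = ·-∼ Γ

      conjugates⇔transversal : ∀ {X A A₁ A₂} → X ∼ A → frob 1 A ≋ A₁ → frob 2 A ≋ A₂ →
                               ∀ y → y ∈⟨ conjugates (φ X) ⟩ ⇔ Transversal A A₁ A₂ y
      conjugates⇔transversal {X} {A} {A₁} {A₂} X∼ e₁ e₂ = span⇔transversal {A} {A₁} {A₂} (φ-∼ X∼)
        (∼-trans (≋⇒∼ (frob1-φ X)) (·-∼ (frob 1 ∘ Γ) (∼-trans (frob-∼ 1 X∼) (≋⇒∼ e₁))))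
        (∼-trans (≋⇒∼ (frob2-φ X)) (·-∼ (frob 2 ∘ Γ) (∼-trans (frob-∼ 2 X∼) (≋⇒∼ e₂))))

      -- (X^(c⁵))^q and (X^(c⁴))^(q²) have the coordinates of X in the conjugate frames,
      -- since x^(q⁶) = x.
      scrollPlane⇔transversal : ∀ {π : Pred (V 3) p₁} (D : Vector (V 3) 3) (D-independent : Independent D)
        (D∈ : ∀ t → Point 1 t → π (D · t)) B (fixes : ∀ X → π X → semilinear B X ∼ X) →
        ∀ {X} x → X ∼ D · x → ∀ y → y ∈⟨ scrollPlane B X ⟩ ⇔ Transversal (D · x) ((frob 1 ∘ D) · x) ((frob 2 ∘ D) · x) y
      scrollPlane⇔transversal D D-independent D∈ B fixes {X} x X∼ =
        span⇔transversal {D · x} {(frob 1 ∘ D) · x} {(frob 2 ∘ D) · x} (φ-∼ X∼) second third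
        where
        open Conjugacy D D-independent D∈ B fixes
        X₅ = iterate (semilinear B) X 5
        X₄ = iterate (semilinear B) X 4
        second : frob 1 (φ X₅) ∼ φ₁ ((frob 1 ∘ D) · x)
        second = ∼-trans (≋⇒∼ (frob1-φ X₅)) (·-∼ (frob 1 ∘ Γ) (∼-trans (frob-∼ 1 (iterated 5 x X∼)) (≋⇒∼ (≋-trans (frob-· 1 D (frob 5 x))
          (·-congˡ (frob 1 ∘ D) (≋-trans (frob-∘ 1 5 x) (frob-6 x)))))))
        third : frob 2 (φ X₄) ∼ φ₂ ((frob 2 ∘ D) · x)
        third = ∼-trans (≋⇒∼ (frob2-φ X₄)) (·-∼ (frob 2 ∘ Γ) (∼-trans (frob-∼ 2 (iterated 4 x X∼)) (≋⇒∼ (≋-trans (frob-· 2 D (frob 4 x))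
          (·-congˡ (frob 2 ∘ D) (≋-trans (frob-∘ 2 4 x) (frob-6 x)))))))

    module Extension (D : Vector (V 3) 3) (D-over : ∀ j → Over 3 (D j)) (D-independent : Independent D)
                     {k} (𝒞⁺ : Conic k) (b : Carrier) (b≉0 : ¬ b ≈ 0#)
                     (equation : ∀ z → quad (Conic.form 𝒞⁺) (D · z) ≈ b * (z 1F * z 1F - z 0F * z 2F)) where

      preimage : ∀ j → (∀ i → Over j (D i)) → ∀ {X} → Point j X → (∀ z → X ≋ D · z → z 1F * z 1F ≈ z 0F * z 2F) →
                 ∃[ u ] Point j u × X ∼ D · veronese 2 u
      preimage j D∈ {X} (X∈ , X≉0) on = go (independent⇒basis {M = D} D-independent X)
        where
        go : X ∈⟨ D ⟩ → ∃[ u ] Point j u × X ∼ D · veronese 2 u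
        go (z , X≋) = go′ (veronese-surjective j (over-coordinates j {D} D-independent D∈ {z} (point-resp-over j X≋ X∈) , z≉0) (on z X≋))
          where
          z≉0 : ¬ z ≋ 𝟎
          z≉0 z≋0 = X≉0 (≋-trans X≋ (≋-trans (·-congˡ D z≋0) (·-𝟎 D)))
          go′ : ∃[ u ] Point j u × z ∼ veronese 2 u → ∃[ u ] Point j u × X ∼ D · veronese 2 u
          go′ (u , u∈ , z∼) = u , u∈ , ∼-trans (≋⇒∼ X≋) (·-∼ D z∼)

      to-parameter : ∀ j → (∀ i → Over j (D i)) → ∀ {X} → Point j X → X ∈ᶜ 𝒞⁺ → ∃[ u ] Point j u × X ∼ D · veronese 2 u
      to-parameter j D∈ {X} X∈ on = preimage j D∈ X∈ (λ z X≋ → x∙y⁻¹≈ε⇒x≈y _ _ (cancel-zero b≉0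
        (trans (sym (equation z)) (trans (quad-cong (Conic.form 𝒞⁺) (≋-sym X≋)) on))))

      from-parameter : ∀ {X} u → X ∼ D · veronese 2 u → X ∈ᶜ 𝒞⁺
      from-parameter {X} u (a , _ , X≋) = begin
        quad (Conic.form 𝒞⁺) X                             ≈⟨ quad-cong (Conic.form 𝒞⁺) X≋ ⟩
        quad (Conic.form 𝒞⁺) (a ⊛ (D · veronese 2 u))      ≈⟨ quad-⊛ (Conic.form 𝒞⁺) a (D · veronese 2 u) ⟩
        a * a * quad (Conic.form 𝒞⁺) (D · veronese 2 u)    ≈⟨ *-congˡ (trans (equation (veronese 2 u)) (trans (*-congˡ (x≈y⇒x∙y⁻¹≈ε (veronese-conic u))) (zeroʳ b))) ⟩
        a * a * 0#                                         ≈⟨ zeroʳ _ ⟩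
        0#                                                 ∎

  open TransversalPlanes

  -- The conic and the line at infinity, seen on the curve

  module LineAndConic where

    linear-cong : ∀ {u w} → u ≋ w → linear u ≋ linear w
    linear-cong eq 0F = -‿cong (eq 1F)
    linear-cong eq 1F = eq 0F

    frob-linear : ∀ k u → frob k (linear u) ≋ linear (frob k u)
    frob-linear k u 0F = σ-neg k (u 1F)
    frob-linear k u 1F = refl

    frob-⊠ : ∀ k f g → frob k (f ⊠ g) ≋ frob k f ⊠ frob k g
    frob-⊠ k f g 0F = σ-* k _ _
    frob-⊠ k f g 1F = trans (σ-+ k _ _) (+-cong (σ-* k _ _) (σ-* k _ _))
    frob-⊠ k f g 2F = σ-* k _ _

    ⊠-cong : ∀ {f g f′ g′} → f ≋ f′ → g ≋ g′ → f ⊠ g ≋ f′ ⊠ g′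
    ⊠-cong p r 0F = *-cong (p 0F) (r 0F)
    ⊠-cong p r 1F = +-cong (*-cong (p 0F) (r 1F)) (*-cong (p 1F) (r 0F))
    ⊠-cong p r 2F = *-cong (p 1F) (r 1F)

    dot-⊠ : ∀ f g (z : V 3) → dot (f ⊠ g) z ≈ (f ⋆ g ⋆ z) 0F
    dot-⊠ f g z = solve 7 (λ a b x y r s t → a :* x :* r :+ ((a :* y :+ b :* x) :* s :+ (b :* y :* t :+ :0)) :=
      a :* (x :* r :+ (y :* s :+ :0)) :+ (b :* (x :* s :+ (y :* t :+ :0)) :+ :0)) refl (f 0F) (f 1F) (g 0F) (g 1F) (z 0F) (z 1F) (z 2F)

    value-cong : ∀ {e} {f g : V (suc e)} u → f ≋ g → value f u ≈ value g u
    value-cong {e} u eq = dot-cong eq (≋-refl {v = monomials (suc e) u})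

    linear-zero : ∀ {r u : V 2} → ¬ r ≋ 𝟎 → ¬ u ≋ 𝟎 → value (linear r) u ≈ 0# → u ∼ r
    linear-zero {r} {u} r≉0 u≉0 eq = parallel⇒∼ r≉0 u≉0 (trans (sym (value-linear r u)) eq)

    linear-vanishes : ∀ {r u : V 2} → u ∼ r → value (linear r) u ≈ 0#
    linear-vanishes {r} {u} (a , _ , eq) = begin
      value (linear r) u                     ≈⟨ value-linear r u ⟩
      r 0F * u 1F - r 1F * u 0F              ≈⟨ +-cong (*-congˡ (eq 1F)) (-‿cong (*-congˡ (eq 0F))) ⟩
      r 0F * (a * r 1F) - r 1F * (a * r 0F)  ≈⟨ solve 3 (λ a x y → x :* (a :* y) :- y :* (a :* x) := :0) refl a (r 0F) (r 1F) ⟩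
      0#                                     ∎

    record LinearFactors (h : V 3) : Set (c ⊔ ℓ₁) where
      field
        r₁ r₂ : V 2
        r₁≉0  : ¬ r₁ ≋ 𝟎
        r₂≉0  : ¬ r₂ ≋ 𝟎
        h≋    : h ≋ linear r₁ ⊠ linear r₂

    module Line (𝒟 : Frame) where

      open Frame 𝒟
      open Section 𝒞
      open SectionForm sectionForm renaming (form to ℓ; over to ℓ-over; nonzero to ℓ-nonzero)

      L : Vector (V 3) 2
      L = Flat.basis ℓ∞

      h : V 3
      h j = dot ℓ (D j)

      h-dot : ∀ k x → dot (frob k ℓ) ((frob k ∘ D) · x) ≈ dot (frob k h) x
      h-dot k x = trans (dot-· (frob k ℓ) (frob k ∘ D) x) (dot-cong {h = λ j → dot (frob k ℓ) (frob k (D j))} {x = x} (λ j → sym (frob-dot k ℓ (D j))) ≋-refl)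

      h-dot₀ : ∀ x → dot ℓ (D · x) ≈ dot h x
      h-dot₀ = dot-· ℓ D

      h-over : Over 3 h
      h-over j = InGF-sum 3 (λ i → ℓ i * D j i) (λ i → InGF-* 3 (ℓ-over i) (D-over j i))

      h-nonzero : ¬ h ≋ 𝟎
      h-nonzero h≋0 = ℓ-nonzero (λ i → trans (sym (trans (sum-cong-≋ (λ j → *-comm (ℓ j) (unit i j))) (sum-unit i ℓ))) (vanish (unit i)))
        where
        vanish : ∀ y → dot ℓ y ≈ 0#
        vanish y = go (independent⇒basis {M = D} D-independent y)
          where
          go : y ∈⟨ D ⟩ → dot ℓ y ≈ 0#
          go (z , y≋) = trans (dot-cong {h = ℓ} ≋-refl y≋) (trans (h-dot₀ z) (trans (sum-cong-≋ (λ j → trans (*-congʳ (h≋0 j)) (zeroˡ (z j)))) (sum-replicate-zero 3)))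

      on-line⇔ : ∀ {X} x → X ∼ D · x → X ∈⟨ L ⟩ ⇔ dot h x ≈ 0#
      on-line⇔ {X} x X∼ = mk⇔
        (λ X∈ → trans (sym (h-dot₀ x)) (Equivalence.to (line (D · x)) (∈⟨⟩-∼ {M = L} (∼-sym X∼) X∈)))
        (λ eq → ∈⟨⟩-∼ {M = L} X∼ (Equivalence.from (line (D · x)) (trans (h-dot₀ x) eq)))

      module Roots (ρ : LinearFactors h) where

        open LinearFactors ρ

        h-value : ∀ u → dot h (veronese 2 u) ≈ value (linear r₁) u * value (linear r₂) u
        h-value u = trans (dot-cong h≋ (≋-refl {v = veronese 2 u})) (value-⊠ (linear r₁) (linear r₂) u)

        roots : ∀ {u} → ¬ u ≋ 𝟎 → dot h (veronese 2 u) ≈ 0# → u ∼ r₁ ⊎ u ∼ r₂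
        roots {u} u≉0 eq = [ (λ p → inj₁ (linear-zero r₁≉0 u≉0 p)) , (λ p → inj₂ (linear-zero r₂≉0 u≉0 p)) ]′ (noZeroDivisors (trans (sym (h-value u)) eq))

        root₁ : ∀ {u} → u ∼ r₁ → dot h (veronese 2 u) ≈ 0#
        root₁ {u} u∼ = trans (h-value u) (trans (*-congʳ (linear-vanishes {r₁} {u} u∼)) (zeroˡ _))

        root₂ : ∀ {u} → u ∼ r₂ → dot h (veronese 2 u) ≈ 0#
        root₂ {u} u∼ = trans (h-value u) (trans (*-congˡ (linear-vanishes {r₂} {u} u∼)) (zeroʳ _))

        meets : ∀ j → (∀ i → Over j (D i)) → ∀ {k} (𝒞⁺ : Conic k) b → ¬ b ≈ 0# →
                (∀ z → quad (Conic.form 𝒞⁺) (D · z) ≈ b * (z 1F * z 1F - z 0F * z 2F)) →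
                ∀ X → Point j X → (X ∈ᶜ 𝒞⁺ × X ∈⟨ L ⟩) ⇔ (X ∼ D · veronese 2 r₁ ⊎ X ∼ D · veronese 2 r₂)
        meets j D∈ 𝒞⁺ b b≉0 equation X X∈ = mk⇔ to from
          where
          open Extension D D-over D-independent 𝒞⁺ b b≉0 equation
          to : X ∈ᶜ 𝒞⁺ × X ∈⟨ L ⟩ → X ∼ D · veronese 2 r₁ ⊎ X ∼ D · veronese 2 r₂
          to (on , X∈L) = go (to-parameter j D∈ X∈ on)
            where
            go : ∃[ u ] Point j u × X ∼ D · veronese 2 u → X ∼ D · veronese 2 r₁ ⊎ X ∼ D · veronese 2 r₂
            go (u , (_ , u≉0) , X∼) = [ (λ u∼ → inj₁ (∼-trans X∼ (·-∼ D (veronese-∼ 2 u∼)))) , (λ u∼ → inj₂ (∼-trans X∼ (·-∼ D (veronese-∼ 2 u∼)))) ]′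
              (roots u≉0 (Equivalence.to (on-line⇔ (veronese 2 u) X∼) X∈L))
          from : X ∼ D · veronese 2 r₁ ⊎ X ∼ D · veronese 2 r₂ → X ∈ᶜ 𝒞⁺ × X ∈⟨ L ⟩
          from (inj₁ X∼) = from-parameter r₁ X∼ , Equivalence.from (on-line⇔ (veronese 2 r₁) X∼) (root₁ (∼-refl {v = r₁}))
          from (inj₂ X∼) = from-parameter r₂ X∼ , Equivalence.from (on-line⇔ (veronese 2 r₂) X∼) (root₂ (∼-refl {v = r₂}))

      module OnCurve (𝒻 : Factor) where

        open Factor 𝒻
        open Planes ℬ
        open AtInfinity ℓ∞ using (Σ∞)
        module 𝒦 = Curve 𝒟 𝒻

        module _ (compatible : ∀ x → dot ℓ (D · (frob 1 f ⋆ frob 2 f ⋆ x)) ≈ dot (frob 1 ℓ) ((frob 1 ∘ D) · (f ⋆ frob 2 f ⋆ x)) ×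
                                     dot (frob 1 ℓ) ((frob 1 ∘ D) · (f ⋆ frob 2 f ⋆ x)) ≈ dot (frob 2 ℓ) ((frob 2 ∘ D) · (f ⋆ frob 1 f ⋆ x))) where

          curve : NRC 𝒦.r Σ₆
          curve = 𝒦.curve compatible

          param : V 2 → V 9
          param = NRC.param curve

          γ : V 2 → V 3
          γ = 𝒦.γ

          frob-param : ∀ k u → frob k (param u) ≋ param (frob k u)
          frob-param k u = ≋-trans (frob-· k 𝒦.basis (veronese 𝒦.r u)) (·-cong (λ j → over-1⇒ k (𝒦.basis-over j)) (frob-veronese k 𝒦.r u))

          -- Two of the three weights contain the factor `value f u`, and the third is nonzero by
          -- coprimality: at a zero of f the curve meets Γ itself.
          param-root : ∀ {u} → ¬ u ≋ 𝟎 → value f u ≈ 0# → param u ∼ φ (γ u)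
          param-root {u} u≉0 fu≈0 = w₀ , w₀≉0 , λ i → trans (𝒦.param-Φ compatible u i) (trans
              (+-cong (·-⊛ Γ w₀ (γ u) i) (trans (+-cong (kill (frob 1 ∘ Γ) (𝒦.γ₁ u) (value (frob 2 f) u) i) (kill (frob 2 ∘ Γ) (𝒦.γ₂ u) (value (frob 1 f) u) i)) (+-identityʳ 0#)))
              (+-identityʳ _))
            where
            w₀ = value (frob 1 f) u * value (frob 2 f) u
            w₀≉0 : ¬ w₀ ≈ 0#
            w₀≉0 = *-nonzero (coprime-values {f = f} {g = frob 1 f} coprime₀₁ u≉0 fu≈0) (coprime-values {f = f} {g = frob 2 f} coprime₀₂ u≉0 fu≈0)
            kill : ∀ (M : Vector (V 9) 3) Y v i → (M · ((value f u * v) ⊛ Y)) i ≈ 0#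
            kill M Y v i = trans (·-⊛ M (value f u * v) Y i) (trans (*-congʳ (trans (*-congʳ fu≈0) (zeroˡ v))) (zeroˡ _))

          param-frob-root : ∀ k {u} → ¬ u ≋ 𝟎 → value f u ≈ 0# → param (frob k u) ∼ frob k (φ (γ u))
          param-frob-root k {u} u≉0 fu≈0 = ∼-trans (≋⇒∼ (≋-sym (frob-param k u))) (frob-∼ k (param-root u≉0 fu≈0))

          param-point : ∀ k {u} → Point k u → Point k (param u)
          param-point k (u∈ , u≉0) = 𝒦.param-over compatible k u∈ , 𝒦.param-nonzero compatible u≉0

          from-curve : ∀ {y u} → y ∼ param u → Transversal (γ u) (𝒦.γ₁ u) (𝒦.γ₂ u) y × y ∈⟨ S ⟩
          from-curve {y} {u} (a , a≉0 , y≋) = (a * w 0F , a * w 1F , a * w 2F , ≋-trans y≋ (≋-trans (⊛-cong refl (𝒦.param-Φ compatible u))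
              (≋-trans (≋-sym (Φ-⊛ a (w 0F ⊛ γ u) (w 1F ⊛ 𝒦.γ₁ u) (w 2F ⊛ 𝒦.γ₂ u)))
              (Φ-cong (λ i → sym (*-assoc a (w 0F) (γ u i))) (λ i → sym (*-assoc a (w 1F) (𝒦.γ₁ u i))) (λ i → sym (*-assoc a (w 2F) (𝒦.γ₂ u i))))))) ,
              ∈⟨⟩-∼ {M = S} (a , a≉0 , y≋) (𝒦.param∈S compatible u)
            where
            w : V 3
            w = 𝒦.weights compatible u

          -- κ is the factor that the forms of Σ₆ share beyond the conjugates of f: the value of the
          -- linear form at T if T is on C, and 1 otherwise.
          to-curve : ∀ {y u κ} → ¬ u ≋ 𝟎 → ¬ y ≋ 𝟎 → ¬ κ ≈ 0# → dot ℓ (γ u) ≈ κ * value f u →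
                     dot (frob 1 ℓ) (𝒦.γ₁ u) ≈ κ * value (frob 1 f) u → dot (frob 2 ℓ) (𝒦.γ₂ u) ≈ κ * value (frob 2 f) u →
                     Transversal (γ u) (𝒦.γ₁ u) (𝒦.γ₂ u) y → y ∈⟨ S ⟩ → y ∼ param u
          to-curve {y} {u} {κ} u≉0 y≉0 κ≉0 e₀ e₁ e₂ (a , b , d , y≋) y∈S =
            𝒦.on-curve compatible {u} {y} {a} {b} {d} u≉0 y≉0 y≋ (cancel {a} {b} (trans (sym at₀) (trans (proj₁ relations) at₁)))
              (cancel {b} {d} (trans (sym at₁) (trans (proj₂ relations) at₂)))
            where
            relations = Equivalence.to (affine (a ⊛ γ u) (b ⊛ 𝒦.γ₁ u) (d ⊛ 𝒦.γ₂ u)) (∈⟨⟩-resp {M = S} y≋ y∈S)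
            scaled : ∀ {k X : V 3} {a v} → dot k X ≈ κ * v → dot k (a ⊛ X) ≈ κ * (a * v)
            scaled {k} {X} {a} {v} e = trans (dot-⊛ k a X) (trans (*-congˡ e) (solve 3 (λ a κ v → a :* (κ :* v) := κ :* (a :* v)) refl a κ v))
            at₀ : dot ℓ (a ⊛ γ u) ≈ κ * (a * value f u)
            at₀ = scaled {ℓ} {γ u} e₀
            at₁ : dot (frob 1 ℓ) (b ⊛ 𝒦.γ₁ u) ≈ κ * (b * value (frob 1 f) u)
            at₁ = scaled {frob 1 ℓ} {𝒦.γ₁ u} e₁
            at₂ : dot (frob 2 ℓ) (d ⊛ 𝒦.γ₂ u) ≈ κ * (d * value (frob 2 f) u)
            at₂ = scaled {frob 2 ℓ} {𝒦.γ₂ u} e₂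
            cancel : ∀ {a b v w} → κ * (a * v) ≈ κ * (b * w) → a * v ≈ b * w
            cancel = *-cancelˡ κ≉0

  open LineAndConic

  -- The case of T on the conic: a curve of degree 4

  module TangentSubplane where

    FirstConclusion : ∀ {p} (ℬ : BosePlane) (ℓ∞ : Flat 3 2 1) (Σ₆ : Flat 1 8 6) (C : Pred (V 3) p) (T : V 3) (C⁺ : Conic 3) → Set (c ⊔ ℓ₁ ⊔ p)
    FirstConclusion ℬ ℓ∞ Σ₆ C T C⁺ = Σ (V 3) λ Q → Point 3 Q × ¬ Q ∼ T ×
      (∀ X → Point 3 X → (X ∈ᶜ C⁺ × X ∈⟨ Flat.basis ℓ∞ ⟩) ⇔ (X ∼ T ⊎ X ∼ Q)) ×
      (Σ (NRC 4 Σ₆) λ N₄ →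
        (∀ y → [_]ₛ ℬ Σ₆ C y ⇔ ([_] ℬ Σ₆ T y ⊎ NRC.curve N₄ 1 y)) ×
        (Σ (V 9) λ R → [_] ℬ Σ₆ T R ×
          (∀ y → Point 3 y → (NRC.curve N₄ 3 y × y ∈⟨ atInfinity ℬ ℓ∞ ⟩) ⇔ (∃[ i ] y ∼ (R ∷ conjugates (BosePlane.φ ℬ Q)) i))))

    record TangentConic : Setω where
      field
        {p₁ p₂}      : Level
        𝒞            : Configuration
        sectionForm  : Section.SectionForm 𝒞
        π            : Pred (V 3) p₁
        C            : Pred (V 3) p₂
        parametrised : Parametrised π C

      open Configuration 𝒞 public

      field
        T       : V 3
        T∈L     : T ∈⟨ Flat.basis ℓ∞ ⟩
        tangent : ∀ X → π X → X ∈⟨ Flat.basis ℓ∞ ⟩ → X ∼ T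
        C⁺      : Conic 3
        C⊆C⁺    : ∀ X → C X → X ∈ᶜ C⁺

      open Parametrised parametrised public using (D; D-over; D-independent; plane; conic)

      frame : Frame
      frame = record { sectionForm = sectionForm ; D-over = D-over ; D-independent = D-independent }

    module Setting (𝒯 : TangentConic) where

      open TangentConic 𝒯
      open Line frame public
      open Section 𝒞 public
      open SectionForm sectionForm public using (infinity; affine) renaming (form to ℓ)
      open Planes ℬ public
      open AtInfinity ℓ∞ public using (Σ∞)

      D·-point : ∀ {t} → Point 1 t → Point 3 (D · t)
      D·-point {t} (t∈ , t≉0) = over-· 3 {D} D-over (over-1⇒ 3 t∈) , independent-nonzero {M = D} D-independent {t} t≉0

      γ-point : ∀ k {u} → (∀ i → Over k (D i)) → Point k u → Point k (D · veronese 2 u)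
      γ-point k {u} D∈ (u∈ , u≉0) = over-· k {D} D∈ (over-veronese k 2 u∈) , independent-nonzero {M = D} D-independent {veronese 2 u} (veronese-nonzero u≉0)

      veronese-point : ∀ k {u} → Point k u → Point k (veronese 2 u)
      veronese-point k (u∈ , u≉0) = over-veronese k 2 u∈ , veronese-nonzero u≉0

      C∋γ : ∀ {u} → Point 1 u → C (D · veronese 2 u)
      C∋γ {u} u∈ = Equivalence.from (conic (D · veronese 2 u)) (D·-point (veronese-point 1 u∈) , u , u∈ , ∼-refl)

      π∋ : ∀ t → Point 1 t → π (D · t)
      π∋ t t∈ = Equivalence.from (plane (D · t)) (D·-point t∈ , t , t∈ , ∼-refl)

      module _ (t : V 3) (T∼ : T ∼ D · t) where

        ht≈0 : dot h t ≈ 0#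
        ht≈0 = Equivalence.to (on-line⇔ t T∼) T∈L

        only : ∀ v → Point 1 v → dot h v ≈ 0# → v ∼ t
        only v v∈ hv≈0 = independent-∼ {M = D} D-independent
          (∼-trans (tangent (D · v) (π∋ v v∈) (Equivalence.from (on-line⇔ v (∼-refl {v = D · v})) hv≈0)) T∼)

      conjugates⇔ : ∀ {X u} → Point 1 u → X ∼ D · veronese 2 u → ∀ y →
                    y ∈⟨ conjugates (φ X) ⟩ ⇔ Transversal (D · veronese 2 u) ((frob 1 ∘ D) · veronese 2 u) ((frob 2 ∘ D) · veronese 2 u) y
      conjugates⇔ {X} {u} (u∈ , _) X∼ = conjugates⇔transversal X∼ (image 1) (image 2)
        where
        image : ∀ k → frob k (D · veronese 2 u) ≋ (frob k ∘ D) · veronese 2 u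
        image k = ≋-trans (frob-· k D (veronese 2 u)) (·-congˡ (frob k ∘ D) (over-veronese k 2 (over-1⇒ k u∈)))

      -- The linear form at T splits off: h = linear u₀ ⊠ f, and f plays the role of h.
      record Splitting : Set (c ⊔ ℓ₁ ⊔ p₂) where
        field
          CT  : C T
          u₀  : V 2
          u₀∈ : Point 1 u₀
          T∼  : T ∼ D · veronese 2 u₀
          g   : V 2
          g∈  : Over 3 g
          h≋g : h ≋ linear u₀ ⊠ g

      module OnConic (𝓈 : Splitting) where

        open Splitting 𝓈

        r₂ : V 2
        r₂ = root g

        f : V 2
        f = linear r₂

        f∈ : Over 3 f
        f∈ = point-resp-over 3 (≋-sym (linear-root g)) g∈

        r₂∈ : Over 3 r₂
        r₂∈ 0F = g∈ 1F
        r₂∈ 1F = InGF-neg 3 (g∈ 0F)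

        h≋ : h ≋ linear u₀ ⊠ f
        h≋ = ≋-trans h≋g (⊠-cong {linear u₀} {g} {linear u₀} {f} (≋-refl {v = linear u₀}) (≋-sym (linear-root g)))

        d : Carrier
        d = det f (frob 1 f)

        d≉0 : ¬ d ≈ 0#
        d≉0 = Tangent.det≉0 h h-nonzero (veronese 2 u₀) (veronese-point 1 u₀∈) (ht≈0 (veronese 2 u₀) T∼) (only (veronese 2 u₀) T∼) {u₀} {f} (proj₁ u₀∈) h≋

        coprime₀₁ : Coprime 3 f (frob 1 f)
        coprime₀₁ = linear-coprime₃ {f} {frob 1 f} d≉0

        -- `σ 2` sends the determinant of f and f₁ to that of f₂ and f, as f is over GF(q³).
        coprime₀₂ : Coprime 3 f (frob 2 f)
        coprime₀₂ = linear-coprime₃ {f} {frob 2 f} (λ eq → σ-≉0 2 d≉0 (begin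
          σ 2 d                                   ≈⟨ det-frob 2 f (frob 1 f) ⟩
          det (frob 2 f) (frob 2 (frob 1 f))      ≈⟨ det-cong {frob 2 f} {frob 2 (frob 1 f)} {frob 2 f} {f} (≋-refl {v = frob 2 f}) (≋-trans (frob-∘ 2 1 f) f∈) ⟩
          det (frob 2 f) f                        ≈⟨ det-swap (frob 2 f) f ⟩
          - det f (frob 2 f)                      ≈⟨ -‿cong eq ⟩
          - 0#                                    ≈⟨ solve 0 (:- :0 := :0) refl ⟩
          0#                                      ∎))

        coprime₁₂ : Coprime 4 (frob 1 f) (frob 2 f)
        coprime₁₂ = linear-coprime₄ {frob 1 f} {frob 2 f} (λ eq → σ-≉0 1 d≉0 (trans (det-frob 1 f (frob 1 f))
          (trans (det-cong {frob 1 f} {frob 1 (frob 1 f)} {frob 1 f} {frob 2 f} (≋-refl {v = frob 1 f}) (frob-∘ 1 1 f)) eq)))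

        r₂≉0 : ¬ r₂ ≋ 𝟎
        r₂≉0 eq = d≉0 (trans (+-cong (trans (*-congʳ f₀) (zeroˡ _)) (-‿cong (trans (*-congʳ f₁) (zeroˡ _)))) (solve 0 (:0 :- :0 := :0) refl))
          where
          f₀ : f 0F ≈ 0#
          f₀ = trans (-‿cong (eq 1F)) (solve 0 (:- :0 := :0) refl)
          f₁ : f 1F ≈ 0#
          f₁ = eq 0F

        frob-h : ∀ k → frob k h ≋ linear u₀ ⊠ frob k f
        frob-h k = ≋-trans (frob-cong k h≋) (≋-trans (frob-⊠ k (linear u₀) f) (⊠-cong {frob k (linear u₀)} {frob k f} {linear u₀} {frob k f}
          (≋-trans (frob-linear k u₀) (linear-cong {frob k u₀} {u₀} (over-1⇒ k (proj₁ u₀∈)))) (≋-refl {v = frob k f})))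

        form-⋆ : ∀ k z → dot (frob k ℓ) ((frob k ∘ D) · z) ≈ (linear u₀ ⋆ frob k f ⋆ z) 0F
        form-⋆ k z = trans (h-dot k z) (trans (dot-cong (frob-h k) (≋-refl {v = z})) (dot-⊠ (linear u₀) (frob k f) z))

        form-⋆₀ : ∀ z → dot ℓ (D · z) ≈ (linear u₀ ⋆ f ⋆ z) 0F
        form-⋆₀ z = trans (h-dot₀ z) (trans (dot-cong h≋ (≋-refl {v = z})) (dot-⊠ (linear u₀) f z))

        -- All three are the product of `linear u₀` with f and its two conjugates, acting on x;
        -- `linear u₀` is its own conjugate because u₀ is rational.
        compatible : ∀ (x : V 5) → dot ℓ (D · (frob 1 f ⋆ frob 2 f ⋆ x)) ≈ dot (frob 1 ℓ) ((frob 1 ∘ D) · (f ⋆ frob 2 f ⋆ x)) ×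
                                   dot (frob 1 ℓ) ((frob 1 ∘ D) · (f ⋆ frob 2 f ⋆ x)) ≈ dot (frob 2 ℓ) ((frob 2 ∘ D) · (f ⋆ frob 1 f ⋆ x))
        compatible x = trans (form-⋆₀ (f₁ ⋆ f₂ ⋆ x)) (trans (⋆-cong (linear u₀) (⋆-comm f f₁ (f₂ ⋆ x)) 0F) (sym (form-⋆ 1 (f ⋆ f₂ ⋆ x)))) ,
            trans (form-⋆ 1 (f ⋆ f₂ ⋆ x)) (trans (⋆-cong (linear u₀) (≋-trans (⋆-cong f₁ (⋆-comm f f₂ x))
              (≋-trans (⋆-comm f₁ f₂ (f ⋆ x)) (⋆-cong f₂ (⋆-comm f₁ f x)))) 0F) (sym (form-⋆ 2 (f ⋆ f₁ ⋆ x))))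
          where
          f₁ f₂ : V 2
          f₁ = frob 1 f
          f₂ = frob 2 f

        form-value : ∀ k u → dot (frob k ℓ) ((frob k ∘ D) · veronese 2 u) ≈ value (linear u₀) u * value (frob k f) u
        form-value k u = trans (h-dot k (veronese 2 u)) (trans (dot-cong (frob-h k) (≋-refl {v = veronese 2 u})) (value-⊠ (linear u₀) (frob k f) u))

        form-value₀ : ∀ u → dot ℓ (D · veronese 2 u) ≈ value (linear u₀) u * value f u
        form-value₀ u = trans (h-dot₀ (veronese 2 u)) (trans (dot-cong h≋ (≋-refl {v = veronese 2 u})) (value-⊠ (linear u₀) f u))

        factor : Factor
        factor = record { f-over = f∈ ; coprime₀₁ = coprime₀₁ ; coprime₀₂ = coprime₀₂ ; coprime₁₂ = coprime₁₂ }

        open OnCurve factor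

        N₄ : NRC 4 Σ₆
        N₄ = curve compatible

        par : V 2 → V 9
        par = param compatible

        Q : V 3
        Q = D · veronese 2 r₂

        Q∈ : Point 3 Q
        Q∈ = γ-point 3 {r₂} D-over (r₂∈ , r₂≉0)

        -- Otherwise r₂ is proportional to the rational u₀, so f is proportional to its conjugate
        -- and the determinant `d` vanishes.
        Q≁T : ¬ Q ∼ T
        Q≁T Q∼T = go (veronese-injective {r₂} {u₀} (independent-∼ {M = D} D-independent (∼-trans Q∼T T∼)) (proj₂ u₀∈) r₂≉0)
          where
          go : r₂ ∼ u₀ → _
          go (a , _ , eq) = d≉0 (begin
            - r₂ 1F * σ 1 (r₂ 0F) - r₂ 0F * σ 1 (- r₂ 1F)
              ≈⟨ +-cong (*-cong (-‿cong (eq 1F)) (trans (σ-cong 1 (eq 0F)) (trans (σ-* 1 a _) (*-congˡ (proj₁ u₀∈ 0F)))))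
                   (-‿cong (*-cong (eq 0F) (trans (σ-neg 1 _) (-‿cong (trans (σ-cong 1 (eq 1F)) (trans (σ-* 1 a _) (*-congˡ (proj₁ u₀∈ 1F)))))))) ⟩
            - (a * u₀ 1F) * (σ 1 a * u₀ 0F) - a * u₀ 0F * - (σ 1 a * u₀ 1F)
              ≈⟨ solve 4 (λ a b x y → :- (a :* y) :* (b :* x) :- a :* x :* :- (b :* y) := :0) refl a (σ 1 a) (u₀ 0F) (u₀ 1F) ⟩
            0#   ∎)

        meets-line : ∀ X → Point 3 X → (X ∈ᶜ C⁺ × X ∈⟨ L ⟩) ⇔ (X ∼ T ⊎ X ∼ Q)
        meets-line X X∈ = mk⇔ ([ (λ X∼ → inj₁ (∼-trans X∼ (∼-sym T∼))) , inj₂ ]′ ∘ Equivalence.to X⇔)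
                              (Equivalence.from X⇔ ∘ [ (λ X∼ → inj₁ (∼-trans X∼ T∼)) , inj₂ ]′)
          where
          factors : LinearFactors h
          factors = record { r₁≉0 = proj₂ u₀∈ ; r₂≉0 = r₂≉0 ; h≋ = h≋ }
          open Roots factors
          equation = extension-equation D D-independent C⁺ (λ u u∈ → C⊆C⁺ (D · veronese 2 u) (C∋γ {u} u∈))
          X⇔ : (X ∈ᶜ C⁺ × X ∈⟨ L ⟩) ⇔ (X ∼ D · veronese 2 u₀ ⊎ X ∼ D · veronese 2 r₂)
          X⇔ = meets 3 D-over C⁺ (proj₁ equation) (proj₁ (proj₂ equation)) (proj₂ (proj₂ equation)) X X∈

        pointset : ∀ y → [_]ₛ ℬ Σ₆ C y ⇔ ([_] ℬ Σ₆ T y ⊎ NRC.curve N₄ 1 y)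
        pointset y = mk⇔ to from
          where
          to : [_]ₛ ℬ Σ₆ C y → [_] ℬ Σ₆ T y ⊎ NRC.curve N₄ 1 y
          to (X , CX , (y∈ , y∈X) , y∈S) = go (proj₂ (Equivalence.to (conic X) CX))
            where
            go : ∃[ u ] Point 1 u × X ∼ D · veronese 2 u → [_] ℬ Σ₆ T y ⊎ NRC.curve N₄ 1 y
            go (u , u∈ , X∼) = by (value (linear u₀) u ≈? 0#)
              where
              transversal = Equivalence.to (conjugates⇔ {X} {u} u∈ X∼ y) y∈X
              -- `linear u₀` vanishes only at the parameter of T, and there y lies in the spread
              -- plane of T; elsewhere its value is a nonzero common factor of the equations and
              -- cancels.
              by : Dec (value (linear u₀) u ≈ 0#) → [_] ℬ Σ₆ T y ⊎ NRC.curve N₄ 1 y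
              by (yes eq) = inj₁ ((y∈ , Equivalence.from (conjugates⇔ {T} {u} u∈
                (∼-trans T∼ (·-∼ D (veronese-∼ 2 (∼-sym (linear-zero {u₀} {u} (proj₂ u₀∈) (proj₂ u∈) eq))))) y) transversal) , y∈S)
              by (no neq) = inj₂ (y∈ , u , u∈ ,
                to-curve compatible {y} {u} {value (linear u₀) u} (proj₂ u∈) (proj₂ y∈) neq (form-value₀ u) (form-value 1 u) (form-value 2 u) transversal y∈S)
          from : [_] ℬ Σ₆ T y ⊎ NRC.curve N₄ 1 y → [_]ₛ ℬ Σ₆ C y
          from (inj₁ y∈T) = T , CT , y∈T
          from (inj₂ (y∈ , u , u∈ , y∼)) = D · veronese 2 u , C∋γ {u} u∈ ,
            (y∈ , Equivalence.from (conjugates⇔ {D · veronese 2 u} {u} u∈ (∼-refl {v = D · veronese 2 u}) y) (proj₁ (from-curve compatible {y} {u} y∼))) ,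
            proj₂ (from-curve compatible {y} {u} y∼)

        -- The curve at the rational parameter of T: ℓ still vanishes there through `linear u₀`, so
        -- this point is at infinity.
        R : V 9
        R = par u₀

        R∈T : [_] ℬ Σ₆ T R
        R∈T = (param-point compatible 1 {u₀} u₀∈ , Equivalence.from (conjugates⇔ {T} {u₀} u₀∈ T∼ R) (proj₁ (from-curve compatible {R} {u₀} (∼-refl {v = R})))) ,
              proj₂ (from-curve compatible {R} {u₀} (∼-refl {v = R}))

        f-r₂ : value f r₂ ≈ 0#
        f-r₂ = linear-vanishes {r₂} {r₂} (∼-refl {v = r₂})

        at-infinity : ∀ y → Point 3 y → (NRC.curve N₄ 3 y × y ∈⟨ Σ∞ ⟩) ⇔ (∃[ i ] y ∼ (R ∷ conjugates (φ Q)) i)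
        at-infinity y y∈ = mk⇔ to from
          where
          -- The equation of infinity on the curve, a quartic with one linear factor for each of the
          -- four points.
          product : V 2 → Carrier
          product u = value (linear u₀) u * value f u * (value (frob 1 f) u * value (frob 2 f) u)
          frob-root : ∀ k {u} → ¬ u ≋ 𝟎 → value (frob k f) u ≈ 0# → u ∼ frob k r₂
          frob-root k {u} u≉0 eq = linear-zero {frob k r₂} {u} (frob-nonzero k r₂≉0) u≉0
            (trans (value-cong {f = linear (frob k r₂)} {g = frob k f} u (≋-sym (frob-linear k r₂))) eq)
          root-frob : ∀ k → value (frob k f) (frob k r₂) ≈ 0#
          root-frob k = trans (sym (frob-value k f r₂)) (trans (σ-cong k f-r₂) (σ-0 k))
          to : NRC.curve N₄ 3 y × y ∈⟨ Σ∞ ⟩ → ∃[ i ] y ∼ (R ∷ conjugates (φ Q)) i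
          to ((_ , u , (u∈ , u≉0) , y∼) , y∈Σ∞) = split (noZeroDivisors (𝒦.at-line compatible {value (linear u₀) u * value f u} {u} (form-value₀ u) y∼ y∈Σ∞))
            where
            via : ∀ {v} → u ∼ v → y ∼ par v
            via u∼v = ∼-trans y∼ (𝒦.param-∼ compatible u∼v)
            split : value (linear u₀) u * value f u ≈ 0# ⊎ value (frob 1 f) u * value (frob 2 f) u ≈ 0# → ∃[ i ] y ∼ (R ∷ conjugates (φ Q)) i
            split (inj₁ p) = [ (λ e → 0F , via {u₀} (linear-zero {u₀} {u} (proj₂ u₀∈) u≉0 e)) ,
              (λ e → 1F , ∼-trans (via {r₂} (linear-zero {r₂} {u} r₂≉0 u≉0 e)) (param-root compatible {r₂} r₂≉0 f-r₂)) ]′ (noZeroDivisors p)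
            split (inj₂ p) = [ (λ e → 2F , ∼-trans (via {frob 1 r₂} (frob-root 1 {u} u≉0 e)) (param-frob-root compatible 1 {r₂} r₂≉0 f-r₂)) ,
              (λ e → 3F , ∼-trans (via {frob 2 r₂} (frob-root 2 {u} u≉0 e)) (param-frob-root compatible 2 {r₂} r₂≉0 f-r₂)) ]′ (noZeroDivisors p)
          over-frob : ∀ k → Over 3 (frob k r₂)
          over-frob k i = trans (σ-∘ 3 k (r₂ i)) (trans (^-congʳ (r₂ i) (≡.cong (q ℕ.^_) (ℕ.+-comm k 3))) (trans (sym (σ-∘ k 3 (r₂ i))) (σ-cong k (r₂∈ i))))
          meets-at : ∀ u → Point 3 u → y ∼ par u → product u ≈ 0# → NRC.curve N₄ 3 y × y ∈⟨ Σ∞ ⟩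
          meets-at u u∈ y∼ eq = (y∈ , u , u∈ , y∼) , 𝒦.on-line compatible {value (linear u₀) u * value f u} {u} (form-value₀ u) y∼ eq
          r₂-point : ∀ k → Point 3 (frob k r₂)
          r₂-point k = over-frob k , frob-nonzero k r₂≉0
          from : ∃[ i ] y ∼ (R ∷ conjugates (φ Q)) i → NRC.curve N₄ 3 y × y ∈⟨ Σ∞ ⟩
          from (0F , y∼) = meets-at u₀ (over-1⇒ 3 (proj₁ u₀∈) , proj₂ u₀∈) y∼
            (trans (*-congʳ (trans (*-congʳ (linear-vanishes {u₀} {u₀} (∼-refl {v = u₀}))) (zeroˡ _))) (zeroˡ _))
          from (1F , y∼) = meets-at r₂ (r₂∈ , r₂≉0) (∼-trans y∼ (∼-sym (param-root compatible {r₂} r₂≉0 f-r₂)))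
            (trans (*-congʳ (trans (*-congˡ f-r₂) (zeroʳ _))) (zeroˡ _))
          from (2F , y∼) = meets-at (frob 1 r₂) (r₂-point 1) (∼-trans y∼ (∼-sym (param-frob-root compatible 1 {r₂} r₂≉0 f-r₂)))
            (trans (*-congˡ (trans (*-congʳ (root-frob 1)) (zeroˡ _))) (zeroʳ _))
          from (3F , y∼) = meets-at (frob 2 r₂) (r₂-point 2) (∼-trans y∼ (∼-sym (param-frob-root compatible 2 {r₂} r₂≉0 f-r₂)))
            (trans (*-congˡ (trans (*-congˡ (root-frob 2)) (zeroʳ _))) (zeroʳ _))

      case₁ : C T → FirstConclusion ℬ ℓ∞ Σ₆ C T C⁺
      case₁ CT = go (proj₂ (Equivalence.to (conic T) CT))
        where
        go : ∃[ u ] Point 1 u × T ∼ D · veronese 2 u → FirstConclusion ℬ ℓ∞ Σ₆ C T C⁺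
        go (u₀ , u₀∈ , T∼) = go′ (factor-at 3 {h} {u₀} h-over (over-1⇒ 3 (proj₁ u₀∈)) (proj₂ u₀∈) (ht≈0 (veronese 2 u₀) T∼))
          where
          go′ : ∃[ g ] Over 3 g × h ≋ linear u₀ ⊠ g → FirstConclusion ℬ ℓ∞ Σ₆ C T C⁺
          go′ (g , g∈ , h≋g) = Q , Q∈ , Q≁T , meets-line , N₄ , pointset , R , R∈T , at-infinity
            where
            splitting : Splitting
            splitting = record { CT = CT ; u₀∈ = u₀∈ ; T∼ = T∼ ; g∈ = g∈ ; h≋g = h≋g }
            open OnConic splitting

  open TangentSubplane

  -- The case of T off the conic: a curve of degree 6

  module TangentOffConic where

    product : ∀ {n} → V n → Carrier
    product = foldr _*_ 1#

    product-zero : ∀ {n} (f : V n) → product f ≈ 0# → ∃[ i ] f i ≈ 0#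
    product-zero {zero}  f eq = contradiction eq 1≉0
    product-zero {suc n} f eq = [ (λ p → zero , p) , (λ p → let i , r = product-zero (f ∘ suc) p in suc i , r) ]′ (noZeroDivisors eq)

    zero-product : ∀ {n} (f : V n) i → f i ≈ 0# → product f ≈ 0#
    zero-product f zero    eq = trans (*-congʳ eq) (zeroˡ _)
    zero-product f (suc i) eq = trans (*-congˡ (zero-product (f ∘ suc) i eq)) (zeroʳ _)

    record OffConic : Setω where
      field
        𝒯 : TangentConic

      open TangentConic 𝒯 public

      field
        T∈  : Point 3 T
        CT∉ : ¬ C T
        t   : V 3
        t∈  : Point 1 t
        T∼  : T ∼ D · t

    module SixPoints (𝒪 : OffConic) where

      open OffConic 𝒪
      open Setting 𝒯

      t∉ : ¬ t 1F * t 1F ≈ t 0F * t 2F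
      t∉ eq = go (veronese-surjective 1 t∈ eq)
        where
        go : ∃[ u ] Point 1 u × t ∼ veronese 2 u → _
        go (u , u∈ , t∼) = CT∉ (Equivalence.from (conic T) (T∈ , u , u∈ , ∼-trans T∼ (·-∼ D t∼)))

      R : Carrier
      R = resultant h (frob 1 h)

      R≉0 : ¬ R ≈ 0#
      R≉0 = Tangent.resultant≉0 h h-nonzero t t∈ (ht≈0 t T∼) (only t T∼) t∉

      coprime₀₁ : Coprime 3 h (frob 1 h)
      coprime₀₁ = quadratic-coprime₃ {h} {frob 1 h} R≉0

      coprime₀₂ : Coprime 3 h (frob 2 h)
      coprime₀₂ = quadratic-coprime₃ {h} {frob 2 h} (λ eq → σ-≉0 2 R≉0 (begin
        σ 2 R                                     ≈⟨ resultant-frob 2 h (frob 1 h) ⟩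
        resultant (frob 2 h) (frob 2 (frob 1 h))  ≈⟨ resultant-cong {frob 2 h} {frob 2 (frob 1 h)} {frob 2 h} {h} (≋-refl {v = frob 2 h}) (≋-trans (frob-∘ 2 1 h) h-over) ⟩
        resultant (frob 2 h) h                    ≈⟨ resultant-sym (frob 2 h) h ⟩
        resultant h (frob 2 h)                    ≈⟨ eq ⟩
        0#                                        ∎))

      coprime₁₂ : Coprime 5 (frob 1 h) (frob 2 h)
      coprime₁₂ = quadratic-coprime₅ {frob 1 h} {frob 2 h} (λ eq → σ-≉0 1 R≉0 (trans (resultant-frob 1 h (frob 1 h))
        (trans (resultant-cong {frob 1 h} {frob 1 (frob 1 h)} {frob 1 h} {frob 2 h} (≋-refl {v = frob 1 h}) (frob-∘ 1 1 h)) eq)))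

      -- All three are the product of h with its two conjugates, acting on x; a dot product with a
      -- form is its action leaving a single entry.
      compatible : ∀ (x : V 7) → dot ℓ (D · (frob 1 h ⋆ frob 2 h ⋆ x)) ≈ dot (frob 1 ℓ) ((frob 1 ∘ D) · (h ⋆ frob 2 h ⋆ x)) ×
                                 dot (frob 1 ℓ) ((frob 1 ∘ D) · (h ⋆ frob 2 h ⋆ x)) ≈ dot (frob 2 ℓ) ((frob 2 ∘ D) · (h ⋆ frob 1 h ⋆ x))
      compatible x = trans (h-dot₀ (h₁ ⋆ h₂ ⋆ x)) (trans (⋆-comm {n = 1} h h₁ (h₂ ⋆ x) 0F) (sym (h-dot 1 (h ⋆ h₂ ⋆ x)))) ,
          trans (h-dot 1 (h ⋆ h₂ ⋆ x)) (trans (≋-trans (⋆-cong {n = 1} h₁ (⋆-comm h h₂ x))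
            (≋-trans (⋆-comm {n = 1} h₁ h₂ (h ⋆ x)) (⋆-cong {n = 1} h₂ (⋆-comm h₁ h x))) 0F) (sym (h-dot 2 (h ⋆ h₁ ⋆ x))))
        where
        h₁ h₂ : V 3
        h₁ = frob 1 h
        h₂ = frob 2 h

      factor : Factor
      factor = record { f-over = h-over ; coprime₀₁ = coprime₀₁ ; coprime₀₂ = coprime₀₂ ; coprime₁₂ = coprime₁₂ }

      open OnCurve factor

      N₆ : NRC 6 Σ₆
      N₆ = curve compatible

      par : V 2 → V 9
      par = param compatible

      form-value₀ : ∀ u → dot ℓ (D · veronese 2 u) ≈ 1# * value h u
      form-value₀ u = trans (h-dot₀ (veronese 2 u)) (sym (*-identityˡ _))

      form-value : ∀ k u → dot (frob k ℓ) ((frob k ∘ D) · veronese 2 u) ≈ 1# * value (frob k h) u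
      form-value k u = trans (h-dot k (veronese 2 u)) (sym (*-identityˡ _))

      to-N₆ : ∀ {y u} → ¬ u ≋ 𝟎 → ¬ y ≋ 𝟎 → Transversal (D · veronese 2 u) ((frob 1 ∘ D) · veronese 2 u) ((frob 2 ∘ D) · veronese 2 u) y →
              y ∈⟨ S ⟩ → y ∼ par u
      to-N₆ {y} {u} u≉0 y≉0 = to-curve compatible {y} {u} {1#} u≉0 y≉0 1≉0 (form-value₀ u) (form-value 1 u) (form-value 2 u)

      equation⁺ : Σ Carrier λ b → ¬ b ≈ 0# × (∀ z → quad (Conic.form C⁺) (D · z) ≈ b * (z 1F * z 1F - z 0F * z 2F))
      equation⁺ = extension-equation D D-independent C⁺ (λ u u∈ → C⊆C⁺ (D · veronese 2 u) (C∋γ {u} u∈))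

      level₁ : {V₀ : Pred (V 9) ℓ₁} → (∀ y → Point 1 y → V₀ y ⇔ ⟦_⟧ₛ ℬ C y) →
               ∀ y → Point 1 y → (V₀ y × y ∈⟨ S ⟩) ⇔ NRC.curve N₆ 1 y
      level₁ {V₀} points y y∈ = mk⇔ to from
        where
        to : V₀ y × y ∈⟨ S ⟩ → NRC.curve N₆ 1 y
        to (y∈V , y∈S) = go (Equivalence.to (points y y∈) y∈V)
          where
          go : ⟦_⟧ₛ ℬ C y → NRC.curve N₆ 1 y
          go (X , CX , _ , y∈X) = go′ (proj₂ (Equivalence.to (conic X) CX))
            where
            go′ : ∃[ u ] Point 1 u × X ∼ D · veronese 2 u → NRC.curve N₆ 1 y
            go′ (u , u∈ , X∼) = y∈ , u , u∈ , to-N₆ {y} {u} (proj₂ u∈) (proj₂ y∈) (Equivalence.to (conjugates⇔ {X} {u} u∈ X∼ y) y∈X) y∈S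
        from : NRC.curve N₆ 1 y → V₀ y × y ∈⟨ S ⟩
        from (_ , u , u∈ , y∼) = Equivalence.from (points y y∈) (D · veronese 2 u , C∋γ {u} u∈ , y∈ ,
            Equivalence.from (conjugates⇔ {D · veronese 2 u} {u} u∈ (∼-refl {v = D · veronese 2 u}) y) (proj₁ (from-curve compatible {y} {u} y∼))) ,
          proj₂ (from-curve compatible {y} {u} y∼)

      -- One argument for levels 3 and 6: points of the extended conic have parameters over the same
      -- level, and the scroll-plane at parameter u is the transversal plane of the three conjugate
      -- frames at u.
      levelₖ : ∀ k → (∀ i → Over k (D i)) → {V₀ : Pred (V 9) ℓ₁} {j : ℕ} (𝒞⁺ : Conic j) →
               (Σ Carrier λ b → ¬ b ≈ 0# × (∀ z → quad (Conic.form 𝒞⁺) (D · z) ≈ b * (z 1F * z 1F - z 0F * z 2F))) →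
               (B : Vector (V 3) 3) → (∀ X → π X → semilinear B X ∼ X) →
               (∀ y → Point k y → V₀ y ⇔ (∃[ X ] Point k X × X ∈ᶜ 𝒞⁺ × y ∈⟨ scrollPlane B X ⟩)) →
               ∀ y → Point k y → (V₀ y × y ∈⟨ S ⟩) ⇔ NRC.curve N₆ k y
      levelₖ k D∈ {V₀} 𝒞⁺ (b , b≉0 , equation) B fixes points y y∈ = mk⇔ to from
        where
        open Extension D D-over D-independent 𝒞⁺ b b≉0 equation
        plane⇔ : ∀ {X} u → X ∼ D · veronese 2 u → y ∈⟨ scrollPlane B X ⟩ ⇔
                 Transversal (D · veronese 2 u) ((frob 1 ∘ D) · veronese 2 u) ((frob 2 ∘ D) · veronese 2 u) y
        plane⇔ u X∼ = scrollPlane⇔transversal D D-independent π∋ B fixes (veronese 2 u) X∼ y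
        to : V₀ y × y ∈⟨ S ⟩ → NRC.curve N₆ k y
        to (y∈V , y∈S) = go (Equivalence.to (points y y∈) y∈V)
          where
          go : ∃[ X ] Point k X × X ∈ᶜ 𝒞⁺ × y ∈⟨ scrollPlane B X ⟩ → NRC.curve N₆ k y
          go (X , X∈ , on , y∈X) = go′ (to-parameter k D∈ X∈ on)
            where
            go′ : ∃[ u ] Point k u × X ∼ D · veronese 2 u → NRC.curve N₆ k y
            go′ (u , u∈ , X∼) = y∈ , u , u∈ , to-N₆ {y} {u} (proj₂ u∈) (proj₂ y∈) (Equivalence.to (plane⇔ u X∼) y∈X) y∈S
        from : NRC.curve N₆ k y → V₀ y × y ∈⟨ S ⟩
        from (_ , u , u∈ , y∼) = Equivalence.from (points y y∈) (D · veronese 2 u , γ-point k {u} D∈ u∈ , from-parameter u (∼-refl {v = D · veronese 2 u}) ,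
            Equivalence.from (plane⇔ u (∼-refl {v = D · veronese 2 u})) (proj₁ (from-curve compatible {y} {u} y∼))) ,
          proj₂ (from-curve compatible {y} {u} y∼)

      module AtRoots (ρ : LinearFactors h) where

        open LinearFactors ρ
        open Roots ρ public using (roots; root₁; root₂; meets)

        P Q : V 3
        P = D · veronese 2 r₁
        Q = D · veronese 2 r₂

        PQ : Vector (V 9) 6
        PQ = conjugates (φ P) ++ conjugates (φ Q)

        parameters : Vector (V 2) 6
        parameters = (r₁ ∷ frob 1 r₁ ∷ frob 2 r₁ ∷ []) ++ (r₂ ∷ frob 1 r₂ ∷ frob 2 r₂ ∷ [])

        parameter-nonzero : ∀ i → ¬ parameters i ≋ 𝟎
        parameter-nonzero 0F = r₁≉0
        parameter-nonzero 1F = frob-nonzero 1 r₁≉0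
        parameter-nonzero 2F = frob-nonzero 2 r₁≉0
        parameter-nonzero 3F = r₂≉0
        parameter-nonzero 4F = frob-nonzero 1 r₂≉0
        parameter-nonzero 5F = frob-nonzero 2 r₂≉0

        PQ∼ : ∀ i → PQ i ∼ par (parameters i)
        PQ∼ 0F = ∼-sym (param-root compatible {r₁} r₁≉0 (root₁ (∼-refl {v = r₁})))
        PQ∼ 1F = ∼-sym (param-frob-root compatible 1 {r₁} r₁≉0 (root₁ (∼-refl {v = r₁})))
        PQ∼ 2F = ∼-sym (param-frob-root compatible 2 {r₁} r₁≉0 (root₁ (∼-refl {v = r₁})))
        PQ∼ 3F = ∼-sym (param-root compatible {r₂} r₂≉0 (root₂ (∼-refl {v = r₂})))
        PQ∼ 4F = ∼-sym (param-frob-root compatible 1 {r₂} r₂≉0 (root₂ (∼-refl {v = r₂})))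
        PQ∼ 5F = ∼-sym (param-frob-root compatible 2 {r₂} r₂≉0 (root₂ (∼-refl {v = r₂})))

        parallel : V 2 → V 2 → Carrier
        parallel u w = u 0F * w 1F - u 1F * w 0F

        -- The equation of infinity on the curve, split into linear factors in the order in which
        -- `PQ` lists the points.
        norm : ∀ w → value h w * (value (frob 1 h) w * value (frob 2 h) w) ≈ product (λ i → parallel (parameters i) w)
        norm w = trans (*-cong (trans (trans (dot-cong h≋ (≋-refl {v = veronese 2 w})) (value-⊠ (linear r₁) (linear r₂) w)) (*-cong (value-linear r₁ w) (value-linear r₂ w)))
              (*-cong (conjugate 1) (conjugate 2)))
            (solve 6 (λ a b a′ b′ a″ b″ → a :* b :* (a′ :* b′ :* (a″ :* b″)) := a :* (a′ :* (a″ :* (b :* (b′ :* (b″ :* :1))))))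
              refl (parallel r₁ w) (parallel r₂ w) (parallel (frob 1 r₁) w) (parallel (frob 1 r₂) w) (parallel (frob 2 r₁) w) (parallel (frob 2 r₂) w))
          where
          conjugate : ∀ k → value (frob k h) w ≈ parallel (frob k r₁) w * parallel (frob k r₂) w
          conjugate k = trans (dot-cong frob-h (≋-refl {v = veronese 2 w})) (trans (value-⊠ (linear (frob k r₁)) (linear (frob k r₂)) w)
            (*-cong (value-linear (frob k r₁) w) (value-linear (frob k r₂) w)))
            where
            frob-h : frob k h ≋ linear (frob k r₁) ⊠ linear (frob k r₂)
            frob-h = ≋-trans (frob-cong k h≋) (≋-trans (frob-⊠ k (linear r₁) (linear r₂))
              (⊠-cong {frob k (linear r₁)} {frob k (linear r₂)} {linear (frob k r₁)} {linear (frob k r₂)} (frob-linear k r₁) (frob-linear k r₂)))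

        line-value : ∀ u → dot ℓ (D · veronese 2 u) ≈ value h u
        line-value u = h-dot₀ (veronese 2 u)

        infinite-points : ∀ k → (∀ i → Over k (parameters i)) → ∀ y → Point k y → (NRC.curve N₆ k y × y ∈⟨ Σ∞ ⟩) ⇔ (∃[ i ] y ∼ PQ i)
        infinite-points k par∈ y y∈ = mk⇔ to from
          where
          to : NRC.curve N₆ k y × y ∈⟨ Σ∞ ⟩ → ∃[ i ] y ∼ PQ i
          to ((_ , u , (u∈ , u≉0) , y∼) , y∈Σ∞) = go (product-zero (λ i → parallel (parameters i) u)
              (trans (sym (norm u)) (𝒦.at-line compatible {value h u} {u} (line-value u) y∼ y∈Σ∞)))
            where
            go : ∃[ i ] parallel (parameters i) u ≈ 0# → ∃[ i ] y ∼ PQ i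
            go (i , eq) = i , ∼-trans y∼ (∼-trans (𝒦.param-∼ compatible (parallel⇒∼ {parameters i} {u} (parameter-nonzero i) u≉0 eq)) (∼-sym (PQ∼ i)))
          from : ∃[ i ] y ∼ PQ i → NRC.curve N₆ k y × y ∈⟨ Σ∞ ⟩
          from (i , y∼PQ) = (y∈ , parameters i , (par∈ i , parameter-nonzero i) , y∼) ,
              𝒦.on-line compatible {value h (parameters i)} {parameters i} (line-value (parameters i)) y∼
                (trans (norm (parameters i)) (zero-product (λ j → parallel (parameters j) (parameters i)) i
                  (solve 2 (λ a b → a :* b :- b :* a := :0) refl (parameters i 0F) (parameters i 1F))))
            where
            y∼ : y ∼ par (parameters i)
            y∼ = ∼-trans y∼PQ (PQ∼ i)

        over-parameters : ∀ k → Over k r₁ → Over k r₂ → ∀ i → Over k (parameters i)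
        over-parameters k r₁∈ r₂∈ = λ { 0F → r₁∈ ; 1F → conj 1 r₁∈ ; 2F → conj 2 r₁∈ ; 3F → r₂∈ ; 4F → conj 1 r₂∈ ; 5F → conj 2 r₂∈ }
          where
          conj : ∀ j {r : V 2} → Over k r → Over k (frob j r)
          conj j {r} r∈ i = trans (σ-∘ k j (r i)) (trans (^-congʳ (r i) (≡.cong (q ℕ.^_) (ℕ.+-comm j k))) (trans (sym (σ-∘ j k (r i))) (σ-cong j (r∈ i))))

        -- Inside Σ₆ the form ℓ on the first block vanishes exactly on Σ∞, because the three forms
        -- agree there. No scalar is left over, since h equals the product of its two linear factors
        -- exactly.
        cuts : CutsWithMultiplicity N₆ Σ∞ PQ
        cuts = go (first-block ℓ)
          where
          open Functional ℬ
          go : (∃[ k ] (∀ X Y Z → dot k (Φ X Y Z) ≈ dot ℓ X)) → CutsWithMultiplicity N₆ Σ∞ PQ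
          go (k , k-Φ) = k , parameters , hyperplane , (λ i → (over-6 (parameters i) , parameter-nonzero i) , PQ∼ i) , factorised
            where
            hyperplane : ∀ y → y ∈⟨ S ⟩ → y ∈⟨ Σ∞ ⟩ ⇔ dot k y ≈ 0#
            hyperplane y y∈S = split (Φ-surjective y)
              where
              split : (Σ (V 3) λ X → Σ (V 3) λ Y → Σ (V 3) λ Z → y ≋ Φ X Y Z) → y ∈⟨ Σ∞ ⟩ ⇔ dot k y ≈ 0#
              split (X , Y , Z , y≋) = mk⇔
                  (λ y∈ → trans (dot-cong {h = k} ≋-refl y≋) (trans (k-Φ X Y Z) (proj₁ (Equivalence.to (infinity X Y Z) (∈⟨⟩-resp {M = Σ∞} y≋ y∈)))))
                  (λ eq → ∈⟨⟩-resp {M = Σ∞} (≋-sym y≋) (Equivalence.from (infinity X Y Z) (first eq , trans (sym (proj₁ relations)) (first eq) ,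
                    trans (sym (trans (proj₁ relations) (proj₂ relations))) (first eq))))
                where
                first : dot k y ≈ 0# → dot ℓ X ≈ 0#
                first eq = trans (sym (k-Φ X Y Z)) (trans (dot-cong {h = k} ≋-refl (≋-sym y≋)) eq)
                relations = Equivalence.to (affine X Y Z) (∈⟨⟩-resp {M = S} y≋ y∈S)
            factorised : ∀ w → dot k (par w) ≈ product (λ i → parallel (parameters i) w)
            factorised w = begin
              dot k (par w)                                     ≈⟨ dot-cong {h = k} ≋-refl (𝒦.param-Φ compatible w) ⟩
              dot k (Φ (ws 0F ⊛ 𝒦.γ w) (ws 1F ⊛ 𝒦.γ₁ w) (ws 2F ⊛ 𝒦.γ₂ w))   ≈⟨ k-Φ (ws 0F ⊛ 𝒦.γ w) (ws 1F ⊛ 𝒦.γ₁ w) (ws 2F ⊛ 𝒦.γ₂ w) ⟩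
              dot ℓ (ws 0F ⊛ 𝒦.γ w)                             ≈⟨ trans (dot-⊛ ℓ (ws 0F) (𝒦.γ w)) (trans (*-congˡ (line-value w)) (*-comm _ _)) ⟩
              value h w * (value (frob 1 h) w * value (frob 2 h) w)         ≈⟨ norm w ⟩
              product (λ i → parallel (parameters i) w)         ∎
              where
              ws : V 3
              ws = 𝒦.weights compatible w

  open TangentOffConic

  -- Rational or conjugate points at infinity, and the two conclusions

  module RationalityOfRoots where

    Rational : V 3 → Set (c ⊔ ℓ₁)
    Rational h = Σ (V 2) λ r₁ → Σ (V 2) λ r₂ → Point 3 r₁ × Point 3 r₂ × h ≋ linear r₁ ⊠ linear r₂

    -- The leading coefficient is absorbed into the first parameter, so that h is exactly the
    -- product of the two linear forms.
    Conjugate : V 3 → Set (c ⊔ ℓ₁)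
    Conjugate h = Σ Carrier λ θ → ¬ InGF 3 θ × ¬ h 0F ≈ 0# × h ≋ linear (h 0F * θ ∷ h 0F ∷ []) ⊠ linear (σ 3 θ ∷ 1# ∷ [])

    -- Division by the factor at one rational root leaves a linear form over GF(q³), whose root is
    -- rational too.
    rational-root : ∀ {h} → Over 3 h → ¬ h ≋ 𝟎 → ∀ u → Point 3 u → dot h (veronese 2 u) ≈ 0# → Rational h
    rational-root {h} h∈ h≉0 u (u∈ , u≉0) eq = go (factor-at 3 {h} {u} h∈ u∈ u≉0 eq)
      where
      go : ∃[ g ] Over 3 g × h ≋ linear u ⊠ g → Rational h
      go (g , g∈ , h≋) = u , root g , (u∈ , u≉0) , ((λ { 0F → g∈ 1F ; 1F → InGF-neg 3 (g∈ 0F) }) , root≉0) ,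
        ≋-trans h≋ (⊠-cong {linear u} {g} {linear u} {linear (root g)} (≋-refl {v = linear u}) (≋-sym (linear-root g)))
        where
        root≉0 : ¬ root g ≋ 𝟎
        root≉0 r≋0 = h≉0 (≋-trans h≋ (λ
            { 0F → trans (*-congˡ g₀) (zeroʳ _)
            ; 1F → trans (+-cong (trans (*-congˡ (r≋0 0F)) (zeroʳ _)) (trans (*-congˡ g₀) (zeroʳ _))) (+-identityʳ 0#)
            ; 2F → trans (*-congˡ (r≋0 0F)) (zeroʳ _) }))
          where
          g₀ : g 0F ≈ 0#
          g₀ = trans (solve 1 (λ x → x := :- :- x) refl (g 0F)) (trans (-‿cong (r≋0 1F)) (solve 0 (:- :0 := :0) refl))

    -- If the leading coefficient vanishes, (1 : 0) is a root. Otherwise K contains a root θ; if it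
    -- is not in GF(q³), the other root is its conjugate.
    roots-dichotomy : ∀ {h} → Over 3 h → ¬ h ≋ 𝟎 → Rational h ⊎ Conjugate h
    roots-dichotomy {h} h∈ h≉0 = by (h 0F ≈? 0#)
      where
      by : Dec (h 0F ≈ 0#) → Rational h ⊎ Conjugate h
      by (yes h₀≈0) = inj₁ (rational-root h∈ h≉0 (1# ∷ 0# ∷ []) ((λ { 0F → σ-1 3 ; 1F → σ-0 3 }) , λ eq → 1≉0 (eq 0F))
        (trans (solve 3 (λ a b c → a :* (:1 :^ 2 :* :0 :^ 0) :+ (b :* (:1 :^ 1 :* :0 :^ 1) :+ (c :* (:1 :^ 0 :* :0 :^ 2) :+ :0)) := a) refl (h 0F) (h 1F) (h 2F)) h₀≈0))
      by (no h₀≉0) = go (root-of h₀≉0 (h∈ 0F) (h∈ 1F) (h∈ 2F))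
        where
        go : ∃[ θ ] h 0F * (θ * θ) + h 1F * θ + h 2F ≈ 0# → Rational h ⊎ Conjugate h
        go (θ , eq) = by′ (InGF? 3 θ)
          where
          by′ : Dec (InGF 3 θ) → Rational h ⊎ Conjugate h
          by′ (yes θ∈) = inj₁ (rational-root h∈ h≉0 (θ ∷ 1# ∷ []) ((λ { 0F → θ∈ ; 1F → σ-1 3 }) , λ eq → 1≉0 (eq 1F))
            (trans (solve 4 (λ a b c t → a :* (t :^ 2 :* :1 :^ 0) :+ (b :* (t :^ 1 :* :1 :^ 1) :+ (c :* (t :^ 0 :* :1 :^ 2) :+ :0)) :=
              a :* (t :* t) :+ b :* t :+ c) refl (h 0F) (h 1F) (h 2F) θ) eq))
          by′ (no θ∉) = inj₂ (θ , θ∉ , h₀≉0 , λ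
            { 0F → solve 1 (λ a → a := :- a :* :- :1) refl (h 0F)
            ; 1F → trans (sum-of-roots {3} {h 0F} {h 1F} {h 2F} {θ} h₀≉0 (h∈ 0F) (h∈ 1F) (h∈ 2F) eq θ∉)
                     (solve 3 (λ a t s → :- (a :* (t :+ s)) := :- a :* s :+ a :* t :* :- :1) refl (h 0F) θ (σ 3 θ))
            ; 2F → trans (product-of-roots {3} {h 0F} {h 1F} {h 2F} {θ} h₀≉0 (h∈ 0F) (h∈ 1F) (h∈ 2F) eq θ∉) (sym (*-assoc _ _ _)) })

    -- A vector over GF(q³) proportional to r would have the same coordinate ratio η.
    irrational : ∀ {r : V 2} {η} → ¬ r 1F ≈ 0# → r 0F ≈ η * r 1F → ¬ InGF 3 η → ∀ {u} → Point 3 u → ¬ u ∼ r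
    irrational {r} {η} r₁≉0 r₀≈ η∉ {u} (u∈ , u≉0) (a , a≉0 , eq) = η∉ (InGF-cong 3 (begin
        u 0F * u 1F ⁻¹        ≈⟨ *-congʳ u₀≈ ⟩
        η * u 1F * u 1F ⁻¹    ≈⟨ trans (*-assoc η _ _) (trans (*-congˡ (*-inverseʳ u₁≉0)) (*-identityʳ η)) ⟩
        η                     ∎) (InGF-* 3 (u∈ 0F) (InGF-⁻¹ 3 (u∈ 1F))))
      where
      u₁≉0 : ¬ u 1F ≈ 0#
      u₁≉0 u₁≈0 = *-nonzero a≉0 r₁≉0 (trans (sym (eq 1F)) u₁≈0)
      u₀≈ : u 0F ≈ η * u 1F
      u₀≈ = begin
        u 0F              ≈⟨ trans (eq 0F) (*-congˡ r₀≈) ⟩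
        a * (η * r 1F)    ≈⟨ solve 3 (λ a η r → a :* (η :* r) := η :* (a :* r)) refl a η (r 1F) ⟩
        η * (a * r 1F)    ≈⟨ *-congˡ (eq 1F) ⟨
        η * u 1F          ∎

    InfinitePoints : (ℬ : BosePlane) (ℓ∞ : Flat 3 2 1) (Σ₆ : Flat 1 8 6) (C⁺ : Conic 3) (C⁺⁺ : Conic 6) → NRC 6 Σ₆ → Set (c ⊔ ℓ₁)
    InfinitePoints ℬ ℓ∞ Σ₆ C⁺ C⁺⁺ N₆ = Σ (V 3) λ P → Σ (V 3) λ Q →
      let open BosePlane ℬ
          L = Flat.basis ℓ∞
          Σ∞ = atInfinity ℬ ℓ∞
          PQ = conjugates (φ P) ++ conjugates (φ Q)
      in
      CutsWithMultiplicity N₆ Σ∞ PQ ×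
      ((Point 3 P × Point 3 Q ×
        (∀ X → Point 3 X → (X ∈ᶜ C⁺ × X ∈⟨ L ⟩) ⇔ (X ∼ P ⊎ X ∼ Q)) ×
        (∀ y → Point 3 y → (NRC.curve N₆ 3 y × y ∈⟨ Σ∞ ⟩) ⇔ (∃[ i ] y ∼ PQ i)))
      ⊎
       (Point 6 P × Point 6 Q ×
        ¬ (∃[ X ] Point 3 X × X ∼ P) × ¬ (∃[ X ] Point 3 X × X ∼ Q) ×
        (∀ X → Point 3 X → ¬ (X ∈ᶜ C⁺ × X ∈⟨ L ⟩)) ×
        (∀ X → Point 6 X → (X ∈ᶜ C⁺⁺ × X ∈⟨ L ⟩) ⇔ (X ∼ P ⊎ X ∼ Q)) ×
        (∀ y → Point 6 y → (NRC.curve N₆ 6 y × y ∈⟨ Σ∞ ⟩) ⇔ (∃[ i ] y ∼ PQ i)) ×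
        φ Q ∼ frob 3 (φ P)))

    SecondConclusion : (ℬ : BosePlane) (ℓ∞ : Flat 3 2 1) (Σ₆ : Flat 1 8 6) (C⁺ : Conic 3) (C⁺⁺ : Conic 6) → Pred (V 9) ℓ₁ → Set (c ⊔ ℓ₁)
    SecondConclusion ℬ ℓ∞ Σ₆ C⁺ C⁺⁺ 𝒱 = Σ (NRC 6 Σ₆) λ N₆ →
      (∀ y → Point 1 y → (𝒱 y × y ∈⟨ Flat.basis Σ₆ ⟩) ⇔ NRC.curve N₆ 1 y) ×
      (∀ y → Point 3 y → (𝒱 y × y ∈⟨ Flat.basis Σ₆ ⟩) ⇔ NRC.curve N₆ 3 y) ×
      (∀ y → Point 6 y → (𝒱 y × y ∈⟨ Flat.basis Σ₆ ⟩) ⇔ NRC.curve N₆ 6 y) ×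
      InfinitePoints ℬ ℓ∞ Σ₆ C⁺ C⁺⁺ N₆

    module SecondCase (𝒪 : OffConic) (C⁺⁺ : Conic 6) (C⁺⊆C⁺⁺ : ∀ X → Point 3 X → X ∈ᶜ OffConic.C⁺ 𝒪 → X ∈ᶜ C⁺⁺) where

      open OffConic 𝒪
      open Setting 𝒯
      open SixPoints 𝒪

      -- C lies on C⁺⁺ through C⁺, and its points over GF(q) already determine the equation.
      equation⁺⁺ : Σ Carrier λ b → ¬ b ≈ 0# × (∀ z → quad (Conic.form C⁺⁺) (D · z) ≈ b * (z 1F * z 1F - z 0F * z 2F))
      equation⁺⁺ = extension-equation D D-independent C⁺⁺ (λ u u∈ → C⁺⊆C⁺⁺ (D · veronese 2 u) (D·-point (veronese-point 1 u∈))
        (C⊆C⁺ (D · veronese 2 u) (C∋γ {u} u∈)))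

      rational-case : Rational h → InfinitePoints ℬ ℓ∞ Σ₆ C⁺ C⁺⁺ N₆
      rational-case (r₁ , r₂ , r₁∈ , r₂∈ , h≋) = P , Q , cuts , inj₁ (γ-point 3 {r₁} D-over r₁∈ , γ-point 3 {r₂} D-over r₂∈ ,
          meets 3 D-over C⁺ (proj₁ equation⁺) (proj₁ (proj₂ equation⁺)) (proj₂ (proj₂ equation⁺)) ,
          infinite-points 3 (over-parameters 3 (proj₁ r₁∈) (proj₁ r₂∈)))
        where
        factors : LinearFactors h
        factors = record { r₁≉0 = proj₂ r₁∈ ; r₂≉0 = proj₂ r₂∈ ; h≋ = h≋ }
        open AtRoots factors

      conjugate-case : Conjugate h → InfinitePoints ℬ ℓ∞ Σ₆ C⁺ C⁺⁺ N₆
      conjugate-case (θ , θ∉ , h₀≉0 , h≋) = P , Q , cuts , inj₂ (γ-point 6 {r₁} D∈₆ (over-6 r₁ , r₁≉0) , γ-point 6 {r₂} D∈₆ (over-6 r₂ , r₂≉0) ,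
          (λ (X , X∈ , X∼) → not-rational r₁ r₁≉0 (irrational {r₁} {θ} h₀≉0 (*-comm _ θ) θ∉) X X∈ X∼) ,
          (λ (X , X∈ , X∼) → not-rational r₂ r₂≉0 (irrational {r₂} {σ 3 θ} 1≉0 (sym (*-identityʳ _)) σθ∉) X X∈ X∼) ,
          (λ X X∈ (on , X∈L) → empty X X∈ (Equivalence.to (meets⁺ X X∈) (on , X∈L))) ,
          meets 6 D∈₆ C⁺⁺ (proj₁ equation⁺⁺) (proj₁ (proj₂ equation⁺⁺)) (proj₂ (proj₂ equation⁺⁺)) ,
          infinite-points 6 (λ i → over-6 (parameters i)) ,
          ∼-trans (φ-∼ (·-∼ D (veronese-∼ 2 r₂∼))) (≋⇒∼ (≋-sym frob-φP)))
        where
        r₁ r₂ : V 2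
        r₁ = h 0F * θ ∷ h 0F ∷ []
        r₂ = σ 3 θ ∷ 1# ∷ []
        r₁≉0 : ¬ r₁ ≋ 𝟎
        r₁≉0 eq = h₀≉0 (eq 1F)
        r₂≉0 : ¬ r₂ ≋ 𝟎
        r₂≉0 eq = 1≉0 (eq 1F)
        factors : LinearFactors h
        factors = record { r₁≉0 = r₁≉0 ; r₂≉0 = r₂≉0 ; h≋ = h≋ }
        open AtRoots factors
        D∈₆ : ∀ i → Over 6 (D i)
        D∈₆ i = over-6 (D i)
        σθ∉ : ¬ InGF 3 (σ 3 θ)
        σθ∉ eq = θ∉ (sym (trans (sym (σ-6 θ)) (trans (sym (σ-∘ 3 3 θ)) eq)))
        open Extension D D-over D-independent C⁺ (proj₁ equation⁺) (proj₁ (proj₂ equation⁺)) (proj₂ (proj₂ equation⁺))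
        -- A point of C⁺ over GF(q³) has a parameter over GF(q³), and the parameter of a point is
        -- unique up to a scalar.
        not-rational : ∀ r → ¬ r ≋ 𝟎 → (∀ {u} → Point 3 u → ¬ u ∼ r) → ∀ X → Point 3 X → ¬ X ∼ D · veronese 2 r
        not-rational r r≉0 none X X∈ X∼ = go (to-parameter 3 D-over X∈ (from-parameter r X∼))
          where
          go : ∃[ u ] Point 3 u × X ∼ D · veronese 2 u → ⊥
          go (u , u∈ , X∼u) = none {u} u∈ (veronese-injective {u} {r} (independent-∼ {M = D} D-independent (∼-trans (∼-sym X∼u) X∼)) r≉0 (proj₂ u∈))
        empty : ∀ X → Point 3 X → ¬ (X ∼ D · veronese 2 r₁ ⊎ X ∼ D · veronese 2 r₂)
        empty X X∈ (inj₁ X∼) = not-rational r₁ r₁≉0 (irrational {r₁} {θ} h₀≉0 (*-comm _ θ) θ∉) X X∈ X∼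
        empty X X∈ (inj₂ X∼) = not-rational r₂ r₂≉0 (irrational {r₂} {σ 3 θ} 1≉0 (sym (*-identityʳ _)) σθ∉) X X∈ X∼
        meets⁺ : ∀ X → Point 3 X → (X ∈ᶜ C⁺ × X ∈⟨ L ⟩) ⇔ (X ∼ D · veronese 2 r₁ ⊎ X ∼ D · veronese 2 r₂)
        meets⁺ = meets 3 D-over C⁺ (proj₁ equation⁺) (proj₁ (proj₂ equation⁺)) (proj₂ (proj₂ equation⁺))
        r₂∼ : r₂ ∼ frob 3 r₁
        -- Conjugating r₁ gives `h 0F` times r₂, because `h 0F` lies in GF(q³).
        r₂∼ = ∼-sym (h 0F , h₀≉0 , λ { 0F → trans (σ-* 3 (h 0F) θ) (*-congʳ (h-over 0F)) ; 1F → trans (h-over 0F) (sym (*-identityʳ _)) })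
        frob-φP : frob 3 (φ (D · veronese 2 r₁)) ≋ φ (D · veronese 2 (frob 3 r₁))
        frob-φP = ≋-trans (frob3-φ (D · veronese 2 r₁)) (·-congˡ Γ (≋-trans (frob-· 3 D (veronese 2 r₁)) (·-cong D-over (frob-veronese 3 2 r₁))))

      points-at-infinity : InfinitePoints ℬ ℓ∞ Σ₆ C⁺ C⁺⁺ N₆
      points-at-infinity = [ rational-case , conjugate-case ]′ (roots-dichotomy h-over h-nonzero)

      module _ (B : Vector (V 3) 3) (fixes : ∀ X → π X → semilinear B X ∼ X) (𝒱C : BoseVariety ℬ C C⁺ C⁺⁺ B) where

        open BoseVariety 𝒱C

        second-conclusion : SecondConclusion ℬ ℓ∞ Σ₆ C⁺ C⁺⁺ 𝒱
        second-conclusion = N₆ , level₁ {𝒱} points , levelₖ 3 D-over {𝒱} C⁺ equation⁺ B fixes points⋆ ,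
          levelₖ 6 (λ i → over-6 (D i)) {𝒱} C⁺⁺ equation⁺⁺ B fixes points⋆⋆ , points-at-infinity

    module _ {p₁ p₂ : Level} (ℬ : BosePlane) (ℓ∞ : Flat 3 2 1) (Σ₆ : Flat 1 8 6) (bruckBose : IsBruckBose ℬ ℓ∞ Σ₆)
             (π : Pred (V 3) p₁)
             (T : V 3) (πT : π T) (T∈L : T ∈⟨ Flat.basis ℓ∞ ⟩) (tangent : ∀ X → π X → X ∈⟨ Flat.basis ℓ∞ ⟩ → X ∼ T)
             (C : Pred (V 3) p₂) (conicOf : IsConicOf π C) (C⁺ : Conic 3) (C⊆C⁺ : ∀ X → C X → X ∈ᶜ C⁺) where

      private
        configuration : Configuration
        configuration = record { bruckBose = bruckBose }

        setting : Section.SectionForm configuration → Parametrised π C → TangentConic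
        setting sectionForm parametrised = record
          { sectionForm = sectionForm ; parametrised = parametrised ; T∈L = T∈L ; tangent = tangent ; C⁺ = C⁺ ; C⊆C⁺ = C⊆C⁺ }

      tangent-on-conic : C T → FirstConclusion ℬ ℓ∞ Σ₆ C T C⁺
      tangent-on-conic = Setting.case₁ (setting (Section.section-form configuration) (parametrise conicOf))

      tangent-off-conic : ¬ C T → (C⁺⁺ : Conic 6) → (∀ X → Point 3 X → X ∈ᶜ C⁺ → X ∈ᶜ C⁺⁺) →
        (B : Vector (V 3) 3) → IsConjugacy π B → (𝒱C : BoseVariety ℬ C C⁺ C⁺⁺ B) →
        SecondConclusion ℬ ℓ∞ Σ₆ C⁺ C⁺⁺ (BoseVariety.𝒱 𝒱C)
      tangent-off-conic CT∉ C⁺⁺ C⁺⊆C⁺⁺ B conjugacy 𝒱C = go (Section.section-form configuration) (parametrise conicOf)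
        where
        go : Section.SectionForm configuration → Parametrised π C → SecondConclusion ℬ ℓ∞ Σ₆ C⁺ C⁺⁺ (BoseVariety.𝒱 𝒱C)
        go sectionForm parametrised = go′ (Equivalence.to (Parametrised.plane parametrised T) πT)
          where
          go′ : Point 3 T × (∃[ t ] Point 1 t × T ∼ Parametrised.D parametrised · t) → SecondConclusion ℬ ℓ∞ Σ₆ C⁺ C⁺⁺ (BoseVariety.𝒱 𝒱C)
          go′ (T∈ , t , t∈ , T∼) = SecondCase.second-conclusion (record { 𝒯 = setting sectionForm parametrised ; T∈ = T∈ ; CT∉ = CT∉ ; t∈ = t∈ ; T∼ = T∼ })
            C⁺⁺ C⁺⊆C⁺⁺ B (IsConjugacy.fixes conjugacy) 𝒱C

  open RationalityOfRoots

corollary4p4 : ∀ {c ℓ₁ ℓ₂ p₁ p₂} (q : ℕ) → IsPrimePower q → 6 ≤ q →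
  (K : FiniteField c ℓ₁ ℓ₂ (q ^ℕ 6)) →
  let open Geometry q K in
  -- the plane Γ, the line at infinity and the 6-space of the Bruck-Bose representation
  (ℬ : BosePlane) (ℓ∞ : Flat 3 2 1) (Σ₆ : Flat 1 8 6) → IsBruckBose ℬ ℓ∞ Σ₆ →
  let open BosePlane ℬ
      L = Flat.basis ℓ∞
      S = Flat.basis Σ₆
      Σ∞ = atInfinity ℬ ℓ∞
  in
  -- the subplane π, tangent to ℓ∞ at T, the conic C of π, and C⁺
  (π : Pred (V 3) p₁) → IsSubplane π →
  (T : V 3) → π T → T ∈⟨ L ⟩ → (∀ X → π X → X ∈⟨ L ⟩ → X ∼ T) →
  (C : Pred (V 3) p₂) → IsConicOf π C →
  (C⁺ : Conic 3) → (∀ X → C X → X ∈ᶜ C⁺) →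
  -- 1.
  (C T →
    (Σ (V 3) λ Q → Point 3 Q × ¬ Q ∼ T ×
      (∀ X → Point 3 X → (X ∈ᶜ C⁺ × X ∈⟨ L ⟩) ⇔ (X ∼ T ⊎ X ∼ Q)) ×
      (Σ (NRC 4 Σ₆) λ N₄ →
        (∀ y → [_]ₛ ℬ Σ₆ C y ⇔ ([_] ℬ Σ₆ T y ⊎ NRC.curve N₄ 1 y)) ×
        (Σ (V 9) λ R → [_] ℬ Σ₆ T R ×
          (∀ y → Point 3 y →
            (NRC.curve N₄ 3 y × y ∈⟨ Σ∞ ⟩) ⇔ (∃[ i ] y ∼ (R ∷ conjugates (φ Q)) i)))))) ×
  -- 2.
  (¬ C T →
    (C⁺⁺ : Conic 6) → (∀ X → Point 3 X → X ∈ᶜ C⁺ → X ∈ᶜ C⁺⁺) →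
    (B : Vector (V 3) 3) → IsConjugacy π B →
    (𝒱C : BoseVariety ℬ C C⁺ C⁺⁺ B) →
    let open BoseVariety 𝒱C using (𝒱) in
    (Σ (NRC 6 Σ₆) λ N₆ →
      -- V([C]) = N₆ over the fields of order q, q³ and q⁶
      (∀ y → Point 1 y → (𝒱 y × y ∈⟨ S ⟩) ⇔ NRC.curve N₆ 1 y) ×
      (∀ y → Point 3 y → (𝒱 y × y ∈⟨ S ⟩) ⇔ NRC.curve N₆ 3 y) ×
      (∀ y → Point 6 y → (𝒱 y × y ∈⟨ S ⟩) ⇔ NRC.curve N₆ 6 y) ×
      (Σ (V 3) λ P → Σ (V 3) λ Q →
        let PQ = conjugates (φ P) ++ conjugates (φ Q) in
        CutsWithMultiplicity N₆ Σ∞ PQ ×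
        -- P and Q on ℓ∞, possibly equal
        ((Point 3 P × Point 3 Q ×
          (∀ X → Point 3 X → (X ∈ᶜ C⁺ × X ∈⟨ L ⟩) ⇔ (X ∼ P ⊎ X ∼ Q)) ×
          (∀ y → Point 3 y → (NRC.curve N₆ 3 y × y ∈⟨ Σ∞ ⟩) ⇔ (∃[ i ] y ∼ PQ i)))
        ⊎
        -- P and Q in the quadratic extension of ℓ∞
         (Point 6 P × Point 6 Q ×
          ¬ (∃[ X ] Point 3 X × X ∼ P) × ¬ (∃[ X ] Point 3 X × X ∼ Q) ×
          (∀ X → Point 3 X → ¬ (X ∈ᶜ C⁺ × X ∈⟨ L ⟩)) ×
          (∀ X → Point 6 X → (X ∈ᶜ C⁺⁺ × X ∈⟨ L ⟩) ⇔ (X ∼ P ⊎ X ∼ Q)) ×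
          (∀ y → Point 6 y → (NRC.curve N₆ 6 y × y ∈⟨ Σ∞ ⟩) ⇔ (∃[ i ] y ∼ PQ i)) ×
          φ Q ∼ frob 3 (φ P))))))
corollary4p4 q primePower 6≤q K ℬ ℓ∞ Σ₆ bruckBose π _ T πT T∈L tangent C conicOf C⁺ C⊆C⁺ =
  tangent-on-conic ℬ ℓ∞ Σ₆ bruckBose π T πT T∈L tangent C conicOf C⁺ C⊆C⁺ ,
  tangent-off-conic ℬ ℓ∞ Σ₆ bruckBose π T πT T∈L tangent C conicOf C⁺ C⊆C⁺
  where open Development.RationalityOfRoots (ground q primePower 6≤q K)
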